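{- Let $t,s$ be two typed linear terms of $\lambda_{\mathrm{MELL}}$. If $t\equiv s$ (structural equivalence) and $t\to^{ - }t'$ (pre-reduction), then there is a linear term $s'$ such that $s\to^{ - }s'$ and $t'\equiv s'$.
   Context: MELL formulae: $A,B::=\alpha\mid\overline\alpha\mid A\otimes B\mid A\wp B\mid\mathbf 1\mid\bot\mid{!}A\mid{?}A$ ($\alpha$ atomic, $\overline\alpha$ its negative version, $\wp$ is "par"). Linear negation is the involution $\alpha^\perp=\overline\alpha$, $\overline\alpha^\perp=\alpha$, $(A\otimes B)^\perp=A^\perp\wp B^\perp$, $(A\wp B)^\perp=A^\perp\otimes B^\perp$, $\mathbf1^\perp=\bot$, $\bot^\perp=\mathbf1$, $({!}A)^\perp={?}(A^\perp)$, $({?}A)^\perp={!}(A^\perp)$. Terms of $\lambda_{\mathrm{MELL}}$, over linear variables $a,b,c,\dots$ and unrestricted variables $u,v,\dots$: $t,s::=a\mid u\mid\langle t,s\rangle\mid t[\langle a,b\rangle:=s]\mid\wp(a,b).t\mid t\bullet s\mid t\blacktriangledown s\mid{!}a.t\mid t[{!}u:=s]\mid{?}u.t\mid t\blacktriangleright^{a}s\mid t\,\sharp\,s\mid\star\mid t[\star:=s]$. Binding: $t[\langle a,b\rangle:=s]$ and $\wp(a,b).t$ bind $a,b$ in $t$; ${!}a.t$ and $t\blacktriangleright^a s$ bind $a$ in $t$; $t[{!}u:=s]$ and ${?}u.t$ bind $u$ in $t$. Terms are taken up to $\alpha$-renaming, and bound variables are always chosen to avoid capture. Typing judgements $\Delta;\Gamma\vdash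 t:A$, where $\Delta$ (resp. $\Gamma$) is a finite partial function from unrestricted (resp. linear) variables to formulae; $\Gamma,\Gamma'$ denotes union with disjoint domains. Typing rules (premises $\Rightarrow$ conclusion): $\Rightarrow\Delta;a:A\vdash a:A$; $\Rightarrow\Delta,u:A;\cdot\vdash u:A$; $\Delta;\Gamma\vdash t:A$ and $\Delta;\Gamma'\vdash s:B$ $\Rightarrow$ $\Delta;\Gamma,\Gamma'\vdash\langle t,s\rangle:A\otimes B$; $\Delta;\Gamma\vdash s:A\otimes B$ and $\Delta;\Gamma',a:A,b:B\vdash t:C$ $\Rightarrow$ $\Delta;\Gamma,\Gamma'\vdash t[\langle a,b\rangle:=s]:C$; $\Delta;\Gamma,a:A,b:B\vdash t:\bot$ $\Rightarrow$ $\Delta;\Gamma\vdash\wp(a,b).t:A^\perp\wp B^\perp$; $\Delta;\Gamma\vdash t:A\wp B$ and $\Delta;\Gamma'\vdash s:A^\perp$ $\Rightarrow$ $\Delta;\Gamma,\Gamma'\vdash t\bullet s:B$; $\Delta;\Gamma\vdash t:A\wp B$ and $\Delta;\Gamma'\vdash s:B^\perp$ $\Rightarrow$ $\Delta;\Gamma,\Gamma'\vdash t\blacktriangledown s:A$; $\Delta;a:A\vdash t:\bot$ $\Rightarrow$ $\Delta;\cdot\vdash{!}a.t:{!}(A^\perp)$; $\Delta;\Gamma\vdash s:{!}A$ and $\Delta,u:A;\Gamma'\vdash t:B$ $\Rightarrow$ $\Delta;\Gamma,\Gamma'\vdash t[{!}u:=s]:B$; $\Delta,u:A^\perp;\Gamma\vdash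 t:\bot$ $\Rightarrow$ $\Delta;\Gamma\vdash{?}u.t:{?}A$; $\Delta;\Gamma\vdash s:{?}A$ and $\Delta;a:A\vdash t:\bot$ $\Rightarrow$ $\Delta;\Gamma\vdash t\blacktriangleright^a s:\bot$; $\Delta;\Gamma\vdash t:B$ and $\Delta;\Gamma'\vdash s:B^\perp$ $\Rightarrow$ $\Delta;\Gamma,\Gamma'\vdash t\,\sharp\,s:\bot$; $\Rightarrow\Delta;\cdot\vdash\star:\mathbf1$; $\Delta;\Gamma\vdash s:\mathbf1$ and $\Delta;\Gamma'\vdash t:A$ $\Rightarrow$ $\Delta;\Gamma,\Gamma'\vdash t[\star:=s]:A$. A term is linear if: each free linear variable occurs exactly once; each bound linear variable occurs exactly once in the scope of its binder; subterms ${!}a.t$ have no free linear variables; in subterms $t\blacktriangleright^a s$ only $a$ occurs as a free linear variable in $t$. $t\{a:=s\}$, $t\{u:=s\}$ denote capture-avoiding substitution. For a linear term $t$ with $a\in\mathrm{fv}(t)$, the contra-substitution $t\{a\backslash\!\backslash s\}$ is defined by induction on $t$ (case "$i$" applies when $a\in\mathrm{fv}(t_i)$): $a\{a\backslash\!\backslash s\}=s$; $\langle t_1,t_2\rangle\{a\backslash\!\backslash s\}=t_1\{a\backslash\!\backslash s\blacktriangledown t_2\}$ (case 1), $t_2\{a\backslash\!\backslash s\bullet t_1\}$ (case 2); $(t_1\bullet t_2)\{a\backslash\!\backslash s\}=t_1\{a\backslash\!\backslash\langle t_2,s\rangle\}$ (1), $t_2\{a\backslash\!\backslash t_1\blacktriangledown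 s\}$ (2); $(t_1\blacktriangledown t_2)\{a\backslash\!\backslash s\}=t_1\{a\backslash\!\backslash\langle s,t_2\rangle\}$ (1), $t_2\{a\backslash\!\backslash t_1\bullet s\}$ (2); $(t_1[\langle b,c\rangle:=t_2])\{a\backslash\!\backslash s\}=(t_1\{a\backslash\!\backslash s\})[\langle b,c\rangle:=t_2]$ (1, $a\notin\{b,c\}$), $t_2\{a\backslash\!\backslash\wp(b,c).(t_1\sharp s)\}$ (2); $(\wp(b,c).t)\{a\backslash\!\backslash s\}=(t\{a\backslash\!\backslash\star\})[\langle b,c\rangle:=s]$; $(t_1[{!}u:=t_2])\{a\backslash\!\backslash s\}=(t_1\{a\backslash\!\backslash s\})[{!}u:=t_2]$ (1), $t_2\{a\backslash\!\backslash{?}u.(t_1\sharp s)\}$ (2); $({?}u.t)\{a\backslash\!\backslash s\}=(t\{a\backslash\!\backslash\star\})[{!}u:=s]$; $(t_1\blacktriangleright^b t_2)\{a\backslash\!\backslash s\}=(t_2\{a\backslash\!\backslash{!}b.t_1\})[\star:=s]$ (only case 2 is possible); $(t_1\sharp t_2)\{a\backslash\!\backslash s\}=(t_1\{a\backslash\!\backslash t_2\})[\star:=s]$ (1), $(t_2\{a\backslash\!\backslash t_1\})[\star:=s]$ (2); $(t_1[\star:=t_2])\{a\backslash\!\backslash s\}=(t_1\{a\backslash\!\backslash s\})[\star:=t_2]$ (1), $t_2\{a\backslash\!\backslash t_1\sharp s\}$ (2). (Terms ${!}b.t$ and $\star$ have no free linear variables, so no clause is needed.) Positive elimination contexts: $L,K::=\Box\mid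 L[\langle a,b\rangle:=t]\mid L[{!}u:=t]\mid L[\star:=t]$; $tL$ denotes filling the hole of $L$ with $t$ (free variables of $t$ may be captured by $L$). Pre-reduction $\to^-$ is the contextual closure (under all term constructors) of the following axioms, where both sides are assumed typed with the same type in the same contexts: $(\wp(a,b).t)L\bullet r\mapsto t\{a:=r\}\{b\backslash\!\backslash\star\}L$ ($b\notin\mathrm{fv}(r)$); $(\wp(a,b).t)L\blacktriangledown r\mapsto t\{b:=r\}\{a\backslash\!\backslash\star\}L$ ($a\notin\mathrm{fv}(r)$); $t[\langle a,b\rangle:=\langle s,r\rangle L]\mapsto t\{a:=s\}\{b:=r\}L$ ($b\notin\mathrm{fv}(s)$); $t[{!}u:=({!}a.s)L]\mapsto t\{u:=s\{a\backslash\!\backslash\star\}\}L$; $t\blacktriangleright^a({?}u.s)L\mapsto s\{u:=t\{a\backslash\!\backslash\star\}\}L$; $(\wp(a,b).t)L\,\sharp\,\langle s,r\rangle K\mapsto t\{a:=s\}\{b:=r\}LK$ ($b\notin\mathrm{fv}(s)$); $\langle s,r\rangle L\,\sharp\,(\wp(a,b).t)K\mapsto t\{a:=s\}\{b:=r\}LK$ ($b\notin\mathrm{fv}(s)$); $({!}a.t)L\,\sharp\,({?}u.r)K\mapsto r\{u:=t\{a\backslash\!\backslash\star\}\}LK$; $({?}u.r)L\,\sharp\,({!}a.t)K\mapsto r\{u:=t\{a\backslash\!\backslash\star\}\}LK$. Positive eliminators $[\langle a,b\rangle:=t]$, $[{!}u:=t]$, $[\star:=t]$ are written $[p:=t]$,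 with $\mathrm{fv}(\langle a,b\rangle)=\{a,b\}$, $\mathrm{fv}({!}u)=\{u\}$, $\mathrm{fv}(\star)=\emptyset$. Surface contexts $S$ are: $\wp(a,b).\Box$, $\langle\Box,t\rangle$, $\langle t,\Box\rangle$, $\Box\bullet t$, $t\bullet\Box$, $\Box\blacktriangledown t$, $t\blacktriangledown\Box$, $\Box\,\sharp\,t$, $t\,\sharp\,\Box$, ${?}u.\Box$, $\Box[p:=t]$, $t[p:=\Box]$, $t\blacktriangleright^a\Box$. A term $r$ is free for $S$ if $S\langle r\rangle$ does not bind free variables of $r$. Structural equivalence $\equiv$ is the reflexive, symmetric, transitive and contextual closure of the following axioms, where both sides are assumed typed with the same type in the same contexts: $S\langle t\rangle[p:=r]\equiv S\langle t[p:=r]\rangle$ if $\mathrm{fv}(p)\cap\mathrm{fv}(S)=\emptyset$ and $r$ is free for $S$; $t[\star:=\star]\equiv t$; $t[\star:=s]\equiv s[\star:=t]$; $t\{a\backslash\!\backslash\star\}\,\sharp\,r\equiv t\{a:=r\}$. -}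

module Defs where

open import Data.Bool using (if_then_else_)
open import Data.Fin using (Fin; zero; suc; _↑ˡ_; _↑ʳ_; splitAt; lift; _≟_)
open import Data.List using (List; []; _∷_)
open import Data.Maybe using (Maybe; just; nothing)
open import Data.Nat using (ℕ; zero; suc; _+_; _<_; _<?_)
open import Data.Product using (_×_; _,_)
open import Data.Sum using ([_,_]′)
open import Data.Unit using (⊤)
open import Data.Vec using (Vec; []; _∷_; replicate; _[_]≔_; _[_]=_)
open import Data.Vec.Functional using (insertAt)
open import Function using (id; _∘_)
open import Relation.Binary.Construct.Closure.Equivalence using (EqClosure)
open import Relation.Binary.PropositionalEquality using (_≡_)
open import Relation.Nullary using (Dec; does; ¬_)

------------------------------------------------------------------------
-- Formulae

infix  9 _^⊥
infixr 8 !_ ¿_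
infixr 7 _⊗_ _⅋_

data Formula (X : Set) : Set where
  atom natom : X → Formula X
  _⊗_ _⅋_    : Formula X → Formula X → Formula X
  𝟙 ⊥        : Formula X
  !_ ¿_      : Formula X → Formula X

_^⊥ : {X : Set} → Formula X → Formula X
(atom x)  ^⊥ = natom x
(natom x) ^⊥ = atom x
(A ⊗ B)   ^⊥ = (A ^⊥) ⅋ (B ^⊥)
(A ⅋ B)   ^⊥ = (A ^⊥) ⊗ (B ^⊥)
𝟙         ^⊥ = ⊥
⊥         ^⊥ = 𝟙
(! A)     ^⊥ = ¿ (A ^⊥)
(¿ A)     ^⊥ = ! (A ^⊥)

------------------------------------------------------------------------
-- Terms

-- The patterns ⟨a,b⟩, !u and ⋆ of the positive eliminators [p := s].
data Pat : Set where
  pair bang unit : Pat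

-- How many unrestricted and linear variables a pattern binds.
#ᵘ #ˡ : Pat → ℕ
#ᵘ pair = 0
#ᵘ bang = 1
#ᵘ unit = 0
#ˡ pair = 2
#ˡ bang = 0
#ˡ unit = 0

infix  7 _•_ _▼_ _♯_ _▸_
infixr 8 ℘_

-- Terms up to α-renaming: well-scoped de Bruijn terms with m unrestricted
-- and n linear variables in scope.  The two kinds of variables are indexed
-- separately.  A binder of a pair a,b makes a the linear variable 0 and b
-- the linear variable 1.
data Term (m n : ℕ) : Set where
  lvar  : Fin n → Term m n
  uvar  : Fin m → Term m n
  ⟨_,_⟩ : Term m n → Term m n → Term m n
  elim  : (p : Pat) → Term (#ᵘ p + m) (#ˡ p + n) → Term m n → Term m n
  ℘_    : Term m (2 + n) → Term m n
  _•_   : Term m n → Term m n → Term m n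
  _▼_   : Term m n → Term m n → Term m n
  !_    : Term m (1 + n) → Term m n
  ¿_    : Term (1 + m) n → Term m n
  -- t ▸ s binds the linear variable 0 in t only.
  _▸_   : Term m (1 + n) → Term m n → Term m n
  _♯_   : Term m n → Term m n → Term m n
  ⋆     : Term m n

infix 6 elim
syntax elim p t s = t [ p := s ]

------------------------------------------------------------------------
-- Renaming and substitution

Ren : (m n m′ n′ : ℕ) → Set
Ren m n m′ n′ = (Fin m → Fin m′) × (Fin n → Fin n′)

liftᴿ : {m n m′ n′ : ℕ} (k l : ℕ) → Ren m n m′ n′ → Ren (k + m) (l + n) (k + m′) (l + n′)
liftᴿ k l (ρ , π) = lift k ρ , lift l π

wk : {m n : ℕ} (k l : ℕ) → Ren m n (k + m) (l + n)
wk k l = (k ↑ʳ_) , (l ↑ʳ_)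

ren : {m n m′ n′ : ℕ} → Ren m n m′ n′ → Term m n → Term m′ n′
ren (ρ , π) (lvar a)       = lvar (π a)
ren (ρ , π) (uvar u)       = uvar (ρ u)
ren ρ       ⟨ t , s ⟩      = ⟨ ren ρ t , ren ρ s ⟩
ren ρ       (t [ p := s ]) = ren (liftᴿ (#ᵘ p) (#ˡ p) ρ) t [ p := ren ρ s ]
ren ρ       (℘ t)          = ℘ ren (liftᴿ 0 2 ρ) t
ren ρ       (t • s)        = ren ρ t • ren ρ s
ren ρ       (t ▼ s)        = ren ρ t ▼ ren ρ s
ren ρ       (! t)          = ! ren (liftᴿ 0 1 ρ) t
ren ρ       (¿ t)          = ¿ ren (liftᴿ 1 0 ρ) t
ren ρ       (t ▸ s)        = ren (liftᴿ 0 1 ρ) t ▸ ren ρ s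
ren ρ       (t ♯ s)        = ren ρ t ♯ ren ρ s
ren ρ       ⋆              = ⋆

Sub : (m n m′ n′ : ℕ) → Set
Sub m n m′ n′ = (Fin m → Term m′ n′) × (Fin n → Term m′ n′)

liftˢ : {m n m′ n′ : ℕ} (k l : ℕ) → Sub m n m′ n′ → Sub (k + m) (l + n) (k + m′) (l + n′)
liftˢ {m′ = m′} {n′ = n′} k l (σ , τ) =
  [ (λ u → uvar (u ↑ˡ m′)) , ren (wk k l) ∘ σ ]′ ∘ splitAt k ,
  [ (λ a → lvar (a ↑ˡ n′)) , ren (wk k l) ∘ τ ]′ ∘ splitAt l

sub : {m n m′ n′ : ℕ} → Sub m n m′ n′ → Term m n → Term m′ n′
sub (σ , τ) (lvar a)       = τ a
sub (σ , τ) (uvar u)       = σ u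
sub σ       ⟨ t , s ⟩      = ⟨ sub σ t , sub σ s ⟩
sub σ       (t [ p := s ]) = sub (liftˢ (#ᵘ p) (#ˡ p) σ) t [ p := sub σ s ]
sub σ       (℘ t)          = ℘ sub (liftˢ 0 2 σ) t
sub σ       (t • s)        = sub σ t • sub σ s
sub σ       (t ▼ s)        = sub σ t ▼ sub σ s
sub σ       (! t)          = ! sub (liftˢ 0 1 σ) t
sub σ       (¿ t)          = ¿ sub (liftˢ 1 0 σ) t
sub σ       (t ▸ s)        = sub (liftˢ 0 1 σ) t ▸ sub σ s
sub σ       (t ♯ s)        = sub σ t ♯ sub σ s
sub σ       ⋆              = ⋆

-- t{a := r} and t{u := r}.  The substituted variable leaves the scope, and
-- the remaining ones are renumbered in order.
substˡ : {m n : ℕ} → Fin (suc n) → Term m (suc n) → Term m n → Term m n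
substˡ a t r = sub (uvar , insertAt lvar a r) t

substᵘ : {m n : ℕ} → Fin (suc m) → Term (suc m) n → Term m n → Term m n
substᵘ u t r = sub (insertAt uvar u r , lvar) t

infixl 9 _[_]ˡ _[_]ᵘ

_[_]ˡ : {m n : ℕ} → Term m (suc n) → Term m n → Term m n
t [ r ]ˡ = substˡ zero t r

_[_]ᵘ : {m n : ℕ} → Term (suc m) n → Term m n → Term m n
t [ r ]ᵘ = substᵘ zero t r

------------------------------------------------------------------------
-- Free linear variables and linear terms

-- Number of free occurrences of a linear variable.
occ : {m n : ℕ} → Fin n → Term m n → ℕ
occ a (lvar b)       = if does (a ≟ b) then 1 else 0
occ a (uvar u)       = 0
occ a ⟨ t , s ⟩      = occ a t + occ a s
occ a (t [ p := s ]) = occ (#ˡ p ↑ʳ a) t + occ a s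
occ a (℘ t)          = occ (2 ↑ʳ a) t
occ a (t • s)        = occ a t + occ a s
occ a (t ▼ s)        = occ a t + occ a s
occ a (! t)          = occ (suc a) t
occ a (¿ t)          = occ a t
occ a (t ▸ s)        = occ (suc a) t + occ a s
occ a (t ♯ s)        = occ a t + occ a s
occ a ⋆              = 0

infix 4 _∈fv_ _∈fv?_

_∈fv_ : {m n : ℕ} → Fin n → Term m n → Set
a ∈fv t = 0 < occ a t

_∈fv?_ : {m n : ℕ} (a : Fin n) (t : Term m n) → Dec (a ∈fv t)
a ∈fv? t = 0 <? occ a t

-- The conditions of linearity on the subterms of a term: bound linear
-- variables occur exactly once, and the bodies of ! t and t ▸ s have no other
-- free linear variable than the bound one.
WellBound : {m n : ℕ} → Term m n → Set
WellBound (lvar a)  = ⊤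
WellBound (uvar u)  = ⊤
WellBound ⟨ t , s ⟩ = WellBound t × WellBound s
WellBound {n = n} (t [ p := s ]) =
  (∀ (i : Fin (#ˡ p)) → occ (i ↑ˡ n) t ≡ 1) × WellBound t × WellBound s
WellBound {n = n} (℘ t) =
  (∀ (i : Fin 2) → occ (i ↑ˡ n) t ≡ 1) × WellBound t
WellBound (t • s)   = WellBound t × WellBound s
WellBound (t ▼ s)   = WellBound t × WellBound s
WellBound (! t)     =
  occ zero t ≡ 1 × (∀ a → ¬ (suc a ∈fv t)) × WellBound t
WellBound (¿ t)     = WellBound t
WellBound (t ▸ s)   =
  occ zero t ≡ 1 × (∀ a → ¬ (suc a ∈fv t)) × WellBound t × WellBound s
WellBound (t ♯ s)   = WellBound t × WellBound s
WellBound ⋆         = ⊤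

Linear : {m n : ℕ} → Term m n → Set
Linear t = (∀ a → a ∈fv t → occ a t ≡ 1) × WellBound t

------------------------------------------------------------------------
-- Contra-substitution

-- t{a \\ s} for linear t with a ∈ fv(t); the values outside of this domain
-- are arbitrary.  The variable a stays in the scope of the result, where it
-- does not occur if a ∉ fv(s).
contra : {m n : ℕ} → Fin n → Term m n → Term m n → Term m n
contra a (lvar _) s = s
contra a (uvar u) s = uvar u
contra a ⟨ t₁ , t₂ ⟩ s =
  if does (a ∈fv? t₁) then contra a t₁ (s ▼ t₂) else contra a t₂ (s • t₁)
contra a (t₁ • t₂) s =
  if does (a ∈fv? t₁) then contra a t₁ ⟨ t₂ , s ⟩ else contra a t₂ (t₁ ▼ s)
contra a (t₁ ▼ t₂) s =
  if does (a ∈fv? t₁) then contra a t₁ ⟨ s , t₂ ⟩ else contra a t₂ (t₁ • s)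
contra a (t₁ [ pair := t₂ ]) s =
  if does (2 ↑ʳ a ∈fv? t₁)
  then contra (2 ↑ʳ a) t₁ (ren (wk 0 2) s) [ pair := t₂ ]
  else contra a t₂ (℘ (t₁ ♯ ren (wk 0 2) s))
contra a (℘ t) s = contra (2 ↑ʳ a) t ⋆ [ pair := s ]
contra a (t₁ [ bang := t₂ ]) s =
  if does (a ∈fv? t₁)
  then contra a t₁ (ren (wk 1 0) s) [ bang := t₂ ]
  else contra a t₂ (¿ (t₁ ♯ ren (wk 1 0) s))
contra a (¿ t) s = contra a t ⋆ [ bang := s ]
contra a (! t) s = ! t
contra a (t₁ ▸ t₂) s = contra a t₂ (! t₁) [ unit := s ]
contra a (t₁ ♯ t₂) s =
  if does (a ∈fv? t₁) then contra a t₁ t₂ [ unit := s ] else contra a t₂ t₁ [ unit := s ]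
contra a (t₁ [ unit := t₂ ]) s =
  if does (a ∈fv? t₁) then contra a t₁ s [ unit := t₂ ] else contra a t₂ (t₁ ♯ s)
contra a ⋆ s = ⋆

infixl 9 _⟪\\⋆⟫

-- t{a \\ ⋆} for a the linear variable 0, in a scope without a.  The outer
-- substitution only strengthens: a does not occur in the term it acts on.
_⟪\\⋆⟫ : {m n : ℕ} → Term m (suc n) → Term m n
t ⟪\\⋆⟫ = contra zero t ⋆ [ ⋆ ]ˡ

------------------------------------------------------------------------
-- Typing

-- An unrestricted context gives a formula to each unrestricted variable in
-- scope.  A linear context is a partial function on the linear variables in
-- scope, since the variables in scope are shared out among the subterms.
UCtx : Set → ℕ → Set
UCtx X m = Vec (Formula X) m

LCtx : Set → ℕ → Set
LCtx X n = Vec (Maybe (Formula X)) n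

∅ : {X : Set} {n : ℕ} → LCtx X n
∅ {n = n} = replicate n nothing

infix 4 _≔_⊎_

-- Γ ≔ Γ₁ ⊎ Γ₂: Γ is the union of Γ₁ and Γ₂, whose domains are disjoint.
data _≔_⊎_ {X : Set} : {n : ℕ} → LCtx X n → LCtx X n → LCtx X n → Set where
  []    : [] ≔ [] ⊎ []
  none  : {n : ℕ} {Γ Γ₁ Γ₂ : LCtx X n} →
          Γ ≔ Γ₁ ⊎ Γ₂ → nothing ∷ Γ ≔ nothing ∷ Γ₁ ⊎ nothing ∷ Γ₂
  left  : {n : ℕ} {Γ Γ₁ Γ₂ : LCtx X n} {A : Formula X} →
          Γ ≔ Γ₁ ⊎ Γ₂ → just A ∷ Γ ≔ just A ∷ Γ₁ ⊎ nothing ∷ Γ₂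
  right : {n : ℕ} {Γ Γ₁ Γ₂ : LCtx X n} {A : Formula X} →
          Γ ≔ Γ₁ ⊎ Γ₂ → just A ∷ Γ ≔ nothing ∷ Γ₁ ⊎ just A ∷ Γ₂

infix 3 _∣_⊢_∶_

data _∣_⊢_∶_ {X : Set} {m n : ℕ} (Δ : UCtx X m) :
             LCtx X n → Term m n → Formula X → Set where
  lvar : ∀ {a A} → Δ ∣ ∅ [ a ]≔ just A ⊢ lvar a ∶ A
  uvar : ∀ {u A} → Δ [ u ]= A → Δ ∣ ∅ ⊢ uvar u ∶ A
  tensor : ∀ {Γ Γ₁ Γ₂ t s A B} → Γ ≔ Γ₁ ⊎ Γ₂ →
    Δ ∣ Γ₁ ⊢ t ∶ A → Δ ∣ Γ₂ ⊢ s ∶ B → Δ ∣ Γ ⊢ ⟨ t , s ⟩ ∶ A ⊗ B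
  elim-pair : ∀ {Γ Γ₁ Γ₂ t s A B C} → Γ ≔ Γ₁ ⊎ Γ₂ →
    Δ ∣ Γ₁ ⊢ s ∶ A ⊗ B → Δ ∣ just A ∷ just B ∷ Γ₂ ⊢ t ∶ C →
    Δ ∣ Γ ⊢ t [ pair := s ] ∶ C
  par : ∀ {Γ t A B} →
    Δ ∣ just A ∷ just B ∷ Γ ⊢ t ∶ ⊥ → Δ ∣ Γ ⊢ ℘ t ∶ (A ^⊥) ⅋ (B ^⊥)
  app : ∀ {Γ Γ₁ Γ₂ t s A B} → Γ ≔ Γ₁ ⊎ Γ₂ →
    Δ ∣ Γ₁ ⊢ t ∶ A ⅋ B → Δ ∣ Γ₂ ⊢ s ∶ A ^⊥ → Δ ∣ Γ ⊢ t • s ∶ B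
  coapp : ∀ {Γ Γ₁ Γ₂ t s A B} → Γ ≔ Γ₁ ⊎ Γ₂ →
    Δ ∣ Γ₁ ⊢ t ∶ A ⅋ B → Δ ∣ Γ₂ ⊢ s ∶ B ^⊥ → Δ ∣ Γ ⊢ t ▼ s ∶ A
  ofcourse : ∀ {t A} →
    Δ ∣ just A ∷ ∅ ⊢ t ∶ ⊥ → Δ ∣ ∅ ⊢ ! t ∶ ! (A ^⊥)
  elim-bang : ∀ {Γ Γ₁ Γ₂ t s A B} → Γ ≔ Γ₁ ⊎ Γ₂ →
    Δ ∣ Γ₁ ⊢ s ∶ ! A → A ∷ Δ ∣ Γ₂ ⊢ t ∶ B → Δ ∣ Γ ⊢ t [ bang := s ] ∶ B
  whynot : ∀ {Γ t A} →
    (A ^⊥) ∷ Δ ∣ Γ ⊢ t ∶ ⊥ → Δ ∣ Γ ⊢ ¿ t ∶ ¿ A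
  elim-whynot : ∀ {Γ t s A} →
    Δ ∣ Γ ⊢ s ∶ ¿ A → Δ ∣ just A ∷ ∅ ⊢ t ∶ ⊥ → Δ ∣ Γ ⊢ t ▸ s ∶ ⊥
  cut : ∀ {Γ Γ₁ Γ₂ t s B} → Γ ≔ Γ₁ ⊎ Γ₂ →
    Δ ∣ Γ₁ ⊢ t ∶ B → Δ ∣ Γ₂ ⊢ s ∶ B ^⊥ → Δ ∣ Γ ⊢ t ♯ s ∶ ⊥
  one : Δ ∣ ∅ ⊢ ⋆ ∶ 𝟙
  elim-unit : ∀ {Γ Γ₁ Γ₂ t s A} → Γ ≔ Γ₁ ⊎ Γ₂ →
    Δ ∣ Γ₁ ⊢ s ∶ 𝟙 → Δ ∣ Γ₂ ⊢ t ∶ A → Δ ∣ Γ ⊢ t [ unit := s ] ∶ A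

------------------------------------------------------------------------
-- Contextual closure

-- The contextual closure, under all term constructors, of the instances of R
-- whose two sides have the same type in the same contexts.  It is indexed by
-- a typing, so that an instance of R is used only at the contexts and type of
-- the position it is plugged into.
data Closure (R : ∀ {m n} → Term m n → Term m n → Set) {X : Set} {m n : ℕ} (Δ : UCtx X m) :
             LCtx X n → Formula X → Term m n → Term m n → Set where
  axiom : ∀ {Γ t t′ A} → R t t′ →
    Δ ∣ Γ ⊢ t ∶ A → Δ ∣ Γ ⊢ t′ ∶ A → Closure R Δ Γ A t t′
  tensorˡ : ∀ {Γ Γ₁ Γ₂ t t′ s A B} → Γ ≔ Γ₁ ⊎ Γ₂ →
    Closure R Δ Γ₁ A t t′ → Δ ∣ Γ₂ ⊢ s ∶ B →
    Closure R Δ Γ (A ⊗ B) ⟨ t , s ⟩ ⟨ t′ , s ⟩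
  tensorʳ : ∀ {Γ Γ₁ Γ₂ t s s′ A B} → Γ ≔ Γ₁ ⊎ Γ₂ →
    Δ ∣ Γ₁ ⊢ t ∶ A → Closure R Δ Γ₂ B s s′ →
    Closure R Δ Γ (A ⊗ B) ⟨ t , s ⟩ ⟨ t , s′ ⟩
  elim-pairˡ : ∀ {Γ Γ₁ Γ₂ t t′ s A B C} → Γ ≔ Γ₁ ⊎ Γ₂ →
    Δ ∣ Γ₁ ⊢ s ∶ A ⊗ B → Closure R Δ (just A ∷ just B ∷ Γ₂) C t t′ →
    Closure R Δ Γ C (t [ pair := s ]) (t′ [ pair := s ])
  elim-pairʳ : ∀ {Γ Γ₁ Γ₂ t s s′ A B C} → Γ ≔ Γ₁ ⊎ Γ₂ →
    Closure R Δ Γ₁ (A ⊗ B) s s′ → Δ ∣ just A ∷ just B ∷ Γ₂ ⊢ t ∶ C →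
    Closure R Δ Γ C (t [ pair := s ]) (t [ pair := s′ ])
  par : ∀ {Γ t t′ A B} →
    Closure R Δ (just A ∷ just B ∷ Γ) ⊥ t t′ →
    Closure R Δ Γ ((A ^⊥) ⅋ (B ^⊥)) (℘ t) (℘ t′)
  appˡ : ∀ {Γ Γ₁ Γ₂ t t′ s A B} → Γ ≔ Γ₁ ⊎ Γ₂ →
    Closure R Δ Γ₁ (A ⅋ B) t t′ → Δ ∣ Γ₂ ⊢ s ∶ A ^⊥ →
    Closure R Δ Γ B (t • s) (t′ • s)
  appʳ : ∀ {Γ Γ₁ Γ₂ t s s′ A B} → Γ ≔ Γ₁ ⊎ Γ₂ →
    Δ ∣ Γ₁ ⊢ t ∶ A ⅋ B → Closure R Δ Γ₂ (A ^⊥) s s′ →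
    Closure R Δ Γ B (t • s) (t • s′)
  coappˡ : ∀ {Γ Γ₁ Γ₂ t t′ s A B} → Γ ≔ Γ₁ ⊎ Γ₂ →
    Closure R Δ Γ₁ (A ⅋ B) t t′ → Δ ∣ Γ₂ ⊢ s ∶ B ^⊥ →
    Closure R Δ Γ A (t ▼ s) (t′ ▼ s)
  coappʳ : ∀ {Γ Γ₁ Γ₂ t s s′ A B} → Γ ≔ Γ₁ ⊎ Γ₂ →
    Δ ∣ Γ₁ ⊢ t ∶ A ⅋ B → Closure R Δ Γ₂ (B ^⊥) s s′ →
    Closure R Δ Γ A (t ▼ s) (t ▼ s′)
  ofcourse : ∀ {t t′ A} →
    Closure R Δ (just A ∷ ∅) ⊥ t t′ →
    Closure R Δ ∅ (! (A ^⊥)) (! t) (! t′)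
  elim-bangˡ : ∀ {Γ Γ₁ Γ₂ t t′ s A B} → Γ ≔ Γ₁ ⊎ Γ₂ →
    Δ ∣ Γ₁ ⊢ s ∶ ! A → Closure R (A ∷ Δ) Γ₂ B t t′ →
    Closure R Δ Γ B (t [ bang := s ]) (t′ [ bang := s ])
  elim-bangʳ : ∀ {Γ Γ₁ Γ₂ t s s′ A B} → Γ ≔ Γ₁ ⊎ Γ₂ →
    Closure R Δ Γ₁ (! A) s s′ → A ∷ Δ ∣ Γ₂ ⊢ t ∶ B →
    Closure R Δ Γ B (t [ bang := s ]) (t [ bang := s′ ])
  whynot : ∀ {Γ t t′ A} →
    Closure R ((A ^⊥) ∷ Δ) Γ ⊥ t t′ →
    Closure R Δ Γ (¿ A) (¿ t) (¿ t′)
  elim-whynotˡ : ∀ {Γ t t′ s A} →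
    Δ ∣ Γ ⊢ s ∶ ¿ A → Closure R Δ (just A ∷ ∅) ⊥ t t′ →
    Closure R Δ Γ ⊥ (t ▸ s) (t′ ▸ s)
  elim-whynotʳ : ∀ {Γ t s s′ A} →
    Closure R Δ Γ (¿ A) s s′ → Δ ∣ just A ∷ ∅ ⊢ t ∶ ⊥ →
    Closure R Δ Γ ⊥ (t ▸ s) (t ▸ s′)
  cutˡ : ∀ {Γ Γ₁ Γ₂ t t′ s B} → Γ ≔ Γ₁ ⊎ Γ₂ →
    Closure R Δ Γ₁ B t t′ → Δ ∣ Γ₂ ⊢ s ∶ B ^⊥ →
    Closure R Δ Γ ⊥ (t ♯ s) (t′ ♯ s)
  cutʳ : ∀ {Γ Γ₁ Γ₂ t s s′ B} → Γ ≔ Γ₁ ⊎ Γ₂ →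
    Δ ∣ Γ₁ ⊢ t ∶ B → Closure R Δ Γ₂ (B ^⊥) s s′ →
    Closure R Δ Γ ⊥ (t ♯ s) (t ♯ s′)
  elim-unitˡ : ∀ {Γ Γ₁ Γ₂ t t′ s A} → Γ ≔ Γ₁ ⊎ Γ₂ →
    Δ ∣ Γ₁ ⊢ s ∶ 𝟙 → Closure R Δ Γ₂ A t t′ →
    Closure R Δ Γ A (t [ unit := s ]) (t′ [ unit := s ])
  elim-unitʳ : ∀ {Γ Γ₁ Γ₂ t s s′ A} → Γ ≔ Γ₁ ⊎ Γ₂ →
    Closure R Δ Γ₁ 𝟙 s s′ → Δ ∣ Γ₂ ⊢ t ∶ A →
    Closure R Δ Γ A (t [ unit := s ]) (t [ unit := s′ ])

------------------------------------------------------------------------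
-- Positive elimination contexts

-- Sizes of the scope of the hole, for a context with eliminators on the
-- patterns ps, outermost first.
holeᵘ holeˡ : List Pat → ℕ → ℕ
holeᵘ []       m = m
holeᵘ (p ∷ ps) m = holeᵘ ps (#ᵘ p + m)
holeˡ []       n = n
holeˡ (p ∷ ps) n = holeˡ ps (#ˡ p + n)

data PosCtx : List Pat → (m n : ℕ) → Set where
  □     : {m n : ℕ} → PosCtx [] m n
  elimᴸ : {ps : List Pat} {m n : ℕ} (p : Pat) →
          PosCtx ps (#ᵘ p + m) (#ˡ p + n) → Term m n → PosCtx (p ∷ ps) m n

infixl 9 _$ᴸ_

-- t $ᴸ L is tL.
_$ᴸ_ : {ps : List Pat} {m n : ℕ} →
       Term (holeᵘ ps m) (holeˡ ps n) → PosCtx ps m n → Term m n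
t $ᴸ □           = t
t $ᴸ elimᴸ p L s = (t $ᴸ L) [ p := s ]

liftᴸ : {m n m′ n′ : ℕ} (ps : List Pat) → Ren m n m′ n′ →
        Ren (holeᵘ ps m) (holeˡ ps n) (holeᵘ ps m′) (holeˡ ps n′)
liftᴸ []       ρ = ρ
liftᴸ (p ∷ ps) ρ = liftᴸ ps (liftᴿ (#ᵘ p) (#ˡ p) ρ)

wkᴸ : {m n : ℕ} (ps : List Pat) → Ren m n (holeᵘ ps m) (holeˡ ps n)
wkᴸ []       = id , id
wkᴸ (p ∷ ps) with wk (#ᵘ p) (#ˡ p) | wkᴸ ps
... | ρ , π | ρ′ , π′ = ρ′ ∘ ρ , π′ ∘ π

renᴸ : {ps : List Pat} {m n m′ n′ : ℕ} → Ren m n m′ n′ → PosCtx ps m n → PosCtx ps m′ n′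
renᴸ ρ □             = □
renᴸ ρ (elimᴸ p L s) = elimᴸ p (renᴸ (liftᴿ (#ᵘ p) (#ˡ p) ρ) L) (ren ρ s)

------------------------------------------------------------------------
-- Pre-reduction

infix 4 _↦_

-- Conditions such as b ∉ fv(r) are ensured by the weakenings.  In the context
-- LK, K is outermost and L is moved into its scope: a term from the hole of L
-- is then renamed by liftᴸ ps (wkᴸ qs), and one from the hole of K by wkᴸ ps.
data _↦_ {m n : ℕ} : Term m n → Term m n → Set where
  ℘-• : ∀ {ps t r} (L : PosCtx ps m n) →
    (℘ t) $ᴸ L • r ↦
    t [ ren (wk 0 1) (ren (wkᴸ ps) r) ]ˡ ⟪\\⋆⟫ $ᴸ L
  ℘-▼ : ∀ {ps t r} (L : PosCtx ps m n) →
    (℘ t) $ᴸ L ▼ r ↦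
    substˡ (suc zero) t (ren (wk 0 1) (ren (wkᴸ ps) r)) ⟪\\⋆⟫ $ᴸ L
  pair-⟨⟩ : ∀ {ps t s r} (L : PosCtx ps m n) →
    t [ pair := ⟨ s , r ⟩ $ᴸ L ] ↦
    ren (liftᴿ 0 2 (wkᴸ ps)) t [ ren (wk 0 1) s ]ˡ [ r ]ˡ $ᴸ L
  bang-! : ∀ {ps t s} (L : PosCtx ps m n) →
    t [ bang := (! s) $ᴸ L ] ↦
    ren (liftᴿ 1 0 (wkᴸ ps)) t [ s ⟪\\⋆⟫ ]ᵘ $ᴸ L
  ▸-¿ : ∀ {ps t s} (L : PosCtx ps m n) →
    t ▸ (¿ s) $ᴸ L ↦
    s [ ren (wkᴸ ps) (t ⟪\\⋆⟫) ]ᵘ $ᴸ L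
  ℘-♯-⟨⟩ : ∀ {ps qs t s r} (L : PosCtx ps m n) (K : PosCtx qs m n) →
    (℘ t) $ᴸ L ♯ ⟨ s , r ⟩ $ᴸ K ↦
    ren (liftᴿ 0 2 (liftᴸ ps (wkᴸ qs))) t
      [ ren (wk 0 1) (ren (wkᴸ ps) s) ]ˡ [ ren (wkᴸ ps) r ]ˡ $ᴸ renᴸ (wkᴸ qs) L $ᴸ K
  ⟨⟩-♯-℘ : ∀ {ps qs t s r} (L : PosCtx ps m n) (K : PosCtx qs m n) →
    ⟨ s , r ⟩ $ᴸ L ♯ (℘ t) $ᴸ K ↦
    ren (liftᴿ 0 2 (wkᴸ ps)) t
      [ ren (wk 0 1) (ren (liftᴸ ps (wkᴸ qs)) s) ]ˡ [ ren (liftᴸ ps (wkᴸ qs)) r ]ˡ $ᴸ renᴸ (wkᴸ qs) L $ᴸ K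
  !-♯-¿ : ∀ {ps qs t r} (L : PosCtx ps m n) (K : PosCtx qs m n) →
    (! t) $ᴸ L ♯ (¿ r) $ᴸ K ↦
    ren (liftᴿ 1 0 (wkᴸ ps)) r
      [ ren (liftᴸ ps (wkᴸ qs)) (t ⟪\\⋆⟫) ]ᵘ $ᴸ renᴸ (wkᴸ qs) L $ᴸ K
  ¿-♯-! : ∀ {ps qs t r} (L : PosCtx ps m n) (K : PosCtx qs m n) →
    (¿ r) $ᴸ L ♯ (! t) $ᴸ K ↦
    ren (liftᴿ 1 0 (liftᴸ ps (wkᴸ qs))) r
      [ ren (wkᴸ ps) (t ⟪\\⋆⟫) ]ᵘ $ᴸ renᴸ (wkᴸ qs) L $ᴸ K

infix 3 _∣_⊢_⟶⁻_∶_

_∣_⊢_⟶⁻_∶_ : {X : Set} {m n : ℕ} → UCtx X m → LCtx X n → Term m n → Term m n → Formula X → Set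
Δ ∣ Γ ⊢ t ⟶⁻ t′ ∶ A = Closure _↦_ Δ Γ A t t′

------------------------------------------------------------------------
-- Surface contexts

-- Surface m n k l: the hole is under k unrestricted and l linear binders.
data Surface (m n : ℕ) : (k l : ℕ) → Set where
  ℘□       : Surface m n 0 2
  ⟨□,_⟩    : Term m n → Surface m n 0 0
  ⟨_,□⟩    : Term m n → Surface m n 0 0
  □•_      : Term m n → Surface m n 0 0
  _•□      : Term m n → Surface m n 0 0
  □▼_      : Term m n → Surface m n 0 0
  _▼□      : Term m n → Surface m n 0 0
  □♯_      : Term m n → Surface m n 0 0
  _♯□      : Term m n → Surface m n 0 0
  ¿□       : Surface m n 1 0
  □[_:=_]  : (p : Pat) → Term m n → Surface m n (#ᵘ p) (#ˡ p)
  elim□    : (p : Pat) → Term (#ᵘ p + m) (#ˡ p + n) → Surface m n 0 0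
  _▸□      : Term m (1 + n) → Surface m n 0 0

plug : {m n k l : ℕ} → Surface m n k l → Term (k + m) (l + n) → Term m n
plug ℘□           r = ℘ r
plug ⟨□, t ⟩      r = ⟨ r , t ⟩
plug ⟨ t ,□⟩      r = ⟨ t , r ⟩
plug (□• t)       r = r • t
plug (t •□)       r = t • r
plug (□▼ t)       r = r ▼ t
plug (t ▼□)       r = t ▼ r
plug (□♯ t)       r = r ♯ t
plug (t ♯□)       r = t ♯ r
plug ¿□           r = ¿ r
plug □[ p := t ]  r = r [ p := t ]
plug (elim□ p t)  r = t [ p := r ]
plug (t ▸□)       r = t ▸ r

renᔆ : {m n m′ n′ k l : ℕ} → Ren m n m′ n′ → Surface m n k l → Surface m′ n′ k l
renᔆ ρ ℘□           = ℘□
renᔆ ρ ⟨□, t ⟩      = ⟨□, ren ρ t ⟩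
renᔆ ρ ⟨ t ,□⟩      = ⟨ ren ρ t ,□⟩
renᔆ ρ (□• t)       = □• ren ρ t
renᔆ ρ (t •□)       = ren ρ t •□
renᔆ ρ (□▼ t)       = □▼ ren ρ t
renᔆ ρ (t ▼□)       = ren ρ t ▼□
renᔆ ρ (□♯ t)       = □♯ ren ρ t
renᔆ ρ (t ♯□)       = ren ρ t ♯□
renᔆ ρ ¿□           = ¿□
renᔆ ρ □[ p := t ]  = □[ p := ren ρ t ]
renᔆ ρ (elim□ p t)  = elim□ p (ren (liftᴿ (#ᵘ p) (#ˡ p) ρ) t)
renᔆ ρ (t ▸□)       = ren (liftᴿ 0 1 ρ) t ▸□

------------------------------------------------------------------------
-- Structural equivalence

-- Exchanges an inner block of k variables with an outer block of j variables.
exchange : {n : ℕ} (k j : ℕ) → Fin (k + (j + n)) → Fin (j + (k + n))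
exchange {n} k j i =
  [ (λ x → j ↑ʳ (x ↑ˡ n))
  , (λ y → [ _↑ˡ (k + n) , (λ z → j ↑ʳ (k ↑ʳ z)) ]′ (splitAt j y))
  ]′ (splitAt k i)

infix 4 _≋₀_

-- In slide, fv(p) ∩ fv(S) = ∅ and the freeness of r for S are ensured by the
-- weakenings of S and r.  The binders of p and of S are distinct by
-- α-renaming, and t is in the scope of both.
data _≋₀_ {m n : ℕ} : Term m n → Term m n → Set where
  slide : ∀ {k l r} (p : Pat) (S : Surface m n k l)
    {t : Term (k + (#ᵘ p + m)) (l + (#ˡ p + n))} →
    plug (renᔆ (wk (#ᵘ p) (#ˡ p)) S) t [ p := r ] ≋₀
    plug S (ren (exchange k (#ᵘ p) , exchange l (#ˡ p)) t [ p := ren (wk k l) r ])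
  unit-⋆ : ∀ {t} → t [ unit := ⋆ ] ≋₀ t
  unit-swap : ∀ {t s} → t [ unit := s ] ≋₀ s [ unit := t ]
  cut-subst : ∀ {t r} → Linear t → zero ∈fv t → t ⟪\\⋆⟫ ♯ r ≋₀ t [ r ]ˡ

infix 3 _∣_⊢_≋_∶_

_∣_⊢_≋_∶_ : {X : Set} {m n : ℕ} → UCtx X m → LCtx X n → Term m n → Term m n → Formula X → Set
Δ ∣ Γ ⊢ t ≋ s ∶ A = EqClosure (Closure _≋₀_ Δ Γ A) t s

{-# OPTIONS --safe #-}

-- Structural equivalence is hard to simulate because of cut-subst, which acts at a
-- distance.  On linear terms it is generated by axioms that move a single term
-- constructor across a cut, such as (t • s) ♯ r ≈ t ♯ ⟨ s , r ⟩ and t ♯ s ≈ s ♯ t: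
-- pushing a term through the surface contexts above a is exactly the recursion that
-- defines t{a \\ s}.  With these axioms, contra-substitution respects ≈ in both of its
-- arguments.
--
-- A redex is a head, that is an elimination, which meets a value under positive
-- eliminators.  A local axiom at a redex either permutes an eliminator with the head or
-- trades an elimination for a cut against the dual value; the axiom comm then swaps
-- the two sides of the cut, each of which can be seen as the head of the other.  In
-- every case the redex survives, and both reducts are equivalent.
--
-- Terms are typed without splitting linear contexts, so that no context has to be
-- redistributed when constructors move; occurrence counts recover the splittings.
module Submission where

open import Data.Bool using (Bool; true; false; if_then_else_; not; _∧_; _∨_; _xor_)
open import Data.Bool.Properties using (not-involutive; ∨-zeroʳ; ∨-identityʳ; xor-assoc; xor-comm; xor-identityʳ)
import Data.Empty as Empty
open import Data.Fin using (Fin; zero; suc; _↑ˡ_; _↑ʳ_; lift; _≟_)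
import Data.Fin.Properties as Fin
open import Data.Fin.Properties using (splitAt-↑ˡ; splitAt-↑ʳ)
open import Data.List using (List; []; _∷_)
open import Data.Maybe using (Maybe; just; nothing)
open import Data.Maybe.Properties using (just-injective)
open import Data.Nat using (ℕ; zero; suc; _+_; _<_; _<?_; z≤n; s≤s)
import Data.Nat.Properties as Nat
open import Data.Nat.Properties using (+-comm; +-assoc; +-identityʳ; m+n≡0⇒m≡0; m+n≡0⇒n≡0)
import Data.Product as Product
open import Data.Product using (∃-syntax; _×_; _,_; proj₁; proj₂)
open import Data.Sum using (_⊎_; inj₁; inj₂; [_,_]′)
open import Data.Unit using (⊤; tt)
open import Data.Vec using (Vec; []; _∷_; _++_; lookup; tabulate; _[_]≔_)
open import Data.Vec.Functional using (insertAt)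
open import Data.Vec.Properties
  using (lookup-++ˡ; lookup-++ʳ; lookup∘tabulate; tabulate∘lookup; tabulate-cong; lookup-replicate;
         lookup∘updateAt; lookup∘update; lookup∘update′; []=⇒lookup; lookup⇒[]=)
open import Function using (id; _∘_)
open import Relation.Binary.Construct.Closure.Equivalence using (gmap; return; symmetric; transitive)
open import Relation.Binary.Construct.Closure.ReflexiveTransitive using (ε; _◅_)
open import Relation.Binary.Construct.Closure.Symmetric using (fwd; bwd)
open import Relation.Binary.PropositionalEquality
  using (_≡_; _≢_; refl; sym; trans; cong; cong₂; subst; subst₂; module ≡-Reasoning)
open import Relation.Nullary using (yes; no; does; ¬_; contradiction)
open import Relation.Nullary.Decidable using (dec-true; dec-false)
open import Defs

-- Contracting a redex leaves a contra-substitution at `⋆`, so rewriting the body of a redex has to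
-- be carried through `contra`. The recursion of `contra` moves the siblings of the variable into
-- its second argument, hence both arguments are rewritten at once; the hard axiom is `slide`, the
-- only one that exchanges binders. In a cut, an equivalence on one side is an equivalence of the
-- head for the other side, which endangers termination. A value seen as a head is never a cut, so
-- head and value exchange roles at most once; `Rank` records this. The given axiom of unit swapping
-- is stated at every type, although outside type `𝟙` it would destroy redexes: `t [ unit := s ]`
-- has the spine of `t`, the swapped term that of `s`. A semantic argument on types excludes such
-- instances. Linearity of the final term is not derived from its reduction. It is carried over from
-- the given reduct, which is typed, along the equivalence of the two.

private
  variable
    X : Set
    m n m′ n′ m″ n″ k l : ℕ

-- Renamings and substitutions

infix 4 _≗ᴿ_ _≗ˢ_
infixr 9 _∘ᴿ_ _ʳ∘ˢ_ _ˢ∘ʳ_ _∘ˢ_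

record _≗ᴿ_ {m n m′ n′ : ℕ} (ρ ρ′ : Ren m n m′ n′) : Set where
  constructor _,_
  field
    atᵘ : ∀ u → proj₁ ρ u ≡ proj₁ ρ′ u
    atˡ : ∀ a → proj₂ ρ a ≡ proj₂ ρ′ a
open _≗ᴿ_

record _≗ˢ_ {m n m′ n′ : ℕ} (σ σ′ : Sub m n m′ n′) : Set where
  constructor _,_
  field
    atᵘ : ∀ u → proj₁ σ u ≡ proj₁ σ′ u
    atˡ : ∀ a → proj₂ σ a ≡ proj₂ σ′ a
open _≗ˢ_

_∘ᴿ_ : Ren m′ n′ m″ n″ → Ren m n m′ n′ → Ren m n m″ n″
(ρ′ , π′) ∘ᴿ (ρ , π) = ρ′ ∘ ρ , π′ ∘ π

_ʳ∘ˢ_ : Ren m′ n′ m″ n″ → Sub m n m′ n′ → Sub m n m″ n″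
ρ ʳ∘ˢ (σ , τ) = ren ρ ∘ σ , ren ρ ∘ τ

_ˢ∘ʳ_ : Sub m′ n′ m″ n″ → Ren m n m′ n′ → Sub m n m″ n″
(σ , τ) ˢ∘ʳ (ρ , π) = σ ∘ ρ , τ ∘ π

_∘ˢ_ : Sub m′ n′ m″ n″ → Sub m n m′ n′ → Sub m n m″ n″
σ′ ∘ˢ (σ , τ) = sub σ′ ∘ σ , sub σ′ ∘ τ

idˢ : Sub m n m n
idˢ = uvar , lvar

-- A view rather than `splitAt`: matching on it puts `i ↑ˡ n` or `k ↑ʳ j` in place of the index,
-- which is the form in which the equations for `lift`, `liftˢ` and `exchange` apply.
data Split (k : ℕ) {n : ℕ} : Fin (k + n) → Set where
  bound : (i : Fin k) → Split k (i ↑ˡ n)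
  free  : (j : Fin n) → Split k (k ↑ʳ j)

split : ∀ k {n} (i : Fin (k + n)) → Split k i
split zero    i       = free i
split (suc k) zero    = bound zero
split (suc k) (suc i) with split k i
... | bound j = bound (suc j)
... | free j  = free j

lift-cong : ∀ k {f g : Fin n → Fin n′} → (∀ i → f i ≡ g i) → ∀ i → lift k f i ≡ lift k g i
lift-cong zero    e i       = e i
lift-cong (suc k) e zero    = refl
lift-cong (suc k) e (suc i) = cong suc (lift-cong k e i)

lift-∘ : ∀ k (g : Fin n′ → Fin n″) (f : Fin n → Fin n′) i → lift k g (lift k f i) ≡ lift k (g ∘ f) i
lift-∘ zero    g f i       = refl
lift-∘ (suc k) g f zero    = refl
lift-∘ (suc k) g f (suc i) = cong suc (lift-∘ k g f i)

lift-↑ʳ : ∀ k (f : Fin n → Fin n′) i → lift k f (k ↑ʳ i) ≡ k ↑ʳ f i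
lift-↑ʳ zero    f i = refl
lift-↑ʳ (suc k) f i = cong suc (lift-↑ʳ k f i)

lift-↑ˡ : ∀ k (f : Fin n → Fin n′) (i : Fin k) → lift k f (i ↑ˡ n) ≡ i ↑ˡ n′
lift-↑ˡ (suc k) f zero    = refl
lift-↑ˡ (suc k) f (suc i) = cong suc (lift-↑ˡ k f i)

lift-id : ∀ k (i : Fin (k + n)) → lift k id i ≡ i
lift-id zero    i       = refl
lift-id (suc k) zero    = refl
lift-id (suc k) (suc i) = cong suc (lift-id k i)

liftᴿ-cong : ∀ k l {ρ ρ′ : Ren m n m′ n′} → ρ ≗ᴿ ρ′ → liftᴿ k l ρ ≗ᴿ liftᴿ k l ρ′
liftᴿ-cong k l (e , f) = lift-cong k e , lift-cong l f

liftᴿ-∘ : ∀ k l (ρ′ : Ren m′ n′ m″ n″) (ρ : Ren m n m′ n′) →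
  liftᴿ k l ρ′ ∘ᴿ liftᴿ k l ρ ≗ᴿ liftᴿ k l (ρ′ ∘ᴿ ρ)
liftᴿ-∘ k l ρ′ ρ = lift-∘ k _ _ , lift-∘ l _ _

liftᴿ-wk : ∀ k l (ρ : Ren m n m′ n′) → liftᴿ k l ρ ∘ᴿ wk k l ≗ᴿ wk k l ∘ᴿ ρ
liftᴿ-wk k l ρ = lift-↑ʳ k _ , lift-↑ʳ l _

liftˢ-boundᵘ : ∀ k l (σ : Sub m n m′ n′) i → proj₁ (liftˢ k l σ) (i ↑ˡ m) ≡ uvar (i ↑ˡ m′)
liftˢ-boundᵘ {m = m} {m′ = m′} {n′ = n′} k l σ i = cong [ (λ u → uvar (u ↑ˡ m′)) , _ ]′ (splitAt-↑ˡ k i m)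

liftˢ-freeᵘ : ∀ k l (σ : Sub m n m′ n′) u → proj₁ (liftˢ k l σ) (k ↑ʳ u) ≡ ren (wk k l) (proj₁ σ u)
liftˢ-freeᵘ {m = m} {m′ = m′} k l σ u = cong [ (λ u → uvar (u ↑ˡ m′)) , _ ]′ (splitAt-↑ʳ k m u)

liftˢ-boundˡ : ∀ k l (σ : Sub m n m′ n′) i → proj₂ (liftˢ k l σ) (i ↑ˡ n) ≡ lvar (i ↑ˡ n′)
liftˢ-boundˡ {n = n} {n′ = n′} k l σ i = cong [ (λ a → lvar (a ↑ˡ n′)) , _ ]′ (splitAt-↑ˡ l i n)

liftˢ-freeˡ : ∀ k l (σ : Sub m n m′ n′) a → proj₂ (liftˢ k l σ) (l ↑ʳ a) ≡ ren (wk k l) (proj₂ σ a)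
liftˢ-freeˡ {n = n} {n′ = n′} k l σ a = cong [ (λ a → lvar (a ↑ˡ n′)) , _ ]′ (splitAt-↑ʳ l n a)

-- A substitution under binders is determined by its values at the bound and at the free variables.
-- Composites are recognised as liftings in this way, by four equations instead of a case analysis
-- on `splitAt` each time.
liftˢ-unique : ∀ k l (σ : Sub m n m′ n′) {σ′ : Sub (k + m) (l + n) (k + m′) (l + n′)} →
  (∀ i → proj₁ σ′ (i ↑ˡ m) ≡ uvar (i ↑ˡ m′)) →
  (∀ u → proj₁ σ′ (k ↑ʳ u) ≡ ren (wk k l) (proj₁ σ u)) →
  (∀ i → proj₂ σ′ (i ↑ˡ n) ≡ lvar (i ↑ˡ n′)) →
  (∀ a → proj₂ σ′ (l ↑ʳ a) ≡ ren (wk k l) (proj₂ σ a)) →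
  σ′ ≗ˢ liftˢ k l σ
liftˢ-unique {m = m} {n = n} k l σ {σ′} bᵘ fᵘ bˡ fˡ = eᵘ , eˡ
  where
  eᵘ : ∀ u → proj₁ σ′ u ≡ proj₁ (liftˢ k l σ) u
  eᵘ u with split k u
  ... | bound i = trans (bᵘ i) (sym (liftˢ-boundᵘ k l σ i))
  ... | free j  = trans (fᵘ j) (sym (liftˢ-freeᵘ k l σ j))
  eˡ : ∀ a → proj₂ σ′ a ≡ proj₂ (liftˢ k l σ) a
  eˡ a with split l a
  ... | bound i = trans (bˡ i) (sym (liftˢ-boundˡ k l σ i))
  ... | free j  = trans (fˡ j) (sym (liftˢ-freeˡ k l σ j))

liftˢ-cong : ∀ k l {σ σ′ : Sub m n m′ n′} → σ ≗ˢ σ′ → liftˢ k l σ ≗ˢ liftˢ k l σ′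
liftˢ-cong k l {σ} {σ′} (e , f) = liftˢ-unique k l σ′
  (liftˢ-boundᵘ k l σ) (λ u → trans (liftˢ-freeᵘ k l σ u) (cong (ren _) (e u)))
  (liftˢ-boundˡ k l σ) (λ a → trans (liftˢ-freeˡ k l σ a) (cong (ren _) (f a)))

ren-cong : {ρ ρ′ : Ren m n m′ n′} → ρ ≗ᴿ ρ′ → ∀ t → ren ρ t ≡ ren ρ′ t
ren-cong e (lvar a)       = cong lvar (atˡ e a)
ren-cong e (uvar u)       = cong uvar (atᵘ e u)
ren-cong e ⟨ t , s ⟩      = cong₂ ⟨_,_⟩ (ren-cong e t) (ren-cong e s)
ren-cong e (t [ p := s ]) = cong₂ (elim p) (ren-cong (liftᴿ-cong (#ᵘ p) (#ˡ p) e) t) (ren-cong e s)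
ren-cong e (℘ t)          = cong ℘_ (ren-cong (liftᴿ-cong 0 2 e) t)
ren-cong e (t • s)        = cong₂ _•_ (ren-cong e t) (ren-cong e s)
ren-cong e (t ▼ s)        = cong₂ _▼_ (ren-cong e t) (ren-cong e s)
ren-cong e (! t)          = cong !_ (ren-cong (liftᴿ-cong 0 1 e) t)
ren-cong e (¿ t)          = cong ¿_ (ren-cong (liftᴿ-cong 1 0 e) t)
ren-cong e (t ▸ s)        = cong₂ _▸_ (ren-cong (liftᴿ-cong 0 1 e) t) (ren-cong e s)
ren-cong e (t ♯ s)        = cong₂ _♯_ (ren-cong e t) (ren-cong e s)
ren-cong e ⋆              = refl

sub-cong : {σ σ′ : Sub m n m′ n′} → σ ≗ˢ σ′ → ∀ t → sub σ t ≡ sub σ′ t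
sub-cong e (lvar a)       = atˡ e a
sub-cong e (uvar u)       = atᵘ e u
sub-cong e ⟨ t , s ⟩      = cong₂ ⟨_,_⟩ (sub-cong e t) (sub-cong e s)
sub-cong e (t [ p := s ]) = cong₂ (elim p) (sub-cong (liftˢ-cong (#ᵘ p) (#ˡ p) e) t) (sub-cong e s)
sub-cong e (℘ t)          = cong ℘_ (sub-cong (liftˢ-cong 0 2 e) t)
sub-cong e (t • s)        = cong₂ _•_ (sub-cong e t) (sub-cong e s)
sub-cong e (t ▼ s)        = cong₂ _▼_ (sub-cong e t) (sub-cong e s)
sub-cong e (! t)          = cong !_ (sub-cong (liftˢ-cong 0 1 e) t)
sub-cong e (¿ t)          = cong ¿_ (sub-cong (liftˢ-cong 1 0 e) t)
sub-cong e (t ▸ s)        = cong₂ _▸_ (sub-cong (liftˢ-cong 0 1 e) t) (sub-cong e s)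
sub-cong e (t ♯ s)        = cong₂ _♯_ (sub-cong e t) (sub-cong e s)
sub-cong e ⋆              = refl

-- The fusion laws come in the usual order: renaming after renaming, substitution after renaming,
-- renaming after substitution, substitution after substitution. The last two need earlier ones to
-- commute with the weakening under a binder. The mutual variant ending in `-lift` serves all
-- binders.
ren-ren : (ρ′ : Ren m′ n′ m″ n″) (ρ : Ren m n m′ n′) → ∀ t → ren ρ′ (ren ρ t) ≡ ren (ρ′ ∘ᴿ ρ) t
ren-ren-lift : ∀ k l (ρ′ : Ren m′ n′ m″ n″) (ρ : Ren m n m′ n′) → ∀ t →
  ren (liftᴿ k l ρ′) (ren (liftᴿ k l ρ) t) ≡ ren (liftᴿ k l (ρ′ ∘ᴿ ρ)) t
ren-ren-lift k l ρ′ ρ t = trans (ren-ren _ _ t) (ren-cong (liftᴿ-∘ k l ρ′ ρ) t)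
ren-ren ρ′ ρ (lvar a)       = refl
ren-ren ρ′ ρ (uvar u)       = refl
ren-ren ρ′ ρ ⟨ t , s ⟩      = cong₂ ⟨_,_⟩ (ren-ren ρ′ ρ t) (ren-ren ρ′ ρ s)
ren-ren ρ′ ρ (t [ p := s ]) = cong₂ (elim p) (ren-ren-lift (#ᵘ p) (#ˡ p) ρ′ ρ t) (ren-ren ρ′ ρ s)
ren-ren ρ′ ρ (℘ t)          = cong ℘_ (ren-ren-lift 0 2 ρ′ ρ t)
ren-ren ρ′ ρ (t • s)        = cong₂ _•_ (ren-ren ρ′ ρ t) (ren-ren ρ′ ρ s)
ren-ren ρ′ ρ (t ▼ s)        = cong₂ _▼_ (ren-ren ρ′ ρ t) (ren-ren ρ′ ρ s)
ren-ren ρ′ ρ (! t)          = cong !_ (ren-ren-lift 0 1 ρ′ ρ t)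
ren-ren ρ′ ρ (¿ t)          = cong ¿_ (ren-ren-lift 1 0 ρ′ ρ t)
ren-ren ρ′ ρ (t ▸ s)        = cong₂ _▸_ (ren-ren-lift 0 1 ρ′ ρ t) (ren-ren ρ′ ρ s)
ren-ren ρ′ ρ (t ♯ s)        = cong₂ _♯_ (ren-ren ρ′ ρ t) (ren-ren ρ′ ρ s)
ren-ren ρ′ ρ ⋆              = refl

ren-wk : ∀ k l (ρ : Ren m n m′ n′) t → ren (liftᴿ k l ρ) (ren (wk k l) t) ≡ ren (wk k l) (ren ρ t)
ren-wk k l ρ t = trans (ren-ren _ _ t) (trans (ren-cong (liftᴿ-wk k l ρ) t) (sym (ren-ren _ _ t)))

liftˢ-ʳ∘ˢ : ∀ k l (ρ : Ren m′ n′ m″ n″) (σ : Sub m n m′ n′) →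
  liftᴿ k l ρ ʳ∘ˢ liftˢ k l σ ≗ˢ liftˢ k l (ρ ʳ∘ˢ σ)
liftˢ-ʳ∘ˢ k l ρ σ = liftˢ-unique k l (ρ ʳ∘ˢ σ)
  (λ i → trans (cong (ren _) (liftˢ-boundᵘ k l σ i)) (cong uvar (lift-↑ˡ k _ i)))
  (λ u → trans (cong (ren _) (liftˢ-freeᵘ k l σ u)) (ren-wk k l ρ _))
  (λ i → trans (cong (ren _) (liftˢ-boundˡ k l σ i)) (cong lvar (lift-↑ˡ l _ i)))
  (λ a → trans (cong (ren _) (liftˢ-freeˡ k l σ a)) (ren-wk k l ρ _))

liftˢ-ˢ∘ʳ : ∀ k l (σ : Sub m′ n′ m″ n″) (ρ : Ren m n m′ n′) →
  liftˢ k l σ ˢ∘ʳ liftᴿ k l ρ ≗ˢ liftˢ k l (σ ˢ∘ʳ ρ)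
liftˢ-ˢ∘ʳ k l σ ρ = liftˢ-unique k l (σ ˢ∘ʳ ρ)
  (λ i → trans (cong (proj₁ (liftˢ k l σ)) (lift-↑ˡ k _ i)) (liftˢ-boundᵘ k l σ i))
  (λ u → trans (cong (proj₁ (liftˢ k l σ)) (lift-↑ʳ k _ u)) (liftˢ-freeᵘ k l σ _))
  (λ i → trans (cong (proj₂ (liftˢ k l σ)) (lift-↑ˡ l _ i)) (liftˢ-boundˡ k l σ i))
  (λ a → trans (cong (proj₂ (liftˢ k l σ)) (lift-↑ʳ l _ a)) (liftˢ-freeˡ k l σ _))

sub-ren : (σ : Sub m′ n′ m″ n″) (ρ : Ren m n m′ n′) → ∀ t → sub σ (ren ρ t) ≡ sub (σ ˢ∘ʳ ρ) t
sub-ren-lift : ∀ k l (σ : Sub m′ n′ m″ n″) (ρ : Ren m n m′ n′) → ∀ t →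
  sub (liftˢ k l σ) (ren (liftᴿ k l ρ) t) ≡ sub (liftˢ k l (σ ˢ∘ʳ ρ)) t
sub-ren-lift k l σ ρ t = trans (sub-ren _ _ t) (sub-cong (liftˢ-ˢ∘ʳ k l σ ρ) t)
sub-ren σ ρ (lvar a)       = refl
sub-ren σ ρ (uvar u)       = refl
sub-ren σ ρ ⟨ t , s ⟩      = cong₂ ⟨_,_⟩ (sub-ren σ ρ t) (sub-ren σ ρ s)
sub-ren σ ρ (t [ p := s ]) = cong₂ (elim p) (sub-ren-lift (#ᵘ p) (#ˡ p) σ ρ t) (sub-ren σ ρ s)
sub-ren σ ρ (℘ t)          = cong ℘_ (sub-ren-lift 0 2 σ ρ t)
sub-ren σ ρ (t • s)        = cong₂ _•_ (sub-ren σ ρ t) (sub-ren σ ρ s)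
sub-ren σ ρ (t ▼ s)        = cong₂ _▼_ (sub-ren σ ρ t) (sub-ren σ ρ s)
sub-ren σ ρ (! t)          = cong !_ (sub-ren-lift 0 1 σ ρ t)
sub-ren σ ρ (¿ t)          = cong ¿_ (sub-ren-lift 1 0 σ ρ t)
sub-ren σ ρ (t ▸ s)        = cong₂ _▸_ (sub-ren-lift 0 1 σ ρ t) (sub-ren σ ρ s)
sub-ren σ ρ (t ♯ s)        = cong₂ _♯_ (sub-ren σ ρ t) (sub-ren σ ρ s)
sub-ren σ ρ ⋆              = refl

ren-sub : (ρ : Ren m′ n′ m″ n″) (σ : Sub m n m′ n′) → ∀ t → ren ρ (sub σ t) ≡ sub (ρ ʳ∘ˢ σ) t
ren-sub-lift : ∀ k l (ρ : Ren m′ n′ m″ n″) (σ : Sub m n m′ n′) → ∀ t →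
  ren (liftᴿ k l ρ) (sub (liftˢ k l σ) t) ≡ sub (liftˢ k l (ρ ʳ∘ˢ σ)) t
ren-sub-lift k l ρ σ t = trans (ren-sub _ _ t) (sub-cong (liftˢ-ʳ∘ˢ k l ρ σ) t)
ren-sub ρ σ (lvar a)       = refl
ren-sub ρ σ (uvar u)       = refl
ren-sub ρ σ ⟨ t , s ⟩      = cong₂ ⟨_,_⟩ (ren-sub ρ σ t) (ren-sub ρ σ s)
ren-sub ρ σ (t [ p := s ]) = cong₂ (elim p) (ren-sub-lift (#ᵘ p) (#ˡ p) ρ σ t) (ren-sub ρ σ s)
ren-sub ρ σ (℘ t)          = cong ℘_ (ren-sub-lift 0 2 ρ σ t)
ren-sub ρ σ (t • s)        = cong₂ _•_ (ren-sub ρ σ t) (ren-sub ρ σ s)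
ren-sub ρ σ (t ▼ s)        = cong₂ _▼_ (ren-sub ρ σ t) (ren-sub ρ σ s)
ren-sub ρ σ (! t)          = cong !_ (ren-sub-lift 0 1 ρ σ t)
ren-sub ρ σ (¿ t)          = cong ¿_ (ren-sub-lift 1 0 ρ σ t)
ren-sub ρ σ (t ▸ s)        = cong₂ _▸_ (ren-sub-lift 0 1 ρ σ t) (ren-sub ρ σ s)
ren-sub ρ σ (t ♯ s)        = cong₂ _♯_ (ren-sub ρ σ t) (ren-sub ρ σ s)
ren-sub ρ σ ⋆              = refl

sub-wk : ∀ k l (σ : Sub m n m′ n′) t → sub (liftˢ k l σ) (ren (wk k l) t) ≡ ren (wk k l) (sub σ t)
sub-wk k l σ t = trans (sub-ren _ _ t)
  (trans (sub-cong (liftˢ-freeᵘ k l σ , liftˢ-freeˡ k l σ) t) (sym (ren-sub _ _ t)))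

liftˢ-∘ˢ : ∀ k l (σ′ : Sub m′ n′ m″ n″) (σ : Sub m n m′ n′) →
  liftˢ k l σ′ ∘ˢ liftˢ k l σ ≗ˢ liftˢ k l (σ′ ∘ˢ σ)
liftˢ-∘ˢ k l σ′ σ = liftˢ-unique k l (σ′ ∘ˢ σ)
  (λ i → trans (cong (sub (liftˢ k l σ′)) (liftˢ-boundᵘ k l σ i)) (liftˢ-boundᵘ k l σ′ i))
  (λ u → trans (cong (sub (liftˢ k l σ′)) (liftˢ-freeᵘ k l σ u)) (sub-wk k l σ′ (proj₁ σ u)))
  (λ i → trans (cong (sub (liftˢ k l σ′)) (liftˢ-boundˡ k l σ i)) (liftˢ-boundˡ k l σ′ i))
  (λ a → trans (cong (sub (liftˢ k l σ′)) (liftˢ-freeˡ k l σ a)) (sub-wk k l σ′ (proj₂ σ a)))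

sub-sub : (σ′ : Sub m′ n′ m″ n″) (σ : Sub m n m′ n′) → ∀ t → sub σ′ (sub σ t) ≡ sub (σ′ ∘ˢ σ) t
sub-sub-lift : ∀ k l (σ′ : Sub m′ n′ m″ n″) (σ : Sub m n m′ n′) → ∀ t →
  sub (liftˢ k l σ′) (sub (liftˢ k l σ) t) ≡ sub (liftˢ k l (σ′ ∘ˢ σ)) t
sub-sub-lift k l σ′ σ t = trans (sub-sub _ _ t) (sub-cong (liftˢ-∘ˢ k l σ′ σ) t)
sub-sub σ′ σ (lvar a)       = refl
sub-sub σ′ σ (uvar u)       = refl
sub-sub σ′ σ ⟨ t , s ⟩      = cong₂ ⟨_,_⟩ (sub-sub σ′ σ t) (sub-sub σ′ σ s)
sub-sub σ′ σ (t [ p := s ]) = cong₂ (elim p) (sub-sub-lift (#ᵘ p) (#ˡ p) σ′ σ t) (sub-sub σ′ σ s)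
sub-sub σ′ σ (℘ t)          = cong ℘_ (sub-sub-lift 0 2 σ′ σ t)
sub-sub σ′ σ (t • s)        = cong₂ _•_ (sub-sub σ′ σ t) (sub-sub σ′ σ s)
sub-sub σ′ σ (t ▼ s)        = cong₂ _▼_ (sub-sub σ′ σ t) (sub-sub σ′ σ s)
sub-sub σ′ σ (! t)          = cong !_ (sub-sub-lift 0 1 σ′ σ t)
sub-sub σ′ σ (¿ t)          = cong ¿_ (sub-sub-lift 1 0 σ′ σ t)
sub-sub σ′ σ (t ▸ s)        = cong₂ _▸_ (sub-sub-lift 0 1 σ′ σ t) (sub-sub σ′ σ s)
sub-sub σ′ σ (t ♯ s)        = cong₂ _♯_ (sub-sub σ′ σ t) (sub-sub σ′ σ s)
sub-sub σ′ σ ⋆              = refl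

⌊_⌋ : Ren m n m′ n′ → Sub m n m′ n′
⌊ ρ , π ⌋ = uvar ∘ ρ , lvar ∘ π

liftˢ-⌊⌋ : ∀ k l (ρ : Ren m n m′ n′) → ⌊ liftᴿ k l ρ ⌋ ≗ˢ liftˢ k l ⌊ ρ ⌋
liftˢ-⌊⌋ k l ρ = liftˢ-unique k l ⌊ ρ ⌋
  (λ i → cong uvar (lift-↑ˡ k _ i)) (λ u → cong uvar (lift-↑ʳ k _ u))
  (λ i → cong lvar (lift-↑ˡ l _ i)) (λ a → cong lvar (lift-↑ʳ l _ a))

liftˢ-id : ∀ k l → idˢ {k + m} {l + n} ≗ˢ liftˢ k l idˢ
liftˢ-id k l = liftˢ-unique k l idˢ (λ _ → refl) (λ _ → refl) (λ _ → refl) (λ _ → refl)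

sub-id : (t : Term m n) → sub idˢ t ≡ t
sub-id-lift : ∀ k l (t : Term (k + m) (l + n)) → sub (liftˢ k l idˢ) t ≡ t
sub-id-lift k l t = trans (sym (sub-cong (liftˢ-id k l) t)) (sub-id t)
sub-id (lvar a)       = refl
sub-id (uvar u)       = refl
sub-id ⟨ t , s ⟩      = cong₂ ⟨_,_⟩ (sub-id t) (sub-id s)
sub-id (t [ p := s ]) = cong₂ (elim p) (sub-id-lift (#ᵘ p) (#ˡ p) t) (sub-id s)
sub-id (℘ t)          = cong ℘_ (sub-id-lift 0 2 t)
sub-id (t • s)        = cong₂ _•_ (sub-id t) (sub-id s)
sub-id (t ▼ s)        = cong₂ _▼_ (sub-id t) (sub-id s)
sub-id (! t)          = cong !_ (sub-id-lift 0 1 t)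
sub-id (¿ t)          = cong ¿_ (sub-id-lift 1 0 t)
sub-id (t ▸ s)        = cong₂ _▸_ (sub-id-lift 0 1 t) (sub-id s)
sub-id (t ♯ s)        = cong₂ _♯_ (sub-id t) (sub-id s)
sub-id ⋆              = refl

-- Transports facts about substitutions to renamings, for instance `ren-into` from `sub-into`.
ren-as-sub : (ρ : Ren m n m′ n′) → ∀ t → ren ρ t ≡ sub ⌊ ρ ⌋ t
ren-as-sub ρ t = trans (cong (ren ρ) (sym (sub-id t))) (ren-sub ρ idˢ t)

ren-id : (t : Term m n) → ren (id , id) t ≡ t
ren-id t = trans (ren-as-sub _ t) (sub-id t)

-- Exchange of binders

xch : (k l k′ l′ : ℕ) → Ren (k + (k′ + m)) (l + (l′ + n)) (k′ + (k + m)) (l′ + (l + n))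
xch k l k′ l′ = exchange k k′ , exchange l l′

module _ {n : ℕ} (k j : ℕ) where

  exchange-inner : (i : Fin k) → exchange {n} k j (i ↑ˡ (j + n)) ≡ j ↑ʳ (i ↑ˡ n)
  exchange-inner i rewrite splitAt-↑ˡ k i (j + n) = refl

  exchange-outer : (i : Fin j) → exchange {n} k j (k ↑ʳ (i ↑ˡ n)) ≡ i ↑ˡ (k + n)
  exchange-outer i rewrite splitAt-↑ʳ k (j + n) (i ↑ˡ n) | splitAt-↑ˡ j i n = refl

  exchange-free : (i : Fin n) → exchange k j (k ↑ʳ (j ↑ʳ i)) ≡ j ↑ʳ (k ↑ʳ i)
  exchange-free i rewrite splitAt-↑ʳ k (j + n) (j ↑ʳ i) | splitAt-↑ʳ j n i = refl

exchange-lift : ∀ k j (f : Fin n → Fin n′) i →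
  exchange k j (lift k (lift j f) i) ≡ lift j (lift k f) (exchange k j i)
exchange-lift {n} {n′} k j f i with split k i
... | bound i = begin
  exchange k j (lift k (lift j f) (i ↑ˡ (j + n)))   ≡⟨ cong (exchange k j) (lift-↑ˡ k (lift j f) i) ⟩
  exchange k j (i ↑ˡ (j + n′))                      ≡⟨ exchange-inner k j i ⟩
  j ↑ʳ (i ↑ˡ n′)                                    ≡⟨ cong (j ↑ʳ_) (lift-↑ˡ k f i) ⟨
  j ↑ʳ lift k f (i ↑ˡ n)                            ≡⟨ lift-↑ʳ j (lift k f) _ ⟨
  lift j (lift k f) (j ↑ʳ (i ↑ˡ n))                 ≡⟨ cong (lift j (lift k f)) (exchange-inner k j i) ⟨
  lift j (lift k f) (exchange k j (i ↑ˡ (j + n)))   ∎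
  where open ≡-Reasoning
... | free y with split j y
... | bound i = begin
  exchange k j (lift k (lift j f) (k ↑ʳ (i ↑ˡ n)))  ≡⟨ cong (exchange k j) (lift-↑ʳ k (lift j f) _) ⟩
  exchange k j (k ↑ʳ lift j f (i ↑ˡ n))             ≡⟨ cong (exchange k j ∘ (k ↑ʳ_)) (lift-↑ˡ j f i) ⟩
  exchange k j (k ↑ʳ (i ↑ˡ n′))                     ≡⟨ exchange-outer k j i ⟩
  i ↑ˡ (k + n′)                                     ≡⟨ lift-↑ˡ j (lift k f) i ⟨
  lift j (lift k f) (i ↑ˡ (k + n))                  ≡⟨ cong (lift j (lift k f)) (exchange-outer k j i) ⟨
  lift j (lift k f) (exchange k j (k ↑ʳ (i ↑ˡ n)))  ∎
  where open ≡-Reasoning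
... | free z = begin
  exchange k j (lift k (lift j f) (k ↑ʳ (j ↑ʳ z)))  ≡⟨ cong (exchange k j) (lift-↑ʳ k (lift j f) _) ⟩
  exchange k j (k ↑ʳ lift j f (j ↑ʳ z))             ≡⟨ cong (exchange k j ∘ (k ↑ʳ_)) (lift-↑ʳ j f z) ⟩
  exchange k j (k ↑ʳ (j ↑ʳ f z))                    ≡⟨ exchange-free k j (f z) ⟩
  j ↑ʳ (k ↑ʳ f z)                                   ≡⟨ cong (j ↑ʳ_) (lift-↑ʳ k f z) ⟨
  j ↑ʳ lift k f (k ↑ʳ z)                            ≡⟨ lift-↑ʳ j (lift k f) _ ⟨
  lift j (lift k f) (j ↑ʳ (k ↑ʳ z))                 ≡⟨ cong (lift j (lift k f)) (exchange-free k j z) ⟨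
  lift j (lift k f) (exchange k j (k ↑ʳ (j ↑ʳ z)))  ∎
  where open ≡-Reasoning

exchange-wk-inner : ∀ k j (i : Fin (k + n)) → exchange k j (lift k (j ↑ʳ_) i) ≡ j ↑ʳ i
exchange-wk-inner k j i with split k i
... | bound i = trans (cong (exchange k j) (lift-↑ˡ k (j ↑ʳ_) i)) (exchange-inner k j i)
... | free z  = trans (cong (exchange k j) (lift-↑ʳ k (j ↑ʳ_) z)) (exchange-free k j z)

exchange-wk-outer : ∀ k j (i : Fin (j + n)) → exchange k j (k ↑ʳ i) ≡ lift j (k ↑ʳ_) i
exchange-wk-outer k j i with split j i
... | bound i = trans (exchange-outer k j i) (sym (lift-↑ˡ j (k ↑ʳ_) i))
... | free z  = trans (exchange-free k j z) (sym (lift-↑ʳ j (k ↑ʳ_) z))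

exchange-involutive : ∀ k j (i : Fin (k + (j + n))) → exchange j k (exchange k j i) ≡ i
exchange-involutive k j i with split k i
... | bound i = trans (cong (exchange j k) (exchange-inner k j i)) (exchange-outer j k i)
... | free y with split j y
... | bound i = trans (cong (exchange j k) (exchange-outer k j i)) (exchange-inner j k i)
... | free z  = trans (cong (exchange j k) (exchange-free k j z)) (exchange-free j k z)

xch-ren : ∀ k l k′ l′ (ρ : Ren m n m′ n′) t →
  ren (xch k l k′ l′) (ren (liftᴿ k l (liftᴿ k′ l′ ρ)) t) ≡ ren (liftᴿ k′ l′ (liftᴿ k l ρ)) (ren (xch k l k′ l′) t)
xch-ren k l k′ l′ ρ t = trans (ren-ren _ _ t)
  (trans (ren-cong (exchange-lift k k′ _ , exchange-lift l l′ _) t) (sym (ren-ren _ _ t)))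

-- A block inserted outside the inner variables of `t` becomes, after the exchange, a block inserted
-- innermost, that is, an ordinary weakening. Terms that do not mention the pattern of a slide cross
-- it in this way.
xch-wk-inner : ∀ k l k′ l′ (t : Term (k + m) (l + n)) →
  ren (xch k l k′ l′) (ren (liftᴿ k l (wk k′ l′)) t) ≡ ren (wk k′ l′) t
xch-wk-inner k l k′ l′ t =
  trans (ren-ren _ _ t) (ren-cong (exchange-wk-inner k k′ , exchange-wk-inner l l′) t)

xch-wk-outer : ∀ k l k′ l′ (t : Term (k′ + m) (l′ + n)) →
  ren (xch k l k′ l′) (ren (wk k l) t) ≡ ren (liftᴿ k′ l′ (wk k l)) t
xch-wk-outer k l k′ l′ t =
  trans (ren-ren _ _ t) (ren-cong (exchange-wk-outer k k′ , exchange-wk-outer l l′) t)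

xch-involutive : ∀ k l k′ l′ (t : Term (k + (k′ + m)) (l + (l′ + n))) →
  ren (xch k′ l′ k l) (ren (xch k l k′ l′) t) ≡ t
xch-involutive k l k′ l′ t = trans (ren-ren _ _ t)
  (trans (ren-cong (exchange-involutive k k′ , exchange-involutive l l′) t) (ren-id t))

-- Naturality of the exchange. A variable lies in the inner block, in the outer block or outside
-- both, and the three equations that characterise `exchange` settle the three cases.
xch-sub : ∀ k l k′ l′ (σ : Sub m n m′ n′) t →
  ren (xch k l k′ l′) (sub (liftˢ k l (liftˢ k′ l′ σ)) t) ≡ sub (liftˢ k′ l′ (liftˢ k l σ)) (ren (xch k l k′ l′) t)
xch-sub {m = m} {n = n} k l k′ l′ σ t =
  trans (ren-sub _ _ t) (trans (sub-cong (eᵘ , eˡ) t) (sym (sub-ren _ _ t)))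
  where
  open ≡-Reasoning
  χ : ∀ {m n} → Ren (k + (k′ + m)) (l + (l′ + n)) (k′ + (k + m)) (l′ + (l + n))
  χ = xch k l k′ l′
  free-case : ∀ r → ren χ (ren (wk k l) (ren (wk k′ l′) r)) ≡ ren (wk k′ l′) (ren (wk k l) r)
  free-case r = trans (xch-wk-outer k l k′ l′ _) (ren-wk k′ l′ (wk k l) r)
  eᵘ : ∀ i → ren χ (proj₁ (liftˢ k l (liftˢ k′ l′ σ)) i) ≡ proj₁ (liftˢ k′ l′ (liftˢ k l σ)) (exchange k k′ i)
  eᵘ i with split k i
  ... | bound i = begin
    ren χ (proj₁ (liftˢ k l (liftˢ k′ l′ σ)) (i ↑ˡ _))                 ≡⟨ cong (ren χ) (liftˢ-boundᵘ k l (liftˢ k′ l′ σ) i) ⟩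
    uvar (exchange k k′ (i ↑ˡ _))                                    ≡⟨ cong uvar (exchange-inner k k′ i) ⟩
    ren (wk k′ l′) (uvar (i ↑ˡ _))                                     ≡⟨ cong (ren (wk k′ l′)) (liftˢ-boundᵘ k l σ i) ⟨
    ren (wk k′ l′) (proj₁ (liftˢ k l σ) (i ↑ˡ _))                      ≡⟨ liftˢ-freeᵘ k′ l′ (liftˢ k l σ) _ ⟨
    proj₁ (liftˢ k′ l′ (liftˢ k l σ)) (k′ ↑ʳ (i ↑ˡ _))                 ≡⟨ cong (proj₁ (liftˢ k′ l′ (liftˢ k l σ))) (exchange-inner k k′ i) ⟨
    proj₁ (liftˢ k′ l′ (liftˢ k l σ)) (exchange k k′ (i ↑ˡ _))       ∎
  ... | free y with split k′ y
  ... | bound i = begin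
    ren χ (proj₁ (liftˢ k l (liftˢ k′ l′ σ)) (k ↑ʳ (i ↑ˡ _)))          ≡⟨ cong (ren χ) (liftˢ-freeᵘ k l (liftˢ k′ l′ σ) _) ⟩
    ren χ (ren (wk k l) (proj₁ (liftˢ k′ l′ σ) (i ↑ˡ _)))              ≡⟨ cong (ren χ ∘ ren (wk k l)) (liftˢ-boundᵘ k′ l′ σ i) ⟩
    uvar (exchange k k′ (k ↑ʳ (i ↑ˡ _)))                             ≡⟨ cong uvar (exchange-outer k k′ i) ⟩
    uvar (i ↑ˡ _)                                                      ≡⟨ liftˢ-boundᵘ k′ l′ (liftˢ k l σ) i ⟨
    proj₁ (liftˢ k′ l′ (liftˢ k l σ)) (i ↑ˡ _)                         ≡⟨ cong (proj₁ (liftˢ k′ l′ (liftˢ k l σ))) (exchange-outer k k′ i) ⟨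
    proj₁ (liftˢ k′ l′ (liftˢ k l σ)) (exchange k k′ (k ↑ʳ (i ↑ˡ _))) ∎
  ... | free z = begin
    ren χ (proj₁ (liftˢ k l (liftˢ k′ l′ σ)) (k ↑ʳ (k′ ↑ʳ z)))         ≡⟨ cong (ren χ) (liftˢ-freeᵘ k l (liftˢ k′ l′ σ) _) ⟩
    ren χ (ren (wk k l) (proj₁ (liftˢ k′ l′ σ) (k′ ↑ʳ z)))             ≡⟨ cong (λ r → ren χ (ren (wk k l) r)) (liftˢ-freeᵘ k′ l′ σ z) ⟩
    ren χ (ren (wk k l) (ren (wk k′ l′) _))                             ≡⟨ free-case (proj₁ σ z) ⟩
    ren (wk k′ l′) (ren (wk k l) (proj₁ σ z))                                     ≡⟨ cong (ren (wk k′ l′)) (liftˢ-freeᵘ k l σ z) ⟨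
    ren (wk k′ l′) (proj₁ (liftˢ k l σ) (k ↑ʳ z))                      ≡⟨ liftˢ-freeᵘ k′ l′ (liftˢ k l σ) _ ⟨
    proj₁ (liftˢ k′ l′ (liftˢ k l σ)) (k′ ↑ʳ (k ↑ʳ z))                 ≡⟨ cong (proj₁ (liftˢ k′ l′ (liftˢ k l σ))) (exchange-free k k′ z) ⟨
    proj₁ (liftˢ k′ l′ (liftˢ k l σ)) (exchange k k′ (k ↑ʳ (k′ ↑ʳ z))) ∎
  eˡ : ∀ i → ren χ (proj₂ (liftˢ k l (liftˢ k′ l′ σ)) i) ≡ proj₂ (liftˢ k′ l′ (liftˢ k l σ)) (exchange l l′ i)
  eˡ i with split l i
  ... | bound i = begin
    ren χ (proj₂ (liftˢ k l (liftˢ k′ l′ σ)) (i ↑ˡ _))                 ≡⟨ cong (ren χ) (liftˢ-boundˡ k l (liftˢ k′ l′ σ) i) ⟩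
    lvar (exchange l l′ (i ↑ˡ _))                                    ≡⟨ cong lvar (exchange-inner l l′ i) ⟩
    ren (wk k′ l′) (lvar (i ↑ˡ _))                                     ≡⟨ cong (ren (wk k′ l′)) (liftˢ-boundˡ k l σ i) ⟨
    ren (wk k′ l′) (proj₂ (liftˢ k l σ) (i ↑ˡ _))                      ≡⟨ liftˢ-freeˡ k′ l′ (liftˢ k l σ) _ ⟨
    proj₂ (liftˢ k′ l′ (liftˢ k l σ)) (l′ ↑ʳ (i ↑ˡ _))                 ≡⟨ cong (proj₂ (liftˢ k′ l′ (liftˢ k l σ))) (exchange-inner l l′ i) ⟨
    proj₂ (liftˢ k′ l′ (liftˢ k l σ)) (exchange l l′ (i ↑ˡ _))       ∎
  ... | free y with split l′ y
  ... | bound i = begin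
    ren χ (proj₂ (liftˢ k l (liftˢ k′ l′ σ)) (l ↑ʳ (i ↑ˡ _)))          ≡⟨ cong (ren χ) (liftˢ-freeˡ k l (liftˢ k′ l′ σ) _) ⟩
    ren χ (ren (wk k l) (proj₂ (liftˢ k′ l′ σ) (i ↑ˡ _)))              ≡⟨ cong (ren χ ∘ ren (wk k l)) (liftˢ-boundˡ k′ l′ σ i) ⟩
    lvar (exchange l l′ (l ↑ʳ (i ↑ˡ _)))                             ≡⟨ cong lvar (exchange-outer l l′ i) ⟩
    lvar (i ↑ˡ _)                                                      ≡⟨ liftˢ-boundˡ k′ l′ (liftˢ k l σ) i ⟨
    proj₂ (liftˢ k′ l′ (liftˢ k l σ)) (i ↑ˡ _)                         ≡⟨ cong (proj₂ (liftˢ k′ l′ (liftˢ k l σ))) (exchange-outer l l′ i) ⟨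
    proj₂ (liftˢ k′ l′ (liftˢ k l σ)) (exchange l l′ (l ↑ʳ (i ↑ˡ _))) ∎
  ... | free z = begin
    ren χ (proj₂ (liftˢ k l (liftˢ k′ l′ σ)) (l ↑ʳ (l′ ↑ʳ z)))         ≡⟨ cong (ren χ) (liftˢ-freeˡ k l (liftˢ k′ l′ σ) _) ⟩
    ren χ (ren (wk k l) (proj₂ (liftˢ k′ l′ σ) (l′ ↑ʳ z)))             ≡⟨ cong (λ r → ren χ (ren (wk k l) r)) (liftˢ-freeˡ k′ l′ σ z) ⟩
    ren χ (ren (wk k l) (ren (wk k′ l′) _))                             ≡⟨ free-case (proj₂ σ z) ⟩
    ren (wk k′ l′) (ren (wk k l) (proj₂ σ z))                                     ≡⟨ cong (ren (wk k′ l′)) (liftˢ-freeˡ k l σ z) ⟨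
    ren (wk k′ l′) (proj₂ (liftˢ k l σ) (l ↑ʳ z))                      ≡⟨ liftˢ-freeˡ k′ l′ (liftˢ k l σ) _ ⟨
    proj₂ (liftˢ k′ l′ (liftˢ k l σ)) (l′ ↑ʳ (l ↑ʳ z))                 ≡⟨ cong (proj₂ (liftˢ k′ l′ (liftˢ k l σ))) (exchange-free l l′ z) ⟨
    proj₂ (liftˢ k′ l′ (liftˢ k l σ)) (exchange l l′ (l ↑ʳ (l′ ↑ʳ z))) ∎

-- Free linear variables

occ-lvar-≡ : ∀ {m n} (a : Fin n) → occ {m} a (lvar a) ≡ 1
occ-lvar-≡ a = cong (if_then 1 else 0) (dec-true (a ≟ a) refl)

occ-lvar-≢ : ∀ {m n} {a b : Fin n} → a ≢ b → occ {m} a (lvar b) ≡ 0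
occ-lvar-≢ {a = a} {b} a≢b = cong (if_then 1 else 0) (dec-false (a ≟ b) a≢b)

occ≡0 : {a : Fin n} {t : Term m n} → ¬ (a ∈fv t) → occ a t ≡ 0
occ≡0 {a = a} {t} a∉t with occ a t
... | zero  = refl
... | suc _ = contradiction (s≤s z≤n) a∉t

+≡0 : ∀ {i j} → i ≡ 0 → j ≡ 0 → i + j ≡ 0
+≡0 refl refl = refl

∈fv-+ˡ : ∀ {i} j → 0 < i → 0 < i + j
∈fv-+ˡ j (s≤s _) = s≤s z≤n

∈fv-+ʳ : ∀ i {j} → 0 < j → 0 < i + j
∈fv-+ʳ zero    p = p
∈fv-+ʳ (suc i) p = s≤s z≤n

↑ʳ-injective : ∀ k {i j : Fin n} → k ↑ʳ i ≡ k ↑ʳ j → i ≡ j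
↑ʳ-injective k = Fin.↑ʳ-injective k _ _

↑ʳ≢↑ˡ : ∀ k {i : Fin k} {j : Fin n} → k ↑ʳ j ≢ i ↑ˡ n
↑ʳ≢↑ˡ (suc k) {suc i} e = ↑ʳ≢↑ˡ k (Fin.suc-injective e)

-- Injectivity at the single variable `a`. Counting occurrences of `a` needs no more, and unlike
-- injectivity of `π` it is available for any lifted renaming at its bound variables.
record Over (π : Fin n → Fin n′) (a : Fin n) (a′ : Fin n′) : Set where
  constructor over
  field
    image    : π a ≡ a′
    preimage : ∀ b → π b ≡ a′ → b ≡ a
open Over

Over-free : ∀ l {π : Fin n → Fin n′} {a a′} → Over π a a′ → Over (lift l π) (l ↑ʳ a) (l ↑ʳ a′)
Over-free {n = n} {n′} l {π} {a} {a′} o = over (trans (lift-↑ʳ l π a) (cong (l ↑ʳ_) (image o))) pre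
  where
  pre : ∀ b → lift l π b ≡ l ↑ʳ a′ → b ≡ l ↑ʳ a
  pre b e with split l b
  ... | bound i = contradiction (trans (sym e) (lift-↑ˡ l π i)) (↑ʳ≢↑ˡ l)
  ... | free b  = cong (l ↑ʳ_) (preimage o b (↑ʳ-injective l (trans (sym (lift-↑ʳ l π b)) e)))

Over-bound : ∀ l (π : Fin n → Fin n′) i → Over (lift l π) (i ↑ˡ n) (i ↑ˡ n′)
Over-bound {n = n} {n′} l π i = over (lift-↑ˡ l π i) pre
  where
  pre : ∀ b → lift l π b ≡ i ↑ˡ n′ → b ≡ i ↑ˡ n
  pre b e with split l b
  ... | bound j = cong (_↑ˡ n) (Fin.↑ˡ-injective n′ j i (trans (sym (lift-↑ˡ l π j)) e))
  ... | free b  = contradiction (trans (sym (lift-↑ʳ l π b)) e) (↑ʳ≢↑ˡ l)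

Over-wk : ∀ l {a : Fin n} → Over (l ↑ʳ_) a (l ↑ʳ a)
Over-wk l = over refl (λ b → ↑ʳ-injective l)

Over-exchange : ∀ l l′ (i : Fin (l + (l′ + n))) → Over (exchange l l′) i (exchange l l′ i)
Over-exchange l l′ i = over refl λ b e →
  trans (sym (exchange-involutive l l′ b)) (trans (cong (exchange l′ l) e) (exchange-involutive l l′ i))

occ-ren : (ρ : Ren m n m′ n′) {a : Fin n} {a′ : Fin n′} → Over (proj₂ ρ) a a′ →
  ∀ t → occ a′ (ren ρ t) ≡ occ a t
occ-ren {m′ = m′} ρ {a} {a′} o (lvar b) with a ≟ b
... | yes refl = trans (cong (occ {m′} a′ ∘ lvar) (image o)) (occ-lvar-≡ {m′} a′)
... | no a≢b   = occ-lvar-≢ {m = m′} (λ e → a≢b (sym (preimage o b (sym e))))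
occ-ren ρ o (uvar u)       = refl
occ-ren ρ o ⟨ t , s ⟩      = cong₂ _+_ (occ-ren ρ o t) (occ-ren ρ o s)
occ-ren ρ o (t [ p := s ]) = cong₂ _+_ (occ-ren _ (Over-free (#ˡ p) o) t) (occ-ren ρ o s)
occ-ren ρ o (℘ t)          = occ-ren _ (Over-free 2 o) t
occ-ren ρ o (t • s)        = cong₂ _+_ (occ-ren ρ o t) (occ-ren ρ o s)
occ-ren ρ o (t ▼ s)        = cong₂ _+_ (occ-ren ρ o t) (occ-ren ρ o s)
occ-ren ρ o (! t)          = occ-ren _ (Over-free 1 o) t
occ-ren ρ o (¿ t)          = occ-ren _ o t
occ-ren ρ o (t ▸ s)        = cong₂ _+_ (occ-ren _ (Over-free 1 o) t) (occ-ren ρ o s)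
occ-ren ρ o (t ♯ s)        = cong₂ _+_ (occ-ren ρ o t) (occ-ren ρ o s)
occ-ren ρ o ⋆              = refl

occ-wk : ∀ k l (a : Fin n) (t : Term m n) → occ (l ↑ʳ a) (ren (wk k l) t) ≡ occ a t
occ-wk k l a t = occ-ren (wk k l) (Over-wk l) t

lift-≢ : ∀ l {π : Fin n → Fin n′} {a′} → (∀ b → π b ≢ a′) → ∀ b → lift l π b ≢ l ↑ʳ a′
lift-≢ zero    f b       e = f b e
lift-≢ (suc l) f (suc b) e = lift-≢ l f b (Fin.suc-injective e)

occ-ren-0 : (ρ : Ren m n m′ n′) {a′ : Fin n′} → (∀ b → proj₂ ρ b ≢ a′) → ∀ t → occ a′ (ren ρ t) ≡ 0
occ-ren-0 {m′ = m′} ρ f (lvar b) = occ-lvar-≢ {m = m′} (f b ∘ sym)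
occ-ren-0 ρ f (uvar u)       = refl
occ-ren-0 ρ f ⟨ t , s ⟩      = +≡0 (occ-ren-0 ρ f t) (occ-ren-0 ρ f s)
occ-ren-0 ρ f (t [ p := s ]) = +≡0 (occ-ren-0 _ (lift-≢ (#ˡ p) f) t) (occ-ren-0 ρ f s)
occ-ren-0 ρ f (℘ t)          = occ-ren-0 _ (lift-≢ 2 f) t
occ-ren-0 ρ f (t • s)        = +≡0 (occ-ren-0 ρ f t) (occ-ren-0 ρ f s)
occ-ren-0 ρ f (t ▼ s)        = +≡0 (occ-ren-0 ρ f t) (occ-ren-0 ρ f s)
occ-ren-0 ρ f (! t)          = occ-ren-0 _ (lift-≢ 1 f) t
occ-ren-0 ρ f (¿ t)          = occ-ren-0 _ f t
occ-ren-0 ρ f (t ▸ s)        = +≡0 (occ-ren-0 _ (lift-≢ 1 f) t) (occ-ren-0 ρ f s)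
occ-ren-0 ρ f (t ♯ s)        = +≡0 (occ-ren-0 ρ f t) (occ-ren-0 ρ f s)
occ-ren-0 ρ f ⋆              = refl

-- Linear variables are constrained only if they are free in `t`. Box bodies rely on this: their
-- single free linear variable is the bound one, and nothing is known about the images of the
-- others.
record NotFree {m n m′ n′ : ℕ} (a′ : Fin n′) (σ : Sub m n m′ n′) (t : Term m n) : Set where
  constructor notFree
  field
    inᵘ : ∀ u → occ a′ (proj₁ σ u) ≡ 0
    inˡ : ∀ c → c ∈fv t → occ a′ (proj₂ σ c) ≡ 0
open NotFree

NotFree-mono : {a′ : Fin n′} {σ : Sub m n m′ n′} {t s : Term m n} →
  (∀ c → c ∈fv t → c ∈fv s) → NotFree a′ σ s → NotFree a′ σ t
NotFree-mono f (notFree e g) = notFree e λ c → g c ∘ f c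

NotFree-lift : ∀ k l {a′ : Fin n′} {σ : Sub m n m′ n′} {t : Term m n} {t′ : Term (k + m) (l + n)} →
  (∀ c → l ↑ʳ c ∈fv t′ → c ∈fv t) → NotFree a′ σ t → NotFree (l ↑ʳ a′) (liftˢ k l σ) t′
NotFree-lift {n′ = n′} {m′ = m′} k l {a′} {σ} {t} {t′} f (notFree e g) = notFree eᵘ eˡ
  where
  eᵘ : ∀ u → occ (l ↑ʳ a′) (proj₁ (liftˢ k l σ) u) ≡ 0
  eᵘ u with split k u
  ... | bound i rewrite liftˢ-boundᵘ k l σ i = refl
  ... | free u  rewrite liftˢ-freeᵘ k l σ u = trans (occ-wk k l a′ (proj₁ σ u)) (e u)
  eˡ : ∀ c → c ∈fv t′ → occ (l ↑ʳ a′) (proj₂ (liftˢ k l σ) c) ≡ 0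
  eˡ c c∈ with split l c
  ... | bound i rewrite liftˢ-boundˡ k l σ i = occ-lvar-≢ {m = k + m′} (↑ʳ≢↑ˡ l {i} {a′})
  ... | free c  rewrite liftˢ-freeˡ k l σ c = trans (occ-wk k l a′ (proj₂ σ c)) (g c (f c c∈))

occ-sub-0 : {a′ : Fin n′} {σ : Sub m n m′ n′} (t : Term m n) → NotFree a′ σ t → occ a′ (sub σ t) ≡ 0
occ-sub-0² : {a′ : Fin n′} {σ : Sub m n m′ n′} (t s : Term m n) {r : Term m n} →
  (∀ c → occ c r ≡ occ c t + occ c s) → NotFree a′ σ r → occ a′ (sub σ t) + occ a′ (sub σ s) ≡ 0
occ-sub-0² t s f e = +≡0
  (occ-sub-0 t (NotFree-mono (λ c c∈ → subst (0 <_) (sym (f c)) (∈fv-+ˡ _ c∈)) e))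
  (occ-sub-0 s (NotFree-mono (λ c c∈ → subst (0 <_) (sym (f c)) (∈fv-+ʳ (occ c t) c∈)) e))
occ-sub-0 {m = m} (lvar b)       e = inˡ e b (subst (0 <_) (sym (occ-lvar-≡ {m} b)) (s≤s z≤n))
occ-sub-0 (uvar u)       e = inᵘ e u
occ-sub-0 ⟨ t , s ⟩      e = occ-sub-0² t s (λ _ → refl) e
occ-sub-0 (t [ p := s ]) e = +≡0
  (occ-sub-0 t (NotFree-lift (#ᵘ p) (#ˡ p) (λ c → ∈fv-+ˡ _) e))
  (occ-sub-0 s (NotFree-mono (λ c → ∈fv-+ʳ (occ (#ˡ p ↑ʳ c) t)) e))
occ-sub-0 (℘ t)          e = occ-sub-0 t (NotFree-lift 0 2 (λ c z → z) e)
occ-sub-0 (t • s)        e = occ-sub-0² t s (λ _ → refl) e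
occ-sub-0 (t ▼ s)        e = occ-sub-0² t s (λ _ → refl) e
occ-sub-0 (! t)          e = occ-sub-0 t (NotFree-lift 0 1 (λ c z → z) e)
occ-sub-0 (¿ t)          e = occ-sub-0 t (NotFree-lift 1 0 (λ c z → z) e)
occ-sub-0 (t ▸ s)        e = +≡0
  (occ-sub-0 t (NotFree-lift 0 1 (λ c → ∈fv-+ˡ _) e))
  (occ-sub-0 s (NotFree-mono (λ c → ∈fv-+ʳ (occ (suc c) t)) e))
occ-sub-0 (t ♯ s)        e = occ-sub-0² t s (λ _ → refl) e
occ-sub-0 ⋆              e = refl

-- An occurrence of `a′` in the result can only stem from `a`. This gives equal counts, as the
-- conditions on bound variables require.
record Keeps {m n m′ n′ : ℕ} (a : Fin n) (a′ : Fin n′) (σ : Sub m n m′ n′) : Set where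
  constructor keeps
  field
    at-a    : proj₂ σ a ≡ lvar a′
    off-a   : ∀ b → b ≢ a → occ a′ (proj₂ σ b) ≡ 0
    inᵘ     : ∀ u → occ a′ (proj₁ σ u) ≡ 0

Keeps-free : ∀ k l {a : Fin n} {a′ : Fin n′} {σ : Sub m n m′ n′} → Keeps a a′ σ → Keeps (l ↑ʳ a) (l ↑ʳ a′) (liftˢ k l σ)
Keeps-free {n = n} {m′ = m′} k l {a} {a′} {σ} (keeps e f g) = keeps
  (trans (liftˢ-freeˡ k l σ a) (cong (ren _) e)) eˡ eᵘ
  where
  eˡ : ∀ b → b ≢ l ↑ʳ a → occ (l ↑ʳ a′) (proj₂ (liftˢ k l σ) b) ≡ 0
  eˡ b b≢a with split l b
  ... | bound i rewrite liftˢ-boundˡ k l σ i = occ-lvar-≢ {m = k + m′} (↑ʳ≢↑ˡ l {i} {a′})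
  ... | free b  rewrite liftˢ-freeˡ k l σ b = trans (occ-wk k l a′ (proj₂ σ b)) (f b (b≢a ∘ cong (l ↑ʳ_)))
  eᵘ : ∀ u → occ (l ↑ʳ a′) (proj₁ (liftˢ k l σ) u) ≡ 0
  eᵘ u with split k u
  ... | bound i rewrite liftˢ-boundᵘ k l σ i = refl
  ... | free u  rewrite liftˢ-freeᵘ k l σ u = trans (occ-wk k l a′ (proj₁ σ u)) (g u)

occ-wk-bound : ∀ k l (i : Fin l) (t : Term m n) → occ (i ↑ˡ n) (ren (wk k l) t) ≡ 0
occ-wk-bound k l i t = occ-ren-0 (wk k l) (λ b → ↑ʳ≢↑ˡ l) t

Keeps-bound : ∀ k l (σ : Sub m n m′ n′) i → Keeps (i ↑ˡ n) (i ↑ˡ n′) (liftˢ k l σ)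
Keeps-bound {n = n} {m′ = m′} {n′ = n′} k l σ i = keeps (liftˢ-boundˡ k l σ i) eˡ eᵘ
  where
  eˡ : ∀ b → b ≢ i ↑ˡ n → occ (i ↑ˡ n′) (proj₂ (liftˢ k l σ) b) ≡ 0
  eˡ b b≢i with split l b
  ... | bound j rewrite liftˢ-boundˡ k l σ j =
    occ-lvar-≢ {m = k + m′} (λ e → b≢i (cong (_↑ˡ n) (sym (Fin.↑ˡ-injective n′ i j e))))
  ... | free b  rewrite liftˢ-freeˡ k l σ b = occ-wk-bound k l i (proj₂ σ b)
  eᵘ : ∀ u → occ (i ↑ˡ n′) (proj₁ (liftˢ k l σ) u) ≡ 0
  eᵘ u with split k u
  ... | bound j rewrite liftˢ-boundᵘ k l σ j = refl
  ... | free u  rewrite liftˢ-freeᵘ k l σ u = occ-wk-bound k l i (proj₁ σ u)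

occ-sub : {a : Fin n} {a′ : Fin n′} {σ : Sub m n m′ n′} → Keeps a a′ σ → ∀ t → occ a′ (sub σ t) ≡ occ a t
occ-sub {m′ = m′} {a = a} {a′} e (lvar b) with a ≟ b
... | yes refl = trans (cong (occ a′) (Keeps.at-a e)) (occ-lvar-≡ {m′} a′)
... | no a≢b   = Keeps.off-a e b (a≢b ∘ sym)
occ-sub e (uvar u)       = Keeps.inᵘ e u
occ-sub e ⟨ t , s ⟩      = cong₂ _+_ (occ-sub e t) (occ-sub e s)
occ-sub e (t [ p := s ]) = cong₂ _+_ (occ-sub (Keeps-free (#ᵘ p) (#ˡ p) e) t) (occ-sub e s)
occ-sub e (℘ t)          = occ-sub (Keeps-free 0 2 e) t
occ-sub e (t • s)        = cong₂ _+_ (occ-sub e t) (occ-sub e s)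
occ-sub e (t ▼ s)        = cong₂ _+_ (occ-sub e t) (occ-sub e s)
occ-sub e (! t)          = occ-sub (Keeps-free 0 1 e) t
occ-sub e (¿ t)          = occ-sub (Keeps-free 1 0 e) t
occ-sub e (t ▸ s)        = cong₂ _+_ (occ-sub (Keeps-free 0 1 e) t) (occ-sub e s)
occ-sub e (t ♯ s)        = cong₂ _+_ (occ-sub e t) (occ-sub e s)
occ-sub e ⋆              = refl

record Agree {m n m′ n′ : ℕ} (σ σ′ : Sub m n m′ n′) (t : Term m n) : Set where
  constructor agree
  field
    onᵘ : ∀ u → proj₁ σ u ≡ proj₁ σ′ u
    onˡ : ∀ c → c ∈fv t → proj₂ σ c ≡ proj₂ σ′ c
open Agree

Agree-mono : {σ σ′ : Sub m n m′ n′} {t s : Term m n} →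
  (∀ c → c ∈fv t → c ∈fv s) → Agree σ σ′ s → Agree σ σ′ t
Agree-mono f (agree e g) = agree e λ c → g c ∘ f c

Agree-lift : ∀ k l {σ σ′ : Sub m n m′ n′} {t : Term m n} {t′ : Term (k + m) (l + n)} →
  (∀ c → l ↑ʳ c ∈fv t′ → c ∈fv t) → Agree σ σ′ t → Agree (liftˢ k l σ) (liftˢ k l σ′) t′
Agree-lift k l {σ} {σ′} {t} {t′} f (agree e g) = agree eᵘ eˡ
  where
  eᵘ : ∀ u → proj₁ (liftˢ k l σ) u ≡ proj₁ (liftˢ k l σ′) u
  eᵘ u with split k u
  ... | bound i = trans (liftˢ-boundᵘ k l σ i) (sym (liftˢ-boundᵘ k l σ′ i))
  ... | free u  = trans (liftˢ-freeᵘ k l σ u) (trans (cong (ren _) (e u)) (sym (liftˢ-freeᵘ k l σ′ u)))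
  eˡ : ∀ c → c ∈fv t′ → proj₂ (liftˢ k l σ) c ≡ proj₂ (liftˢ k l σ′) c
  eˡ c c∈ with split l c
  ... | bound i = trans (liftˢ-boundˡ k l σ i) (sym (liftˢ-boundˡ k l σ′ i))
  ... | free c  = trans (liftˢ-freeˡ k l σ c) (trans (cong (ren _) (g c (f c c∈))) (sym (liftˢ-freeˡ k l σ′ c)))

sub-agree : {σ σ′ : Sub m n m′ n′} (t : Term m n) → Agree σ σ′ t → sub σ t ≡ sub σ′ t
sub-agree {m} (lvar b)       e = onˡ e b (subst (0 <_) (sym (occ-lvar-≡ {m} b)) (s≤s z≤n))
sub-agree (uvar u)       e = onᵘ e u
sub-agree ⟨ t , s ⟩      e = cong₂ ⟨_,_⟩
  (sub-agree t (Agree-mono (λ c → ∈fv-+ˡ _) e)) (sub-agree s (Agree-mono (λ c → ∈fv-+ʳ (occ c t)) e))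
sub-agree (t [ p := s ]) e = cong₂ (elim p)
  (sub-agree t (Agree-lift (#ᵘ p) (#ˡ p) (λ c → ∈fv-+ˡ _) e))
  (sub-agree s (Agree-mono (λ c → ∈fv-+ʳ (occ (#ˡ p ↑ʳ c) t)) e))
sub-agree (℘ t)          e = cong ℘_ (sub-agree t (Agree-lift 0 2 (λ c z → z) e))
sub-agree (t • s)        e = cong₂ _•_
  (sub-agree t (Agree-mono (λ c → ∈fv-+ˡ _) e)) (sub-agree s (Agree-mono (λ c → ∈fv-+ʳ (occ c t)) e))
sub-agree (t ▼ s)        e = cong₂ _▼_
  (sub-agree t (Agree-mono (λ c → ∈fv-+ˡ _) e)) (sub-agree s (Agree-mono (λ c → ∈fv-+ʳ (occ c t)) e))
sub-agree (! t)          e = cong !_ (sub-agree t (Agree-lift 0 1 (λ c z → z) e))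
sub-agree (¿ t)          e = cong ¿_ (sub-agree t (Agree-lift 1 0 (λ c z → z) e))
sub-agree (t ▸ s)        e = cong₂ _▸_
  (sub-agree t (Agree-lift 0 1 (λ c → ∈fv-+ˡ _) e))
  (sub-agree s (Agree-mono (λ c → ∈fv-+ʳ (occ (suc c) t)) e))
sub-agree (t ♯ s)        e = cong₂ _♯_
  (sub-agree t (Agree-mono (λ c → ∈fv-+ˡ _) e)) (sub-agree s (Agree-mono (λ c → ∈fv-+ʳ (occ c t)) e))
sub-agree ⋆              e = refl

-- The tests in `contra` look only at occurrence counts, which `Over` preserves, so both sides take
-- the same branch.
contra-ren : (ρ : Ren m n m′ n′) {a : Fin n} {a′ : Fin n′} → Over (proj₂ ρ) a a′ →
  ∀ t s → ren ρ (contra a t s) ≡ contra a′ (ren ρ t) (ren ρ s)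
contra-ren ρ o (lvar b) s = refl
contra-ren ρ o (uvar u) s = refl
contra-ren ρ {a} {a′} o ⟨ t₁ , t₂ ⟩ s rewrite occ-ren ρ o t₁ with does (0 <? occ a t₁)
... | true  = contra-ren ρ o t₁ _
... | false = contra-ren ρ o t₂ _
contra-ren ρ {a} {a′} o (t₁ [ pair := t₂ ]) s rewrite occ-ren (liftᴿ 0 2 ρ) (Over-free 2 o) t₁ with does (0 <? occ (2 ↑ʳ a) t₁)
... | true  = cong (λ r → r [ pair := ren ρ t₂ ])
  (trans (contra-ren _ (Over-free 2 o) t₁ _) (cong (contra (2 ↑ʳ a′) (ren (liftᴿ 0 2 ρ) t₁)) (ren-wk 0 2 ρ s)))
... | false = trans (contra-ren ρ o t₂ _) (cong (λ r → contra a′ (ren ρ t₂) (℘ (ren (liftᴿ 0 2 ρ) t₁ ♯ r))) (ren-wk 0 2 ρ s))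
contra-ren ρ {a} {a′} o (t₁ [ bang := t₂ ]) s rewrite occ-ren (liftᴿ 1 0 ρ) o t₁ with does (0 <? occ a t₁)
... | true  = cong (λ r → r [ bang := ren ρ t₂ ]) (trans (contra-ren _ o t₁ _) (cong (contra a′ (ren (liftᴿ 1 0 ρ) t₁)) (ren-wk 1 0 ρ s)))
... | false = trans (contra-ren ρ o t₂ _) (cong (λ r → contra a′ (ren ρ t₂) (¿ (ren (liftᴿ 1 0 ρ) t₁ ♯ r))) (ren-wk 1 0 ρ s))
contra-ren ρ {a} {a′} o (t₁ [ unit := t₂ ]) s rewrite occ-ren (liftᴿ 0 0 ρ) o t₁ with does (0 <? occ a t₁)
... | true  = cong (λ r → r [ unit := ren ρ t₂ ]) (contra-ren ρ o t₁ _)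
... | false = contra-ren ρ o t₂ _
contra-ren ρ o (℘ t) s = cong (λ r → r [ pair := ren ρ s ]) (contra-ren _ (Over-free 2 o) t ⋆)
contra-ren ρ {a} {a′} o (t₁ • t₂) s rewrite occ-ren ρ o t₁ with does (0 <? occ a t₁)
... | true  = contra-ren ρ o t₁ _
... | false = contra-ren ρ o t₂ _
contra-ren ρ {a} {a′} o (t₁ ▼ t₂) s rewrite occ-ren ρ o t₁ with does (0 <? occ a t₁)
... | true  = contra-ren ρ o t₁ _
... | false = contra-ren ρ o t₂ _
contra-ren ρ o (! t) s = refl
contra-ren ρ o (¿ t) s = cong (λ r → r [ bang := ren ρ s ]) (contra-ren _ o t ⋆)
contra-ren ρ o (t₁ ▸ t₂) s = cong (λ r → r [ unit := ren ρ s ]) (contra-ren ρ o t₂ _)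
contra-ren ρ {a} {a′} o (t₁ ♯ t₂) s rewrite occ-ren ρ o t₁ with does (0 <? occ a t₁)
... | true  = cong (λ r → r [ unit := ren ρ s ]) (contra-ren ρ o t₁ _)
... | false = cong (λ r → r [ unit := ren ρ s ]) (contra-ren ρ o t₂ _)
contra-ren ρ o ⋆ s = refl

-- Surface contexts

-- Lifting under no binder still composes with a renaming by the identity, so it is trivial only up
-- to this equation. Every surface context without binders meets it.
sub-lift-0 : (σ : Sub m n m′ n′) (t : Term m n) → sub (liftˢ 0 0 σ) t ≡ sub σ t
sub-lift-0 σ = sub-cong ((λ u → ren-id (proj₁ σ u)) , (λ a → ren-id (proj₂ σ a)))

subᔆ : Sub m n m′ n′ → Surface m n k l → Surface m′ n′ k l
subᔆ σ ℘□           = ℘□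
subᔆ σ ⟨□, t ⟩      = ⟨□, sub σ t ⟩
subᔆ σ ⟨ t ,□⟩      = ⟨ sub σ t ,□⟩
subᔆ σ (□• t)       = □• sub σ t
subᔆ σ (t •□)       = sub σ t •□
subᔆ σ (□▼ t)       = □▼ sub σ t
subᔆ σ (t ▼□)       = sub σ t ▼□
subᔆ σ (□♯ t)       = □♯ sub σ t
subᔆ σ (t ♯□)       = sub σ t ♯□
subᔆ σ ¿□           = ¿□
subᔆ σ □[ p := t ]  = □[ p := sub σ t ]
subᔆ σ (elim□ p t)  = elim□ p (sub (liftˢ (#ᵘ p) (#ˡ p) σ) t)
subᔆ σ (t ▸□)       = sub (liftˢ 0 1 σ) t ▸□

subᔆ-cong : {σ σ′ : Sub m n m′ n′} → σ ≗ˢ σ′ → (S : Surface m n k l) → subᔆ σ S ≡ subᔆ σ′ S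
subᔆ-cong e ℘□          = refl
subᔆ-cong e ⟨□, t ⟩     = cong ⟨□,_⟩ (sub-cong e t)
subᔆ-cong e ⟨ t ,□⟩     = cong ⟨_,□⟩ (sub-cong e t)
subᔆ-cong e (□• t)      = cong □•_ (sub-cong e t)
subᔆ-cong e (t •□)      = cong _•□ (sub-cong e t)
subᔆ-cong e (□▼ t)      = cong □▼_ (sub-cong e t)
subᔆ-cong e (t ▼□)      = cong _▼□ (sub-cong e t)
subᔆ-cong e (□♯ t)      = cong □♯_ (sub-cong e t)
subᔆ-cong e (t ♯□)      = cong _♯□ (sub-cong e t)
subᔆ-cong e ¿□          = refl
subᔆ-cong e □[ p := t ] = cong □[ p :=_] (sub-cong e t)
subᔆ-cong e (elim□ p t) = cong (elim□ p) (sub-cong (liftˢ-cong (#ᵘ p) (#ˡ p) e) t)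
subᔆ-cong e (t ▸□)      = cong _▸□ (sub-cong (liftˢ-cong 0 1 e) t)

subᔆ-subᔆ : (σ′ : Sub m′ n′ m″ n″) (σ : Sub m n m′ n′) (S : Surface m n k l) →
  subᔆ σ′ (subᔆ σ S) ≡ subᔆ (σ′ ∘ˢ σ) S
subᔆ-subᔆ σ′ σ ℘□          = refl
subᔆ-subᔆ σ′ σ ⟨□, t ⟩     = cong ⟨□,_⟩ (sub-sub σ′ σ t)
subᔆ-subᔆ σ′ σ ⟨ t ,□⟩     = cong ⟨_,□⟩ (sub-sub σ′ σ t)
subᔆ-subᔆ σ′ σ (□• t)      = cong □•_ (sub-sub σ′ σ t)
subᔆ-subᔆ σ′ σ (t •□)      = cong _•□ (sub-sub σ′ σ t)
subᔆ-subᔆ σ′ σ (□▼ t)      = cong □▼_ (sub-sub σ′ σ t)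
subᔆ-subᔆ σ′ σ (t ▼□)      = cong _▼□ (sub-sub σ′ σ t)
subᔆ-subᔆ σ′ σ (□♯ t)      = cong □♯_ (sub-sub σ′ σ t)
subᔆ-subᔆ σ′ σ (t ♯□)      = cong _♯□ (sub-sub σ′ σ t)
subᔆ-subᔆ σ′ σ ¿□          = refl
subᔆ-subᔆ σ′ σ □[ p := t ] = cong □[ p :=_] (sub-sub σ′ σ t)
subᔆ-subᔆ σ′ σ (elim□ p t) = cong (elim□ p) (sub-sub-lift (#ᵘ p) (#ˡ p) σ′ σ t)
subᔆ-subᔆ σ′ σ (t ▸□)      = cong _▸□ (sub-sub-lift 0 1 σ′ σ t)

renᔆ-as-subᔆ : (ρ : Ren m n m′ n′) (S : Surface m n k l) → renᔆ ρ S ≡ subᔆ ⌊ ρ ⌋ S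
renᔆ-as-subᔆ ρ ℘□          = refl
renᔆ-as-subᔆ ρ ⟨□, t ⟩     = cong ⟨□,_⟩ (ren-as-sub ρ t)
renᔆ-as-subᔆ ρ ⟨ t ,□⟩     = cong ⟨_,□⟩ (ren-as-sub ρ t)
renᔆ-as-subᔆ ρ (□• t)      = cong □•_ (ren-as-sub ρ t)
renᔆ-as-subᔆ ρ (t •□)      = cong _•□ (ren-as-sub ρ t)
renᔆ-as-subᔆ ρ (□▼ t)      = cong □▼_ (ren-as-sub ρ t)
renᔆ-as-subᔆ ρ (t ▼□)      = cong _▼□ (ren-as-sub ρ t)
renᔆ-as-subᔆ ρ (□♯ t)      = cong □♯_ (ren-as-sub ρ t)
renᔆ-as-subᔆ ρ (t ♯□)      = cong _♯□ (ren-as-sub ρ t)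
renᔆ-as-subᔆ ρ ¿□          = refl
renᔆ-as-subᔆ ρ □[ p := t ] = cong □[ p :=_] (ren-as-sub ρ t)
renᔆ-as-subᔆ ρ (elim□ p t) = cong (elim□ p)
  (trans (ren-as-sub _ t) (sub-cong (liftˢ-⌊⌋ (#ᵘ p) (#ˡ p) ρ) t))
renᔆ-as-subᔆ ρ (t ▸□)      = cong _▸□ (trans (ren-as-sub _ t) (sub-cong (liftˢ-⌊⌋ 0 1 ρ) t))

subᔆ-renᔆ : (σ : Sub m′ n′ m″ n″) (ρ : Ren m n m′ n′) (S : Surface m n k l) →
  subᔆ σ (renᔆ ρ S) ≡ subᔆ (σ ˢ∘ʳ ρ) S
subᔆ-renᔆ σ ρ S = trans (cong (subᔆ σ) (renᔆ-as-subᔆ ρ S)) (subᔆ-subᔆ σ ⌊ ρ ⌋ S)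

renᔆ-subᔆ : (ρ : Ren m′ n′ m″ n″) (σ : Sub m n m′ n′) (S : Surface m n k l) →
  renᔆ ρ (subᔆ σ S) ≡ subᔆ (ρ ʳ∘ˢ σ) S
renᔆ-subᔆ ρ σ S = trans (renᔆ-as-subᔆ ρ (subᔆ σ S)) (trans (subᔆ-subᔆ ⌊ ρ ⌋ σ S)
  (subᔆ-cong ((λ u → sym (ren-as-sub ρ (proj₁ σ u))) , (λ a → sym (ren-as-sub ρ (proj₂ σ a)))) S))

renᔆ-renᔆ : (ρ′ : Ren m′ n′ m″ n″) (ρ : Ren m n m′ n′) (S : Surface m n k l) →
  renᔆ ρ′ (renᔆ ρ S) ≡ renᔆ (ρ′ ∘ᴿ ρ) S
renᔆ-renᔆ ρ′ ρ S = trans (renᔆ-as-subᔆ ρ′ (renᔆ ρ S))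
  (trans (subᔆ-renᔆ ⌊ ρ′ ⌋ ρ S) (sym (renᔆ-as-subᔆ (ρ′ ∘ᴿ ρ) S)))

renᔆ-cong : {ρ ρ′ : Ren m n m′ n′} → ρ ≗ᴿ ρ′ → (S : Surface m n k l) → renᔆ ρ S ≡ renᔆ ρ′ S
renᔆ-cong {ρ = ρ} {ρ′} (e , f) S = trans (renᔆ-as-subᔆ ρ S)
  (trans (subᔆ-cong ((λ u → cong uvar (e u)) , (λ a → cong lvar (f a))) S) (sym (renᔆ-as-subᔆ ρ′ S)))

subᔆ-id : (S : Surface m n k l) → subᔆ idˢ S ≡ S
subᔆ-id ℘□          = refl
subᔆ-id ⟨□, t ⟩     = cong ⟨□,_⟩ (sub-id t)
subᔆ-id ⟨ t ,□⟩     = cong ⟨_,□⟩ (sub-id t)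
subᔆ-id (□• t)      = cong □•_ (sub-id t)
subᔆ-id (t •□)      = cong _•□ (sub-id t)
subᔆ-id (□▼ t)      = cong □▼_ (sub-id t)
subᔆ-id (t ▼□)      = cong _▼□ (sub-id t)
subᔆ-id (□♯ t)      = cong □♯_ (sub-id t)
subᔆ-id (t ♯□)      = cong _♯□ (sub-id t)
subᔆ-id ¿□          = refl
subᔆ-id □[ p := t ] = cong □[ p :=_] (sub-id t)
subᔆ-id (elim□ p t) = cong (elim□ p) (sub-id-lift (#ᵘ p) (#ˡ p) t)
subᔆ-id (t ▸□)      = cong _▸□ (sub-id-lift 0 1 t)

subᔆ-wk : ∀ k′ l′ (σ : Sub m n m′ n′) (S : Surface m n k l) →
  subᔆ (liftˢ k′ l′ σ) (renᔆ (wk k′ l′) S) ≡ renᔆ (wk k′ l′) (subᔆ σ S)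
subᔆ-wk k′ l′ σ S = trans (subᔆ-renᔆ _ _ S)
  (trans (subᔆ-cong (liftˢ-freeᵘ k′ l′ σ , liftˢ-freeˡ k′ l′ σ) S) (sym (renᔆ-subᔆ _ σ S)))

renᔆ-wk : ∀ k′ l′ (ρ : Ren m n m′ n′) (S : Surface m n k l) →
  renᔆ (liftᴿ k′ l′ ρ) (renᔆ (wk k′ l′) S) ≡ renᔆ (wk k′ l′) (renᔆ ρ S)
renᔆ-wk k′ l′ ρ S = trans (renᔆ-renᔆ _ _ S) (trans (renᔆ-cong (liftᴿ-wk k′ l′ ρ) S) (sym (renᔆ-renᔆ _ _ S)))

ren-plug : (ρ : Ren m n m′ n′) (S : Surface m n k l) (t : Term (k + m) (l + n)) →
  ren ρ (plug S t) ≡ plug (renᔆ ρ S) (ren (liftᴿ k l ρ) t)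
ren-plug ρ ℘□          t = refl
ren-plug ρ ⟨□, _ ⟩     t = refl
ren-plug ρ ⟨ _ ,□⟩     t = refl
ren-plug ρ (□• _)      t = refl
ren-plug ρ (_ •□)      t = refl
ren-plug ρ (□▼ _)      t = refl
ren-plug ρ (_ ▼□)      t = refl
ren-plug ρ (□♯ _)      t = refl
ren-plug ρ (_ ♯□)      t = refl
ren-plug ρ ¿□          t = refl
ren-plug ρ □[ p := _ ] t = refl
ren-plug ρ (elim□ p _) t = refl
ren-plug ρ (_ ▸□)      t = refl

sub-plug : (σ : Sub m n m′ n′) (S : Surface m n k l) (t : Term (k + m) (l + n)) →
  sub σ (plug S t) ≡ plug (subᔆ σ S) (sub (liftˢ k l σ) t)
sub-plug σ ℘□          t = refl
sub-plug σ ⟨□, _ ⟩     t = cong ⟨_, _ ⟩ (sym (sub-lift-0 σ t))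
sub-plug σ ⟨ _ ,□⟩     t = cong ⟨ _ ,_⟩ (sym (sub-lift-0 σ t))
sub-plug σ (□• _)      t = cong (_• _) (sym (sub-lift-0 σ t))
sub-plug σ (_ •□)      t = cong (_ •_) (sym (sub-lift-0 σ t))
sub-plug σ (□▼ _)      t = cong (_▼ _) (sym (sub-lift-0 σ t))
sub-plug σ (_ ▼□)      t = cong (_ ▼_) (sym (sub-lift-0 σ t))
sub-plug σ (□♯ _)      t = cong (_♯ _) (sym (sub-lift-0 σ t))
sub-plug σ (_ ♯□)      t = cong (_ ♯_) (sym (sub-lift-0 σ t))
sub-plug σ ¿□          t = refl
sub-plug σ □[ p := _ ] t = refl
sub-plug σ (elim□ p _) t = cong (elim p _) (sym (sub-lift-0 σ t))
sub-plug σ (_ ▸□)      t = cong (_ ▸_) (sym (sub-lift-0 σ t))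

-- Contra-substitution into plug S t pushes the term into S s to t and wraps
-- the result by wrap S s.
into : Surface m n k l → Term m n → Term (k + m) (l + n)
into ℘□             s = ⋆
into ⟨□, t ⟩        s = s ▼ t
into ⟨ t ,□⟩        s = s • t
into (□• t)         s = ⟨ t , s ⟩
into (t •□)         s = t ▼ s
into (□▼ t)         s = ⟨ s , t ⟩
into (t ▼□)         s = t • s
into (□♯ t)         s = t
into (t ♯□)         s = t
into ¿□             s = ⋆
into □[ p := t ]    s = ren (wk (#ᵘ p) (#ˡ p)) s
into (elim□ pair t) s = ℘ (t ♯ ren (wk 0 2) s)
into (elim□ bang t) s = ¿ (t ♯ ren (wk 1 0) s)
into (elim□ unit t) s = t ♯ s
into (t ▸□)         s = ! t

wrap : Surface m n k l → Term m n → Term (k + m) (l + n) → Term m n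
wrap ℘□          s y = y [ pair := s ]
wrap ⟨□, t ⟩     s y = y
wrap ⟨ t ,□⟩     s y = y
wrap (□• t)      s y = y
wrap (t •□)      s y = y
wrap (□▼ t)      s y = y
wrap (t ▼□)      s y = y
wrap (□♯ t)      s y = y [ unit := s ]
wrap (t ♯□)      s y = y [ unit := s ]
wrap ¿□          s y = y [ bang := s ]
wrap □[ p := t ] s y = y [ p := t ]
wrap (elim□ p t) s y = y
wrap (t ▸□)      s y = y [ unit := s ]

sub-into : (σ : Sub m n m′ n′) (S : Surface m n k l) (s : Term m n) →
  sub (liftˢ k l σ) (into S s) ≡ into (subᔆ σ S) (sub σ s)
sub-into σ ℘□             s = refl
sub-into σ ⟨□, t ⟩        s = sub-lift-0 σ (s ▼ t)
sub-into σ ⟨ t ,□⟩        s = sub-lift-0 σ (s • t)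
sub-into σ (□• t)         s = sub-lift-0 σ ⟨ t , s ⟩
sub-into σ (t •□)         s = sub-lift-0 σ (t ▼ s)
sub-into σ (□▼ t)         s = sub-lift-0 σ ⟨ s , t ⟩
sub-into σ (t ▼□)         s = sub-lift-0 σ (t • s)
sub-into σ (□♯ t)         s = sub-lift-0 σ t
sub-into σ (t ♯□)         s = sub-lift-0 σ t
sub-into σ ¿□             s = refl
sub-into σ □[ p := t ]    s = sub-wk (#ᵘ p) (#ˡ p) σ s
sub-into σ (elim□ pair t) s = trans (sub-lift-0 σ (℘ (t ♯ ren (wk 0 2) s)))
  (cong (λ r → ℘ (sub (liftˢ 0 2 σ) t ♯ r)) (sub-wk 0 2 σ s))
sub-into σ (elim□ bang t) s = trans (sub-lift-0 σ (¿ (t ♯ ren (wk 1 0) s)))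
  (cong (λ r → ¿ (sub (liftˢ 1 0 σ) t ♯ r)) (sub-wk 1 0 σ s))
sub-into σ (elim□ unit t) s = cong (sub (liftˢ 0 0 σ) t ♯_) (sub-lift-0 σ s)
sub-into σ (t ▸□)         s = sub-lift-0 σ (! t)

sub-wrap : (σ : Sub m n m′ n′) (S : Surface m n k l) (s : Term m n) (y : Term (k + m) (l + n)) →
  sub σ (wrap S s y) ≡ wrap (subᔆ σ S) (sub σ s) (sub (liftˢ k l σ) y)
sub-wrap σ ℘□          s y = refl
sub-wrap σ ⟨□, t ⟩     s y = sym (sub-lift-0 σ y)
sub-wrap σ ⟨ t ,□⟩     s y = sym (sub-lift-0 σ y)
sub-wrap σ (□• t)      s y = sym (sub-lift-0 σ y)
sub-wrap σ (t •□)      s y = sym (sub-lift-0 σ y)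
sub-wrap σ (□▼ t)      s y = sym (sub-lift-0 σ y)
sub-wrap σ (t ▼□)      s y = sym (sub-lift-0 σ y)
sub-wrap σ (□♯ t)      s y = refl
sub-wrap σ (t ♯□)      s y = refl
sub-wrap σ ¿□          s y = refl
sub-wrap σ □[ p := t ] s y = refl
sub-wrap σ (elim□ p t) s y = sym (sub-lift-0 σ y)
sub-wrap σ (t ▸□)      s y = refl

ren-into : (ρ : Ren m n m′ n′) (S : Surface m n k l) (s : Term m n) →
  ren (liftᴿ k l ρ) (into S s) ≡ into (renᔆ ρ S) (ren ρ s)
ren-into {k = k} {l = l} ρ S s = begin
  ren (liftᴿ k l ρ) (into S s)       ≡⟨ ren-as-sub _ (into S s) ⟩
  sub ⌊ liftᴿ k l ρ ⌋ (into S s)     ≡⟨ sub-cong (liftˢ-⌊⌋ k l ρ) (into S s) ⟩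
  sub (liftˢ k l ⌊ ρ ⌋) (into S s)   ≡⟨ sub-into ⌊ ρ ⌋ S s ⟩
  into (subᔆ ⌊ ρ ⌋ S) (sub ⌊ ρ ⌋ s)  ≡⟨ cong₂ into (renᔆ-as-subᔆ ρ S) (ren-as-sub ρ s) ⟨
  into (renᔆ ρ S) (ren ρ s)          ∎
  where open ≡-Reasoning

occᔆ : Fin n → Surface m n k l → ℕ
occᔆ a ℘□          = 0
occᔆ a ⟨□, t ⟩     = occ a t
occᔆ a ⟨ t ,□⟩     = occ a t
occᔆ a (□• t)      = occ a t
occᔆ a (t •□)      = occ a t
occᔆ a (□▼ t)      = occ a t
occᔆ a (t ▼□)      = occ a t
occᔆ a (□♯ t)      = occ a t
occᔆ a (t ♯□)      = occ a t
occᔆ a ¿□          = 0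
occᔆ a □[ p := t ] = occ a t
occᔆ a (elim□ p t) = occ (#ˡ p ↑ʳ a) t
occᔆ a (t ▸□)      = occ (suc a) t

occ-plug : (a : Fin n) (S : Surface m n k l) (t : Term (k + m) (l + n)) →
  occ a (plug S t) ≡ occ (l ↑ʳ a) t + occᔆ a S
occ-plug a ℘□          t = sym (+-identityʳ _)
occ-plug a ⟨□, _ ⟩     t = refl
occ-plug a ⟨ r ,□⟩     t = +-comm (occ a r) (occ a t)
occ-plug a (□• _)      t = refl
occ-plug a (r •□)      t = +-comm (occ a r) (occ a t)
occ-plug a (□▼ _)      t = refl
occ-plug a (r ▼□)      t = +-comm (occ a r) (occ a t)
occ-plug a (□♯ _)      t = refl
occ-plug a (r ♯□)      t = +-comm (occ a r) (occ a t)
occ-plug a ¿□          t = sym (+-identityʳ _)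
occ-plug a □[ p := _ ] t = refl
occ-plug a (elim□ p r) t = +-comm (occ (#ˡ p ↑ʳ a) r) (occ a t)
occ-plug a (r ▸□)      t = +-comm (occ (suc a) r) (occ a t)

occᔆ-ren : (ρ : Ren m n m′ n′) {a : Fin n} {a′ : Fin n′} → Over (proj₂ ρ) a a′ →
  (S : Surface m n k l) → occᔆ a′ (renᔆ ρ S) ≡ occᔆ a S
occᔆ-ren ρ o ℘□          = refl
occᔆ-ren ρ o ⟨□, t ⟩     = occ-ren ρ o t
occᔆ-ren ρ o ⟨ t ,□⟩     = occ-ren ρ o t
occᔆ-ren ρ o (□• t)      = occ-ren ρ o t
occᔆ-ren ρ o (t •□)      = occ-ren ρ o t
occᔆ-ren ρ o (□▼ t)      = occ-ren ρ o t
occᔆ-ren ρ o (t ▼□)      = occ-ren ρ o t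
occᔆ-ren ρ o (□♯ t)      = occ-ren ρ o t
occᔆ-ren ρ o (t ♯□)      = occ-ren ρ o t
occᔆ-ren ρ o ¿□          = refl
occᔆ-ren ρ o □[ p := t ] = occ-ren ρ o t
occᔆ-ren ρ o (elim□ p t) = occ-ren _ (Over-free (#ˡ p) o) t
occᔆ-ren ρ o (t ▸□)      = occ-ren _ (Over-free 1 o) t

occᔆ-ren-0 : (ρ : Ren m n m′ n′) {a′ : Fin n′} → (∀ b → proj₂ ρ b ≢ a′) →
  (S : Surface m n k l) → occᔆ a′ (renᔆ ρ S) ≡ 0
occᔆ-ren-0 ρ f ℘□          = refl
occᔆ-ren-0 ρ f ⟨□, t ⟩     = occ-ren-0 ρ f t
occᔆ-ren-0 ρ f ⟨ t ,□⟩     = occ-ren-0 ρ f t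
occᔆ-ren-0 ρ f (□• t)      = occ-ren-0 ρ f t
occᔆ-ren-0 ρ f (t •□)      = occ-ren-0 ρ f t
occᔆ-ren-0 ρ f (□▼ t)      = occ-ren-0 ρ f t
occᔆ-ren-0 ρ f (t ▼□)      = occ-ren-0 ρ f t
occᔆ-ren-0 ρ f (□♯ t)      = occ-ren-0 ρ f t
occᔆ-ren-0 ρ f (t ♯□)      = occ-ren-0 ρ f t
occᔆ-ren-0 ρ f ¿□          = refl
occᔆ-ren-0 ρ f □[ p := t ] = occ-ren-0 ρ f t
occᔆ-ren-0 ρ f (elim□ p t) = occ-ren-0 _ (lift-≢ (#ˡ p) f) t
occᔆ-ren-0 ρ f (t ▸□)      = occ-ren-0 _ (lift-≢ 1 f) t

WBᔆ : Surface m n k l → Set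
WBᔆ         ℘□          = ⊤
WBᔆ         ⟨□, t ⟩     = WellBound t
WBᔆ         ⟨ t ,□⟩     = WellBound t
WBᔆ         (□• t)      = WellBound t
WBᔆ         (t •□)      = WellBound t
WBᔆ         (□▼ t)      = WellBound t
WBᔆ         (t ▼□)      = WellBound t
WBᔆ         (□♯ t)      = WellBound t
WBᔆ         (t ♯□)      = WellBound t
WBᔆ         ¿□          = ⊤
WBᔆ         □[ p := t ] = WellBound t
WBᔆ {n = n} (elim□ p t) = (∀ (i : Fin (#ˡ p)) → occ (i ↑ˡ n) t ≡ 1) × WellBound t
WBᔆ         (t ▸□)      = occ zero t ≡ 1 × (∀ a → ¬ (suc a ∈fv t)) × WellBound t

WB-plug⁻ : (S : Surface m n k l) {t : Term (k + m) (l + n)} → WellBound (plug S t) →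
  (∀ (i : Fin l) → occ (i ↑ˡ n) t ≡ 1) × WellBound t × WBᔆ S
WB-plug⁻ ℘□          (o , w)         = o , w , tt
WB-plug⁻ ⟨□, _ ⟩     (w , v)         = (λ ()) , w , v
WB-plug⁻ ⟨ _ ,□⟩     (v , w)         = (λ ()) , w , v
WB-plug⁻ (□• _)      (w , v)         = (λ ()) , w , v
WB-plug⁻ (_ •□)      (v , w)         = (λ ()) , w , v
WB-plug⁻ (□▼ _)      (w , v)         = (λ ()) , w , v
WB-plug⁻ (_ ▼□)      (v , w)         = (λ ()) , w , v
WB-plug⁻ (□♯ _)      (w , v)         = (λ ()) , w , v
WB-plug⁻ (_ ♯□)      (v , w)         = (λ ()) , w , v
WB-plug⁻ ¿□          w               = (λ ()) , w , tt
WB-plug⁻ □[ p := _ ] (o , w , v)     = o , w , v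
WB-plug⁻ (elim□ p _) (o , v , w)     = (λ ()) , w , o , v
WB-plug⁻ (_ ▸□)      (o , f , v , w) = (λ ()) , w , o , f , v

WB-plug⁺ : (S : Surface m n k l) {t : Term (k + m) (l + n)} →
  (∀ (i : Fin l) → occ (i ↑ˡ n) t ≡ 1) → WellBound t → WBᔆ S → WellBound (plug S t)
WB-plug⁺ ℘□          o w v           = o , w
WB-plug⁺ ⟨□, _ ⟩     o w v           = w , v
WB-plug⁺ ⟨ _ ,□⟩     o w v           = v , w
WB-plug⁺ (□• _)      o w v           = w , v
WB-plug⁺ (_ •□)      o w v           = v , w
WB-plug⁺ (□▼ _)      o w v           = w , v
WB-plug⁺ (_ ▼□)      o w v           = v , w
WB-plug⁺ (□♯ _)      o w v           = w , v
WB-plug⁺ (_ ♯□)      o w v           = v , w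
WB-plug⁺ ¿□          o w v           = w
WB-plug⁺ □[ p := _ ] o w v           = o , w , v
WB-plug⁺ (elim□ p _) o w (o′ , v)    = o′ , v , w
WB-plug⁺ (_ ▸□)      o w (o′ , f , v) = o′ , f , v , w

Injective : (Fin n → Fin n′) → Set
Injective π = ∀ {a b} → π a ≡ π b → a ≡ b

Injective-lift : ∀ l {π : Fin n → Fin n′} → Injective π → Injective (lift l π)
Injective-lift zero    inj e = inj e
Injective-lift (suc l) inj {zero}  {zero}  e = refl
Injective-lift (suc l) inj {suc a} {suc b} e = cong suc (Injective-lift l inj (Fin.suc-injective e))

Injective⇒Over : {π : Fin n → Fin n′} → Injective π → ∀ a → Over π a (π a)
Injective⇒Over inj a = over refl (λ b → inj)

boxed-ren⁺ : (ρ : Ren m n m′ n′) {t : Term m (suc n)} →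
  (∀ a → ¬ (suc a ∈fv t)) → ∀ a → ¬ (suc a ∈fv ren (liftᴿ 0 1 ρ) t)
boxed-ren⁺ {m′ = m′} ρ {t} f a a∈ = contradiction (subst (0 <_) z a∈) λ ()
  where
  images : ∀ c → c ∈fv t → occ {m′} (suc a) (lvar (lift 1 (proj₂ ρ) c)) ≡ 0
  images zero    _  = refl
  images (suc c) c∈ = contradiction c∈ (f c)
  z : occ (suc a) (ren (liftᴿ 0 1 ρ) t) ≡ 0
  z = trans (cong (occ (suc a)) (ren-as-sub (liftᴿ 0 1 ρ) t)) (occ-sub-0 t (notFree (λ _ → refl) images))

boxed-ren⁻ : (ρ : Ren m n m′ n′) → Injective (proj₂ ρ) → {t : Term m (suc n)} →
  (∀ a → ¬ (suc a ∈fv ren (liftᴿ 0 1 ρ) t)) → ∀ a → ¬ (suc a ∈fv t)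
boxed-ren⁻ ρ inj {t} f a a∈ = f (proj₂ ρ a)
  (subst (0 <_) (sym (occ-ren (liftᴿ 0 1 ρ) (Over-free 1 (Injective⇒Over inj a)) t)) a∈)

bound-ren⁺ : ∀ k l (ρ : Ren m n m′ n′) {t : Term (k + m) (l + n)} →
  (∀ (i : Fin l) → occ (i ↑ˡ n) t ≡ 1) → ∀ (i : Fin l) → occ (i ↑ˡ n′) (ren (liftᴿ k l ρ) t) ≡ 1
bound-ren⁺ k l ρ {t} o i = trans (occ-ren (liftᴿ k l ρ) (Over-bound l (proj₂ ρ) i) t) (o i)

bound-ren⁻ : ∀ k l (ρ : Ren m n m′ n′) {t : Term (k + m) (l + n)} →
  (∀ (i : Fin l) → occ (i ↑ˡ n′) (ren (liftᴿ k l ρ) t) ≡ 1) → ∀ (i : Fin l) → occ (i ↑ˡ n) t ≡ 1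
bound-ren⁻ k l ρ {t} o i = trans (sym (occ-ren (liftᴿ k l ρ) (Over-bound l (proj₂ ρ) i) t)) (o i)

-- `WellBound` counts bound variables only, which lifting keeps apart from all others, so free
-- variables may be identified. Boxes stay closed because their bodies have no further linear
-- variable to rename.
WB-ren⁺ : (ρ : Ren m n m′ n′) (t : Term m n) → WellBound t → WellBound (ren ρ t)
WB-ren⁺ ρ (lvar a)       w           = tt
WB-ren⁺ ρ (uvar u)       w           = tt
WB-ren⁺ ρ ⟨ t , s ⟩      (w , v)     = WB-ren⁺ ρ t w , WB-ren⁺ ρ s v
WB-ren⁺ ρ (t [ p := s ]) (o , w , v) =
  bound-ren⁺ (#ᵘ p) (#ˡ p) ρ {t} o , WB-ren⁺ _ t w , WB-ren⁺ ρ s v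
WB-ren⁺ ρ (℘ t)          (o , w)     = bound-ren⁺ 0 2 ρ {t} o , WB-ren⁺ _ t w
WB-ren⁺ ρ (t • s)        (w , v)     = WB-ren⁺ ρ t w , WB-ren⁺ ρ s v
WB-ren⁺ ρ (t ▼ s)        (w , v)     = WB-ren⁺ ρ t w , WB-ren⁺ ρ s v
WB-ren⁺ ρ (! t)          (o , f , w) =
  trans (occ-ren (liftᴿ 0 1 ρ) (Over-bound 1 (proj₂ ρ) zero) t) o , boxed-ren⁺ ρ {t} f , WB-ren⁺ _ t w
WB-ren⁺ ρ (¿ t)          w           = WB-ren⁺ _ t w
WB-ren⁺ ρ (t ▸ s)        (o , f , w , v) =
  trans (occ-ren (liftᴿ 0 1 ρ) (Over-bound 1 (proj₂ ρ) zero) t) o ,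
  boxed-ren⁺ ρ {t} f , WB-ren⁺ _ t w , WB-ren⁺ ρ s v
WB-ren⁺ ρ (t ♯ s)        (w , v)     = WB-ren⁺ ρ t w , WB-ren⁺ ρ s v
WB-ren⁺ ρ ⋆              w           = tt

-- Injectivity serves the boxes, where it turns an occurrence of a forbidden variable in the body
-- into an occurrence of its image.
WB-ren⁻ : (ρ : Ren m n m′ n′) → Injective (proj₂ ρ) → (t : Term m n) → WellBound (ren ρ t) → WellBound t
WB-ren⁻ ρ j (lvar a)       w           = tt
WB-ren⁻ ρ j (uvar u)       w           = tt
WB-ren⁻ ρ j ⟨ t , s ⟩      (w , v)     = WB-ren⁻ ρ j t w , WB-ren⁻ ρ j s v
WB-ren⁻ ρ j (t [ p := s ]) (o , w , v) =
  bound-ren⁻ (#ᵘ p) (#ˡ p) ρ {t} o , WB-ren⁻ _ (Injective-lift (#ˡ p) j) t w , WB-ren⁻ ρ j s v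
WB-ren⁻ ρ j (℘ t)          (o , w)     = bound-ren⁻ 0 2 ρ {t} o , WB-ren⁻ _ (Injective-lift 2 j) t w
WB-ren⁻ ρ j (t • s)        (w , v)     = WB-ren⁻ ρ j t w , WB-ren⁻ ρ j s v
WB-ren⁻ ρ j (t ▼ s)        (w , v)     = WB-ren⁻ ρ j t w , WB-ren⁻ ρ j s v
WB-ren⁻ ρ j (! t)          (o , f , w) =
  trans (sym (occ-ren (liftᴿ 0 1 ρ) (Over-bound 1 (proj₂ ρ) zero) t)) o ,
  boxed-ren⁻ ρ j {t} f , WB-ren⁻ _ (Injective-lift 1 j) t w
WB-ren⁻ ρ j (¿ t)          w           = WB-ren⁻ _ j t w
WB-ren⁻ ρ j (t ▸ s)        (o , f , w , v) =
  trans (sym (occ-ren (liftᴿ 0 1 ρ) (Over-bound 1 (proj₂ ρ) zero) t)) o ,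
  boxed-ren⁻ ρ j {t} f , WB-ren⁻ _ (Injective-lift 1 j) t w , WB-ren⁻ ρ j s v
WB-ren⁻ ρ j (t ♯ s)        (w , v)     = WB-ren⁻ ρ j t w , WB-ren⁻ ρ j s v
WB-ren⁻ ρ j ⋆              w           = tt

WBᔆ-ren⁺ : (ρ : Ren m n m′ n′) (S : Surface m n k l) → WBᔆ S → WBᔆ (renᔆ ρ S)
WBᔆ-ren⁺ ρ ℘□          w = tt
WBᔆ-ren⁺ ρ ⟨□, t ⟩     w = WB-ren⁺ ρ t w
WBᔆ-ren⁺ ρ ⟨ t ,□⟩     w = WB-ren⁺ ρ t w
WBᔆ-ren⁺ ρ (□• t)      w = WB-ren⁺ ρ t w
WBᔆ-ren⁺ ρ (t •□)      w = WB-ren⁺ ρ t w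
WBᔆ-ren⁺ ρ (□▼ t)      w = WB-ren⁺ ρ t w
WBᔆ-ren⁺ ρ (t ▼□)      w = WB-ren⁺ ρ t w
WBᔆ-ren⁺ ρ (□♯ t)      w = WB-ren⁺ ρ t w
WBᔆ-ren⁺ ρ (t ♯□)      w = WB-ren⁺ ρ t w
WBᔆ-ren⁺ ρ ¿□          w = tt
WBᔆ-ren⁺ ρ □[ p := t ] w = WB-ren⁺ ρ t w
WBᔆ-ren⁺ ρ (elim□ p t) (o , w) = bound-ren⁺ (#ᵘ p) (#ˡ p) ρ {t} o , WB-ren⁺ _ t w
WBᔆ-ren⁺ ρ (t ▸□)      w = proj₁ (WB-ren⁺ ρ (! t) w) , proj₂ (WB-ren⁺ ρ (! t) w)

WBᔆ-ren⁻ : (ρ : Ren m n m′ n′) → Injective (proj₂ ρ) → (S : Surface m n k l) → WBᔆ (renᔆ ρ S) → WBᔆ S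
WBᔆ-ren⁻ ρ j ℘□          w = tt
WBᔆ-ren⁻ ρ j ⟨□, t ⟩     w = WB-ren⁻ ρ j t w
WBᔆ-ren⁻ ρ j ⟨ t ,□⟩     w = WB-ren⁻ ρ j t w
WBᔆ-ren⁻ ρ j (□• t)      w = WB-ren⁻ ρ j t w
WBᔆ-ren⁻ ρ j (t •□)      w = WB-ren⁻ ρ j t w
WBᔆ-ren⁻ ρ j (□▼ t)      w = WB-ren⁻ ρ j t w
WBᔆ-ren⁻ ρ j (t ▼□)      w = WB-ren⁻ ρ j t w
WBᔆ-ren⁻ ρ j (□♯ t)      w = WB-ren⁻ ρ j t w
WBᔆ-ren⁻ ρ j (t ♯□)      w = WB-ren⁻ ρ j t w
WBᔆ-ren⁻ ρ j ¿□          w = tt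
WBᔆ-ren⁻ ρ j □[ p := t ] w = WB-ren⁻ ρ j t w
WBᔆ-ren⁻ ρ j (elim□ p t) (o , w) =
  bound-ren⁻ (#ᵘ p) (#ˡ p) ρ {t} o , WB-ren⁻ _ (Injective-lift (#ˡ p) j) t w
WBᔆ-ren⁻ ρ j (t ▸□)      w = WB-ren⁻ ρ j (! t) w

-- For a well-bound term, equivalent to occ a t ≡ 1: the path to the occurrence
-- crosses no exponential box.
data Surf {m n : ℕ} (a : Fin n) : Term m n → Set where
  here  : Surf a (lvar a)
  there : ∀ {k l} (S : Surface m n k l) {t : Term (k + m) (l + n)} →
    occᔆ a S ≡ 0 → Surf (l ↑ʳ a) t → Surf a (plug S t)

+≡1 : ∀ i {j} → i + j ≡ 1 → (i ≡ 1 × j ≡ 0) ⊎ (i ≡ 0 × j ≡ 1)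
+≡1 zero    e = inj₂ (refl , e)
+≡1 (suc i) e = inj₁ (cong suc (m+n≡0⇒m≡0 i (Nat.suc-injective e)) , m+n≡0⇒n≡0 i (Nat.suc-injective e))

surf : {a : Fin n} (t : Term m n) → occ a t ≡ 1 → WellBound t → Surf a t
surf {a = a} (lvar b) o w with a ≟ b
... | yes refl = here
surf {a = a} ⟨ t , s ⟩ o (w , v) with +≡1 (occ a t) o
... | inj₁ (o₁ , o₂) = there ⟨□, s ⟩ o₂ (surf t o₁ w)
... | inj₂ (o₁ , o₂) = there ⟨ t ,□⟩ o₁ (surf s o₂ v)
surf {a = a} (t [ p := s ]) o (_ , w , v) with +≡1 (occ (#ˡ p ↑ʳ a) t) o
... | inj₁ (o₁ , o₂) = there □[ p := s ] o₂ (surf t o₁ w)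
... | inj₂ (o₁ , o₂) = there (elim□ p t) o₁ (surf s o₂ v)
surf (℘ t) o (_ , w) = there ℘□ refl (surf t o w)
surf {a = a} (t • s) o (w , v) with +≡1 (occ a t) o
... | inj₁ (o₁ , o₂) = there (□• s) o₂ (surf t o₁ w)
... | inj₂ (o₁ , o₂) = there (t •□) o₁ (surf s o₂ v)
surf {a = a} (t ▼ s) o (w , v) with +≡1 (occ a t) o
... | inj₁ (o₁ , o₂) = there (□▼ s) o₂ (surf t o₁ w)
... | inj₂ (o₁ , o₂) = there (t ▼□) o₁ (surf s o₂ v)
surf {a = a} (! t) o (_ , f , _) = contradiction (subst (0 <_) (sym o) (s≤s z≤n)) (f a)
surf (¿ t) o w = there ¿□ refl (surf t o w)
surf {a = a} (t ▸ s) o (_ , f , _ , v) =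
  there (t ▸□) t≡0 (surf s (trans (sym (cong (_+ occ a s) t≡0)) o) v)
  where t≡0 = occ≡0 {t = t} (f a)
surf {a = a} (t ♯ s) o (w , v) with +≡1 (occ a t) o
... | inj₁ (o₁ , o₂) = there (□♯ s) o₂ (surf t o₁ w)
... | inj₂ (o₁ , o₂) = there (t ♯□) o₁ (surf s o₂ v)

Surf-occ : {a : Fin n} {t : Term m n} → Surf a t → occ a t ≡ 1
Surf-occ {m = m} {a = a} here = occ-lvar-≡ {m} a
Surf-occ {a = a} (there S {t} o p) = trans (occ-plug a S t) (cong₂ _+_ (Surf-occ p) o)

Surf-∈fv : {a : Fin n} {t : Term m n} → Surf a t → a ∈fv t
Surf-∈fv p = subst (0 <_) (sym (Surf-occ p)) (s≤s z≤n)

-- All clauses of `contra` in one equation. Later facts about contra-substitution are proved by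
-- induction on `Surf` with this equation, instead of by the cases and tests of the definition.
contra-plug : (a : Fin n) (S : Surface m n k l) (t : Term (k + m) (l + n)) (s : Term m n) →
  l ↑ʳ a ∈fv t → occᔆ a S ≡ 0 → contra a (plug S t) s ≡ wrap S s (contra (l ↑ʳ a) t (into S s))
contra-plug a ℘□          t s i o = refl
contra-plug a ⟨□, r ⟩     t s i o rewrite dec-true (0 <? occ a t) i = refl
contra-plug a ⟨ r ,□⟩     t s i o rewrite o = refl
contra-plug a (□• r)      t s i o rewrite dec-true (0 <? occ a t) i = refl
contra-plug a (r •□)      t s i o rewrite o = refl
contra-plug a (□▼ r)      t s i o rewrite dec-true (0 <? occ a t) i = refl
contra-plug a (r ▼□)      t s i o rewrite o = refl
contra-plug a (□♯ r)      t s i o rewrite dec-true (0 <? occ a t) i = refl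
contra-plug a (r ♯□)      t s i o rewrite o = refl
contra-plug a ¿□          t s i o = refl
contra-plug a □[ pair := r ] t s i o rewrite dec-true (0 <? occ (2 ↑ʳ a) t) i = refl
contra-plug a □[ bang := r ] t s i o rewrite dec-true (0 <? occ a t) i = refl
-- Here `into` weakens by the empty block, whereas `contra` passes `s` on unchanged.
contra-plug a □[ unit := r ] t s i o rewrite dec-true (0 <? occ a t) i =
  cong (λ q → contra a t q [ unit := r ]) (sym (ren-id s))
contra-plug a (elim□ pair r) t s i o rewrite o = refl
contra-plug a (elim□ bang r) t s i o rewrite o = refl
contra-plug a (elim□ unit r) t s i o rewrite o = refl
contra-plug a (r ▸□)      t s i o = refl

-- Typing without linearity

infix 3 _⨾_⊩_∶_

^⊥-involutive : (A : Formula X) → A ^⊥ ^⊥ ≡ A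
^⊥-involutive (atom x)  = refl
^⊥-involutive (natom x) = refl
^⊥-involutive (A ⊗ B)   = cong₂ _⊗_ (^⊥-involutive A) (^⊥-involutive B)
^⊥-involutive (A ⅋ B)   = cong₂ _⅋_ (^⊥-involutive A) (^⊥-involutive B)
^⊥-involutive 𝟙         = refl
^⊥-involutive ⊥         = refl
^⊥-involutive (! A)     = cong !_ (^⊥-involutive A)
^⊥-involutive (¿ A)     = cong ¿_ (^⊥-involutive A)

data PatTyping {X : Set} : (p : Pat) → Formula X → UCtx X (#ᵘ p) → LCtx X (#ˡ p) → Set where
  pair : ∀ {A B} → PatTyping pair (A ⊗ B) [] (just A ∷ just B ∷ [])
  bang : ∀ {A} → PatTyping bang (! A) (A ∷ []) []
  unit : PatTyping unit 𝟙 [] []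

-- The linear context is shared instead of split; linearity is left to occ and
-- WellBound.
data _⨾_⊩_∶_ {X : Set} {m n : ℕ} (Δ : UCtx X m) (Γ : LCtx X n) : Term m n → Formula X → Set where
  lvar : ∀ {a A} → lookup Γ a ≡ just A → Δ ⨾ Γ ⊩ lvar a ∶ A
  uvar : ∀ {u A} → lookup Δ u ≡ A → Δ ⨾ Γ ⊩ uvar u ∶ A
  tensor : ∀ {t s A B} → Δ ⨾ Γ ⊩ t ∶ A → Δ ⨾ Γ ⊩ s ∶ B → Δ ⨾ Γ ⊩ ⟨ t , s ⟩ ∶ A ⊗ B
  elim : ∀ {p t s A B Δₚ Γₚ} → PatTyping p A Δₚ Γₚ →
    Δ ⨾ Γ ⊩ s ∶ A → Δₚ ++ Δ ⨾ Γₚ ++ Γ ⊩ t ∶ B → Δ ⨾ Γ ⊩ t [ p := s ] ∶ B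
  par : ∀ {t A B} → Δ ⨾ just (A ^⊥) ∷ just (B ^⊥) ∷ Γ ⊩ t ∶ ⊥ → Δ ⨾ Γ ⊩ ℘ t ∶ A ⅋ B
  app : ∀ {t s A B} → Δ ⨾ Γ ⊩ t ∶ A ⅋ B → Δ ⨾ Γ ⊩ s ∶ A ^⊥ → Δ ⨾ Γ ⊩ t • s ∶ B
  coapp : ∀ {t s A B} → Δ ⨾ Γ ⊩ t ∶ A ⅋ B → Δ ⨾ Γ ⊩ s ∶ B ^⊥ → Δ ⨾ Γ ⊩ t ▼ s ∶ A
  ofcourse : ∀ {t A} → Δ ⨾ just (A ^⊥) ∷ Γ ⊩ t ∶ ⊥ → Δ ⨾ Γ ⊩ ! t ∶ ! A
  whynot : ∀ {t A} → (A ^⊥) ∷ Δ ⨾ Γ ⊩ t ∶ ⊥ → Δ ⨾ Γ ⊩ ¿ t ∶ ¿ A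
  elim-whynot : ∀ {t s A} → Δ ⨾ Γ ⊩ s ∶ ¿ A → Δ ⨾ just A ∷ Γ ⊩ t ∶ ⊥ → Δ ⨾ Γ ⊩ t ▸ s ∶ ⊥
  cut : ∀ {t s B} → Δ ⨾ Γ ⊩ t ∶ B → Δ ⨾ Γ ⊩ s ∶ B ^⊥ → Δ ⨾ Γ ⊩ t ♯ s ∶ ⊥
  one : Δ ⨾ Γ ⊩ ⋆ ∶ 𝟙

record TyRen {X : Set} {m n m′ n′ : ℕ} (ρ : Ren m n m′ n′)
             (Δ : UCtx X m) (Γ : LCtx X n) (Δ′ : UCtx X m′) (Γ′ : LCtx X n′) : Set where
  constructor tyRen
  field
    tyᵘ : ∀ u → lookup Δ′ (proj₁ ρ u) ≡ lookup Δ u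
    tyˡ : ∀ a → lookup Γ′ (proj₂ ρ a) ≡ lookup Γ a
open TyRen

lookup-lift : {A : Set} (as : Vec A k) {xs : Vec A n} {ys : Vec A n′} {f : Fin n → Fin n′} →
  (∀ i → lookup ys (f i) ≡ lookup xs i) → ∀ i → lookup (as ++ ys) (lift k f i) ≡ lookup (as ++ xs) i
lookup-lift []       e i       = e i
lookup-lift (a ∷ as) e zero    = refl
lookup-lift (a ∷ as) e (suc i) = lookup-lift as e i

TyRen-lift : {ρ : Ren m n m′ n′} {Δ : UCtx X m} {Γ : LCtx X n} {Δ′ : UCtx X m′} {Γ′ : LCtx X n′}
  (Δ₀ : UCtx X k) (Γ₀ : LCtx X l) → TyRen ρ Δ Γ Δ′ Γ′ →
  TyRen (liftᴿ k l ρ) (Δ₀ ++ Δ) (Γ₀ ++ Γ) (Δ₀ ++ Δ′) (Γ₀ ++ Γ′)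
TyRen-lift Δ₀ Γ₀ (tyRen e f) = tyRen (lookup-lift Δ₀ e) (lookup-lift Γ₀ f)

TyRen-wk : (Δ₀ : UCtx X k) (Γ₀ : LCtx X l) {Δ : UCtx X m} {Γ : LCtx X n} →
  TyRen (wk k l) Δ Γ (Δ₀ ++ Δ) (Γ₀ ++ Γ)
TyRen-wk Δ₀ Γ₀ {Δ} {Γ} = tyRen (lookup-++ʳ Δ₀ Δ) (lookup-++ʳ Γ₀ Γ)

lookup-exchange : {A : Set} (as : Vec A k) (bs : Vec A l) (xs : Vec A n) (i : Fin (k + (l + n))) →
  lookup (bs ++ (as ++ xs)) (exchange k l i) ≡ lookup (as ++ (bs ++ xs)) i
lookup-exchange {k = k} {l = l} as bs xs i with split k i
... | bound i = trans (cong (lookup (bs ++ (as ++ xs))) (exchange-inner k l i))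
  (trans (lookup-++ʳ bs (as ++ xs) _) (trans (lookup-++ˡ as xs i) (sym (lookup-++ˡ as (bs ++ xs) i))))
... | free y with split l y
... | bound i = trans (cong (lookup (bs ++ (as ++ xs))) (exchange-outer k l i))
  (trans (lookup-++ˡ bs (as ++ xs) i)
    (trans (sym (lookup-++ˡ bs xs i)) (sym (lookup-++ʳ as (bs ++ xs) _))))
... | free z  = trans (cong (lookup (bs ++ (as ++ xs))) (exchange-free k l z))
  (trans (lookup-++ʳ bs (as ++ xs) _) (trans (lookup-++ʳ as xs z)
    (trans (sym (lookup-++ʳ bs xs z)) (sym (lookup-++ʳ as (bs ++ xs) _)))))

TyRen-xch : (Δ₁ : UCtx X k) (Γ₁ : LCtx X l) (Δ₂ : UCtx X m′) (Γ₂ : LCtx X n′) {Δ : UCtx X m} {Γ : LCtx X n} →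
  TyRen (xch k l m′ n′) (Δ₁ ++ (Δ₂ ++ Δ)) (Γ₁ ++ (Γ₂ ++ Γ)) (Δ₂ ++ (Δ₁ ++ Δ)) (Γ₂ ++ (Γ₁ ++ Γ))
TyRen-xch Δ₁ Γ₁ Δ₂ Γ₂ = tyRen (lookup-exchange Δ₁ Δ₂ _) (lookup-exchange Γ₁ Γ₂ _)

ren-ty⁺ : {ρ : Ren m n m′ n′} {Δ : UCtx X m} {Γ : LCtx X n} {Δ′ : UCtx X m′} {Γ′ : LCtx X n′} →
  TyRen ρ Δ Γ Δ′ Γ′ → ∀ {t A} → Δ ⨾ Γ ⊩ t ∶ A → Δ′ ⨾ Γ′ ⊩ ren ρ t ∶ A
ren-ty⁺ e (lvar {a} x)      = lvar (trans (tyˡ e a) x)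
ren-ty⁺ e (uvar {u} x)      = uvar (trans (tyᵘ e u) x)
ren-ty⁺ e (tensor t s)      = tensor (ren-ty⁺ e t) (ren-ty⁺ e s)
ren-ty⁺ e (elim {Δₚ = Δₚ} {Γₚ} p s t) = elim p (ren-ty⁺ e s) (ren-ty⁺ (TyRen-lift Δₚ Γₚ e) t)
ren-ty⁺ e (par t)           = par (ren-ty⁺ (TyRen-lift [] (_ ∷ _ ∷ []) e) t)
ren-ty⁺ e (app t s)         = app (ren-ty⁺ e t) (ren-ty⁺ e s)
ren-ty⁺ e (coapp t s)       = coapp (ren-ty⁺ e t) (ren-ty⁺ e s)
ren-ty⁺ e (ofcourse t)      = ofcourse (ren-ty⁺ (TyRen-lift [] (_ ∷ []) e) t)
ren-ty⁺ e (whynot t)        = whynot (ren-ty⁺ (TyRen-lift (_ ∷ []) [] e) t)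
ren-ty⁺ e (elim-whynot s t) = elim-whynot (ren-ty⁺ e s) (ren-ty⁺ (TyRen-lift [] (_ ∷ []) e) t)
ren-ty⁺ e (cut t s)         = cut (ren-ty⁺ e t) (ren-ty⁺ e s)
ren-ty⁺ e one               = one

-- `TyRen` asks for equal lookups, absent variables included, so typings are reflected as well as
-- preserved. Typing the two sides of `slide` relies on both directions.
ren-ty⁻ : {ρ : Ren m n m′ n′} {Δ : UCtx X m} {Γ : LCtx X n} {Δ′ : UCtx X m′} {Γ′ : LCtx X n′} →
  TyRen ρ Δ Γ Δ′ Γ′ → ∀ t {A} → Δ′ ⨾ Γ′ ⊩ ren ρ t ∶ A → Δ ⨾ Γ ⊩ t ∶ A
ren-ty⁻ e (lvar a)       (lvar x)          = lvar (trans (sym (tyˡ e a)) x)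
ren-ty⁻ e (uvar u)       (uvar x)          = uvar (trans (sym (tyᵘ e u)) x)
ren-ty⁻ e ⟨ t , s ⟩      (tensor d d′)     = tensor (ren-ty⁻ e t d) (ren-ty⁻ e s d′)
ren-ty⁻ e (t [ p := s ]) (elim {Δₚ = Δₚ} {Γₚ} q d d′) =
  elim q (ren-ty⁻ e s d) (ren-ty⁻ (TyRen-lift Δₚ Γₚ e) t d′)
ren-ty⁻ e (℘ t)          (par d)           = par (ren-ty⁻ (TyRen-lift [] (_ ∷ _ ∷ []) e) t d)
ren-ty⁻ e (t • s)        (app d d′)        = app (ren-ty⁻ e t d) (ren-ty⁻ e s d′)
ren-ty⁻ e (t ▼ s)        (coapp d d′)      = coapp (ren-ty⁻ e t d) (ren-ty⁻ e s d′)
ren-ty⁻ e (! t)          (ofcourse d)      = ofcourse (ren-ty⁻ (TyRen-lift [] (_ ∷ []) e) t d)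
ren-ty⁻ e (¿ t)          (whynot d)        = whynot (ren-ty⁻ (TyRen-lift (_ ∷ []) [] e) t d)
ren-ty⁻ e (t ▸ s)        (elim-whynot d d′) =
  elim-whynot (ren-ty⁻ e s d) (ren-ty⁻ (TyRen-lift [] (_ ∷ []) e) t d′)
ren-ty⁻ e (t ♯ s)        (cut d d′)        = cut (ren-ty⁻ e t d) (ren-ty⁻ e s d′)
ren-ty⁻ e ⋆              one               = one

-- Only variables free in `t` need typed images. Contra-substitution at `⋆` ends by substituting `⋆`
-- for a variable that has disappeared and whose type is arbitrary; this could not be typed
-- otherwise.
record TySub {X : Set} {m n m′ n′ : ℕ} (σ : Sub m n m′ n′) (t : Term m n)
             (Δ : UCtx X m) (Γ : LCtx X n) (Δ′ : UCtx X m′) (Γ′ : LCtx X n′) : Set where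
  constructor tySub
  field
    tyᵘ : ∀ u → Δ′ ⨾ Γ′ ⊩ proj₁ σ u ∶ lookup Δ u
    tyˡ : ∀ a {A} → a ∈fv t → lookup Γ a ≡ just A → Δ′ ⨾ Γ′ ⊩ proj₂ σ a ∶ A

TySub-mono : {σ : Sub m n m′ n′} {t s : Term m n}
  {Δ : UCtx X m} {Γ : LCtx X n} {Δ′ : UCtx X m′} {Γ′ : LCtx X n′} →
  (∀ a → a ∈fv s → a ∈fv t) → TySub σ t Δ Γ Δ′ Γ′ → TySub σ s Δ Γ Δ′ Γ′
TySub-mono f (tySub e g) = tySub e (λ a → g a ∘ f a)

TySub-lift : {σ : Sub m n m′ n′} {t : Term m n} {s : Term (k + m) (l + n)}
  {Δ : UCtx X m} {Γ : LCtx X n} {Δ′ : UCtx X m′} {Γ′ : LCtx X n′}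
  (Δ₀ : UCtx X k) (Γ₀ : LCtx X l) → (∀ a → l ↑ʳ a ∈fv s → a ∈fv t) → TySub σ t Δ Γ Δ′ Γ′ →
  TySub (liftˢ k l σ) s (Δ₀ ++ Δ) (Γ₀ ++ Γ) (Δ₀ ++ Δ′) (Γ₀ ++ Γ′)
TySub-lift {m′ = m′} {n′ = n′} {k = k} {l = l} {σ = σ} {t} {s} {Δ} {Γ} {Δ′} {Γ′} Δ₀ Γ₀ f (tySub e g) = tySub eᵘ eˡ
  where
  eᵘ : ∀ u → Δ₀ ++ Δ′ ⨾ Γ₀ ++ Γ′ ⊩ proj₁ (liftˢ k l σ) u ∶ lookup (Δ₀ ++ Δ) u
  eᵘ u with split k u
  ... | bound i rewrite liftˢ-boundᵘ k l σ i =
    uvar (trans (lookup-++ˡ Δ₀ Δ′ i) (sym (lookup-++ˡ Δ₀ Δ i)))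
  ... | free j rewrite liftˢ-freeᵘ k l σ j | lookup-++ʳ Δ₀ Δ j = ren-ty⁺ (TyRen-wk Δ₀ Γ₀) (e j)
  eˡ : ∀ a {A} → a ∈fv s → lookup (Γ₀ ++ Γ) a ≡ just A → Δ₀ ++ Δ′ ⨾ Γ₀ ++ Γ′ ⊩ proj₂ (liftˢ k l σ) a ∶ A
  eˡ a a∈ x with split l a
  ... | bound i rewrite liftˢ-boundˡ k l σ i =
    lvar (trans (lookup-++ˡ Γ₀ Γ′ i) (trans (sym (lookup-++ˡ Γ₀ Γ i)) x))
  ... | free j rewrite liftˢ-freeˡ k l σ j | lookup-++ʳ Γ₀ Γ j = ren-ty⁺ (TyRen-wk Δ₀ Γ₀) (g j (f j a∈) x)

sub-ty : {σ : Sub m n m′ n′} {Δ : UCtx X m} {Γ : LCtx X n} {Δ′ : UCtx X m′} {Γ′ : LCtx X n′} →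
  ∀ {t A} → TySub σ t Δ Γ Δ′ Γ′ → Δ ⨾ Γ ⊩ t ∶ A → Δ′ ⨾ Γ′ ⊩ sub σ t ∶ A
sub-ty {m = m} e (lvar {a} x) = TySub.tyˡ e a (subst (0 <_) (sym (occ-lvar-≡ {m} a)) (s≤s z≤n)) x
sub-ty e (uvar {u} refl) = TySub.tyᵘ e u
sub-ty e (tensor {t} d d′) = tensor (sub-ty (TySub-mono (λ a → ∈fv-+ˡ _) e) d) (sub-ty (TySub-mono (λ a → ∈fv-+ʳ (occ a t)) e) d′)
sub-ty e (elim {p} {t} {Δₚ = Δₚ} {Γₚ} q d d′) = elim q (sub-ty (TySub-mono (λ a → ∈fv-+ʳ (occ (#ˡ p ↑ʳ a) t)) e) d)
  (sub-ty (TySub-lift Δₚ Γₚ (λ a → ∈fv-+ˡ _) e) d′)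
sub-ty e (par d) = par (sub-ty (TySub-lift [] (_ ∷ _ ∷ []) (λ _ z → z) e) d)
sub-ty e (app {t} d d′) = app (sub-ty (TySub-mono (λ a → ∈fv-+ˡ _) e) d) (sub-ty (TySub-mono (λ a → ∈fv-+ʳ (occ a t)) e) d′)
sub-ty e (coapp {t} d d′) = coapp (sub-ty (TySub-mono (λ a → ∈fv-+ˡ _) e) d) (sub-ty (TySub-mono (λ a → ∈fv-+ʳ (occ a t)) e) d′)
sub-ty e (ofcourse d) = ofcourse (sub-ty (TySub-lift [] (_ ∷ []) (λ _ z → z) e) d)
sub-ty e (whynot d) = whynot (sub-ty (TySub-lift (_ ∷ []) [] (λ _ z → z) e) d)
sub-ty e (elim-whynot {t} d d′) = elim-whynot (sub-ty (TySub-mono (λ a → ∈fv-+ʳ (occ (suc a) t)) e) d)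
  (sub-ty (TySub-lift [] (_ ∷ []) (λ a → ∈fv-+ˡ _) e) d′)
sub-ty e (cut {t} d d′) = cut (sub-ty (TySub-mono (λ a → ∈fv-+ˡ _) e) d) (sub-ty (TySub-mono (λ a → ∈fv-+ʳ (occ a t)) e) d′)
sub-ty e one = one

infix 3 _⨾_⊩ᔆ_∶_⨾_⊢_⇒_

data _⨾_⊩ᔆ_∶_⨾_⊢_⇒_ {X : Set} {m n : ℕ} (Δ : UCtx X m) (Γ : LCtx X n) :
    {k l : ℕ} → Surface m n k l → UCtx X k → LCtx X l → Formula X → Formula X → Set where
  ℘□ : ∀ {A B} → Δ ⨾ Γ ⊩ᔆ ℘□ ∶ [] ⨾ just (A ^⊥) ∷ just (B ^⊥) ∷ [] ⊢ ⊥ ⇒ A ⅋ B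
  ⟨□,_⟩ : ∀ {t A B} → Δ ⨾ Γ ⊩ t ∶ B → Δ ⨾ Γ ⊩ᔆ ⟨□, t ⟩ ∶ [] ⨾ [] ⊢ A ⇒ A ⊗ B
  ⟨_,□⟩ : ∀ {t A B} → Δ ⨾ Γ ⊩ t ∶ A → Δ ⨾ Γ ⊩ᔆ ⟨ t ,□⟩ ∶ [] ⨾ [] ⊢ B ⇒ A ⊗ B
  □•_ : ∀ {t A B} → Δ ⨾ Γ ⊩ t ∶ A ^⊥ → Δ ⨾ Γ ⊩ᔆ □• t ∶ [] ⨾ [] ⊢ A ⅋ B ⇒ B
  _•□ : ∀ {t A B} → Δ ⨾ Γ ⊩ t ∶ A ⅋ B → Δ ⨾ Γ ⊩ᔆ t •□ ∶ [] ⨾ [] ⊢ A ^⊥ ⇒ B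
  □▼_ : ∀ {t A B} → Δ ⨾ Γ ⊩ t ∶ B ^⊥ → Δ ⨾ Γ ⊩ᔆ □▼ t ∶ [] ⨾ [] ⊢ A ⅋ B ⇒ A
  _▼□ : ∀ {t A B} → Δ ⨾ Γ ⊩ t ∶ A ⅋ B → Δ ⨾ Γ ⊩ᔆ t ▼□ ∶ [] ⨾ [] ⊢ B ^⊥ ⇒ A
  □♯_ : ∀ {t A} → Δ ⨾ Γ ⊩ t ∶ A ^⊥ → Δ ⨾ Γ ⊩ᔆ □♯ t ∶ [] ⨾ [] ⊢ A ⇒ ⊥
  _♯□ : ∀ {t A} → Δ ⨾ Γ ⊩ t ∶ A → Δ ⨾ Γ ⊩ᔆ t ♯□ ∶ [] ⨾ [] ⊢ A ^⊥ ⇒ ⊥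
  ¿□ : ∀ {A} → Δ ⨾ Γ ⊩ᔆ ¿□ ∶ (A ^⊥) ∷ [] ⨾ [] ⊢ ⊥ ⇒ ¿ A
  □[_:=_] : ∀ {p t A C Δₚ Γₚ} → PatTyping p A Δₚ Γₚ → Δ ⨾ Γ ⊩ t ∶ A →
    Δ ⨾ Γ ⊩ᔆ □[ p := t ] ∶ Δₚ ⨾ Γₚ ⊢ C ⇒ C
  elim□ : ∀ {p t A C Δₚ Γₚ} → PatTyping p A Δₚ Γₚ → Δₚ ++ Δ ⨾ Γₚ ++ Γ ⊩ t ∶ C →
    Δ ⨾ Γ ⊩ᔆ elim□ p t ∶ [] ⨾ [] ⊢ A ⇒ C
  _▸□ : ∀ {t A} → Δ ⨾ just A ∷ Γ ⊩ t ∶ ⊥ → Δ ⨾ Γ ⊩ᔆ t ▸□ ∶ [] ⨾ [] ⊢ ¿ A ⇒ ⊥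

plug-ty⁺ : {Δ : UCtx X m} {Γ : LCtx X n} {S : Surface m n k l} {Δₛ : UCtx X k} {Γₛ : LCtx X l} {A B : Formula X} →
  Δ ⨾ Γ ⊩ᔆ S ∶ Δₛ ⨾ Γₛ ⊢ B ⇒ A → ∀ {t} → Δₛ ++ Δ ⨾ Γₛ ++ Γ ⊩ t ∶ B → Δ ⨾ Γ ⊩ plug S t ∶ A
plug-ty⁺ ℘□           d = par d
plug-ty⁺ ⟨□, e ⟩      d = tensor d e
plug-ty⁺ ⟨ e ,□⟩      d = tensor e d
plug-ty⁺ (□• e)       d = app d e
plug-ty⁺ (e •□)       d = app e d
plug-ty⁺ (□▼ e)       d = coapp d e
plug-ty⁺ (e ▼□)       d = coapp e d
plug-ty⁺ (□♯ e)       d = cut d e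
plug-ty⁺ (e ♯□)       d = cut e d
plug-ty⁺ ¿□           d = whynot d
plug-ty⁺ □[ p := e ]  d = elim p e d
plug-ty⁺ (elim□ p e)  d = elim p d e
plug-ty⁺ (e ▸□)       d = elim-whynot d e

record Plugged {X : Set} {m n k l : ℕ} (Δ : UCtx X m) (Γ : LCtx X n) (S : Surface m n k l)
               (t : Term (k + m) (l + n)) (A : Formula X) : Set where
  constructor plugged
  field
    {Δₛ} : UCtx X k
    {Γₛ} : LCtx X l
    {B}  : Formula X
    outer : Δ ⨾ Γ ⊩ᔆ S ∶ Δₛ ⨾ Γₛ ⊢ B ⇒ A
    inner : Δₛ ++ Δ ⨾ Γₛ ++ Γ ⊩ t ∶ B

plug-ty⁻ : {Δ : UCtx X m} {Γ : LCtx X n} (S : Surface m n k l) {t : Term (k + m) (l + n)} {A : Formula X} →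
  Δ ⨾ Γ ⊩ plug S t ∶ A → Plugged Δ Γ S t A
plug-ty⁻ ℘□          (par d)           = plugged ℘□ d
plug-ty⁻ ⟨□, _ ⟩     (tensor d e)      = plugged ⟨□, e ⟩ d
plug-ty⁻ ⟨ _ ,□⟩     (tensor e d)      = plugged ⟨ e ,□⟩ d
plug-ty⁻ (□• _)      (app d e)         = plugged (□• e) d
plug-ty⁻ (_ •□)      (app e d)         = plugged (e •□) d
plug-ty⁻ (□▼ _)      (coapp d e)       = plugged (□▼ e) d
plug-ty⁻ (_ ▼□)      (coapp e d)       = plugged (e ▼□) d
plug-ty⁻ (□♯ _)      (cut d e)         = plugged (□♯ e) d
plug-ty⁻ (_ ♯□)      (cut e d)         = plugged (e ♯□) d
plug-ty⁻ ¿□          (whynot d)        = plugged ¿□ d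
plug-ty⁻ □[ _ := _ ] (elim p e d)      = plugged □[ p := e ] d
plug-ty⁻ (elim□ _ _) (elim p d e)      = plugged (elim□ p e) d
plug-ty⁻ (_ ▸□)      (elim-whynot d e) = plugged (e ▸□) d

ren-tyᔆ⁺ : {ρ : Ren m n m′ n′} {Δ : UCtx X m} {Γ : LCtx X n} {Δ′ : UCtx X m′} {Γ′ : LCtx X n′} →
  TyRen ρ Δ Γ Δ′ Γ′ → {S : Surface m n k l} {Δₛ : UCtx X k} {Γₛ : LCtx X l} {A B : Formula X} →
  Δ ⨾ Γ ⊩ᔆ S ∶ Δₛ ⨾ Γₛ ⊢ B ⇒ A → Δ′ ⨾ Γ′ ⊩ᔆ renᔆ ρ S ∶ Δₛ ⨾ Γₛ ⊢ B ⇒ A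
ren-tyᔆ⁺ r ℘□           = ℘□
ren-tyᔆ⁺ r ⟨□, e ⟩      = ⟨□, ren-ty⁺ r e ⟩
ren-tyᔆ⁺ r ⟨ e ,□⟩      = ⟨ ren-ty⁺ r e ,□⟩
ren-tyᔆ⁺ r (□• e)       = □• ren-ty⁺ r e
ren-tyᔆ⁺ r (e •□)       = ren-ty⁺ r e •□
ren-tyᔆ⁺ r (□▼ e)       = □▼ ren-ty⁺ r e
ren-tyᔆ⁺ r (e ▼□)       = ren-ty⁺ r e ▼□
ren-tyᔆ⁺ r (□♯ e)       = □♯ ren-ty⁺ r e
ren-tyᔆ⁺ r (e ♯□)       = ren-ty⁺ r e ♯□
ren-tyᔆ⁺ r ¿□           = ¿□
ren-tyᔆ⁺ r □[ p := e ]  = □[ p := ren-ty⁺ r e ]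
ren-tyᔆ⁺ r (elim□ {Δₚ = Δₚ} {Γₚ} p e) = elim□ p (ren-ty⁺ (TyRen-lift Δₚ Γₚ r) e)
ren-tyᔆ⁺ r (e ▸□)       = ren-ty⁺ (TyRen-lift [] (_ ∷ []) r) e ▸□

ren-tyᔆ⁻ : {ρ : Ren m n m′ n′} {Δ : UCtx X m} {Γ : LCtx X n} {Δ′ : UCtx X m′} {Γ′ : LCtx X n′} →
  TyRen ρ Δ Γ Δ′ Γ′ → (S : Surface m n k l) {Δₛ : UCtx X k} {Γₛ : LCtx X l} {A B : Formula X} →
  Δ′ ⨾ Γ′ ⊩ᔆ renᔆ ρ S ∶ Δₛ ⨾ Γₛ ⊢ B ⇒ A → Δ ⨾ Γ ⊩ᔆ S ∶ Δₛ ⨾ Γₛ ⊢ B ⇒ A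
ren-tyᔆ⁻ r ℘□          ℘□           = ℘□
ren-tyᔆ⁻ r ⟨□, t ⟩     ⟨□, e ⟩      = ⟨□, ren-ty⁻ r t e ⟩
ren-tyᔆ⁻ r ⟨ t ,□⟩     ⟨ e ,□⟩      = ⟨ ren-ty⁻ r t e ,□⟩
ren-tyᔆ⁻ r (□• t)      (□• e)       = □• ren-ty⁻ r t e
ren-tyᔆ⁻ r (t •□)      (e •□)       = ren-ty⁻ r t e •□
ren-tyᔆ⁻ r (□▼ t)      (□▼ e)       = □▼ ren-ty⁻ r t e
ren-tyᔆ⁻ r (t ▼□)      (e ▼□)       = ren-ty⁻ r t e ▼□
ren-tyᔆ⁻ r (□♯ t)      (□♯ e)       = □♯ ren-ty⁻ r t e
ren-tyᔆ⁻ r (t ♯□)      (e ♯□)       = ren-ty⁻ r t e ♯□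
ren-tyᔆ⁻ r ¿□          ¿□           = ¿□
ren-tyᔆ⁻ r □[ _ := t ] □[ p := e ]  = □[ p := ren-ty⁻ r t e ]
ren-tyᔆ⁻ r (elim□ _ t) (elim□ {Δₚ = Δₚ} {Γₚ} p e) = elim□ p (ren-ty⁻ (TyRen-lift Δₚ Γₚ r) t e)
ren-tyᔆ⁻ r (t ▸□)      (e ▸□)       = ren-ty⁻ (TyRen-lift [] (_ ∷ []) r) t e ▸□

-- The rule in its original shape. `par` and `ofcourse` put the negation into the premise instead,
-- so that the type in the conclusion is a constructor form and a typing can be inverted by
-- matching.
par′ : {Δ : UCtx X m} {Γ : LCtx X n} {t : Term m (2 + n)} {A B : Formula X} →
  Δ ⨾ just A ∷ just B ∷ Γ ⊩ t ∶ ⊥ → Δ ⨾ Γ ⊩ ℘ t ∶ (A ^⊥) ⅋ (B ^⊥)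
par′ {Δ = Δ} {Γ} {t} {A} {B} d = par (subst₂ (λ C D → Δ ⨾ just C ∷ just D ∷ Γ ⊩ t ∶ ⊥)
  (sym (^⊥-involutive A)) (sym (^⊥-involutive B)) d)

ofcourse′ : {Δ : UCtx X m} {Γ : LCtx X n} {t : Term m (suc n)} {A : Formula X} →
  Δ ⨾ just A ∷ Γ ⊩ t ∶ ⊥ → Δ ⨾ Γ ⊩ ! t ∶ ! (A ^⊥)
ofcourse′ {Δ = Δ} {Γ} {t} {A} d = ofcourse (subst (λ C → Δ ⨾ just C ∷ Γ ⊩ t ∶ ⊥) (sym (^⊥-involutive A)) d)

whynot′ : {Δ : UCtx X m} {Γ : LCtx X n} {t : Term (suc m) n} {A : Formula X} →
  A ∷ Δ ⨾ Γ ⊩ t ∶ ⊥ → Δ ⨾ Γ ⊩ ¿ t ∶ ¿ (A ^⊥)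
whynot′ {Δ = Δ} {Γ} {t} {A} d = whynot (subst (λ C → C ∷ Δ ⨾ Γ ⊩ t ∶ ⊥) (sym (^⊥-involutive A)) d)

cut′ : {Δ : UCtx X m} {Γ : LCtx X n} {t s : Term m n} {A : Formula X} →
  Δ ⨾ Γ ⊩ t ∶ A ^⊥ → Δ ⨾ Γ ⊩ s ∶ A → Δ ⨾ Γ ⊩ t ♯ s ∶ ⊥
cut′ {Δ = Δ} {Γ} {t} {s} {A} d e = cut d (subst (Δ ⨾ Γ ⊩ s ∶_) (sym (^⊥-involutive A)) e)

-- Congruences

infixr 5 _⊙_

-- Axioms depend on a formula because some of them are meant at one type only: `unit-swap` at `𝟙`,
-- the axioms on cuts at `⊥`.
Axioms : Set₁
Axioms = {X : Set} {m n : ℕ} → Formula X → Term m n → Term m n → Set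

-- The rules copy the typing rules, so a derivation contains typings of both sides, and reflexivity
-- and symmetry are lemmas. There are three sets of axioms in use: `Ax`, the given axioms `Base`,
-- and the empty set, for which a congruence is just a typing.
data Cong (R : Axioms) {X : Set} {m n : ℕ} (Δ : UCtx X m) (Γ : LCtx X n) :
          Formula X → Term m n → Term m n → Set where
  lvar : ∀ {a A} → lookup Γ a ≡ just A → Cong R Δ Γ A (lvar a) (lvar a)
  uvar : ∀ {u A} → lookup Δ u ≡ A → Cong R Δ Γ A (uvar u) (uvar u)
  tensor : ∀ {t t′ s s′ A B} → Cong R Δ Γ A t t′ → Cong R Δ Γ B s s′ →
    Cong R Δ Γ (A ⊗ B) ⟨ t , s ⟩ ⟨ t′ , s′ ⟩
  elim : ∀ {p t t′ s s′ A B Δₚ Γₚ} → PatTyping p A Δₚ Γₚ →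
    Cong R Δ Γ A s s′ → Cong R (Δₚ ++ Δ) (Γₚ ++ Γ) B t t′ →
    Cong R Δ Γ B (t [ p := s ]) (t′ [ p := s′ ])
  par : ∀ {t t′ A B} → Cong R Δ (just (A ^⊥) ∷ just (B ^⊥) ∷ Γ) ⊥ t t′ → Cong R Δ Γ (A ⅋ B) (℘ t) (℘ t′)
  app : ∀ {t t′ s s′ A B} → Cong R Δ Γ (A ⅋ B) t t′ → Cong R Δ Γ (A ^⊥) s s′ →
    Cong R Δ Γ B (t • s) (t′ • s′)
  coapp : ∀ {t t′ s s′ A B} → Cong R Δ Γ (A ⅋ B) t t′ → Cong R Δ Γ (B ^⊥) s s′ →
    Cong R Δ Γ A (t ▼ s) (t′ ▼ s′)
  ofcourse : ∀ {t t′ A} → Cong R Δ (just (A ^⊥) ∷ Γ) ⊥ t t′ → Cong R Δ Γ (! A) (! t) (! t′)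
  whynot : ∀ {t t′ A} → Cong R ((A ^⊥) ∷ Δ) Γ ⊥ t t′ → Cong R Δ Γ (¿ A) (¿ t) (¿ t′)
  elim-whynot : ∀ {t t′ s s′ A} → Cong R Δ Γ (¿ A) s s′ → Cong R Δ (just A ∷ Γ) ⊥ t t′ →
    Cong R Δ Γ ⊥ (t ▸ s) (t′ ▸ s′)
  cut : ∀ {t t′ s s′ B} → Cong R Δ Γ B t t′ → Cong R Δ Γ (B ^⊥) s s′ →
    Cong R Δ Γ ⊥ (t ♯ s) (t′ ♯ s′)
  one : Cong R Δ Γ 𝟙 ⋆ ⋆
  fwd : ∀ {A t s} → R A t s → Δ ⨾ Γ ⊩ t ∶ A → Δ ⨾ Γ ⊩ s ∶ A → Cong R Δ Γ A t s
  bwd : ∀ {A t s} → R A t s → Δ ⨾ Γ ⊩ t ∶ A → Δ ⨾ Γ ⊩ s ∶ A → Cong R Δ Γ A s t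
  _⊙_ : ∀ {A t s r} → Cong R Δ Γ A t s → Cong R Δ Γ A s r → Cong R Δ Γ A t r

module _ {R : Axioms} where

  Cong-tyˡ : {Δ : UCtx X m} {Γ : LCtx X n} {A : Formula X} {t s : Term m n} → Cong R Δ Γ A t s → Δ ⨾ Γ ⊩ t ∶ A
  Cong-tyˡ (lvar x)          = lvar x
  Cong-tyˡ (uvar x)          = uvar x
  Cong-tyˡ (tensor c d)      = tensor (Cong-tyˡ c) (Cong-tyˡ d)
  Cong-tyˡ (elim p c d)      = elim p (Cong-tyˡ c) (Cong-tyˡ d)
  Cong-tyˡ (par c)           = par (Cong-tyˡ c)
  Cong-tyˡ (app c d)         = app (Cong-tyˡ c) (Cong-tyˡ d)
  Cong-tyˡ (coapp c d)       = coapp (Cong-tyˡ c) (Cong-tyˡ d)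
  Cong-tyˡ (ofcourse c)      = ofcourse (Cong-tyˡ c)
  Cong-tyˡ (whynot c)        = whynot (Cong-tyˡ c)
  Cong-tyˡ (elim-whynot c d) = elim-whynot (Cong-tyˡ c) (Cong-tyˡ d)
  Cong-tyˡ (cut c d)         = cut (Cong-tyˡ c) (Cong-tyˡ d)
  Cong-tyˡ one               = one
  Cong-tyˡ (fwd _ d e)       = d
  Cong-tyˡ (bwd _ d e)       = e
  Cong-tyˡ (c ⊙ d)           = Cong-tyˡ c

  Cong-sym : {Δ : UCtx X m} {Γ : LCtx X n} {A : Formula X} {t s : Term m n} → Cong R Δ Γ A t s → Cong R Δ Γ A s t
  Cong-sym (lvar x)          = lvar x
  Cong-sym (uvar x)          = uvar x
  Cong-sym (tensor c d)      = tensor (Cong-sym c) (Cong-sym d)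
  Cong-sym (elim p c d)      = elim p (Cong-sym c) (Cong-sym d)
  Cong-sym (par c)           = par (Cong-sym c)
  Cong-sym (app c d)         = app (Cong-sym c) (Cong-sym d)
  Cong-sym (coapp c d)       = coapp (Cong-sym c) (Cong-sym d)
  Cong-sym (ofcourse c)      = ofcourse (Cong-sym c)
  Cong-sym (whynot c)        = whynot (Cong-sym c)
  Cong-sym (elim-whynot c d) = elim-whynot (Cong-sym c) (Cong-sym d)
  Cong-sym (cut c d)         = cut (Cong-sym c) (Cong-sym d)
  Cong-sym one               = one
  Cong-sym (fwd r d e)       = bwd r d e
  Cong-sym (bwd r d e)       = fwd r d e
  Cong-sym (c ⊙ d)           = Cong-sym d ⊙ Cong-sym c

  Cong-tyʳ : {Δ : UCtx X m} {Γ : LCtx X n} {A : Formula X} {t s : Term m n} → Cong R Δ Γ A t s → Δ ⨾ Γ ⊩ s ∶ A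
  Cong-tyʳ c = Cong-tyˡ (Cong-sym c)

  Cong-refl : {Δ : UCtx X m} {Γ : LCtx X n} {A : Formula X} {t : Term m n} → Δ ⨾ Γ ⊩ t ∶ A → Cong R Δ Γ A t t
  Cong-refl (lvar x)          = lvar x
  Cong-refl (uvar x)          = uvar x
  Cong-refl (tensor d e)      = tensor (Cong-refl d) (Cong-refl e)
  Cong-refl (elim p d e)      = elim p (Cong-refl d) (Cong-refl e)
  Cong-refl (par d)           = par (Cong-refl d)
  Cong-refl (app d e)         = app (Cong-refl d) (Cong-refl e)
  Cong-refl (coapp d e)       = coapp (Cong-refl d) (Cong-refl e)
  Cong-refl (ofcourse d)      = ofcourse (Cong-refl d)
  Cong-refl (whynot d)        = whynot (Cong-refl d)
  Cong-refl (elim-whynot d e) = elim-whynot (Cong-refl d) (Cong-refl e)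
  Cong-refl (cut d e)         = cut (Cong-refl d) (Cong-refl e)
  Cong-refl one               = one

  Cong-plug : {Δ : UCtx X m} {Γ : LCtx X n} {S : Surface m n k l} {Δₛ : UCtx X k} {Γₛ : LCtx X l} {A B : Formula X} →
    Δ ⨾ Γ ⊩ᔆ S ∶ Δₛ ⨾ Γₛ ⊢ B ⇒ A → ∀ {t s} → Cong R (Δₛ ++ Δ) (Γₛ ++ Γ) B t s → Cong R Δ Γ A (plug S t) (plug S s)
  Cong-plug ℘□           c = par c
  Cong-plug ⟨□, e ⟩      c = tensor c (Cong-refl e)
  Cong-plug ⟨ e ,□⟩      c = tensor (Cong-refl e) c
  Cong-plug (□• e)       c = app c (Cong-refl e)
  Cong-plug (e •□)       c = app (Cong-refl e) c
  Cong-plug (□▼ e)       c = coapp c (Cong-refl e)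
  Cong-plug (e ▼□)       c = coapp (Cong-refl e) c
  Cong-plug (□♯ e)       c = cut c (Cong-refl e)
  Cong-plug (e ♯□)       c = cut (Cong-refl e) c
  Cong-plug ¿□           c = whynot c
  Cong-plug □[ p := e ]  c = elim p (Cong-refl e) c
  Cong-plug (elim□ p e)  c = elim p c (Cong-refl e)
  Cong-plug (e ▸□)       c = elim-whynot c (Cong-refl e)

-- On linear terms they generate structural equivalence, but where cut-subst
-- substitutes, they move one term constructor across a cut.
data Ax {X : Set} {m n : ℕ} : Formula X → Term m n → Term m n → Set where
  slide : ∀ {k l r A} (p : Pat) (S : Surface m n k l) {t : Term (k + (#ᵘ p + m)) (l + (#ˡ p + n))} →
    Ax A (plug (renᔆ (wk (#ᵘ p) (#ˡ p)) S) t [ p := r ])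
         (plug S (ren (xch k l (#ᵘ p) (#ˡ p)) t [ p := ren (wk k l) r ]))
  unit-⋆ : ∀ {t A} → Ax A (t [ unit := ⋆ ]) t
  unit-swap : ∀ {t s} → Ax 𝟙 (t [ unit := s ]) (s [ unit := t ])
  comm : ∀ {t s} → Ax ⊥ (t ♯ s) (s ♯ t)
  ⋆-♯ : ∀ {t} → Ax ⊥ (⋆ ♯ t) t
  •-♯ : ∀ {t s r} → Ax ⊥ ((t • s) ♯ r) (t ♯ ⟨ s , r ⟩)
  ▼-♯ : ∀ {t s r} → Ax ⊥ ((t ▼ s) ♯ r) (t ♯ ⟨ r , s ⟩)
  ℘-♯ : ∀ {t r} → Ax ⊥ ((℘ t) ♯ r) (t [ pair := r ])
  ¿-♯ : ∀ {t r} → Ax ⊥ ((¿ t) ♯ r) (t [ bang := r ])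
  ▸-♯ : ∀ {t r} → Ax ⊥ (t ▸ r) (r ♯ (! t))

Ax-ty⁺ : {Δ : UCtx X m} {Γ : LCtx X n} {A : Formula X} {t s : Term m n} → Ax A t s → Δ ⨾ Γ ⊩ t ∶ A → Δ ⨾ Γ ⊩ s ∶ A
Ax-ty⁺ (slide p S {t}) (elim {Δₚ = Δₚ} {Γₚ} q e d) with plug-ty⁻ (renᔆ (wk (#ᵘ p) (#ˡ p)) S) d
... | plugged {Δₛ} {Γₛ} o i = plug-ty⁺ (ren-tyᔆ⁻ (TyRen-wk Δₚ Γₚ) S o)
  (elim q (ren-ty⁺ (TyRen-wk Δₛ Γₛ) e) (ren-ty⁺ (TyRen-xch Δₛ Γₛ Δₚ Γₚ) i))
Ax-ty⁺ unit-⋆ (elim unit one d) = d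
Ax-ty⁺ unit-swap (elim unit e d) = elim unit d e
Ax-ty⁺ comm (cut d e) = cut′ e d
Ax-ty⁺ ⋆-♯ (cut one d) = d
Ax-ty⁺ •-♯ (cut (app d e) f) = cut d (tensor e f)
Ax-ty⁺ ▼-♯ (cut (coapp d e) f) = cut d (tensor f e)
Ax-ty⁺ ℘-♯ (cut (par d) e) = elim pair e d
Ax-ty⁺ ¿-♯ (cut (whynot d) e) = elim bang e d
Ax-ty⁺ ▸-♯ (elim-whynot e d) = cut e (ofcourse′ d)

Ax-ty⁻ : {Δ : UCtx X m} {Γ : LCtx X n} {A : Formula X} {t s : Term m n} → Ax A t s → Δ ⨾ Γ ⊩ s ∶ A → Δ ⨾ Γ ⊩ t ∶ A
Ax-ty⁻ (slide {r = r} p S {t}) d with plug-ty⁻ S d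
... | plugged {Δₛ} {Γₛ} o (elim {Δₚ = Δₚ} {Γₚ} q e i) = elim q (ren-ty⁻ (TyRen-wk Δₛ Γₛ) r e)
  (plug-ty⁺ (ren-tyᔆ⁺ (TyRen-wk Δₚ Γₚ) o) (ren-ty⁻ (TyRen-xch Δₛ Γₛ Δₚ Γₚ) t i))
Ax-ty⁻ unit-⋆ d = elim unit one d
Ax-ty⁻ unit-swap (elim unit e d) = elim unit d e
Ax-ty⁻ comm (cut d e) = cut′ e d
Ax-ty⁻ ⋆-♯ d = cut one d
-- The dual of the cut formula is a tensor; matching on the formula as a par lets `_^⊥` compute.
Ax-ty⁻ •-♯ (cut {B = _ ⅋ _} d (tensor e f)) = cut (app d e) f
Ax-ty⁻ ▼-♯ (cut {B = _ ⅋ _} d (tensor f e)) = cut (coapp d e) f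
Ax-ty⁻ ℘-♯ (elim (pair {A} {B}) e d) = cut′ {A = A ⊗ B} (par′ d) e
Ax-ty⁻ ¿-♯ (elim (bang {A}) e d) = cut′ {A = ! A} (whynot′ d) e
Ax-ty⁻ {Δ = Δ} {Γ} (▸-♯ {t}) (cut {B = ¿ A} e (ofcourse d)) =
  elim-whynot e (subst (λ C → Δ ⨾ just C ∷ Γ ⊩ t ∶ ⊥) (^⊥-involutive A) d)

module _ {m n k l : ℕ} (p : Pat) (S : Surface m n k l)
         (t : Term (k + (#ᵘ p + m)) (l + (#ˡ p + n))) (r : Term m n) where
  private
    S′ = renᔆ (wk (#ᵘ p) (#ˡ p)) S
    t′ = ren (xch k l (#ᵘ p) (#ˡ p)) t

  occ-slide-free : ∀ a → occ (#ˡ p ↑ʳ (l ↑ʳ a)) t′ ≡ occ (l ↑ʳ (#ˡ p ↑ʳ a)) t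
  occ-slide-free a = trans (cong (λ b → occ b t′) (sym (exchange-free l (#ˡ p) a)))
    (occ-ren _ (Over-exchange l (#ˡ p) _) t)

  occ-slide-inner : ∀ i → occ (#ˡ p ↑ʳ (i ↑ˡ n)) t′ ≡ occ (i ↑ˡ (#ˡ p + n)) t
  occ-slide-inner i = trans (cong (λ b → occ b t′) (sym (exchange-inner l (#ˡ p) i)))
    (occ-ren _ (Over-exchange l (#ˡ p) _) t)

  occ-slide-outer : ∀ i → occ (i ↑ˡ (l + n)) t′ ≡ occ (l ↑ʳ (i ↑ˡ n)) t
  occ-slide-outer i = trans (cong (λ b → occ b t′) (sym (exchange-outer l (#ˡ p) i)))
    (occ-ren _ (Over-exchange l (#ˡ p) _) t)

  occ-slide : ∀ a → occ a (plug S′ t [ p := r ]) ≡ occ a (plug S (t′ [ p := ren (wk k l) r ]))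
  occ-slide a = begin
    occ (#ˡ p ↑ʳ a) (plug S′ t) + occ a r
      ≡⟨ cong (_+ occ a r) (occ-plug (#ˡ p ↑ʳ a) S′ t) ⟩
    occ (l ↑ʳ (#ˡ p ↑ʳ a)) t + occᔆ (#ˡ p ↑ʳ a) S′ + occ a r
      ≡⟨ +-assoc (occ (l ↑ʳ (#ˡ p ↑ʳ a)) t) _ _ ⟩
    occ (l ↑ʳ (#ˡ p ↑ʳ a)) t + (occᔆ (#ˡ p ↑ʳ a) S′ + occ a r)
      ≡⟨ cong₂ _+_ (sym (occ-slide-free a)) (+-comm (occᔆ (#ˡ p ↑ʳ a) S′) (occ a r)) ⟩
    occ (#ˡ p ↑ʳ (l ↑ʳ a)) t′ + (occ a r + occᔆ (#ˡ p ↑ʳ a) S′)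
      ≡⟨ cong₂ (λ i j → occ (#ˡ p ↑ʳ (l ↑ʳ a)) t′ + (i + j)) (sym (occ-wk k l a r))
           (occᔆ-ren (wk (#ᵘ p) (#ˡ p)) (Over-wk (#ˡ p)) S) ⟩
    occ (#ˡ p ↑ʳ (l ↑ʳ a)) t′ + (occ (l ↑ʳ a) (ren (wk k l) r) + occᔆ a S)
      ≡⟨ +-assoc (occ (#ˡ p ↑ʳ (l ↑ʳ a)) t′) _ _ ⟨
    occ (l ↑ʳ a) (t′ [ p := ren (wk k l) r ]) + occᔆ a S
      ≡⟨ occ-plug a S (t′ [ p := ren (wk k l) r ]) ⟨
    occ a (plug S (t′ [ p := ren (wk k l) r ])) ∎
    where open ≡-Reasoning

  occ-plug-bound : ∀ i → occ (i ↑ˡ n) (plug S′ t) ≡ occ (l ↑ʳ (i ↑ˡ n)) t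
  occ-plug-bound i = trans (occ-plug (i ↑ˡ n) S′ t) (trans
    (cong (occ (l ↑ʳ (i ↑ˡ n)) t +_) (occᔆ-ren-0 (wk (#ᵘ p) (#ˡ p)) (λ b → ↑ʳ≢↑ˡ (#ˡ p)) S)) (+-identityʳ _))

  occ-elim-bound : ∀ i → occ (i ↑ˡ n) (t′ [ p := ren (wk k l) r ]) ≡ occ (i ↑ˡ (#ˡ p + n)) t
  occ-elim-bound i = trans
    (cong₂ _+_ (occ-slide-inner i) (occ-wk-bound k l i r)) (+-identityʳ _)

  WB-slide⁺ : WellBound (plug S′ t [ p := r ]) → WellBound (plug S (t′ [ p := ren (wk k l) r ]))
  WB-slide⁺ (o , w , v) with WB-plug⁻ S′ w
  ... | o′ , w′ , wS = WB-plug⁺ S (λ i → trans (occ-elim-bound i) (o′ i))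
    ((λ i → trans (occ-slide-outer i) (trans (sym (occ-plug-bound i)) (o i))) , WB-ren⁺ _ t w′ , WB-ren⁺ _ r v)
    (WBᔆ-ren⁻ _ (↑ʳ-injective (#ˡ p)) S wS)

  WB-slide⁻ : WellBound (plug S (t′ [ p := ren (wk k l) r ])) → WellBound (plug S′ t [ p := r ])
  WB-slide⁻ w with WB-plug⁻ S w
  ... | o , (o′ , w′ , v) , wS =
    (λ i → trans (occ-plug-bound i) (trans (sym (occ-slide-outer i)) (o′ i))) ,
    WB-plug⁺ S′ (λ i → trans (sym (occ-elim-bound i)) (o i))
      (WB-ren⁻ _ (λ {b} {c} e → Over.preimage (Over-exchange l (#ˡ p) c) b e) t w′)
      (WBᔆ-ren⁺ _ S wS) ,
    WB-ren⁻ _ (↑ʳ-injective l) r v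

-- Every axiom is balanced: it neither copies nor drops a subterm, apart from `⋆`, which has no free
-- variables.
Ax-occ : {A : Formula X} {t s : Term m n} → Ax A t s → ∀ a → occ a t ≡ occ a s
Ax-occ (slide {r = r} p S {t}) a = occ-slide p S t r a
Ax-occ unit-⋆ a = +-identityʳ _
Ax-occ (unit-swap {t} {s}) a = +-comm (occ a t) (occ a s)
Ax-occ (comm {t} {s}) a = +-comm (occ a t) (occ a s)
Ax-occ ⋆-♯ a = refl
Ax-occ (•-♯ {t} {s} {r}) a = +-assoc (occ a t) (occ a s) (occ a r)
Ax-occ (▼-♯ {t} {s} {r}) a = trans (+-assoc (occ a t) (occ a s) (occ a r))
  (cong (occ a t +_) (+-comm (occ a s) (occ a r)))
Ax-occ ℘-♯ a = refl
Ax-occ ¿-♯ a = refl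
Ax-occ (▸-♯ {t} {r}) a = +-comm (occ (suc a) t) (occ a r)

Ax-WB⁺ : {A : Formula X} {t s : Term m n} → Ax A t s → WellBound t → WellBound s
Ax-WB⁺ (slide {r = r} p S {t}) w = WB-slide⁺ p S t r w
Ax-WB⁺ unit-⋆ (_ , w , _) = w
Ax-WB⁺ unit-swap (_ , w , v) = (λ ()) , v , w
Ax-WB⁺ comm (w , v) = v , w
Ax-WB⁺ ⋆-♯ (_ , w) = w
Ax-WB⁺ •-♯ ((w , v) , u) = w , v , u
Ax-WB⁺ ▼-♯ ((w , v) , u) = w , u , v
Ax-WB⁺ ℘-♯ ((o , w) , v) = o , w , v
Ax-WB⁺ ¿-♯ (w , v) = (λ ()) , w , v
Ax-WB⁺ ▸-♯ (o , f , w , v) = v , o , f , w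

Ax-WB⁻ : {A : Formula X} {t s : Term m n} → Ax A t s → WellBound s → WellBound t
Ax-WB⁻ (slide {r = r} p S {t}) w = WB-slide⁻ p S t r w
Ax-WB⁻ unit-⋆ w = (λ ()) , w , tt
Ax-WB⁻ unit-swap (_ , w , v) = (λ ()) , v , w
Ax-WB⁻ comm (w , v) = v , w
Ax-WB⁻ ⋆-♯ w = tt , w
Ax-WB⁻ •-♯ (w , v , u) = (w , v) , u
Ax-WB⁻ ▼-♯ (w , u , v) = (w , v) , u
Ax-WB⁻ ℘-♯ (o , w , v) = (o , w) , v
Ax-WB⁻ ¿-♯ (_ , w , v) = w , v
Ax-WB⁻ ▸-♯ (v , o , f , w) = o , f , w , v

infix 3 _⨾_⊩_≈_∶_

_⨾_⊩_≈_∶_ : UCtx X m → LCtx X n → Term m n → Term m n → Formula X → Set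
Δ ⨾ Γ ⊩ t ≈ s ∶ A = Cong Ax Δ Γ A t s

≈-occ : {Δ : UCtx X m} {Γ : LCtx X n} {A : Formula X} {t s : Term m n} →
  Δ ⨾ Γ ⊩ t ≈ s ∶ A → ∀ a → occ a t ≡ occ a s
≈-occ (lvar x)           a = refl
≈-occ (uvar x)           a = refl
≈-occ (tensor c d)       a = cong₂ _+_ (≈-occ c a) (≈-occ d a)
≈-occ (elim {p} _ c d)   a = cong₂ _+_ (≈-occ d (#ˡ p ↑ʳ a)) (≈-occ c a)
≈-occ (par c)            a = ≈-occ c (2 ↑ʳ a)
≈-occ (app c d)          a = cong₂ _+_ (≈-occ c a) (≈-occ d a)
≈-occ (coapp c d)        a = cong₂ _+_ (≈-occ c a) (≈-occ d a)
≈-occ (ofcourse c)       a = ≈-occ c (suc a)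
≈-occ (whynot c)         a = ≈-occ c a
≈-occ (elim-whynot c d)  a = cong₂ _+_ (≈-occ d (suc a)) (≈-occ c a)
≈-occ (cut c d)          a = cong₂ _+_ (≈-occ c a) (≈-occ d a)
≈-occ one                a = refl
≈-occ (fwd r _ _)        a = Ax-occ r a
≈-occ (bwd r _ _)        a = sym (Ax-occ r a)
≈-occ (c ⊙ d)            a = trans (≈-occ c a) (≈-occ d a)

≈-WB : {Δ : UCtx X m} {Γ : LCtx X n} {A : Formula X} {t s : Term m n} →
  Δ ⨾ Γ ⊩ t ≈ s ∶ A → WellBound t → WellBound s
≈-WB (lvar x)          w           = tt
≈-WB (uvar x)          w           = tt
≈-WB (tensor c d)      (w , v)     = ≈-WB c w , ≈-WB d v
≈-WB (elim _ c d)      (o , w , v) = (λ i → trans (sym (≈-occ d _)) (o i)) , ≈-WB d w , ≈-WB c v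
≈-WB (par c)           (o , w)     = (λ i → trans (sym (≈-occ c _)) (o i)) , ≈-WB c w
≈-WB (app c d)         (w , v)     = ≈-WB c w , ≈-WB d v
≈-WB (coapp c d)       (w , v)     = ≈-WB c w , ≈-WB d v
≈-WB (ofcourse c)      (o , f , w) = trans (sym (≈-occ c _)) o ,
  (λ a → f a ∘ subst (0 <_) (sym (≈-occ c (suc a)))) , ≈-WB c w
≈-WB (whynot c)        w           = ≈-WB c w
≈-WB (elim-whynot c d) (o , f , w , v) = trans (sym (≈-occ d _)) o ,
  (λ a → f a ∘ subst (0 <_) (sym (≈-occ d (suc a)))) , ≈-WB d w , ≈-WB c v
≈-WB (cut c d)         (w , v)     = ≈-WB c w , ≈-WB d v
≈-WB one               w           = tt
≈-WB (fwd r _ _)       w           = Ax-WB⁺ r w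
≈-WB (bwd r _ _)       w           = Ax-WB⁻ r w
≈-WB (c ⊙ d)           w           = ≈-WB d (≈-WB c w)

-- Substitution in congruences

Ax-sub : {A : Formula X} {t s : Term m n} → Ax A t s → (σ : Sub m n m′ n′) → Ax A (sub σ t) (sub σ s)
Ax-sub {m′ = m′} {n′ = n′} (slide {k} {l} {r} {A} p S {t}) σ = subst₂ (Ax A) (sym eₗ) (sym eᵣ) (slide p (subᔆ σ S))
  where
  open ≡-Reasoning
  t′ = sub (liftˢ k l (liftˢ (#ᵘ p) (#ˡ p) σ)) t
  eₗ : sub σ (plug (renᔆ (wk (#ᵘ p) (#ˡ p)) S) t [ p := r ]) ≡
       plug (renᔆ (wk (#ᵘ p) (#ˡ p)) (subᔆ σ S)) t′ [ p := sub σ r ]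
  eₗ = cong (λ x → x [ p := sub σ r ]) (trans (sub-plug _ (renᔆ (wk (#ᵘ p) (#ˡ p)) S) t)
    (cong (λ Z → plug Z t′) (subᔆ-wk (#ᵘ p) (#ˡ p) σ S)))
  eᵣ : sub σ (plug S (ren (xch k l (#ᵘ p) (#ˡ p)) t [ p := ren (wk k l) r ])) ≡
       plug (subᔆ σ S) (ren (xch k l (#ᵘ p) (#ˡ p)) t′ [ p := ren (wk k l) (sub σ r) ])
  eᵣ = trans (sub-plug σ S _) (cong₂ (λ x y → plug (subᔆ σ S) (x [ p := y ]))
    (sym (xch-sub k l (#ᵘ p) (#ˡ p) σ t)) (sub-wk k l σ r))
Ax-sub (unit-⋆ {t}) σ = subst (Ax _ _) (sub-lift-0 σ t) unit-⋆
Ax-sub (unit-swap {t} {s}) σ = subst₂ (Ax _)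
  (cong (λ x → x [ unit := sub σ s ]) (sym (sub-lift-0 σ t)))
  (cong (λ x → x [ unit := sub σ t ]) (sym (sub-lift-0 σ s))) unit-swap
Ax-sub comm σ = comm
Ax-sub ⋆-♯ σ = ⋆-♯
Ax-sub •-♯ σ = •-♯
Ax-sub ▼-♯ σ = ▼-♯
Ax-sub ℘-♯ σ = ℘-♯
Ax-sub ¿-♯ σ = ¿-♯
Ax-sub ▸-♯ σ = ▸-♯

≡⇒≈ : {Δ : UCtx X m} {Γ : LCtx X n} {A : Formula X} {t s : Term m n} →
  t ≡ s → Δ ⨾ Γ ⊩ t ∶ A → Δ ⨾ Γ ⊩ t ≈ s ∶ A
≡⇒≈ refl d = Cong-refl d

-- The typing hypothesis on `σ` depends on the free variables of `t`. It passes to the other side of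
-- an axiom and through transitivity because equivalent terms have the same free linear variables.
≈-sub : {σ : Sub m n m′ n′} {Δ : UCtx X m} {Γ : LCtx X n} {Δ′ : UCtx X m′} {Γ′ : LCtx X n′} →
  ∀ {t s A} → TySub σ t Δ Γ Δ′ Γ′ → Δ ⨾ Γ ⊩ t ≈ s ∶ A → Δ′ ⨾ Γ′ ⊩ sub σ t ≈ sub σ s ∶ A
≈-sub {m = m} e (lvar {a} x) = lvar′ (TySub.tyˡ e a (subst (0 <_) (sym (occ-lvar-≡ {m} a)) (s≤s z≤n)) x)
  where lvar′ = Cong-refl
≈-sub e (uvar {u} refl) = Cong-refl (TySub.tyᵘ e u)
≈-sub e (tensor {t} c d) = tensor (≈-sub (TySub-mono (λ a → ∈fv-+ˡ _) e) c) (≈-sub (TySub-mono (λ a → ∈fv-+ʳ (occ a t)) e) d)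
≈-sub e (elim {p} {t} {Δₚ = Δₚ} {Γₚ} q c d) = elim q
  (≈-sub (TySub-mono (λ a → ∈fv-+ʳ (occ (#ˡ p ↑ʳ a) t)) e) c)
  (≈-sub (TySub-lift Δₚ Γₚ (λ a → ∈fv-+ˡ _) e) d)
≈-sub e (par c) = par (≈-sub (TySub-lift [] (_ ∷ _ ∷ []) (λ _ z → z) e) c)
≈-sub e (app {t} c d) = app (≈-sub (TySub-mono (λ a → ∈fv-+ˡ _) e) c) (≈-sub (TySub-mono (λ a → ∈fv-+ʳ (occ a t)) e) d)
≈-sub e (coapp {t} c d) = coapp (≈-sub (TySub-mono (λ a → ∈fv-+ˡ _) e) c) (≈-sub (TySub-mono (λ a → ∈fv-+ʳ (occ a t)) e) d)
≈-sub e (ofcourse c) = ofcourse (≈-sub (TySub-lift [] (_ ∷ []) (λ _ z → z) e) c)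
≈-sub e (whynot c) = whynot (≈-sub (TySub-lift (_ ∷ []) [] (λ _ z → z) e) c)
≈-sub e (elim-whynot {t} c d) = elim-whynot
  (≈-sub (TySub-mono (λ a → ∈fv-+ʳ (occ (suc a) t)) e) c) (≈-sub (TySub-lift [] (_ ∷ []) (λ a → ∈fv-+ˡ _) e) d)
≈-sub e (cut {t} c d) = cut (≈-sub (TySub-mono (λ a → ∈fv-+ˡ _) e) c) (≈-sub (TySub-mono (λ a → ∈fv-+ʳ (occ a t)) e) d)
≈-sub e one = one
≈-sub {σ = σ} e (fwd r d d′) = fwd (Ax-sub r σ) (sub-ty e d) (sub-ty (TySub-mono (λ a → subst (0 <_) (sym (Ax-occ r a))) e) d′)
≈-sub {σ = σ} e (bwd r d d′) = bwd (Ax-sub r σ) (sub-ty (TySub-mono (λ a → subst (0 <_) (Ax-occ r a)) e) d) (sub-ty e d′)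
≈-sub e (c ⊙ d) = ≈-sub e c ⊙ ≈-sub (TySub-mono (λ a → subst (0 <_) (sym (≈-occ c a))) e) d

TySub-ren : {ρ : Ren m n m′ n′} {Δ : UCtx X m} {Γ : LCtx X n} {Δ′ : UCtx X m′} {Γ′ : LCtx X n′} →
  TyRen ρ Δ Γ Δ′ Γ′ → ∀ {t} → TySub ⌊ ρ ⌋ t Δ Γ Δ′ Γ′
TySub-ren r = tySub (λ u → uvar (TyRen.tyᵘ r u)) (λ a _ x → lvar (trans (TyRen.tyˡ r a) x))

≈-ren : {ρ : Ren m n m′ n′} {Δ : UCtx X m} {Γ : LCtx X n} {Δ′ : UCtx X m′} {Γ′ : LCtx X n′} →
  TyRen ρ Δ Γ Δ′ Γ′ → ∀ {t s A} → Δ ⨾ Γ ⊩ t ≈ s ∶ A → Δ′ ⨾ Γ′ ⊩ ren ρ t ≈ ren ρ s ∶ A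
≈-ren {ρ = ρ} r {t} {s} c = subst₂ (Cong Ax _ _ _) (sym (ren-as-sub ρ t)) (sym (ren-as-sub ρ s))
  (≈-sub (TySub-ren r) c)

record ≈Sub {X : Set} {m n m′ n′ : ℕ} (σ σ′ : Sub m n m′ n′)
            (Δ : UCtx X m) (Γ : LCtx X n) (Δ′ : UCtx X m′) (Γ′ : LCtx X n′) : Set where
  constructor ≈sub
  field
    ≈ᵘ : ∀ u → Δ′ ⨾ Γ′ ⊩ proj₁ σ u ≈ proj₁ σ′ u ∶ lookup Δ u
    ≈ˡ : ∀ a {A} → lookup Γ a ≡ just A → Δ′ ⨾ Γ′ ⊩ proj₂ σ a ≈ proj₂ σ′ a ∶ A

≈Sub-lift : {σ σ′ : Sub m n m′ n′} {Δ : UCtx X m} {Γ : LCtx X n} {Δ′ : UCtx X m′} {Γ′ : LCtx X n′}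
  (Δ₀ : UCtx X k) (Γ₀ : LCtx X l) → ≈Sub σ σ′ Δ Γ Δ′ Γ′ →
  ≈Sub (liftˢ k l σ) (liftˢ k l σ′) (Δ₀ ++ Δ) (Γ₀ ++ Γ) (Δ₀ ++ Δ′) (Γ₀ ++ Γ′)
≈Sub-lift {k = k} {l = l} {σ = σ} {σ′} {Δ} {Γ} {Δ′} {Γ′} Δ₀ Γ₀ (≈sub e g) = ≈sub eᵘ eˡ
  where
  eᵘ : ∀ u → Δ₀ ++ Δ′ ⨾ Γ₀ ++ Γ′ ⊩ proj₁ (liftˢ k l σ) u ≈ proj₁ (liftˢ k l σ′) u ∶ lookup (Δ₀ ++ Δ) u
  eᵘ u with split k u
  ... | bound i rewrite liftˢ-boundᵘ k l σ i | liftˢ-boundᵘ k l σ′ i =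
    uvar (trans (lookup-++ˡ Δ₀ Δ′ i) (sym (lookup-++ˡ Δ₀ Δ i)))
  ... | free j rewrite liftˢ-freeᵘ k l σ j | liftˢ-freeᵘ k l σ′ j | lookup-++ʳ Δ₀ Δ j =
    ≈-ren (TyRen-wk Δ₀ Γ₀) (e j)
  eˡ : ∀ a {A} → lookup (Γ₀ ++ Γ) a ≡ just A →
    Δ₀ ++ Δ′ ⨾ Γ₀ ++ Γ′ ⊩ proj₂ (liftˢ k l σ) a ≈ proj₂ (liftˢ k l σ′) a ∶ A
  eˡ a x with split l a
  ... | bound i rewrite liftˢ-boundˡ k l σ i | liftˢ-boundˡ k l σ′ i =
    lvar (trans (lookup-++ˡ Γ₀ Γ′ i) (trans (sym (lookup-++ˡ Γ₀ Γ i)) x))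
  ... | free j rewrite liftˢ-freeˡ k l σ j | liftˢ-freeˡ k l σ′ j | lookup-++ʳ Γ₀ Γ j =
    ≈-ren (TyRen-wk Δ₀ Γ₀) (g j x)

sub-≈ : {σ σ′ : Sub m n m′ n′} {Δ : UCtx X m} {Γ : LCtx X n} {Δ′ : UCtx X m′} {Γ′ : LCtx X n′} →
  ≈Sub σ σ′ Δ Γ Δ′ Γ′ → ∀ {t A} → Δ ⨾ Γ ⊩ t ∶ A → Δ′ ⨾ Γ′ ⊩ sub σ t ≈ sub σ′ t ∶ A
sub-≈ e (lvar {a} x)      = ≈Sub.≈ˡ e a x
sub-≈ e (uvar {u} refl)   = ≈Sub.≈ᵘ e u
sub-≈ e (tensor t s)      = tensor (sub-≈ e t) (sub-≈ e s)
sub-≈ e (elim {Δₚ = Δₚ} {Γₚ} p s t) = elim p (sub-≈ e s) (sub-≈ (≈Sub-lift Δₚ Γₚ e) t)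
sub-≈ e (par t)           = par (sub-≈ (≈Sub-lift [] (_ ∷ _ ∷ []) e) t)
sub-≈ e (app t s)         = app (sub-≈ e t) (sub-≈ e s)
sub-≈ e (coapp t s)       = coapp (sub-≈ e t) (sub-≈ e s)
sub-≈ e (ofcourse t)      = ofcourse (sub-≈ (≈Sub-lift [] (_ ∷ []) e) t)
sub-≈ e (whynot t)        = whynot (sub-≈ (≈Sub-lift (_ ∷ []) [] e) t)
sub-≈ e (elim-whynot s t) = elim-whynot (sub-≈ e s) (sub-≈ (≈Sub-lift [] (_ ∷ []) e) t)
sub-≈ e (cut t s)         = cut (sub-≈ e t) (sub-≈ e s)
sub-≈ e one               = one

≈Sub-TySub : {σ σ′ : Sub m n m′ n′} {Δ : UCtx X m} {Γ : LCtx X n} {Δ′ : UCtx X m′} {Γ′ : LCtx X n′} →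
  ≈Sub σ σ′ Δ Γ Δ′ Γ′ → ∀ {t} → TySub σ t Δ Γ Δ′ Γ′
≈Sub-TySub e = tySub (λ u → Cong-tyˡ (≈Sub.≈ᵘ e u)) (λ a _ x → Cong-tyˡ (≈Sub.≈ˡ e a x))

sub-≈² : {σ σ′ : Sub m n m′ n′} {Δ : UCtx X m} {Γ : LCtx X n} {Δ′ : UCtx X m′} {Γ′ : LCtx X n′} →
  ≈Sub σ σ′ Δ Γ Δ′ Γ′ → ∀ {t s A} → Δ ⨾ Γ ⊩ t ≈ s ∶ A → Δ′ ⨾ Γ′ ⊩ sub σ t ≈ sub σ′ s ∶ A
sub-≈² e c = ≈-sub (≈Sub-TySub e) c ⊙ sub-≈ e (Cong-tyʳ c)

-- Equivalence at every type at which one of the two sides is typed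

infix 3 _⇌_
infixr 4 _⨟_

record _⇌_ {m n : ℕ} (t s : Term m n) : Set₁ where
  field
    to   : {X : Set} {Δ : UCtx X m} {Γ : LCtx X n} {A : Formula X} → Δ ⨾ Γ ⊩ t ∶ A → Δ ⨾ Γ ⊩ t ≈ s ∶ A
    from : {X : Set} {Δ : UCtx X m} {Γ : LCtx X n} {A : Formula X} → Δ ⨾ Γ ⊩ s ∶ A → Δ ⨾ Γ ⊩ s ≈ t ∶ A
open _⇌_

≡⇒⇌ : {t s : Term m n} → t ≡ s → t ⇌ s
≡⇒⇌ refl = record { to = Cong-refl ; from = Cong-refl }

⇌-refl : {t : Term m n} → t ⇌ t
⇌-refl = ≡⇒⇌ refl

⇌-sym : {t s : Term m n} → t ⇌ s → s ⇌ t
⇌-sym e = record { to = from e ; from = to e }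

-- Each link types the next one, so chains of `⇌` are written like equations, with a single typing
-- supplied at one end.
_⨟_ : {t s r : Term m n} → t ⇌ s → s ⇌ r → t ⇌ r
e ⨟ f = record
  { to   = λ d → let c = to e d in c ⊙ to f (Cong-tyʳ c)
  ; from = λ d → let c = from f d in c ⊙ from e (Cong-tyʳ c) }

plug-⇌ : (S : Surface m n k l) {t s : Term (k + m) (l + n)} → t ⇌ s → plug S t ⇌ plug S s
plug-⇌ S e = record
  { to   = λ d → let open Plugged (plug-ty⁻ S d) in Cong-plug outer (to e inner)
  ; from = λ d → let open Plugged (plug-ty⁻ S d) in Cong-plug outer (from e inner) }

slide-⇌ : ∀ p (S : Surface m n k l) (t : Term (k + (#ᵘ p + m)) (l + (#ˡ p + n))) (r : Term m n) →
  plug (renᔆ (wk (#ᵘ p) (#ˡ p)) S) t [ p := r ] ⇌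
  plug S (ren (xch k l (#ᵘ p) (#ˡ p)) t [ p := ren (wk k l) r ])
slide-⇌ p S t r = record
  { to   = λ d → fwd (slide p S) d (Ax-ty⁺ (slide p S) d)
  ; from = λ d → bwd (slide p S) (Ax-ty⁻ (slide p S) d) d }

xch-0 : ∀ k l (t : Term (k + m) (l + n)) → ren (xch 0 0 k l) t ≡ t
xch-0 {m} {n} k l t = trans (ren-cong (exchange-0 k , exchange-0 l) t) (ren-id t)
  where
  exchange-0 : ∀ j (i : Fin (j + n′)) → exchange 0 j i ≡ i
  exchange-0 j i with split j i
  ... | bound i = exchange-outer 0 j i
  ... | free i  = exchange-free 0 j i

-- For a context without binders the exchange and the weakening in `slide` are identities, up to an
-- equation that is absorbed here.
slide₀ : ∀ p (S : Surface m n 0 0) (t : Term (#ᵘ p + m) (#ˡ p + n)) (r : Term m n) →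
  plug (renᔆ (wk (#ᵘ p) (#ˡ p)) S) t [ p := r ] ⇌ plug S (t [ p := r ])
slide₀ p S t r = slide-⇌ p S t r ⨟
  ≡⇒⇌ (cong₂ (λ x y → plug S (x [ p := y ])) (xch-0 (#ᵘ p) (#ˡ p) t) (ren-id r))

unit-⋆-⇌ : (t : Term m n) → t [ unit := ⋆ ] ⇌ t
unit-⋆-⇌ t = record
  { to   = λ d → fwd unit-⋆ d (Ax-ty⁺ unit-⋆ d)
  ; from = λ d → bwd unit-⋆ (Ax-ty⁻ unit-⋆ d) d }

comm-⇌ : (t s : Term m n) → t ♯ s ⇌ s ♯ t
comm-⇌ t s = record
  -- Matching on the typing reveals that the type is `⊥`, as the axiom demands. The axiom is its own
  -- converse, hence `fwd` in both directions.
  { to   = λ { d@(cut _ _) → fwd comm d (Ax-ty⁺ comm d) }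
  ; from = λ { d@(cut _ _) → fwd comm d (Ax-ty⁺ comm d) } }

•-♯-⇌ : (t s r : Term m n) → (t • s) ♯ r ⇌ t ♯ ⟨ s , r ⟩
•-♯-⇌ t s r = record
  { to   = λ { d@(cut _ _) → fwd •-♯ d (Ax-ty⁺ •-♯ d) }
  ; from = λ { d@(cut _ _) → bwd •-♯ (Ax-ty⁻ •-♯ d) d } }

▼-♯-⇌ : (t s r : Term m n) → (t ▼ s) ♯ r ⇌ t ♯ ⟨ r , s ⟩
▼-♯-⇌ t s r = record
  { to   = λ { d@(cut _ _) → fwd ▼-♯ d (Ax-ty⁺ ▼-♯ d) }
  ; from = λ { d@(cut _ _) → bwd ▼-♯ (Ax-ty⁻ ▼-♯ d) d } }

▸-♯-⇌ : (t : Term m (suc n)) (r : Term m n) → t ▸ r ⇌ r ♯ (! t)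
▸-♯-⇌ t r = record
  { to   = λ { d@(elim-whynot _ _) → fwd ▸-♯ d (Ax-ty⁺ ▸-♯ d) }
  ; from = λ { d@(cut _ _) → bwd ▸-♯ (Ax-ty⁻ ▸-♯ d) d } }

-- The equivalence also holds for other bodies, but only at type ⊥.
℘-♯-⇌ : (t s : Term m (2 + n)) (r : Term m n) → (℘ (t ♯ s)) ♯ r ⇌ (t ♯ s) [ pair := r ]
℘-♯-⇌ t s r = record
  { to   = λ { d@(cut (par _) _) → fwd ℘-♯ d (Ax-ty⁺ ℘-♯ d) }
  ; from = λ { d@(elim pair _ (cut _ _)) → bwd ℘-♯ (Ax-ty⁻ ℘-♯ d) d } }

¿-♯-⇌ : (t s : Term (suc m) n) (r : Term m n) → (¿ (t ♯ s)) ♯ r ⇌ (t ♯ s) [ bang := r ]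
¿-♯-⇌ t s r = record
  { to   = λ { d@(cut (whynot _) _) → fwd ¿-♯ d (Ax-ty⁺ ¿-♯ d) }
  ; from = λ { d@(elim bang _ (cut _ _)) → bwd ¿-♯ (Ax-ty⁻ ¿-♯ d) d } }

module _ {Δ : UCtx X m} {Γ : LCtx X n} where

  ⋆-♯-≈ : ∀ {t} → Δ ⨾ Γ ⊩ t ∶ ⊥ → Δ ⨾ Γ ⊩ ⋆ ♯ t ≈ t ∶ ⊥
  ⋆-♯-≈ d = fwd ⋆-♯ (cut one d) d

  ♯-⋆-≈ : ∀ {t} → Δ ⨾ Γ ⊩ t ∶ ⊥ → Δ ⨾ Γ ⊩ t ♯ ⋆ ≈ t ∶ ⊥
  ♯-⋆-≈ {t} d = to (comm-⇌ t ⋆) (cut d one) ⊙ ⋆-♯-≈ d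

  ⋆-unit-≈ : ∀ {s} → Δ ⨾ Γ ⊩ s ∶ 𝟙 → Δ ⨾ Γ ⊩ ⋆ [ unit := s ] ≈ s ∶ 𝟙
  ⋆-unit-≈ {s} d = fwd unit-swap (elim unit d one) (elim unit one d) ⊙ to (unit-⋆-⇌ s) (elim unit one d)

  -- Writing `t` as `⋆ ♯ t` gives the eliminator a `⋆` to slide onto, where `unit-swap` and `unit-⋆`
  -- turn `⋆ [ unit := s ]` into `s`.
  unit-♯-≈ : ∀ {t s} → Δ ⨾ Γ ⊩ t ∶ ⊥ → Δ ⨾ Γ ⊩ s ∶ 𝟙 → Δ ⨾ Γ ⊩ t [ unit := s ] ≈ t ♯ s ∶ ⊥
  unit-♯-≈ {t} {s} d e =
    elim unit (Cong-refl e) (Cong-sym (⋆-♯-≈ d)) ⊙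
    slide′ ⊙ cut (⋆-unit-≈ e) (Cong-refl d) ⊙ to (comm-⇌ s t) (cut e d)
    where
    slide′ : Δ ⨾ Γ ⊩ (⋆ ♯ t) [ unit := s ] ≈ (⋆ [ unit := s ]) ♯ t ∶ ⊥
    slide′ = to (≡⇒⇌ (cong (λ x → (⋆ ♯ x) [ unit := s ]) (sym (ren-id t))) ⨟ slide₀ unit (□♯ t) ⋆ s)
      (elim unit e (cut one d))

unit-♯-⇌ : (t s r : Term m n) → (t ♯ s) ♯ r ⇌ (t ♯ s) [ unit := r ]
unit-♯-⇌ t s r = record
  { to   = λ { (cut d@(cut _ _) e) → Cong-sym (unit-♯-≈ d e) }
  ; from = λ { (elim unit e d@(cut _ _)) → unit-♯-≈ d e } }

-- If the hole is an argument, the axiom for the elimination is used and the one for the opposite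
-- elimination is undone: `x • t` against `s` is `x` against `⟨ t , s ⟩`, which is `x ▼ s` against
-- `t`. For a hole in a pair, `comm` first brings the pair to the right.
♯-plug : (S : Surface m n k l) (t : Term (k + m) (l + n)) (s : Term m n) →
  plug S t ♯ s ⇌ wrap S s (t ♯ into S s)
♯-plug ℘□ t s = record
  { to   = λ { (cut (par d) e) →
      -- Under a binder `into` yields `⋆`, so the body, which has type `⊥`, is first cut against
      -- `⋆`.
      let c = Cong-sym (♯-⋆-≈ d) in
      cut (par c) (Cong-refl e) ⊙ to (℘-♯-⇌ t ⋆ s) (cut (par (Cong-tyʳ c)) e) }
  ; from = λ { (elim pair e (cut {B = ⊥} d one)) →
      elim pair (Cong-refl e) (♯-⋆-≈ d) ⊙ bwd ℘-♯ (Ax-ty⁻ ℘-♯ (elim pair e d)) (elim pair e d) } }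
♯-plug ⟨□, x ⟩ t s = comm-⇌ _ s ⨟ ⇌-sym (▼-♯-⇌ s x t) ⨟ comm-⇌ _ t
♯-plug ⟨ x ,□⟩ t s = comm-⇌ _ s ⨟ ⇌-sym (•-♯-⇌ s x t) ⨟ comm-⇌ _ t
♯-plug (□• x) t s = •-♯-⇌ t x s
♯-plug (x •□) t s = •-♯-⇌ x t s ⨟ ⇌-sym (▼-♯-⇌ x s t) ⨟ comm-⇌ _ t
♯-plug (□▼ x) t s = ▼-♯-⇌ t x s
♯-plug (x ▼□) t s = ▼-♯-⇌ x t s ⨟ ⇌-sym (•-♯-⇌ x s t) ⨟ comm-⇌ _ t
♯-plug (□♯ x) t s = unit-♯-⇌ t x s
♯-plug (x ♯□) t s = plug-⇌ (□♯ s) (comm-⇌ x t) ⨟ unit-♯-⇌ t x s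
♯-plug ¿□ t s = record
  { to   = λ { (cut (whynot d) e) →
      let c = Cong-sym (♯-⋆-≈ d) in
      cut (whynot c) (Cong-refl e) ⊙ to (¿-♯-⇌ t ⋆ s) (cut (whynot (Cong-tyʳ c)) e) }
  ; from = λ { (elim bang e (cut {B = ⊥} d one)) →
      elim bang (Cong-refl e) (♯-⋆-≈ d) ⊙ bwd ¿-♯ (Ax-ty⁻ ¿-♯ (elim bang e d)) (elim bang e d) } }
♯-plug □[ p := x ] t s = ⇌-sym (slide₀ p (□♯ s) t x)
♯-plug (elim□ pair x) t s = ⇌-sym (slide₀ pair (□♯ s) x t) ⨟ ⇌-sym (℘-♯-⇌ x _ t) ⨟ comm-⇌ _ t
♯-plug (elim□ bang x) t s = ⇌-sym (slide₀ bang (□♯ s) x t) ⨟ ⇌-sym (¿-♯-⇌ x _ t) ⨟ comm-⇌ _ t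
♯-plug (elim□ unit x) t s = ⇌-sym (slide₀ unit (□♯ s) x t) ⨟
  ≡⇒⇌ (cong (λ y → (x ♯ y) [ unit := t ]) (ren-id s)) ⨟ ⇌-sym (unit-♯-⇌ x s t) ⨟ comm-⇌ _ t
♯-plug (x ▸□) t s = plug-⇌ (□♯ s) (▸-♯-⇌ x t) ⨟ unit-♯-⇌ t (! x) s

-- Contra-substitution and equivalence

ren-⇌ : (ρ : Ren m n m′ n′) {t s : Term m n} → t ⇌ s → ren ρ t ⇌ ren ρ s
ren-⇌ {m} {n} ρ {t} {s} e = record
  { to   = λ d → ≈-ren r (to e (ren-ty⁻ r t d))
  ; from = λ d → ≈-ren r (from e (ren-ty⁻ r s d)) }
  where
  -- The contexts pulled back along `ρ`: a typing of a renamed term comes from a typing of the term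
  -- there.
  r : {Δ′ : UCtx X _} {Γ′ : LCtx X _} →
    TyRen ρ (tabulate (lookup Δ′ ∘ proj₁ ρ)) (tabulate (lookup Γ′ ∘ proj₂ ρ)) Δ′ Γ′
  r = tyRen (λ u → sym (lookup∘tabulate _ u)) (λ a → sym (lookup∘tabulate _ a))

into-⇌ : (S : Surface m n k l) {s s′ : Term m n} → s ⇌ s′ → into S s ⇌ into S s′
into-⇌ ℘□             e = ⇌-refl
into-⇌ ⟨□, t ⟩        e = plug-⇌ (□▼ t) e
into-⇌ ⟨ t ,□⟩        e = plug-⇌ (□• t) e
into-⇌ (□• t)         e = plug-⇌ ⟨ t ,□⟩ e
into-⇌ (t •□)         e = plug-⇌ (t ▼□) e
into-⇌ (□▼ t)         e = plug-⇌ ⟨□, t ⟩ e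
into-⇌ (t ▼□)         e = plug-⇌ (t •□) e
into-⇌ (□♯ t)         e = ⇌-refl
into-⇌ (t ♯□)         e = ⇌-refl
into-⇌ ¿□             e = ⇌-refl
into-⇌ □[ p := t ]    e = ren-⇌ (wk (#ᵘ p) (#ˡ p)) e
into-⇌ (elim□ pair t) e = plug-⇌ ℘□ (plug-⇌ (t ♯□) (ren-⇌ (wk 0 2) e))
into-⇌ (elim□ bang t) e = plug-⇌ ¿□ (plug-⇌ (t ♯□) (ren-⇌ (wk 1 0) e))
into-⇌ (elim□ unit t) e = plug-⇌ (t ♯□) e
into-⇌ (t ▸□)         e = ⇌-refl

elim-⇌ : ∀ p {t t′ : Term (#ᵘ p + m) (#ˡ p + n)} {s s′ : Term m n} → t ⇌ t′ → s ⇌ s′ → t [ p := s ] ⇌ t′ [ p := s′ ]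
elim-⇌ p {t′ = t′} {s} e f = plug-⇌ □[ p := s ] e ⨟ plug-⇌ (elim□ p t′) f

wrap-⇌ : (S : Surface m n k l) {s s′ : Term m n} {y y′ : Term (k + m) (l + n)} →
  s ⇌ s′ → y ⇌ y′ → wrap S s y ⇌ wrap S s′ y′
wrap-⇌ ℘□          e f = elim-⇌ pair f e
wrap-⇌ ⟨□, t ⟩     e f = f
wrap-⇌ ⟨ t ,□⟩     e f = f
wrap-⇌ (□• t)      e f = f
wrap-⇌ (t •□)      e f = f
wrap-⇌ (□▼ t)      e f = f
wrap-⇌ (t ▼□)      e f = f
wrap-⇌ (□♯ t)      e f = elim-⇌ unit f e
wrap-⇌ (t ♯□)      e f = elim-⇌ unit f e
wrap-⇌ ¿□          e f = elim-⇌ bang f e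
wrap-⇌ □[ p := t ] e f = elim-⇌ p f ⇌-refl
wrap-⇌ (elim□ p t) e f = f
wrap-⇌ (t ▸□)      e f = elim-⇌ unit f e

contra-there : {a : Fin n} (S : Surface m n k l) {t : Term (k + m) (l + n)} → occᔆ a S ≡ 0 → Surf (l ↑ʳ a) t →
  ∀ s → contra a (plug S t) s ≡ wrap S s (contra (l ↑ʳ a) t (into S s))
contra-there {a = a} S {t} o p s = contra-plug a S t s (Surf-∈fv p) o

contra-⇌ : {a : Fin n} {t : Term m n} → Surf a t → ∀ {s s′} → s ⇌ s′ → contra a t s ⇌ contra a t s′
contra-⇌ here e = e
contra-⇌ (there S o p) {s} {s′} e = ≡⇒⇌ (contra-there S o p s) ⨟
  wrap-⇌ S e (contra-⇌ p (into-⇌ S e)) ⨟ ≡⇒⇌ (sym (contra-there S o p s′))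

occᔆ-wk : ∀ k′ l′ (a : Fin n) (S : Surface m n k l) → occᔆ (l′ ↑ʳ a) (renᔆ (wk k′ l′) S) ≡ occᔆ a S
occᔆ-wk k′ l′ a S = occᔆ-ren (wk k′ l′) (Over-wk l′) S

∈fv-ren : (ρ : Ren m n m′ n′) {a : Fin n} {a′ : Fin n′} → Over (proj₂ ρ) a a′ →
  ∀ t → a ∈fv t → a′ ∈fv ren ρ t
∈fv-ren ρ o t = subst (0 <_) (sym (occ-ren ρ o t))

-- `F` is `℘□` or `¿□`, the binder that `into` builds for an eliminator. The pattern `p` leaves
-- first the cut and then this binder; the second move exchanges two blocks of variables.
under-slide : ∀ p j (F : ∀ {m n} → Surface m n (#ᵘ j) (#ˡ j)) → (∀ {m n m′ n′} (ρ : Ren m n m′ n′) → renᔆ ρ F ≡ F) →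
  (x : Term (#ᵘ j + m) (#ˡ j + n)) (s : Term (#ᵘ p + m) (#ˡ p + n)) (q : Term m n) →
  plug F (x ♯ ren (wk (#ᵘ j) (#ˡ j)) (s [ p := q ])) ⇌
  plug F (ren (liftᴿ (#ᵘ j) (#ˡ j) (wk (#ᵘ p) (#ˡ p))) x ♯ ren (wk (#ᵘ j) (#ˡ j)) s) [ p := q ]
under-slide p j F F-ren x s q =
  plug-⇌ F (⇌-sym (slide₀ p (x ♯□) (ren (liftᴿ (#ᵘ p) (#ˡ p) J) s) (ren J q)) ⨟
    ≡⇒⇌ (cong₂ (λ y z → (y ♯ z) [ p := ren J q ])
      (sym (xch-wk-inner (#ᵘ j) (#ˡ j) (#ᵘ p) (#ˡ p) x)) (sym (xch-wk-outer (#ᵘ j) (#ˡ j) (#ᵘ p) (#ˡ p) s)))) ⨟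
  ⇌-sym (≡⇒⇌ (cong (λ F → plug F (ren (liftᴿ (#ᵘ j) (#ˡ j) (wk (#ᵘ p) (#ˡ p))) x ♯ ren J s) [ p := q ])
    (sym (F-ren _))) ⨟ slide-⇌ p F _ q)
  where
  J : ∀ {m n} → Ren m n (#ᵘ j + m) (#ˡ j + n)
  J = wk (#ᵘ j) (#ˡ j)

into-elim-slide : ∀ p j (x : Term (#ᵘ j + m) (#ˡ j + n)) (s : Term (#ᵘ p + m) (#ˡ p + n)) (q : Term m n) →
  into (elim□ j x) (s [ p := q ]) ⇌ into (renᔆ (wk (#ᵘ p) (#ˡ p)) (elim□ j x)) s [ p := q ]
into-elim-slide p pair x s q = under-slide p pair ℘□ (λ _ → refl) x s q
into-elim-slide p bang x s q = under-slide p bang ¿□ (λ _ → refl) x s q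
into-elim-slide p unit x s q = ⇌-sym (slide₀ p (x ♯□) s q)

-- `contra` puts its second argument into surface position only, either handed down by `into` or
-- left behind by `wrap`. An eliminator on that argument can therefore slide out to the root.
contra-slide : ∀ p {a : Fin n} {t : Term m n} → Surf a t → (s : Term (#ᵘ p + m) (#ˡ p + n)) (q : Term m n) →
  contra a t (s [ p := q ]) ⇌ contra (#ˡ p ↑ʳ a) (ren (wk (#ᵘ p) (#ˡ p)) t) s [ p := q ]

module _ {m n k l : ℕ} (p : Pat) (a : Fin n) (S : Surface m n k l) (t : Term (k + m) (l + n))
         (o : occᔆ a S ≡ 0) (f : Surf (l ↑ʳ a) t) (s : Term (#ᵘ p + m) (#ˡ p + n)) (q : Term m n) where
  private
    W : ∀ {m n} → Ren m n (#ᵘ p + m) (#ˡ p + n)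
    W = wk (#ᵘ p) (#ˡ p)
    S′ = renᔆ W S
    t′ = ren (liftᴿ k l W) t

  contra-there-wk : contra (#ˡ p ↑ʳ a) (ren W (plug S t)) s ≡ wrap S′ s (contra (l ↑ʳ (#ˡ p ↑ʳ a)) t′ (into S′ s))
  contra-there-wk = trans (cong (λ x → contra (#ˡ p ↑ʳ a) x s) (ren-plug W S t))
    (contra-plug (#ˡ p ↑ʳ a) S′ t′ s (∈fv-ren (liftᴿ k l W) (Over-free l (Over-wk (#ˡ p))) t (Surf-∈fv f))
      (trans (occᔆ-wk (#ᵘ p) (#ˡ p) a S) o))

  contra-slide-there :
    wrap S (s [ p := q ]) (contra (l ↑ʳ a) t (into S (s [ p := q ]))) ⇌
    wrap S′ s (contra (l ↑ʳ (#ˡ p ↑ʳ a)) t′ (into S′ s)) [ p := q ] →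
    contra a (plug S t) (s [ p := q ]) ⇌ contra (#ˡ p ↑ʳ a) (ren W (plug S t)) s [ p := q ]
  contra-slide-there e = ≡⇒⇌ (contra-there S o f (s [ p := q ])) ⨟ e ⨟
    ≡⇒⇌ (cong (λ x → x [ p := q ]) (sym contra-there-wk))

-- The cases where into S carries the term: it slides there, then through t.
contra-slide-pass : ∀ p {a : Fin n} {t : Term m n} → Surf a t → {s : Term m n}
  (s′ : Term (#ᵘ p + m) (#ˡ p + n)) (q : Term m n) → s ⇌ s′ [ p := q ] →
  contra a t s ⇌ contra (#ˡ p ↑ʳ a) (ren (wk (#ᵘ p) (#ˡ p)) t) s′ [ p := q ]
contra-slide-pass p f s′ q e = contra-⇌ f e ⨟ contra-slide p f s′ q

-- The cases where wrap S carries the term.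
contra-slide-turn : ∀ p q (a : Fin n) (t : Term (#ᵘ q + m) (#ˡ q + n)) (c : Term (#ᵘ q + m) (#ˡ q + n))
  (s : Term (#ᵘ p + m) (#ˡ p + n)) (r : Term m n) →
  contra (#ˡ q ↑ʳ a) t c [ q := s [ p := r ] ] ⇌
  contra (#ˡ q ↑ʳ (#ˡ p ↑ʳ a)) (ren (liftᴿ (#ᵘ q) (#ˡ q) (wk (#ᵘ p) (#ˡ p))) t)
    (ren (liftᴿ (#ᵘ q) (#ˡ q) (wk (#ᵘ p) (#ˡ p))) c) [ q := s ] [ p := r ]
contra-slide-turn p q a t c s r = ⇌-sym (slide₀ p (elim□ q (contra (#ˡ q ↑ʳ a) t c)) s r) ⨟
  ≡⇒⇌ (cong (λ x → x [ q := s ] [ p := r ]) (contra-ren _ (Over-free (#ˡ q) (Over-wk (#ˡ p))) t c))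

contra-slide p here s q = ⇌-refl
contra-slide p {a} (there ℘□ {t} o f) s q = contra-slide-there p a ℘□ t o f s q (contra-slide-turn p pair a t ⋆ s q)
contra-slide p {a} (there ⟨□, x ⟩ {t} o f) s q = contra-slide-there p a ⟨□, x ⟩ t o f s q
  (contra-slide-pass p f _ q (⇌-sym (slide₀ p (□▼ x) s q)))
contra-slide p {a} (there ⟨ x ,□⟩ {t} o f) s q = contra-slide-there p a ⟨ x ,□⟩ t o f s q
  (contra-slide-pass p f _ q (⇌-sym (slide₀ p (□• x) s q)))
contra-slide p {a} (there (□• x) {t} o f) s q = contra-slide-there p a (□• x) t o f s q
  (contra-slide-pass p f _ q (⇌-sym (slide₀ p ⟨ x ,□⟩ s q)))
contra-slide p {a} (there (x •□) {t} o f) s q = contra-slide-there p a (x •□) t o f s q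
  (contra-slide-pass p f _ q (⇌-sym (slide₀ p (x ▼□) s q)))
contra-slide p {a} (there (□▼ x) {t} o f) s q = contra-slide-there p a (□▼ x) t o f s q
  (contra-slide-pass p f _ q (⇌-sym (slide₀ p ⟨□, x ⟩ s q)))
contra-slide p {a} (there (x ▼□) {t} o f) s q = contra-slide-there p a (x ▼□) t o f s q
  (contra-slide-pass p f _ q (⇌-sym (slide₀ p (x •□) s q)))
contra-slide p {a} (there (□♯ x) {t} o f) s q = contra-slide-there p a (□♯ x) t o f s q
  (contra-slide-turn p unit a t x s q)
contra-slide p {a} (there (x ♯□) {t} o f) s q = contra-slide-there p a (x ♯□) t o f s q
  (contra-slide-turn p unit a t x s q)
contra-slide p {a} (there ¿□ {t} o f) s q = contra-slide-there p a ¿□ t o f s q (contra-slide-turn p bang a t ⋆ s q)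
-- Here `p` also has to leave the scope of the pattern `r`. The two blocks are exchanged, and
-- `contra-ren` moves the exchange through the contra-substitution.
contra-slide p {a} (there □[ r := x ] {t} o f) s q = contra-slide-there p a □[ r := x ] t o f s q
  (elim-⇌ r (contra-slide p f (ren (liftᴿ (#ᵘ p) (#ˡ p) (wk (#ᵘ r) (#ˡ r))) s) (ren (wk (#ᵘ r) (#ˡ r)) q)) ⇌-refl ⨟
   ≡⇒⇌ (cong (λ y → y [ p := ren (wk (#ᵘ r) (#ˡ r)) q ] [ r := x ]) (sym e)) ⨟
   ⇌-sym (slide-⇌ p □[ r := x ] y q))
  where
  y : Term (#ᵘ r + (#ᵘ p + _)) (#ˡ r + (#ˡ p + _))
  y = contra (#ˡ r ↑ʳ (#ˡ p ↑ʳ a)) (ren (liftᴿ (#ᵘ r) (#ˡ r) (wk (#ᵘ p) (#ˡ p))) t) (ren (wk (#ᵘ r) (#ˡ r)) s)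
  χ : Ren (#ᵘ r + (#ᵘ p + m)) (#ˡ r + (#ˡ p + n)) (#ᵘ p + (#ᵘ r + m)) (#ˡ p + (#ˡ r + n))
  χ = xch (#ᵘ r) (#ˡ r) (#ᵘ p) (#ˡ p)
  e : ren χ y ≡ contra (#ˡ p ↑ʳ (#ˡ r ↑ʳ a)) (ren (wk (#ᵘ p) (#ˡ p)) t)
    (ren (liftᴿ (#ᵘ p) (#ˡ p) (wk (#ᵘ r) (#ˡ r))) s)
  e = trans (contra-ren χ (subst (Over _ _) (exchange-free (#ˡ r) (#ˡ p) a) (Over-exchange (#ˡ r) (#ˡ p) _))
    (ren (liftᴿ (#ᵘ r) (#ˡ r) (wk (#ᵘ p) (#ˡ p))) t) (ren (wk (#ᵘ r) (#ˡ r)) s))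
    (cong₂ (contra _) (xch-wk-inner (#ᵘ r) (#ˡ r) (#ᵘ p) (#ˡ p) t) (xch-wk-outer (#ᵘ r) (#ˡ r) (#ᵘ p) (#ˡ p) s))
contra-slide p {a} (there (elim□ pair x) {t} o f) s q = contra-slide-there p a (elim□ pair x) t o f s q
  (contra-slide-pass p f _ q (into-elim-slide p pair x s q))
contra-slide p {a} (there (elim□ bang x) {t} o f) s q = contra-slide-there p a (elim□ bang x) t o f s q
  (contra-slide-pass p f _ q (into-elim-slide p bang x s q))
contra-slide p {a} (there (elim□ unit x) {t} o f) s q = contra-slide-there p a (elim□ unit x) t o f s q
  (contra-slide-pass p f _ q (into-elim-slide p unit x s q))
contra-slide p {a} (there (x ▸□) {t} o f) s q = contra-slide-there p a (x ▸□) t o f s q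
  (contra-slide-turn p unit a t (! x) s q)

-- Contra-substitution as the other side of a cut, and eliminators on substituted terms

record AgreeOff {m n m′ n′ : ℕ} (a : Fin n) (σ τ : Sub m n m′ n′) : Set where
  constructor agreeOff
  field
    agreeᵘ : ∀ u → proj₁ σ u ≡ proj₁ τ u
    agreeˡ : ∀ b → b ≢ a → proj₂ σ b ≡ proj₂ τ b

AgreeOff-lift : ∀ k l {a : Fin n} {σ τ : Sub m n m′ n′} →
  AgreeOff a σ τ → AgreeOff (l ↑ʳ a) (liftˢ k l σ) (liftˢ k l τ)
AgreeOff-lift k l {a} {σ} {τ} (agreeOff e g) = agreeOff eᵘ eˡ
  where
  eᵘ : ∀ u → proj₁ (liftˢ k l σ) u ≡ proj₁ (liftˢ k l τ) u
  eᵘ u with split k u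
  ... | bound i = trans (liftˢ-boundᵘ k l σ i) (sym (liftˢ-boundᵘ k l τ i))
  ... | free u  = trans (liftˢ-freeᵘ k l σ u) (trans (cong (ren _) (e u)) (sym (liftˢ-freeᵘ k l τ u)))
  eˡ : ∀ b → b ≢ l ↑ʳ a → proj₂ (liftˢ k l σ) b ≡ proj₂ (liftˢ k l τ) b
  eˡ b b≢a with split l b
  ... | bound i = trans (liftˢ-boundˡ k l σ i) (sym (liftˢ-boundˡ k l τ i))
  ... | free c  = trans (liftˢ-freeˡ k l σ c)
    (trans (cong (ren _) (g c (b≢a ∘ cong (l ↑ʳ_)))) (sym (liftˢ-freeˡ k l τ c)))

sub-agreeOff : {a : Fin n} {σ τ : Sub m n m′ n′} → AgreeOff a σ τ → ∀ t → occ a t ≡ 0 → sub σ t ≡ sub τ t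
sub-agreeOff (agreeOff e g) t o = sub-agree t
  (agree e (λ c c∈ → g c λ { refl → contradiction (subst (0 <_) o c∈) λ () }))

subᔆ-agreeOff : {a : Fin n} {σ τ : Sub m n m′ n′} → AgreeOff a σ τ →
  (S : Surface m n k l) → occᔆ a S ≡ 0 → subᔆ σ S ≡ subᔆ τ S
subᔆ-agreeOff e ℘□          o = refl
subᔆ-agreeOff e ⟨□, t ⟩     o = cong ⟨□,_⟩ (sub-agreeOff e t o)
subᔆ-agreeOff e ⟨ t ,□⟩     o = cong ⟨_,□⟩ (sub-agreeOff e t o)
subᔆ-agreeOff e (□• t)      o = cong □•_ (sub-agreeOff e t o)
subᔆ-agreeOff e (t •□)      o = cong _•□ (sub-agreeOff e t o)
subᔆ-agreeOff e (□▼ t)      o = cong □▼_ (sub-agreeOff e t o)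
subᔆ-agreeOff e (t ▼□)      o = cong _▼□ (sub-agreeOff e t o)
subᔆ-agreeOff e (□♯ t)      o = cong □♯_ (sub-agreeOff e t o)
subᔆ-agreeOff e (t ♯□)      o = cong _♯□ (sub-agreeOff e t o)
subᔆ-agreeOff e ¿□          o = refl
subᔆ-agreeOff e □[ p := t ] o = cong □[ p :=_] (sub-agreeOff e t o)
subᔆ-agreeOff e (elim□ p t) o = cong (elim□ p) (sub-agreeOff (AgreeOff-lift (#ᵘ p) (#ˡ p) e) t o)
subᔆ-agreeOff e (t ▸□)      o = cong _▸□ (sub-agreeOff (AgreeOff-lift 0 1 e) t o)

-- `wrap` adds at most one eliminator, and an eliminator slides out of a cut.
wrap-♯ : (S : Surface m n k l) (s : Term m n) (y : Term (k + m) (l + n)) (r : Term m n) →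
  wrap S s (y ♯ ren (wk k l) r) ⇌ wrap S s y ♯ r
wrap-♯ ℘□          s y r = slide₀ pair (□♯ r) y s
wrap-♯ ⟨□, _ ⟩     s y r = ≡⇒⇌ (cong (y ♯_) (ren-id r))
wrap-♯ ⟨ _ ,□⟩     s y r = ≡⇒⇌ (cong (y ♯_) (ren-id r))
wrap-♯ (□• _)      s y r = ≡⇒⇌ (cong (y ♯_) (ren-id r))
wrap-♯ (_ •□)      s y r = ≡⇒⇌ (cong (y ♯_) (ren-id r))
wrap-♯ (□▼ _)      s y r = ≡⇒⇌ (cong (y ♯_) (ren-id r))
wrap-♯ (_ ▼□)      s y r = ≡⇒⇌ (cong (y ♯_) (ren-id r))
wrap-♯ (□♯ _)      s y r = slide₀ unit (□♯ r) y s
wrap-♯ (_ ♯□)      s y r = slide₀ unit (□♯ r) y s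
wrap-♯ ¿□          s y r = slide₀ bang (□♯ r) y s
wrap-♯ □[ p := x ] s y r = slide₀ p (□♯ r) y x
wrap-♯ (elim□ _ _) s y r = ≡⇒⇌ (cong (y ♯_) (ren-id r))
wrap-♯ (_ ▸□)      s y r = slide₀ unit (□♯ r) y s

-- The generalisation of cut-subst from t{a \\ ⋆} to t{a \\ s}, with τ for the
-- substitution of a and σ for its removal.
♯-contra : {a : Fin n} {t : Term m n} → Surf a t → {σ τ : Sub m n m′ n′} → AgreeOff a σ τ → ∀ s →
  sub τ t ♯ sub σ s ⇌ sub σ (contra a t s) ♯ proj₂ τ a
♯-contra here e s = comm-⇌ _ _
♯-contra {a = a} (there {k} {l} S {t} o f) {σ} {τ} e s =
  ≡⇒⇌ (cong (_♯ sub σ s) (trans (sub-plug τ S t)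
    (cong (λ Z → plug Z (sub (liftˢ k l τ) t)) (sym (subᔆ-agreeOff e S o))))) ⨟
  -- The cut is moved into the hole, the induction hypothesis is applied there, and `wrap-♯` moves
  -- the cut out again.
  ♯-plug (subᔆ σ S) _ (sub σ s) ⨟
  wrap-⇌ (subᔆ σ S) ⇌-refl
    (≡⇒⇌ (cong (sub (liftˢ k l τ) t ♯_) (sym (sub-into σ S s))) ⨟
     ♯-contra f (AgreeOff-lift k l e) (into S s) ⨟
     ≡⇒⇌ (cong (sub (liftˢ k l σ) (contra (l ↑ʳ a) t (into S s)) ♯_) (liftˢ-freeˡ k l τ a))) ⨟
  wrap-♯ (subᔆ σ S) (sub σ s) _ (proj₂ τ a) ⨟
  ≡⇒⇌ (cong (_♯ proj₂ τ a) (trans (sym (sub-wrap σ S s _)) (cong (sub σ) (sym (contra-there S o f s)))))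

record Pull {m n m′ n′ : ℕ} (p : Pat) (a : Fin n) (r : Term (#ᵘ p + m′) (#ˡ p + n′)) (q : Term m′ n′)
            (σ : Sub m n (#ᵘ p + m′) (#ˡ p + n′)) (τ : Sub m n m′ n′) : Set where
  constructor pull
  field
    at-τ  : proj₂ τ a ≡ r [ p := q ]
    at-σ  : proj₂ σ a ≡ r
    off-a : ∀ b → b ≢ a → proj₂ σ b ≡ ren (wk (#ᵘ p) (#ˡ p)) (proj₂ τ b)
    inᵘ   : ∀ u → proj₁ σ u ≡ ren (wk (#ᵘ p) (#ˡ p)) (proj₁ τ u)

-- Under the binders of a surface context the block of `p` has to stay innermost, so the lifted `σ`
-- is followed by the exchange.
Pull-lift : ∀ k l p {a : Fin n} {r : Term (#ᵘ p + m′) (#ˡ p + n′)} {q : Term m′ n′}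
  {σ : Sub m n (#ᵘ p + m′) (#ˡ p + n′)} {τ : Sub m n m′ n′} → Pull p a r q σ τ →
  Pull p (l ↑ʳ a) (ren (liftᴿ (#ᵘ p) (#ˡ p) (wk k l)) r) (ren (wk k l) q)
    (xch k l (#ᵘ p) (#ˡ p) ʳ∘ˢ liftˢ k l σ) (liftˢ k l τ)
Pull-lift {n = n} {m′ = m′} {n′ = n′} {m = m} k l p {a} {r} {q} {σ} {τ} (pull e f g h) = pull
  (trans (liftˢ-freeˡ k l τ a) (cong (ren (wk k l)) e))
  (trans (cong (ren χ) (trans (liftˢ-freeˡ k l σ a) (cong (ren (wk k l)) f))) (xch-wk-outer k l (#ᵘ p) (#ˡ p) r))
  eˡ eᵘ
  where
  χ : Ren (k + (#ᵘ p + m′)) (l + (#ˡ p + n′)) (#ᵘ p + (k + m′)) (#ˡ p + (l + n′))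
  χ = xch k l (#ᵘ p) (#ˡ p)
  W : ∀ {m n} → Ren m n (#ᵘ p + m) (#ˡ p + n)
  W = wk (#ᵘ p) (#ˡ p)
  weaken : ∀ x → ren χ (ren (wk k l) (ren W x)) ≡ ren W (ren (wk k l) x)
  weaken x = trans (xch-wk-outer k l (#ᵘ p) (#ˡ p) (ren W x)) (ren-wk (#ᵘ p) (#ˡ p) (wk k l) x)
  eˡ : ∀ b → b ≢ l ↑ʳ a → ren χ (proj₂ (liftˢ k l σ) b) ≡ ren W (proj₂ (liftˢ k l τ) b)
  eˡ b b≢a with split l b
  ... | bound i = trans (cong (ren χ) (liftˢ-boundˡ k l σ i))
    (trans (cong lvar (exchange-inner l (#ˡ p) i)) (cong (ren W) (sym (liftˢ-boundˡ k l τ i))))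
  ... | free c  = trans (cong (ren χ) (trans (liftˢ-freeˡ k l σ c) (cong (ren (wk k l)) (g c (b≢a ∘ cong (l ↑ʳ_))))))
    (trans (weaken (proj₂ τ c)) (cong (ren W) (sym (liftˢ-freeˡ k l τ c))))
  eᵘ : ∀ u → ren χ (proj₁ (liftˢ k l σ) u) ≡ ren W (proj₁ (liftˢ k l τ) u)
  eᵘ u with split k u
  ... | bound i = trans (cong (ren χ) (liftˢ-boundᵘ k l σ i))
    (trans (cong uvar (exchange-inner k (#ᵘ p) i)) (cong (ren W) (sym (liftˢ-boundᵘ k l τ i))))
  ... | free c  = trans (cong (ren χ) (trans (liftˢ-freeᵘ k l σ c) (cong (ren (wk k l)) (h c))))
    (trans (weaken (proj₁ τ c)) (cong (ren W) (sym (liftˢ-freeᵘ k l τ c))))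

-- The only occurrence of `a` is in surface position, so the eliminator on the term substituted
-- there climbs to the root by one `slide` per surface context. `Pull` is the invariant that relates
-- the substitutions before and after.
sub-pull : ∀ p {a : Fin n} {t : Term m n} → Surf a t → {r : Term (#ᵘ p + m′) (#ˡ p + n′)} {q : Term m′ n′}
  {σ : Sub m n (#ᵘ p + m′) (#ˡ p + n′)} {τ : Sub m n m′ n′} → Pull p a r q σ τ → sub τ t ⇌ sub σ t [ p := q ]
sub-pull p here {q = q} e = ≡⇒⇌ (trans (Pull.at-τ e) (cong (λ x → x [ p := q ]) (sym (Pull.at-σ e))))
sub-pull {m′ = m′} {n′ = n′} p {a} (there {k} {l} S {t} o f) {r} {q} {σ} {τ} e =
  ≡⇒⇌ (sub-plug τ S t) ⨟
  plug-⇌ (subᔆ τ S) (sub-pull p f (Pull-lift k l p e) ⨟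
    ≡⇒⇌ (cong (λ x → x [ p := ren (wk k l) q ]) (sym (ren-sub χ (liftˢ k l σ) t)))) ⨟
  ⇌-sym (slide-⇌ p (subᔆ τ S) (sub (liftˢ k l σ) t) q) ⨟
  ≡⇒⇌ (cong (λ x → x [ p := q ]) (sym (trans (sub-plug σ S t) (cong (λ Z → plug Z (sub (liftˢ k l σ) t)) e-S))))
  where
  χ : Ren (k + (#ᵘ p + m′)) (l + (#ˡ p + n′)) (#ᵘ p + (k + m′)) (#ˡ p + (l + n′))
  χ = xch k l (#ᵘ p) (#ˡ p)
  e-S : subᔆ σ S ≡ renᔆ (wk (#ᵘ p) (#ˡ p)) (subᔆ τ S)
  e-S = trans (subᔆ-agreeOff (agreeOff (Pull.inᵘ e) (Pull.off-a e)) S o) (sym (renᔆ-subᔆ (wk (#ᵘ p) (#ˡ p)) τ S))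

-- Typing of contra-substitution and equivalence in its second argument

module _ {Δ : UCtx X m} {Γ : LCtx X n} where

  ≈-invol : ∀ {t s A} → Δ ⨾ Γ ⊩ t ≈ s ∶ A → Δ ⨾ Γ ⊩ t ≈ s ∶ A ^⊥ ^⊥
  ≈-invol {t} {s} {A} = subst (Δ ⨾ Γ ⊩ t ≈ s ∶_) (sym (^⊥-involutive A))

  par-≈ : ∀ {t s A B} → Δ ⨾ just A ∷ just B ∷ Γ ⊩ t ≈ s ∶ ⊥ → Δ ⨾ Γ ⊩ ℘ t ≈ ℘ s ∶ (A ^⊥) ⅋ (B ^⊥)
  par-≈ {t} {s} {A} {B} c = par (subst₂ (λ C D → Δ ⨾ just C ∷ just D ∷ Γ ⊩ t ≈ s ∶ ⊥)
    (sym (^⊥-involutive A)) (sym (^⊥-involutive B)) c)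

  whynot-≈ : ∀ {t s A} → A ∷ Δ ⨾ Γ ⊩ t ≈ s ∶ ⊥ → Δ ⨾ Γ ⊩ ¿ t ≈ ¿ s ∶ ¿ (A ^⊥)
  whynot-≈ {t} {s} {A} c = whynot (subst (λ C → C ∷ Δ ⨾ Γ ⊩ t ≈ s ∶ ⊥) (sym (^⊥-involutive A)) c)

  ofcourse-≈ : ∀ {t s A} → Δ ⨾ just A ∷ Γ ⊩ t ≈ s ∶ ⊥ → Δ ⨾ Γ ⊩ ! t ≈ ! s ∶ ! (A ^⊥)
  ofcourse-≈ {t} {s} {A} c = ofcourse (subst (λ C → Δ ⨾ just C ∷ Γ ⊩ t ≈ s ∶ ⊥) (sym (^⊥-involutive A)) c)

  into-elim-≈ : ∀ {p x x′ s s′ A C Δₚ Γₚ} → PatTyping p A Δₚ Γₚ → Δₚ ++ Δ ⨾ Γₚ ++ Γ ⊩ x ≈ x′ ∶ C →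
    Δ ⨾ Γ ⊩ s ≈ s′ ∶ C ^⊥ → Δ ⨾ Γ ⊩ into (elim□ p x) s ≈ into (elim□ p x′) s′ ∶ A ^⊥
  into-elim-≈ pair c d = par-≈ (cut c (≈-ren (TyRen-wk [] (_ ∷ _ ∷ [])) d))
  into-elim-≈ bang c d = whynot-≈ (cut c (≈-ren (TyRen-wk (_ ∷ []) []) d))
  into-elim-≈ unit c d = cut c d

  -- On types, `into` acts as the transpose of `S`: a context from `B` to `A` yields a map from
  -- `A ^⊥` to `B ^⊥`.
  into-≈ : ∀ {k l} {S : Surface m n k l} {Δₛ Γₛ A B} → Δ ⨾ Γ ⊩ᔆ S ∶ Δₛ ⨾ Γₛ ⊢ B ⇒ A →
    ∀ {s s′} → Δ ⨾ Γ ⊩ s ≈ s′ ∶ A ^⊥ → Δₛ ++ Δ ⨾ Γₛ ++ Γ ⊩ into S s ≈ into S s′ ∶ B ^⊥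
  into-≈ ℘□           c = one
  into-≈ ⟨□, d ⟩      c = coapp c (≈-invol (Cong-refl d))
  into-≈ ⟨ d ,□⟩      c = app c (≈-invol (Cong-refl d))
  into-≈ (□• d)       c = tensor (Cong-refl d) c
  into-≈ (d •□)       c = ≈-invol (coapp (Cong-refl d) c)
  into-≈ (□▼ d)       c = tensor c (Cong-refl d)
  into-≈ (d ▼□)       c = ≈-invol (app (Cong-refl d) c)
  into-≈ (□♯ d)       c = Cong-refl d
  into-≈ (d ♯□)       c = ≈-invol (Cong-refl d)
  into-≈ ¿□           c = one
  into-≈ (□[_:=_] {Δₚ = Δₚ} {Γₚ} p d) c = ≈-ren (TyRen-wk Δₚ Γₚ) c
  into-≈ (elim□ p d)  c = into-elim-≈ p (Cong-refl d) c
  into-≈ (d ▸□)       c = ofcourse-≈ (Cong-refl d)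

  wrap-≈ : ∀ {k l} {S : Surface m n k l} {Δₛ Γₛ A B C} → Δ ⨾ Γ ⊩ᔆ S ∶ Δₛ ⨾ Γₛ ⊢ B ⇒ A →
    ∀ {s s′ y y′} → Δ ⨾ Γ ⊩ s ≈ s′ ∶ A ^⊥ → Δₛ ++ Δ ⨾ Γₛ ++ Γ ⊩ y ≈ y′ ∶ C → Δ ⨾ Γ ⊩ wrap S s y ≈ wrap S s′ y′ ∶ C
  wrap-≈ ℘□           c d = elim pair c d
  wrap-≈ ⟨□, _ ⟩      c d = d
  wrap-≈ ⟨ _ ,□⟩      c d = d
  wrap-≈ (□• _)       c d = d
  wrap-≈ (_ •□)       c d = d
  wrap-≈ (□▼ _)       c d = d
  wrap-≈ (_ ▼□)       c d = d
  wrap-≈ (□♯ _)       c d = elim unit c d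
  wrap-≈ (_ ♯□)       c d = elim unit c d
  wrap-≈ ¿□           c d = elim bang c d
  wrap-≈ □[ p := e ]  c d = elim p (Cong-refl e) d
  wrap-≈ (elim□ _ _)  c d = d
  wrap-≈ (_ ▸□)       c d = elim unit c d

-- At a reflexive equivalence this is the typing of contra-substitution, so `contra-ty` takes no
-- induction of its own.
contra-≈ʳ : {Δ : UCtx X m} {Γ : LCtx X n} {A B : Formula X} {a : Fin n} {t s s′ : Term m n} → Surf a t →
  Δ ⨾ Γ ⊩ t ∶ A → Δ ⨾ Γ ⊩ s ≈ s′ ∶ A ^⊥ → lookup Γ a ≡ just B → Δ ⨾ Γ ⊩ contra a t s ≈ contra a t s′ ∶ B ^⊥
contra-≈ʳ {Δ = Δ} {Γ} {s = s} {s′} here (lvar x) c y =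
  subst (λ A → Δ ⨾ Γ ⊩ s ≈ s′ ∶ A ^⊥) (just-injective (trans (sym x) y)) c
contra-≈ʳ {s = s} {s′} (there S o f) d c x with plug-ty⁻ S d
... | plugged {Γₛ = Γₛ} dS dt = subst₂ (Cong Ax _ _ _) (sym (contra-there S o f s)) (sym (contra-there S o f s′))
  (wrap-≈ dS c (contra-≈ʳ f dt (into-≈ dS c) (trans (lookup-++ʳ Γₛ _ _) x)))

-- Contra-substitution respects the axioms in its first argument

elim-0 : ∀ p (y : Term (#ᵘ p + m) (#ˡ p + n)) (r : Term m n) →
  ren (xch 0 0 (#ᵘ p) (#ˡ p)) y [ p := ren (wk 0 0) r ] ≡ y [ p := r ]
elim-0 p y r = cong₂ (elim p) (xch-0 (#ᵘ p) (#ˡ p) y) (ren-id r)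

wrap-slide : ∀ p (S : Surface m n k l) (s : Term m n) (y : Term (k + (#ᵘ p + m)) (l + (#ˡ p + n))) (r : Term m n) →
  wrap (renᔆ (wk (#ᵘ p) (#ˡ p)) S) (ren (wk (#ᵘ p) (#ˡ p)) s) y [ p := r ] ⇌
  wrap S s (ren (xch k l (#ᵘ p) (#ˡ p)) y [ p := ren (wk k l) r ])
wrap-slide p ℘□          s y r = slide-⇌ p □[ pair := s ] y r
wrap-slide p ⟨□, _ ⟩     s y r = ≡⇒⇌ (sym (elim-0 p y r))
wrap-slide p ⟨ _ ,□⟩     s y r = ≡⇒⇌ (sym (elim-0 p y r))
wrap-slide p (□• _)      s y r = ≡⇒⇌ (sym (elim-0 p y r))
wrap-slide p (_ •□)      s y r = ≡⇒⇌ (sym (elim-0 p y r))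
wrap-slide p (□▼ _)      s y r = ≡⇒⇌ (sym (elim-0 p y r))
wrap-slide p (_ ▼□)      s y r = ≡⇒⇌ (sym (elim-0 p y r))
wrap-slide p (□♯ _)      s y r = slide-⇌ p □[ unit := s ] y r
wrap-slide p (_ ♯□)      s y r = slide-⇌ p □[ unit := s ] y r
wrap-slide p ¿□          s y r = slide-⇌ p □[ bang := s ] y r
wrap-slide p □[ q := x ] s y r = slide-⇌ p □[ q := x ] y r
wrap-slide p (elim□ _ _) s y r = ≡⇒⇌ (sym (elim-0 p y r))
wrap-slide p (_ ▸□)      s y r = slide-⇌ p □[ unit := s ] y r

contra-ren-id : (a : Fin n) (r z : Term m n) → contra a (ren (id , id) r) z ⇌ contra a r z
contra-ren-id a r z = ≡⇒⇌ (cong (λ r → contra a r z) (ren-id r))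

-- Either `wrap` adds nothing, or it adds one eliminator and this is `contra-slide` read backwards.
contra-wrap : {a : Fin n} {r : Term m n} → Surf a r → (S : Surface m n k l) (s : Term m n) (z : Term (k + m) (l + n)) →
  wrap S s (contra (l ↑ʳ a) (ren (wk k l) r) z) ⇌ contra a r (wrap S s z)
contra-wrap {a = a} {r} f ℘□          s z = ⇌-sym (contra-slide pair f z s)
contra-wrap {a = a} {r} f ⟨□, _ ⟩     s z = contra-ren-id a r z
contra-wrap {a = a} {r} f ⟨ _ ,□⟩     s z = contra-ren-id a r z
contra-wrap {a = a} {r} f (□• _)      s z = contra-ren-id a r z
contra-wrap {a = a} {r} f (_ •□)      s z = contra-ren-id a r z
contra-wrap {a = a} {r} f (□▼ _)      s z = contra-ren-id a r z
contra-wrap {a = a} {r} f (_ ▼□)      s z = contra-ren-id a r z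
contra-wrap {a = a} {r} f (□♯ _)      s z = ⇌-sym (contra-slide unit f z s)
contra-wrap {a = a} {r} f (_ ♯□)      s z = ⇌-sym (contra-slide unit f z s)
contra-wrap {a = a} {r} f ¿□          s z = ⇌-sym (contra-slide bang f z s)
contra-wrap {a = a} {r} f □[ q := x ] s z = ⇌-sym (contra-slide q f z x)
contra-wrap {a = a} {r} f (elim□ _ _) s z = contra-ren-id a r z
contra-wrap {a = a} {r} f (_ ▸□)      s z = ⇌-sym (contra-slide unit f z s)

module _ (p : Pat) (F : ∀ {m n} → Surface m n (#ᵘ p) (#ˡ p))
         (F-ren : ∀ {m n m′ n′} (ρ : Ren m n m′ n′) → renᔆ ρ F ≡ F) where

  slide-under : ∀ q (s : Term m n) (y : Term (#ᵘ q + (#ᵘ p + m)) (#ˡ q + (#ˡ p + n))) →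
    plug F (y [ q := ren (wk (#ᵘ p) (#ˡ p)) s ]) ⇌ plug F (ren (xch (#ᵘ q) (#ˡ q) (#ᵘ p) (#ˡ p)) y) [ q := s ]
  slide-under q s y =
    ≡⇒⇌ (cong (λ x → plug F (x [ q := ren (wk (#ᵘ p) (#ˡ p)) s ])) (sym (xch-involutive (#ᵘ q) (#ˡ q) (#ᵘ p) (#ˡ p) y))) ⨟
    ⇌-sym (≡⇒⇌ (cong (λ F → plug F (ren (xch (#ᵘ q) (#ˡ q) (#ᵘ p) (#ˡ p)) y) [ q := s ]) (sym (F-ren _))) ⨟ slide-⇌ q F _ s)

  wrap-under : (S : Surface m n k l) (s : Term m n) (y : Term (k + (#ᵘ p + m)) (l + (#ˡ p + n))) →
    plug F (wrap (renᔆ (wk (#ᵘ p) (#ˡ p)) S) (ren (wk (#ᵘ p) (#ˡ p)) s) y) ⇌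
    wrap S s (plug F (ren (xch k l (#ᵘ p) (#ˡ p)) y))
  wrap-under ℘□          s y = slide-under pair s y
  wrap-under ⟨□, _ ⟩     s y = ≡⇒⇌ (cong (plug F) (sym (xch-0 (#ᵘ p) (#ˡ p) y)))
  wrap-under ⟨ _ ,□⟩     s y = ≡⇒⇌ (cong (plug F) (sym (xch-0 (#ᵘ p) (#ˡ p) y)))
  wrap-under (□• _)      s y = ≡⇒⇌ (cong (plug F) (sym (xch-0 (#ᵘ p) (#ˡ p) y)))
  wrap-under (_ •□)      s y = ≡⇒⇌ (cong (plug F) (sym (xch-0 (#ᵘ p) (#ˡ p) y)))
  wrap-under (□▼ _)      s y = ≡⇒⇌ (cong (plug F) (sym (xch-0 (#ᵘ p) (#ˡ p) y)))
  wrap-under (_ ▼□)      s y = ≡⇒⇌ (cong (plug F) (sym (xch-0 (#ᵘ p) (#ˡ p) y)))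
  wrap-under (□♯ _)      s y = slide-under unit s y
  wrap-under (_ ♯□)      s y = slide-under unit s y
  wrap-under ¿□          s y = slide-under bang s y
  wrap-under □[ q := x ] s y = slide-under q x y
  wrap-under (elim□ _ _) s y = ≡⇒⇌ (cong (plug F) (sym (xch-0 (#ᵘ p) (#ˡ p) y)))
  wrap-under (_ ▸□)      s y = slide-under unit s y

  into-under : (S : Surface m n k l) (t : Term (k + (#ᵘ p + m)) (l + (#ˡ p + n))) (s : Term m n) →
    plug F (plug (renᔆ (wk (#ᵘ p) (#ˡ p)) S) t ♯ ren (wk (#ᵘ p) (#ˡ p)) s) ⇌
    wrap S s (plug F (ren (xch k l (#ᵘ p) (#ˡ p)) t ♯ ren (wk (#ᵘ p) (#ˡ p)) (into S s)))
  into-under {k = k} {l} S t s =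
    plug-⇌ F (♯-plug (renᔆ W S) t (ren W s)) ⨟ wrap-under S s (t ♯ into (renᔆ W S) (ren W s)) ⨟
    ≡⇒⇌ (cong (λ x → wrap S s (plug F (ren (xch k l (#ᵘ p) (#ˡ p)) t ♯ x)))
      (trans (cong (ren (xch k l (#ᵘ p) (#ˡ p))) (sym (ren-into W S s))) (xch-wk-inner k l (#ᵘ p) (#ˡ p) (into S s))))
    where
    W : ∀ {m n} → Ren m n (#ᵘ p + m) (#ˡ p + n)
    W = wk (#ᵘ p) (#ˡ p)

  elim-under : ∀ q (t : Term (#ᵘ p + (#ᵘ q + m)) (#ˡ p + (#ˡ q + n))) (r s : Term m n) →
    plug F ((ren (xch (#ᵘ p) (#ˡ p) (#ᵘ q) (#ˡ q)) t [ q := ren (wk (#ᵘ p) (#ˡ p)) r ]) ♯ ren (wk (#ᵘ p) (#ˡ p)) s) ⇌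
    plug F (t ♯ ren (wk (#ᵘ p) (#ˡ p)) (ren (wk (#ᵘ q) (#ˡ q)) s)) [ q := r ]
  elim-under q t r s =
    plug-⇌ F (⇌-sym (slide₀ q (□♯ ren W s) (ren χ t) (ren W r)) ⨟
      ≡⇒⇌ (cong (λ x → (ren χ t ♯ x) [ q := ren W r ]) (sym
        (trans (xch-wk-outer (#ᵘ p) (#ˡ p) (#ᵘ q) (#ˡ q) (ren (wk (#ᵘ q) (#ˡ q)) s)) (ren-wk (#ᵘ q) (#ˡ q) W s))))) ⨟
    ⇌-sym (≡⇒⇌ (cong (λ F → plug F (t ♯ ren W (ren (wk (#ᵘ q) (#ˡ q)) s)) [ q := r ]) (sym (F-ren _))) ⨟ slide-⇌ q F _ r)
    where
    W : ∀ {m n} → Ren m n (#ᵘ p + m) (#ˡ p + n)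
    W = wk (#ᵘ p) (#ˡ p)
    χ : ∀ {m n} → Ren (#ᵘ p + (#ᵘ q + m)) (#ˡ p + (#ˡ q + n)) (#ᵘ q + (#ᵘ p + m)) (#ˡ q + (#ˡ p + n))
    χ = xch (#ᵘ p) (#ˡ p) (#ᵘ q) (#ˡ q)

exchange-0ʳ : ∀ k (i : Fin (k + n)) → exchange k 0 i ≡ i
exchange-0ʳ k i with split k i
... | bound i = exchange-inner k 0 i
... | free i  = exchange-free k 0 i

xch-0ʳ : ∀ k l (t : Term (k + m) (l + n)) → ren (xch k l 0 0) t ≡ t
xch-0ʳ k l t = trans (ren-cong (exchange-0ʳ k , exchange-0ʳ l) t) (ren-id t)

renᔆ-id : (S : Surface m n k l) → renᔆ (id , id) S ≡ S
renᔆ-id S = trans (renᔆ-as-subᔆ (id , id) S) (subᔆ-id S)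

-- For the case where the variable lies in the eliminated term: what reaches it is then the whole of
-- `plug S t`, abstracted over `p`.
into-elim-plug : ∀ p (S : Surface m n k l) (t : Term (k + (#ᵘ p + m)) (l + (#ˡ p + n))) (s : Term m n) →
  into (elim□ p (plug (renᔆ (wk (#ᵘ p) (#ˡ p)) S) t)) s ⇌
  wrap S s (into (elim□ p (ren (xch k l (#ᵘ p) (#ˡ p)) t)) (into S s))
into-elim-plug pair S t s = into-under pair ℘□ (λ _ → refl) S t s
into-elim-plug bang S t s = into-under bang ¿□ (λ _ → refl) S t s
into-elim-plug {k = k} {l} unit S t s = ≡⇒⇌ (cong (λ Z → plug Z t ♯ s) (renᔆ-id S)) ⨟ ♯-plug S t s ⨟
  ≡⇒⇌ (cong (λ x → wrap S s (x ♯ into S s)) (sym (xch-0ʳ k l t)))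

into-elim-elim : ∀ p q (t : Term (#ᵘ p + (#ᵘ q + m)) (#ˡ p + (#ˡ q + n))) (r s : Term m n) →
  into (elim□ p (ren (xch (#ᵘ p) (#ˡ p) (#ᵘ q) (#ˡ q)) t [ q := ren (wk (#ᵘ p) (#ˡ p)) r ])) s ⇌
  into (elim□ p t) (ren (wk (#ᵘ q) (#ˡ q)) s) [ q := r ]
into-elim-elim pair q t r s = elim-under pair ℘□ (λ _ → refl) q t r s
into-elim-elim bang q t r s = elim-under bang ¿□ (λ _ → refl) q t r s
into-elim-elim unit q t r s = ≡⇒⇌ (cong (_♯ s) (elim-0 q t r)) ⨟ ⇌-sym (slide₀ q (□♯ s) t r)

module _ {m n k l : ℕ} (p : Pat) (S : Surface m n k l)
         (t : Term (k + (#ᵘ p + m)) (l + (#ˡ p + n))) (r : Term m n) (a : Fin n) (s : Term m n) where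
  private
    W : ∀ {m n} → Ren m n (#ᵘ p + m) (#ˡ p + n)
    W = wk (#ᵘ p) (#ˡ p)
    χ : Ren (k + (#ᵘ p + m)) (l + (#ˡ p + n)) (#ᵘ p + (k + m)) (#ˡ p + (l + n))
    χ = xch k l (#ᵘ p) (#ˡ p)
    S′ = renᔆ W S
    t′ = ren χ t
    r′ = ren (wk k l) r

  -- With `a` in `t` both sides cross `S` and the eliminator, in opposite orders, and the results
  -- differ by sliding the eliminator across `wrap S s`.
  contra-slide-body : occ (l ↑ʳ (#ˡ p ↑ʳ a)) t ≡ 1 → WellBound t → occᔆ a S ≡ 0 → occ a r ≡ 0 →
    contra a (plug S′ t [ p := r ]) s ⇌ contra a (plug S (t′ [ p := r′ ])) s
  contra-slide-body ot wt oS or =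
    ≡⇒⇌ (trans (contra-there □[ p := r ] or (there S′ oS′ f) s)
      (cong (λ x → x [ p := r ]) (contra-there S′ oS′ f (ren W s)))) ⨟
    wrap-slide p S s (contra (l ↑ʳ (#ˡ p ↑ʳ a)) t (into S′ (ren W s))) r ⨟
    ≡⇒⇌ (sym (trans (contra-there S oS (there □[ p := r′ ] (trans (occ-wk k l a r) or) f′) s)
      (cong (wrap S s) (trans (contra-there □[ p := r′ ] (trans (occ-wk k l a r) or) f′ (into S s))
        (cong (λ x → x [ p := r′ ]) (sym e))))))
    where
    oS′ : occᔆ (#ˡ p ↑ʳ a) S′ ≡ 0
    oS′ = trans (occᔆ-wk (#ᵘ p) (#ˡ p) a S) oS
    f : Surf (l ↑ʳ (#ˡ p ↑ʳ a)) t
    f = surf t ot wt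
    f′ : Surf (#ˡ p ↑ʳ (l ↑ʳ a)) t′
    f′ = surf t′ (trans (occ-slide-free p S t r a) ot) (WB-ren⁺ χ t wt)
    e : ren χ (contra (l ↑ʳ (#ˡ p ↑ʳ a)) t (into S′ (ren W s))) ≡ contra (#ˡ p ↑ʳ (l ↑ʳ a)) t′ (ren W (into S s))
    e = trans (contra-ren χ (subst (Over _ _) (exchange-free l (#ˡ p) a) (Over-exchange l (#ˡ p) _)) t _)
      (cong (contra _ t′) (trans (cong (ren χ) (sym (ren-into W S s))) (xch-wk-inner k l (#ᵘ p) (#ˡ p) (into S s))))

  -- With `a` in `r` the left side enters the eliminator at once and carries all of `S` along. The
  -- right side enters `S` first and leaves a `wrap` outside, which `contra-wrap` pushes into the
  -- argument.
  contra-slide-arg : occ a r ≡ 1 → WellBound r → occ (l ↑ʳ (#ˡ p ↑ʳ a)) t ≡ 0 → occᔆ a S ≡ 0 →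
    contra a (plug S′ t [ p := r ]) s ⇌ contra a (plug S (t′ [ p := r′ ])) s
  contra-slide-arg or wr ot oS =
    ≡⇒⇌ (contra-there (elim□ p (plug S′ t)) (trans (occ-plug (#ˡ p ↑ʳ a) S′ t)
      (+≡0 ot (trans (occᔆ-wk (#ᵘ p) (#ˡ p) a S) oS))) f s) ⨟
    contra-⇌ f (into-elim-plug p S t s) ⨟
    ⇌-sym (contra-wrap f S s (into (elim□ p t′) (into S s))) ⨟
    ≡⇒⇌ (sym (trans (contra-there S oS (there (elim□ p t′) (trans (occ-slide-free p S t r a) ot) f′) s)
      (cong (wrap S s) (contra-there (elim□ p t′) (trans (occ-slide-free p S t r a) ot) f′ (into S s)))))
    where
    f : Surf a r
    f = surf r or wr
    f′ : Surf (l ↑ʳ a) r′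
    f′ = surf r′ (trans (occ-wk k l a r) or) (WB-ren⁺ (wk k l) r wr)

-- The contra-substituted variable lies in the side term x of a surface context
-- whose hole is filled by t.  Seen from x, the surface context is S t.
module _ {m n : ℕ} (p : Pat) (x : Term m n) (r : Term m n) (a : Fin n) (s : Term m n)
         (ox : occ a x ≡ 1) (wx : WellBound x) (or : occ a r ≡ 0) where
  private
    W : ∀ {m n} → Ren m n (#ᵘ p + m) (#ˡ p + n)
    W = wk (#ᵘ p) (#ˡ p)
    f : Surf a x
    f = surf x ox wx
    f′ : Surf (#ˡ p ↑ʳ a) (ren W x)
    f′ = surf (ren W x) (trans (occ-wk (#ᵘ p) (#ˡ p) a x) ox) (WB-ren⁺ W x wx)

  contra-side :
    (S′ : Surface (#ᵘ p + m) (#ˡ p + n) 0 0) (S : Surface m n 0 0) → occᔆ (#ˡ p ↑ʳ a) S′ ≡ 0 → occᔆ a S ≡ 0 →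
    wrap S s (contra a x (into S s)) ⇌
    wrap S′ (ren W s) (contra (#ˡ p ↑ʳ a) (ren W x) (into S′ (ren W s))) [ p := r ] →
    contra a (plug S′ (ren W x) [ p := r ]) s ⇌ contra a (plug S x) s
  contra-side S′ S oS′ oS e =
    ≡⇒⇌ (trans (contra-there □[ p := r ] or (there S′ oS′ f′) s)
      (cong (λ x → x [ p := r ]) (contra-there S′ oS′ f′ (ren W s)))) ⨟
    ⇌-sym e ⨟ ≡⇒⇌ (sym (contra-there S oS f s))

-- A variable that occurs once lies in the body `t`, in the eliminated term `r` or in a side term of
-- `S`; one lemma covers each position.
contra-Ax-slide : ∀ p (S : Surface m n k l) (t : Term (k + (#ᵘ p + m)) (l + (#ˡ p + n))) (r : Term m n)
  (a : Fin n) (s : Term m n) → let S′ = renᔆ (wk (#ᵘ p) (#ˡ p)) S in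
  occ a (plug S′ t [ p := r ]) ≡ 1 → WellBound (plug S′ t [ p := r ]) →
  contra a (plug S′ t [ p := r ]) s ⇌
  contra a (plug S (ren (xch k l (#ᵘ p) (#ˡ p)) t [ p := ren (wk k l) r ])) s

contra-slide-side : ∀ p (S : Surface m n k l) (t : Term (k + (#ᵘ p + m)) (l + (#ˡ p + n))) (r : Term m n)
  (a : Fin n) (s : Term m n) → let S′ = renᔆ (wk (#ᵘ p) (#ˡ p)) S in
  occᔆ a S ≡ 1 → WBᔆ S → occ (l ↑ʳ (#ˡ p ↑ʳ a)) t ≡ 0 → occ a r ≡ 0 →
  contra a (plug S′ t [ p := r ]) s ⇌
  contra a (plug S (ren (xch k l (#ᵘ p) (#ˡ p)) t [ p := ren (wk k l) r ])) s

contra-Ax-slide {k = k} {l} p S t r a s o (_ , w , v) with +≡1 (occ (#ˡ p ↑ʳ a) (plug (renᔆ (wk (#ᵘ p) (#ˡ p)) S) t)) o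
... | inj₂ (o₁ , o₂) = contra-slide-arg p S t r a s o₂ v
  (m+n≡0⇒m≡0 _ (trans (sym (occ-plug (#ˡ p ↑ʳ a) (renᔆ (wk (#ᵘ p) (#ˡ p)) S) t)) o₁))
  (trans (sym (occᔆ-wk (#ᵘ p) (#ˡ p) a S))
    (m+n≡0⇒n≡0 (occ (l ↑ʳ (#ˡ p ↑ʳ a)) t) (trans (sym (occ-plug (#ˡ p ↑ʳ a) (renᔆ (wk (#ᵘ p) (#ˡ p)) S) t)) o₁)))
... | inj₁ (o₁ , o₂) with +≡1 (occ (l ↑ʳ (#ˡ p ↑ʳ a)) t) (trans (sym (occ-plug (#ˡ p ↑ʳ a) (renᔆ (wk (#ᵘ p) (#ˡ p)) S) t)) o₁)
... | inj₁ (o₃ , o₄) = contra-slide-body p S t r a s o₃ (proj₁ (proj₂ (WB-plug⁻ (renᔆ (wk (#ᵘ p) (#ˡ p)) S) w)))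
  (trans (sym (occᔆ-wk (#ᵘ p) (#ˡ p) a S)) o₄) o₂
... | inj₂ (o₃ , o₄) = contra-slide-side p S t r a s (trans (sym (occᔆ-wk (#ᵘ p) (#ˡ p) a S)) o₄)
  (WBᔆ-ren⁻ _ (↑ʳ-injective (#ˡ p)) S (proj₂ (proj₂ (WB-plug⁻ (renᔆ (wk (#ᵘ p) (#ˡ p)) S) w)))) o₃ o₂

module _ {m n : ℕ} (p : Pat) (t : Term (#ᵘ p + m) (#ˡ p + n)) (x : Term m n) (r : Term m n) (a : Fin n)
         (f : Surf a x) where
  private
    W : ∀ {m n} → Ren m n (#ᵘ p + m) (#ˡ p + n)
    W = wk (#ᵘ p) (#ˡ p)

  contra-side-pass : (F : Surface m n 0 0) →
    contra a x (plug F (ren (xch 0 0 (#ᵘ p) (#ˡ p)) t [ p := ren (wk 0 0) r ])) ⇌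
    contra (#ˡ p ↑ʳ a) (ren W x) (plug (renᔆ W F) t) [ p := r ]
  contra-side-pass F = contra-slide-pass p f _ r
    (≡⇒⇌ (cong (plug F) (elim-0 p t r)) ⨟ ⇌-sym (slide₀ p F t r))

  contra-side-turn : ∀ s →
    contra a x (ren (xch 0 0 (#ᵘ p) (#ˡ p)) t [ p := ren (wk 0 0) r ]) [ unit := s ] ⇌
    contra (#ˡ p ↑ʳ a) (ren W x) t [ unit := ren W s ] [ p := r ]
  contra-side-turn s = elim-⇌ unit (contra-slide-pass p f t r (≡⇒⇌ (elim-0 p t r))) ⇌-refl ⨟
    ⇌-sym (slide₀ p □[ unit := s ] (contra (#ˡ p ↑ʳ a) (ren W x) t) r)

occ-elim-0 : ∀ p (t : Term (#ᵘ p + m) (#ˡ p + n)) (r : Term m n) {a : Fin n} → occ (#ˡ p ↑ʳ a) t ≡ 0 → occ a r ≡ 0 →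
  occ a (ren (xch 0 0 (#ᵘ p) (#ˡ p)) t [ p := ren (wk 0 0) r ]) ≡ 0
occ-elim-0 p t r {a} ot or = trans (cong (occ a) (elim-0 p t r)) (+≡0 ot or)

contra-slide-side p ℘□ t r a s () w ot or
contra-slide-side p ¿□ t r a s () w ot or
contra-slide-side p ⟨□, x ⟩ t r a s o w ot or =
  contra-side p x r a s o w or ⟨ t ,□⟩ ⟨ _ ,□⟩ ot (occ-elim-0 p t r ot or)
    (contra-side-pass p t x r a (surf x o w) (s •□))
contra-slide-side p ⟨ x ,□⟩ t r a s o w ot or =
  contra-side p x r a s o w or ⟨□, t ⟩ ⟨□, _ ⟩ ot (occ-elim-0 p t r ot or)
    (contra-side-pass p t x r a (surf x o w) (s ▼□))
contra-slide-side p (□• x) t r a s o w ot or =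
  contra-side p x r a s o w or (t •□) (_ •□) ot (occ-elim-0 p t r ot or)
    (contra-side-pass p t x r a (surf x o w) (□▼ s))
contra-slide-side p (x •□) t r a s o w ot or =
  contra-side p x r a s o w or (□• t) (□• _) ot (occ-elim-0 p t r ot or)
    (contra-side-pass p t x r a (surf x o w) ⟨□, s ⟩)
contra-slide-side p (□▼ x) t r a s o w ot or =
  contra-side p x r a s o w or (t ▼□) (_ ▼□) ot (occ-elim-0 p t r ot or)
    (contra-side-pass p t x r a (surf x o w) (□• s))
contra-slide-side p (x ▼□) t r a s o w ot or =
  contra-side p x r a s o w or (□▼ t) (□▼ _) ot (occ-elim-0 p t r ot or)
    (contra-side-pass p t x r a (surf x o w) ⟨ s ,□⟩)
contra-slide-side p (□♯ x) t r a s o w ot or =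
  contra-side p x r a s o w or (t ♯□) (_ ♯□) ot (occ-elim-0 p t r ot or)
    (contra-side-turn p t x r a (surf x o w) s)
contra-slide-side p (x ♯□) t r a s o w ot or =
  contra-side p x r a s o w or (□♯ t) (□♯ _) ot (occ-elim-0 p t r ot or)
    (contra-side-turn p t x r a (surf x o w) s)
contra-slide-side p □[ q := x ] t r a s o w ot or =
  contra-side p x r a s o w or (elim□ q t) (elim□ q _) ot
    (+≡0 (trans (occ-slide-free p □[ q := x ] t r a) ot) (trans (occ-wk (#ᵘ q) (#ˡ q) a r) or))
    (contra-slide-pass p (surf x o w) _ r (into-elim-elim q p t r s))
-- `x` is the body of the eliminator on `q` and `t` its argument. On both sides `t` stays behind as
-- that argument, which makes this an instance of `contra-slide-turn`.
contra-slide-side p (elim□ q x) t r a s o (_ , w) ot or =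
  ≡⇒⇌ (trans (contra-there □[ p := r ] or (there □[ q := t ] ot f′) s)
    (cong (λ y → y [ p := r ]) (contra-there □[ q := t ] ot f′ (ren W s)))) ⨟
  ≡⇒⇌ (cong (λ y → contra (#ˡ q ↑ʳ (#ˡ p ↑ʳ a)) x′ y [ q := t ] [ p := r ]) (sym (ren-wk (#ᵘ q) (#ˡ q) W s))) ⨟
  ⇌-sym (contra-slide-turn p q a x (ren (wk (#ᵘ q) (#ˡ q)) s) t r) ⨟
  ≡⇒⇌ (cong (λ y → contra (#ˡ q ↑ʳ a) x (ren (wk (#ᵘ q) (#ˡ q)) s) [ q := y ]) (sym (elim-0 p t r))) ⨟
  ≡⇒⇌ (sym (contra-there □[ q := _ ] (occ-elim-0 p t r ot or) (surf x o w) s))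
  where
  W : ∀ {m n} → Ren m n (#ᵘ p + m) (#ˡ p + n)
  W = wk (#ᵘ p) (#ˡ p)
  x′ = ren (liftᴿ (#ᵘ q) (#ˡ q) W) x
  f′ : Surf (#ˡ q ↑ʳ (#ˡ p ↑ʳ a)) x′
  f′ = surf x′ (trans (occ-ren (liftᴿ (#ᵘ q) (#ˡ q) W) (Over-free (#ˡ q) (Over-wk (#ˡ p))) x) o) (WB-ren⁺ _ x w)
contra-slide-side p (x ▸□) t r a s o (_ , f , _) ot or = contradiction (subst (0 <_) (sym o) (s≤s z≤n)) (f a)

contra-ty : {Δ : UCtx X m} {Γ : LCtx X n} {A B : Formula X} {a : Fin n} {t s : Term m n} → Surf a t →
  Δ ⨾ Γ ⊩ t ∶ A → Δ ⨾ Γ ⊩ s ∶ A ^⊥ → lookup Γ a ≡ just B → Δ ⨾ Γ ⊩ contra a t s ∶ B ^⊥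
contra-ty f d e x = Cong-tyˡ (contra-≈ʳ f d (Cong-refl e) x)

contra-unit-slide : {a : Fin n} {t : Term m n} → Surf a t → (s q : Term m n) →
  contra a t s [ unit := q ] ⇌ contra a t (s [ unit := q ])
contra-unit-slide {a = a} {t} f s q = elim-⇌ unit (⇌-sym (contra-ren-id a t s)) ⇌-refl ⨟ ⇌-sym (contra-slide unit f s q)

elim-unit-slide : ∀ p (y : Term (#ᵘ p + m) (#ˡ p + n)) (r s : Term m n) →
  y [ p := r ] [ unit := s ] ⇌ y [ unit := ren (wk (#ᵘ p) (#ˡ p)) s ] [ p := r ]
elim-unit-slide p y r s = ≡⇒⇌ (cong (λ r → y [ p := r ] [ unit := s ]) (sym (ren-id r))) ⨟
  slide-⇌ unit □[ p := r ] y s ⨟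
  ≡⇒⇌ (cong (λ y → y [ unit := ren (wk (#ᵘ p) (#ˡ p)) s ] [ p := r ]) (xch-0ʳ (#ᵘ p) (#ˡ p) y))

contra-unit : {a : Fin n} {t : Term m n} → Surf a t → {r : Term m n} → occ a r ≡ 0 → (s : Term m n) →
  contra a (t [ unit := r ]) s ≡ contra a t s [ unit := r ]
contra-unit {a = a} {t} f {r} o s = trans (contra-there □[ unit := r ] o f s)
  (cong (λ y → contra a t y [ unit := r ]) (ren-id s))

-- The eliminator slides onto the argument `⋆`, where `unit-swap` and `unit-⋆` turn it into `s`.
contra-⋆-unit : {Δ : UCtx X m} {Γ : LCtx X n} {a : Fin n} {B : Formula X} → lookup Γ a ≡ just B →
  ∀ {t s} → Surf a t → Δ ⨾ Γ ⊩ t ∶ ⊥ → Δ ⨾ Γ ⊩ s ∶ 𝟙 →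
  Δ ⨾ Γ ⊩ contra a t ⋆ [ unit := s ] ≈ contra a t s ∶ B ^⊥
contra-⋆-unit x f d e = to (contra-unit-slide f ⋆ _) (elim unit e (contra-ty f d one x)) ⊙
  contra-≈ʳ f d (⋆-unit-≈ e) x

module _ {X : Set} {m n : ℕ} {Δ : UCtx X m} {Γ : LCtx X n} {a : Fin n} {B : Formula X} (x : lookup Γ a ≡ just B) where

  contra-unit-swap : ∀ {t r s} → Surf a t → occ a r ≡ 0 → Δ ⨾ Γ ⊩ t ∶ 𝟙 → Δ ⨾ Γ ⊩ r ∶ 𝟙 → Δ ⨾ Γ ⊩ s ∶ ⊥ →
    Δ ⨾ Γ ⊩ contra a (t [ unit := r ]) s ≈ contra a (r [ unit := t ]) s ∶ B ^⊥
  contra-unit-swap {t} {r} {s} f o d e g = subst₂ (Cong Ax Δ Γ _)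
    (sym (contra-unit f o s)) (sym (contra-there (elim□ unit r) o f s))
    (to (contra-unit-slide f s r) (elim unit e (contra-ty f d g x)) ⊙
     contra-≈ʳ f d (unit-♯-≈ g e ⊙ to (comm-⇌ s r) (cut g e)) x)

  -- For `comm`, `•-♯`, `▼-♯` and `▸-♯` the two contra-substitutions are the same term. In most of
  -- the other cases a unit eliminator is left at different places, and sliding it makes up for the
  -- difference.
  contra-Ax : ∀ {A t t′ s} → Ax A t t′ → Δ ⨾ Γ ⊩ t ∶ A → occ a t ≡ 1 → WellBound t → Δ ⨾ Γ ⊩ s ∶ A ^⊥ →
    Δ ⨾ Γ ⊩ contra a t s ≈ contra a t′ s ∶ B ^⊥
  contra-Ax {s = s} (slide {r = r} p S {t}) d o w e =
    to (contra-Ax-slide p S t r a s o w) (contra-ty (surf _ o w) d e x)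
  contra-Ax {s = s} (unit-⋆ {t}) d@(elim unit _ dt) o w@(_ , wt , _) e =
    to (≡⇒⇌ (contra-unit f refl s) ⨟ unit-⋆-⇌ _) (contra-ty (surf _ o w) d e x)
    where f = surf t (trans (sym (+-identityʳ _)) o) wt
  contra-Ax (unit-swap {t} {r}) (elim unit dr dt) o (_ , wt , wr) e with +≡1 (occ a t) o
  ... | inj₁ (ot , or) = contra-unit-swap (surf t ot wt) or dt dr e
  ... | inj₂ (ot , or) = Cong-sym (contra-unit-swap (surf r or wr) ot dr dt e)
  contra-Ax {s = s} (comm {t} {r}) d o w@(wt , wr) e = ≡⇒≈ eq (contra-ty (surf _ o w) d e x)
    where
    eq : contra a (t ♯ r) s ≡ contra a (r ♯ t) s
    eq with +≡1 (occ a t) o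
    ... | inj₁ (ot , or) = trans (contra-there (□♯ r) or f s) (sym (contra-there (r ♯□) or f s))
      where f = surf t ot wt
    ... | inj₂ (ot , or) = trans (contra-there (t ♯□) ot f s) (sym (contra-there (□♯ t) ot f s))
      where f = surf r or wr
  contra-Ax {s = s} (⋆-♯ {t}) (cut one d) o (_ , w) e =
    subst (λ y → Δ ⨾ Γ ⊩ y ≈ contra a t s ∶ B ^⊥) (sym (contra-there (⋆ ♯□) refl f s)) (contra-⋆-unit x f d e)
    where f = surf t o w
  contra-Ax {s = s} (•-♯ {t} {q} {r}) d o w@((wt , wq) , wr) e = ≡⇒≈ eq (contra-ty (surf _ o w) d e x)
    where
    eq : contra a ((t • q) ♯ r) s ≡ contra a (t ♯ ⟨ q , r ⟩) s
    eq with +≡1 (occ a t + occ a q) o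
    ... | inj₂ (otq , or) = trans (contra-there ((t • q) ♯□) otq f s)
      (sym (trans (contra-there (t ♯□) (m+n≡0⇒m≡0 _ otq) (there ⟨ q ,□⟩ oq f) s)
        (cong (λ y → y [ unit := s ]) (contra-there ⟨ q ,□⟩ oq f t))))
      where
      f  = surf r or wr
      oq = m+n≡0⇒n≡0 (occ a t) otq
    ... | inj₁ (otq , or) with +≡1 (occ a t) otq
    ... | inj₁ (ot , oq) = trans (contra-there (□♯ r) or (there (□• q) oq f) s)
      (trans (cong (λ y → y [ unit := s ]) (contra-there (□• q) oq f r))
        (sym (contra-there (□♯ ⟨ q , r ⟩) (+≡0 oq or) f s)))
      where f = surf t ot wt
    ... | inj₂ (ot , oq) = trans (contra-there (□♯ r) or (there (t •□) ot f) s)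
      (trans (cong (λ y → y [ unit := s ]) (trans (contra-there (t •□) ot f r) (sym (contra-there ⟨□, r ⟩ or f t))))
        (sym (contra-there (t ♯□) ot (there ⟨□, r ⟩ or f) s)))
      where f = surf q oq wq
  contra-Ax {s = s} (▼-♯ {t} {q} {r}) d o w@((wt , wq) , wr) e = ≡⇒≈ eq (contra-ty (surf _ o w) d e x)
    where
    eq : contra a ((t ▼ q) ♯ r) s ≡ contra a (t ♯ ⟨ r , q ⟩) s
    eq with +≡1 (occ a t + occ a q) o
    ... | inj₂ (otq , or) = trans (contra-there ((t ▼ q) ♯□) otq f s)
      (sym (trans (contra-there (t ♯□) (m+n≡0⇒m≡0 _ otq) (there ⟨□, q ⟩ oq f) s)
        (cong (λ y → y [ unit := s ]) (contra-there ⟨□, q ⟩ oq f t))))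
      where
      f  = surf r or wr
      oq = m+n≡0⇒n≡0 (occ a t) otq
    ... | inj₁ (otq , or) with +≡1 (occ a t) otq
    ... | inj₁ (ot , oq) = trans (contra-there (□♯ r) or (there (□▼ q) oq f) s)
      (trans (cong (λ y → y [ unit := s ]) (contra-there (□▼ q) oq f r))
        (sym (contra-there (□♯ ⟨ r , q ⟩) (+≡0 or oq) f s)))
      where f = surf t ot wt
    ... | inj₂ (ot , oq) = trans (contra-there (□♯ r) or (there (t ▼□) ot f) s)
      (trans (cong (λ y → y [ unit := s ]) (trans (contra-there (t ▼□) ot f r) (sym (contra-there ⟨ r ,□⟩ or f t))))
        (sym (contra-there (t ♯□) ot (there ⟨ r ,□⟩ or f) s)))
      where f = surf q oq wq
  contra-Ax {s = s} (℘-♯ {t} {r}) (cut (par {A = A} {C} d) dr) o ((_ , wt) , wr) e with +≡1 (occ (2 ↑ʳ a) t) o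
  ... | inj₁ (ot , or) = subst₂ (Cong Ax Δ Γ _)
    (sym (trans (contra-there (□♯ r) or (there ℘□ refl f) s) (cong (λ y → y [ unit := s ]) (contra-there ℘□ refl f r))))
    (sym (contra-there □[ pair := r ] or f s))
    (to (elim-unit-slide pair (contra (2 ↑ʳ a) t ⋆) r s) (elim unit e (elim pair dr (contra-ty f d one x))) ⊙
     elim pair (Cong-refl dr) (contra-⋆-unit x f d (ren-ty⁺ (TyRen-wk [] (just (A ^⊥) ∷ just (C ^⊥) ∷ [])) e)))
    where f = surf t ot wt
  ... | inj₂ (ot , or) = subst₂ (Cong Ax Δ Γ _)
    (sym (contra-there ((℘ t) ♯□) ot f s)) (sym (contra-there (elim□ pair t) ot f s))
    -- The unit eliminator travels to `℘ t`, goes below its binder and becomes a cut of the body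
    -- against `s`.
    (to (contra-unit-slide f (℘ t) s) (elim unit e (contra-ty f dr (Cong-tyˡ (≈-invol (Cong-refl (par d)))) x)) ⊙
     contra-≈ʳ f dr (≈-invol
       (to (slide-⇌ unit ℘□ t s ⨟ ≡⇒⇌ (cong (λ y → ℘ (y [ unit := ren (wk 0 2) s ])) (xch-0ʳ 0 2 t))) (elim unit e (par d)) ⊙
        par (unit-♯-≈ d (ren-ty⁺ (TyRen-wk [] (_ ∷ _ ∷ [])) e)))) x)
    where f = surf r or wr
  contra-Ax {s = s} (¿-♯ {t} {r}) (cut (whynot {A = A} d) dr) o (wt , wr) e with +≡1 (occ a t) o
  ... | inj₁ (ot , or) = subst₂ (Cong Ax Δ Γ _)
    (sym (trans (contra-there (□♯ r) or (there ¿□ refl f) s) (cong (λ y → y [ unit := s ]) (contra-there ¿□ refl f r))))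
    (sym (contra-there □[ bang := r ] or f s))
    (to (elim-unit-slide bang (contra a t ⋆) r s) (elim unit e (elim bang dr (contra-ty f d one x))) ⊙
     elim bang (Cong-refl dr) (contra-⋆-unit x f d (ren-ty⁺ (TyRen-wk (A ^⊥ ∷ []) []) e)))
    where f = surf t ot wt
  ... | inj₂ (ot , or) = subst₂ (Cong Ax Δ Γ _)
    (sym (contra-there ((¿ t) ♯□) ot f s)) (sym (contra-there (elim□ bang t) ot f s))
    (to (contra-unit-slide f (¿ t) s) (elim unit e (contra-ty f dr (Cong-tyˡ (≈-invol (Cong-refl (whynot d)))) x)) ⊙
     contra-≈ʳ f dr (≈-invol
       (to (slide-⇌ unit ¿□ t s ⨟ ≡⇒⇌ (cong (λ y → ¿ (y [ unit := ren (wk 1 0) s ])) (xch-0ʳ 1 0 t))) (elim unit e (whynot d)) ⊙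
        whynot (unit-♯-≈ d (ren-ty⁺ (TyRen-wk (_ ∷ []) []) e)))) x)
    where f = surf r or wr
  contra-Ax {s = s} (▸-♯ {y} {r}) d o w@(_ , g , _ , wr) e = ≡⇒≈
    (trans (contra-there (y ▸□) oy f s) (sym (contra-there (□♯ (! y)) oy f s))) (contra-ty (surf _ o w) d e x)
    where
    oy : occ (suc a) y ≡ 0
    oy = occ≡0 {t = y} (g a)
    f : Surf a r
    f = surf r (trans (cong (_+ occ a r) (sym oy)) o) wr

-- Both arguments vary at once because `contra` moves the sibling of the subterm containing `a` into
-- its second argument, and that sibling may have been rewritten too.
contra-≈ : {Δ : UCtx X m} {Γ : LCtx X n} {A B : Formula X} {a : Fin n} {t t′ s s′ : Term m n} → lookup Γ a ≡ just B →
  Δ ⨾ Γ ⊩ t ≈ t′ ∶ A → occ a t ≡ 1 → WellBound t → Δ ⨾ Γ ⊩ s ≈ s′ ∶ A ^⊥ →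
  Δ ⨾ Γ ⊩ contra a t s ≈ contra a t′ s′ ∶ B ^⊥

contra-≈-plug : {Δ : UCtx X m} {Γ : LCtx X n} {B : Formula X} {a : Fin n} {s s′ : Term m n}
  (S S′ : Surface m n k l) (t t′ : Term (k + m) (l + n)) → occᔆ a S ≡ 0 → occᔆ a S ≡ occᔆ a S′ →
  occ (l ↑ʳ a) t ≡ 1 → occ (l ↑ʳ a) t ≡ occ (l ↑ʳ a) t′ →
  Δ ⨾ Γ ⊩ wrap S s (contra (l ↑ʳ a) t (into S s)) ≈ wrap S′ s′ (contra (l ↑ʳ a) t′ (into S′ s′)) ∶ B →
  Δ ⨾ Γ ⊩ contra a (plug S t) s ≈ contra a (plug S′ t′) s′ ∶ B
contra-≈-plug {l = l} {a = a} {s} {s′} S S′ t t′ o e i f c = subst₂ (Cong Ax _ _ _)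
  (sym (contra-plug a S t s (subst (0 <_) (sym i) (s≤s z≤n)) o))
  (sym (contra-plug a S′ t′ s′ (subst (0 <_) (trans (sym i) f) (s≤s z≤n)) (trans (sym e) o))) c

contra-≈ {a = a} x (tensor {t} {t′} {r} {r′} c d) o (wt , wr) e with +≡1 (occ a t) o
... | inj₁ (ot , or) = contra-≈-plug ⟨□, r ⟩ ⟨□, r′ ⟩ t t′ or (≈-occ d a) ot (≈-occ c a)
  (contra-≈ x c ot wt (coapp e (≈-invol d)))
... | inj₂ (ot , or) = contra-≈-plug ⟨ t ,□⟩ ⟨ t′ ,□⟩ r r′ ot (≈-occ c a) or (≈-occ d a)
  (contra-≈ x d or wr (app e (≈-invol c)))
contra-≈ {a = a} x (elim {p} {t} {t′} {r} {r′} {Δₚ = Δₚ} {Γₚ} q d c) o (_ , wt , wr) e with +≡1 (occ (#ˡ p ↑ʳ a) t) o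
... | inj₁ (ot , or) = contra-≈-plug □[ p := r ] □[ p := r′ ] t t′ or (≈-occ d a) ot (≈-occ c _)
  (elim q d (contra-≈ (trans (lookup-++ʳ Γₚ _ _) x) c ot wt (≈-ren (TyRen-wk Δₚ Γₚ) e)))
... | inj₂ (ot , or) = contra-≈-plug (elim□ p t) (elim□ p t′) r r′ ot (≈-occ c _) or (≈-occ d a)
  (contra-≈ x d or wr (into-elim-≈ q c e))
contra-≈ x (par {t} {t′} c) o (_ , wt) e = contra-≈-plug ℘□ ℘□ t t′ refl refl o (≈-occ c _) (elim pair e (contra-≈ x c o wt one))
contra-≈ {a = a} x (app {t} {t′} {r} {r′} c d) o (wt , wr) e with +≡1 (occ a t) o
... | inj₁ (ot , or) = contra-≈-plug (□• r) (□• r′) t t′ or (≈-occ d a) ot (≈-occ c a) (contra-≈ x c ot wt (tensor d e))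
... | inj₂ (ot , or) = contra-≈-plug (t •□) (t′ •□) r r′ ot (≈-occ c a) or (≈-occ d a)
  (contra-≈ x d or wr (≈-invol (coapp c e)))
contra-≈ {a = a} x (coapp {t} {t′} {r} {r′} c d) o (wt , wr) e with +≡1 (occ a t) o
... | inj₁ (ot , or) = contra-≈-plug (□▼ r) (□▼ r′) t t′ or (≈-occ d a) ot (≈-occ c a) (contra-≈ x c ot wt (tensor e d))
... | inj₂ (ot , or) = contra-≈-plug (t ▼□) (t′ ▼□) r r′ ot (≈-occ c a) or (≈-occ d a)
  (contra-≈ x d or wr (≈-invol (app c e)))
contra-≈ {a = a} x (ofcourse c) o (_ , g , _) e = contradiction (subst (0 <_) (sym o) (s≤s z≤n)) (g a)
contra-≈ x (whynot {t} {t′} c) o wt e = contra-≈-plug ¿□ ¿□ t t′ refl refl o (≈-occ c _) (elim bang e (contra-≈ x c o wt one))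
contra-≈ {a = a} x (elim-whynot {t} {t′} {r} {r′} d c) o (_ , g , _ , wr) e =
  contra-≈-plug (t ▸□) (t′ ▸□) r r′ ot (≈-occ c _) or (≈-occ d a) (elim unit e (contra-≈ x d or wr (ofcourse-≈ c)))
  where
  ot : occ (suc a) t ≡ 0
  ot = occ≡0 {t = t} (g a)
  or : occ a r ≡ 1
  or = trans (cong (_+ occ a r) (sym ot)) o
contra-≈ {a = a} x (cut {t} {t′} {r} {r′} c d) o (wt , wr) e with +≡1 (occ a t) o
... | inj₁ (ot , or) = contra-≈-plug (□♯ r) (□♯ r′) t t′ or (≈-occ d a) ot (≈-occ c a) (elim unit e (contra-≈ x c ot wt d))
... | inj₂ (ot , or) = contra-≈-plug (t ♯□) (t′ ♯□) r r′ ot (≈-occ c a) or (≈-occ d a)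
  (elim unit e (contra-≈ x d or wr (≈-invol c)))
contra-≈ {a = a} x (lvar {b} y) o w e = contra-≈ʳ (surf _ o w) (lvar y) e x
contra-≈ x (fwd r d d′) o w e = contra-≈ʳ (surf _ o w) d e x ⊙ contra-Ax x r d o w (Cong-tyʳ e)
contra-≈ {a = a} x (bwd r d d′) o w e =
  Cong-sym (contra-Ax x r d o′ w′ (Cong-tyˡ e)) ⊙ contra-≈ʳ (surf _ o′ w′) d e x
  where
  o′ = trans (Ax-occ r a) o
  w′ = Ax-WB⁻ r w
contra-≈ {a = a} x (c ⊙ d) o w e = contra-≈ x c o w e ⊙
  contra-≈ x d (trans (sym (≈-occ c a)) o) (≈-WB c w) (Cong-refl (Cong-tyʳ e))

-- Heads: the eliminations of a value

data Head (m n : ℕ) : Set where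
  -- □ • r and □ ▼ r
  appᴴ    : Bool → Term m n → Head m n
  -- □ ♯ ⟨ s , r ⟩
  tensorᴴ : Term m n → Term m n → Head m n
  pairᴴ   : Term m (2 + n) → Head m n
  bangᴴ   : Term (1 + m) n → Head m n
  whynotᴴ : Term m (1 + n) → Head m n
  -- x ♯ □
  cutᴴ    : Term m n → Head m n

renᴴ : Ren m n m′ n′ → Head m n → Head m′ n′
renᴴ ρ (appᴴ d r)    = appᴴ d (ren ρ r)
renᴴ ρ (tensorᴴ s r) = tensorᴴ (ren ρ s) (ren ρ r)
renᴴ ρ (pairᴴ t)     = pairᴴ (ren (liftᴿ 0 2 ρ) t)
renᴴ ρ (bangᴴ t)     = bangᴴ (ren (liftᴿ 1 0 ρ) t)
renᴴ ρ (whynotᴴ t)   = whynotᴴ (ren (liftᴿ 0 1 ρ) t)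
renᴴ ρ (cutᴴ x)      = cutᴴ (ren ρ x)

-- Substitutes r for the variable 0 (for •) or 1 (for ▼); the other becomes 0.
appˢ : Bool → Term m n → Sub m (2 + n) m (1 + n)
appˢ {m} {n} d r = uvar , f d
  where
  f : Bool → Fin (2 + n) → Term m (1 + n)
  f true  zero          = ren (wk 0 1) r
  f true  (suc a)       = lvar a
  f false zero          = lvar zero
  f false (suc zero)    = ren (wk 0 1) r
  f false (suc (suc a)) = lvar (suc a)

pairˢ : Term m n → Term m n → Sub m (2 + n) m n
pairˢ {m} {n} s r = uvar , f
  where
  f : Fin (2 + n) → Term m n
  f zero          = s
  f (suc zero)    = r
  f (suc (suc a)) = lvar a

infix 4 _∣_↘_

-- H ∣ v L ↘ y L when the head H meets the value v and they reduce to y.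
data _∣_↘_ {m n : ℕ} : Head m n → Term m n → Term m n → Set where
  app-℘    : ∀ {d r t} → appᴴ d r ∣ ℘ t ↘ sub (appˢ d r) t ⟪\\⋆⟫
  tensor-℘ : ∀ {s r t} → tensorᴴ s r ∣ ℘ t ↘ sub (pairˢ s r) t
  pair-⟨⟩  : ∀ {s r t} → pairᴴ t ∣ ⟨ s , r ⟩ ↘ sub (pairˢ s r) t
  bang-!   : ∀ {s t} → bangᴴ t ∣ ! s ↘ t [ s ⟪\\⋆⟫ ]ᵘ
  whynot-¿ : ∀ {s t} → whynotᴴ t ∣ ¿ s ↘ s [ t ⟪\\⋆⟫ ]ᵘ
  -- A cut peels its right side first. The value found there becomes a head for the left side, whose
  -- eliminators end up inside those of the right one, in the order of `_↦_`.
  cut-⟨⟩   : ∀ {x s r y} → tensorᴴ s r ∣ x ↘ y → cutᴴ x ∣ ⟨ s , r ⟩ ↘ y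
  cut-℘    : ∀ {x t y} → pairᴴ t ∣ x ↘ y → cutᴴ x ∣ ℘ t ↘ y
  cut-!    : ∀ {x t y} → whynotᴴ t ∣ x ↘ y → cutᴴ x ∣ ! t ↘ y
  cut-¿    : ∀ {x t y} → bangᴴ t ∣ x ↘ y → cutᴴ x ∣ ¿ t ↘ y
  peel     : ∀ p {H t s y} → renᴴ (wk (#ᵘ p) (#ˡ p)) H ∣ t ↘ y → H ∣ t [ p := s ] ↘ y [ p := s ]

renᴴ-renᴴ : (ρ′ : Ren m′ n′ m″ n″) (ρ : Ren m n m′ n′) (H : Head m n) → renᴴ ρ′ (renᴴ ρ H) ≡ renᴴ (ρ′ ∘ᴿ ρ) H
renᴴ-renᴴ ρ′ ρ (appᴴ d r)    = cong (appᴴ d) (ren-ren ρ′ ρ r)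
renᴴ-renᴴ ρ′ ρ (tensorᴴ s r) = cong₂ tensorᴴ (ren-ren ρ′ ρ s) (ren-ren ρ′ ρ r)
renᴴ-renᴴ ρ′ ρ (pairᴴ t)     = cong pairᴴ (ren-ren-lift 0 2 ρ′ ρ t)
renᴴ-renᴴ ρ′ ρ (bangᴴ t)     = cong bangᴴ (ren-ren-lift 1 0 ρ′ ρ t)
renᴴ-renᴴ ρ′ ρ (whynotᴴ t)   = cong whynotᴴ (ren-ren-lift 0 1 ρ′ ρ t)
renᴴ-renᴴ ρ′ ρ (cutᴴ x)      = cong cutᴴ (ren-ren ρ′ ρ x)

renᴴ-cong : {ρ ρ′ : Ren m n m′ n′} → ρ ≗ᴿ ρ′ → (H : Head m n) → renᴴ ρ H ≡ renᴴ ρ′ H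
renᴴ-cong e (appᴴ d r)    = cong (appᴴ d) (ren-cong e r)
renᴴ-cong e (tensorᴴ s r) = cong₂ tensorᴴ (ren-cong e s) (ren-cong e r)
renᴴ-cong e (pairᴴ t)     = cong pairᴴ (ren-cong (liftᴿ-cong 0 2 e) t)
renᴴ-cong e (bangᴴ t)     = cong bangᴴ (ren-cong (liftᴿ-cong 1 0 e) t)
renᴴ-cong e (whynotᴴ t)   = cong whynotᴴ (ren-cong (liftᴿ-cong 0 1 e) t)
renᴴ-cong e (cutᴴ x)      = cong cutᴴ (ren-cong e x)

renᴴ-wk : ∀ k l (ρ : Ren m n m′ n′) (H : Head m n) → renᴴ (liftᴿ k l ρ) (renᴴ (wk k l) H) ≡ renᴴ (wk k l) (renᴴ ρ H)
renᴴ-wk k l ρ H = trans (renᴴ-renᴴ _ _ H) (trans (renᴴ-cong (liftᴿ-wk k l ρ) H) (sym (renᴴ-renᴴ _ _ H)))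

ren-appˢ : (ρ : Ren m n m′ n′) (d : Bool) (r : Term m n) (t : Term m (2 + n)) →
  ren (liftᴿ 0 1 ρ) (sub (appˢ d r) t) ≡ sub (appˢ d (ren ρ r)) (ren (liftᴿ 0 2 ρ) t)
ren-appˢ ρ d r t = trans (ren-sub _ _ t) (trans (sub-cong ((λ _ → refl) , e d) t) (sym (sub-ren _ _ t)))
  where
  e : ∀ d a → ren (liftᴿ 0 1 ρ) (proj₂ (appˢ d r) a) ≡ proj₂ (appˢ d (ren ρ r)) (lift 2 (proj₂ ρ) a)
  e true  zero          = ren-wk 0 1 ρ r
  e true  (suc zero)    = refl
  e true  (suc (suc a)) = refl
  e false zero          = refl
  e false (suc zero)    = ren-wk 0 1 ρ r
  e false (suc (suc a)) = refl

ren-pairˢ : (ρ : Ren m n m′ n′) (s r : Term m n) (t : Term m (2 + n)) →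
  ren ρ (sub (pairˢ s r) t) ≡ sub (pairˢ (ren ρ s) (ren ρ r)) (ren (liftᴿ 0 2 ρ) t)
ren-pairˢ ρ s r t = trans (ren-sub _ _ t) (trans (sub-cong ((λ _ → refl) , e) t) (sym (sub-ren _ _ t)))
  where
  e : ∀ a → ren ρ (proj₂ (pairˢ s r) a) ≡ proj₂ (pairˢ (ren ρ s) (ren ρ r)) (lift 2 (proj₂ ρ) a)
  e zero          = refl
  e (suc zero)    = refl
  e (suc (suc a)) = refl

ren-substˡ : (ρ : Ren m n m′ n′) (t : Term m (suc n)) (r : Term m n) →
  ren ρ (t [ r ]ˡ) ≡ ren (liftᴿ 0 1 ρ) t [ ren ρ r ]ˡ
ren-substˡ ρ t r = trans (ren-sub _ _ t)
  (trans (sub-cong ((λ _ → refl) , λ { zero → refl ; (suc a) → refl }) t) (sym (sub-ren _ _ t)))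

ren-substᵘ : (ρ : Ren m n m′ n′) (t : Term (suc m) n) (r : Term m n) →
  ren ρ (t [ r ]ᵘ) ≡ ren (liftᴿ 1 0 ρ) t [ ren ρ r ]ᵘ
ren-substᵘ ρ t r = trans (ren-sub _ _ t)
  (trans (sub-cong ((λ { zero → refl ; (suc a) → refl }) , λ _ → refl) t) (sym (sub-ren _ _ t)))

ren-⟪⟫ : (ρ : Ren m n m′ n′) (t : Term m (suc n)) → ren ρ (t ⟪\\⋆⟫) ≡ ren (liftᴿ 0 1 ρ) t ⟪\\⋆⟫
ren-⟪⟫ ρ t = trans (ren-substˡ ρ (contra zero t ⋆) ⋆)
  (cong (_[ ⋆ ]ˡ) (contra-ren (liftᴿ 0 1 ρ) (Over-bound 1 (proj₂ ρ) zero) t ⋆))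

wk-substˡ : (t r : Term m n) → ren (wk 0 1) t [ r ]ˡ ≡ t
wk-substˡ t r = trans (sub-ren _ _ t) (sub-id t)

↘-ren⁺ : (ρ : Ren m n m′ n′) → ∀ {H t y} → H ∣ t ↘ y → renᴴ ρ H ∣ ren ρ t ↘ ren ρ y
↘-ren⁺ ρ (app-℘ {d} {r} {t}) = subst (_ ∣ _ ↘_)
  (sym (trans (ren-⟪⟫ ρ (sub (appˢ d r) t)) (cong _⟪\\⋆⟫ (ren-appˢ ρ d r t)))) app-℘
↘-ren⁺ ρ (tensor-℘ {s} {r} {t}) = subst (_ ∣ _ ↘_) (sym (ren-pairˢ ρ s r t)) tensor-℘
↘-ren⁺ ρ (pair-⟨⟩ {s} {r} {t}) = subst (_ ∣ _ ↘_) (sym (ren-pairˢ ρ s r t)) pair-⟨⟩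
↘-ren⁺ ρ (bang-! {s} {t}) = subst (_ ∣ _ ↘_)
  (sym (trans (ren-substᵘ ρ t (s ⟪\\⋆⟫)) (cong (ren (liftᴿ 1 0 ρ) t [_]ᵘ) (ren-⟪⟫ ρ s)))) bang-!
↘-ren⁺ ρ (whynot-¿ {s} {t}) = subst (_ ∣ _ ↘_)
  (sym (trans (ren-substᵘ ρ s (t ⟪\\⋆⟫)) (cong (ren (liftᴿ 1 0 ρ) s [_]ᵘ) (ren-⟪⟫ ρ t)))) whynot-¿
↘-ren⁺ ρ (cut-⟨⟩ r) = cut-⟨⟩ (↘-ren⁺ ρ r)
↘-ren⁺ ρ (cut-℘ r) = cut-℘ (↘-ren⁺ ρ r)
↘-ren⁺ ρ (cut-! r) = cut-! (↘-ren⁺ ρ r)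
↘-ren⁺ ρ (cut-¿ r) = cut-¿ (↘-ren⁺ ρ r)
↘-ren⁺ ρ (peel p {H} {t} {s} {y} r) = peel p
  (subst (_∣ ren (liftᴿ (#ᵘ p) (#ˡ p) ρ) t ↘ ren (liftᴿ (#ᵘ p) (#ˡ p) ρ) y) (renᴴ-wk (#ᵘ p) (#ˡ p) ρ H) (↘-ren⁺ _ r))

-- Renaming changes neither the shape of the head nor that of the term, so the same rules apply
-- before it.
↘-ren⁻ : (ρ : Ren m n m′ n′) (H : Head m n) (t : Term m n) → ∀ {y} →
  renᴴ ρ H ∣ ren ρ t ↘ y → ∃[ y′ ] (H ∣ t ↘ y′ × y ≡ ren ρ y′)
↘-ren⁻ ρ (appᴴ d r) (℘ t) app-℘ = _ , app-℘ ,
  sym (trans (ren-⟪⟫ ρ (sub (appˢ d r) t)) (cong _⟪\\⋆⟫ (ren-appˢ ρ d r t)))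
↘-ren⁻ ρ (tensorᴴ s r) (℘ t) tensor-℘ = _ , tensor-℘ , sym (ren-pairˢ ρ s r t)
↘-ren⁻ ρ (pairᴴ t) ⟨ s , r ⟩ pair-⟨⟩ = _ , pair-⟨⟩ , sym (ren-pairˢ ρ s r t)
↘-ren⁻ ρ (bangᴴ t) (! s) bang-! = _ , bang-! ,
  sym (trans (ren-substᵘ ρ t (s ⟪\\⋆⟫)) (cong (ren (liftᴿ 1 0 ρ) t [_]ᵘ) (ren-⟪⟫ ρ s)))
↘-ren⁻ ρ (whynotᴴ t) (¿ s) whynot-¿ = _ , whynot-¿ ,
  sym (trans (ren-substᵘ ρ s (t ⟪\\⋆⟫)) (cong (ren (liftᴿ 1 0 ρ) s [_]ᵘ) (ren-⟪⟫ ρ t)))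
↘-ren⁻ ρ (cutᴴ x) ⟨ s , r ⟩ (cut-⟨⟩ c) with ↘-ren⁻ ρ (tensorᴴ s r) x c
... | y , c′ , e = y , cut-⟨⟩ c′ , e
↘-ren⁻ ρ (cutᴴ x) (℘ t) (cut-℘ c) with ↘-ren⁻ ρ (pairᴴ t) x c
... | y , c′ , e = y , cut-℘ c′ , e
↘-ren⁻ ρ (cutᴴ x) (! t) (cut-! c) with ↘-ren⁻ ρ (whynotᴴ t) x c
... | y , c′ , e = y , cut-! c′ , e
↘-ren⁻ ρ (cutᴴ x) (¿ t) (cut-¿ c) with ↘-ren⁻ ρ (bangᴴ t) x c
... | y , c′ , e = y , cut-¿ c′ , e
↘-ren⁻ ρ H (t [ p := s ]) (peel _ {y = y} c)
  with ↘-ren⁻ (liftᴿ (#ᵘ p) (#ˡ p) ρ) (renᴴ (wk (#ᵘ p) (#ˡ p)) H) t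
    (subst (_∣ ren (liftᴿ (#ᵘ p) (#ˡ p) ρ) t ↘ y) (sym (renᴴ-wk (#ᵘ p) (#ˡ p) ρ H)) c)
... | y′ , c′ , e = y′ [ p := s ] , peel p c′ , cong (λ y → y [ p := ren ρ s ]) e

-- The substitutions that contract redexes

record Block (k l k′ l′ : ℕ) {m n : ℕ} (σ : Sub (k + m) (l + n) (k′ + m) (l′ + n)) : Set where
  constructor block
  field
    outerᵘ : ∀ u → proj₁ σ (k ↑ʳ u) ≡ uvar (k′ ↑ʳ u)
    outerˡ : ∀ a → proj₂ σ (l ↑ʳ a) ≡ lvar (l′ ↑ʳ a)

Block-wk : ∀ k l k′ l′ {σ : Sub (k + m) (l + n) (k′ + m) (l′ + n)} → Block k l k′ l′ σ →
  ∀ t → sub σ (ren (wk k l) t) ≡ ren (wk k′ l′) t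
Block-wk k l k′ l′ (block e f) t = trans (sub-ren _ _ t) (trans (sub-cong (e , f) t) (sym (ren-as-sub _ t)))

-- A substitution for the inner block commutes with bringing an outer block inside. The instances
-- are the substitutions that contract redexes, when the body is an eliminator that has slid below
-- the binder of the redex.
Block-xch : ∀ j j′ k l k′ l′ {σ : Sub (k + m) (l + n) (k′ + m) (l′ + n)}
  {σ⁺ : Sub (k + (j + m)) (l + (j′ + n)) (k′ + (j + m)) (l′ + (j′ + n))} →
  Block k l k′ l′ σ → Block k l k′ l′ σ⁺ →
  (∀ i → proj₁ σ⁺ (i ↑ˡ (j + m)) ≡ ren (liftᴿ k′ l′ (wk j j′)) (proj₁ σ (i ↑ˡ m))) →
  (∀ i → proj₂ σ⁺ (i ↑ˡ (j′ + n)) ≡ ren (liftᴿ k′ l′ (wk j j′)) (proj₂ σ (i ↑ˡ n))) →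
  ∀ t → sub (liftˢ j j′ σ) (ren (xch k l j j′) t) ≡ ren (xch k′ l′ j j′) (sub σ⁺ t)
Block-xch {m} {n} j j′ k l k′ l′ {σ} {σ⁺} (block e f) (block e⁺ f⁺) b c t =
  trans (sub-ren _ _ t) (trans (sub-cong (eᵘ , eˡ) t) (sym (ren-sub _ _ t)))
  where
  W : ∀ {m n} → Ren m n (j + m) (j′ + n)
  W = wk j j′
  L = liftˢ j j′ σ
  χ : Ren (k′ + (j + m)) (l′ + (j′ + n)) (j + (k′ + m)) (j′ + (l′ + n))
  χ = xch k′ l′ j j′
  eᵘ : ∀ u → proj₁ L (exchange k j u) ≡ ren χ (proj₁ σ⁺ u)
  eᵘ u with split k u
  ... | bound i = trans (cong (proj₁ L) (exchange-inner k j i)) (trans (liftˢ-freeᵘ j j′ σ _)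
    (sym (trans (cong (ren χ) (b i)) (xch-wk-inner k′ l′ j j′ _))))
  ... | free y with split j y
  ... | bound i = trans (cong (proj₁ L) (exchange-outer k j i)) (trans (liftˢ-boundᵘ j j′ σ i)
    (sym (trans (cong (ren χ) (e⁺ _)) (cong uvar (exchange-outer k′ j i)))))
  ... | free z  = trans (cong (proj₁ L) (exchange-free k j z)) (trans (liftˢ-freeᵘ j j′ σ _)
    (trans (cong (ren W) (e z)) (sym (trans (cong (ren χ) (e⁺ _)) (cong uvar (exchange-free k′ j z))))))
  eˡ : ∀ a → proj₂ L (exchange l j′ a) ≡ ren χ (proj₂ σ⁺ a)
  eˡ a with split l a
  ... | bound i = trans (cong (proj₂ L) (exchange-inner l j′ i)) (trans (liftˢ-freeˡ j j′ σ _)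
    (sym (trans (cong (ren χ) (c i)) (xch-wk-inner k′ l′ j j′ _))))
  ... | free y with split j′ y
  ... | bound i = trans (cong (proj₂ L) (exchange-outer l j′ i)) (trans (liftˢ-boundˡ j j′ σ i)
    (sym (trans (cong (ren χ) (f⁺ _)) (cong lvar (exchange-outer l′ j′ i)))))
  ... | free z  = trans (cong (proj₂ L) (exchange-free l j′ z)) (trans (liftˢ-freeˡ j j′ σ _)
    (trans (cong (ren W) (f z)) (sym (trans (cong (ren χ) (f⁺ _)) (cong lvar (exchange-free l′ j′ z))))))

appˢ-block : ∀ d (r : Term m n) → Block 0 2 0 1 (appˢ d r)
appˢ-block true  r = block (λ _ → refl) (λ _ → refl)
appˢ-block false r = block (λ _ → refl) (λ _ → refl)

appˢ-elim : ∀ p d (r : Term m n) (t : Term (#ᵘ p + m) (2 + (#ˡ p + n))) (q : Term m n) →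
  sub (appˢ d r) (ren (xch 0 2 (#ᵘ p) (#ˡ p)) t [ p := ren (wk 0 2) q ]) ≡
  ren (xch 0 1 (#ᵘ p) (#ˡ p)) (sub (appˢ d (ren (wk (#ᵘ p) (#ˡ p)) r)) t) [ p := ren (wk 0 1) q ]
appˢ-elim {m = m} {n = n} p d r t q = cong₂ (elim p)
  (Block-xch (#ᵘ p) (#ˡ p) 0 2 0 1 (appˢ-block d r) (appˢ-block d (ren (wk (#ᵘ p) (#ˡ p)) r)) (λ ()) (e d) t)
  (Block-wk 0 2 0 1 (appˢ-block d r) q)
  where
  e : ∀ d (i : Fin 2) → proj₂ (appˢ d (ren (wk (#ᵘ p) (#ˡ p)) r)) (i ↑ˡ (#ˡ p + n)) ≡
    ren (liftᴿ 0 1 (wk (#ᵘ p) (#ˡ p))) (proj₂ (appˢ d r) (i ↑ˡ n))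
  e true  zero       = sym (ren-wk 0 1 (wk (#ᵘ p) (#ˡ p)) r)
  e true  (suc zero) = refl
  e false zero       = refl
  e false (suc zero) = sym (ren-wk 0 1 (wk (#ᵘ p) (#ˡ p)) r)

pairˢ-elim : ∀ p (s r : Term m n) (t : Term (#ᵘ p + m) (2 + (#ˡ p + n))) (q : Term m n) →
  sub (pairˢ s r) (ren (xch 0 2 (#ᵘ p) (#ˡ p)) t [ p := ren (wk 0 2) q ]) ≡
  sub (pairˢ (ren (wk (#ᵘ p) (#ˡ p)) s) (ren (wk (#ᵘ p) (#ˡ p)) r)) t [ p := q ]
pairˢ-elim p s r t q = trans (cong₂ (elim p)
  (Block-xch (#ᵘ p) (#ˡ p) 0 2 0 0 {pairˢ s r} {pairˢ _ _} (block (λ _ → refl) (λ _ → refl)) (block (λ _ → refl) (λ _ → refl))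
    (λ ()) (λ { zero → refl ; (suc zero) → refl }) t)
  (Block-wk 0 2 0 0 {pairˢ s r} (block (λ _ → refl) (λ _ → refl)) q)) (elim-0 p _ q)

substᵘ-elim : ∀ p (r : Term m n) (t : Term (1 + (#ᵘ p + m)) (#ˡ p + n)) (q : Term m n) →
  (ren (xch 1 0 (#ᵘ p) (#ˡ p)) t [ p := ren (wk 1 0) q ]) [ r ]ᵘ ≡ t [ ren (wk (#ᵘ p) (#ˡ p)) r ]ᵘ [ p := q ]
substᵘ-elim p r t q = trans (cong₂ (elim p)
  (Block-xch (#ᵘ p) (#ˡ p) 1 0 0 0 {insertAt uvar zero r , lvar} {insertAt uvar zero _ , lvar}
    (block (λ _ → refl) (λ _ → refl)) (block (λ _ → refl) (λ _ → refl)) (λ { zero → refl }) (λ ()) t)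
  (Block-wk 1 0 0 0 {insertAt uvar zero r , lvar} (block (λ _ → refl) (λ _ → refl)) q)) (elim-0 p _ q)

-- An equation, not just an equivalence, because `contra` descends into the body of an eliminator
-- and leaves the eliminator in place.
⟪⟫-elim : ∀ p (t : Term (#ᵘ p + m) (1 + (#ˡ p + n))) (q : Term m n) → zero ∈fv t →
  (ren (xch 0 1 (#ᵘ p) (#ˡ p)) t [ p := ren (wk 0 1) q ]) ⟪\\⋆⟫ ≡ t ⟪\\⋆⟫ [ p := q ]
⟪⟫-elim {m} {n} p t q i = trans (cong _[ ⋆ ]ˡ
    (trans (contra-plug zero □[ p := ren (wk 0 1) q ] (ren χ t) ⋆ (∈fv-ren χ o t i) (occ-wk-bound 0 1 zero q))
      (cong (λ x → x [ p := ren (wk 0 1) q ]) (sym (contra-ren χ o t ⋆)))))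
  (trans (cong₂ (elim p)
    (Block-xch (#ᵘ p) (#ˡ p) 0 1 0 0 {uvar , insertAt lvar zero ⋆} {uvar , insertAt lvar zero ⋆}
      (block (λ _ → refl) (λ _ → refl)) (block (λ _ → refl) (λ _ → refl)) (λ ()) (λ { zero → refl }) (contra zero t ⋆))
    (wk-substˡ q ⋆)) (cong (λ x → x [ p := q ]) (xch-0 (#ᵘ p) (#ˡ p) (t ⟪\\⋆⟫))))
  where
  χ : Ren (#ᵘ p + m) (1 + (#ˡ p + n)) (#ᵘ p + m) (#ˡ p + (1 + n))
  χ = xch 0 1 (#ᵘ p) (#ˡ p)
  o : Over (proj₂ χ) zero (#ˡ p ↑ʳ zero)
  o = subst (Over _ _) (exchange-inner 1 (#ˡ p) zero) (Over-exchange 1 (#ˡ p) zero)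

other : Bool → Fin (2 + n)
other true  = suc zero
other false = zero

arg : Bool → Fin (2 + n)
arg true  = zero
arg false = suc zero

appˢ-keeps : ∀ d (r : Term m n) → Keeps (other d) zero (appˢ d r)
appˢ-keeps true r = keeps refl (λ { zero _ → occ-wk-bound 0 1 zero r
  ; (suc zero) f → contradiction refl f ; (suc (suc _)) _ → refl }) (λ _ → refl)
appˢ-keeps false r = keeps refl (λ { zero f → contradiction refl f
  ; (suc zero) _ → occ-wk-bound 0 1 zero r ; (suc (suc _)) _ → refl }) (λ _ → refl)

-- `closed` protects boxes: an unrestricted variable may occur in a box, and its image must not
-- bring in a linear variable.
record WBSub {m n m′ n′ : ℕ} (σ : Sub m n m′ n′) : Set where
  constructor wbSub
  field
    wbᵘ : ∀ u → WellBound (proj₁ σ u)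
    wbˡ : ∀ a → WellBound (proj₂ σ a)
    closed : ∀ u a → occ a (proj₁ σ u) ≡ 0

WBSub-lift : ∀ k l {σ : Sub m n m′ n′} → WBSub σ → WBSub (liftˢ k l σ)
WBSub-lift {n′ = n′} k l {σ} (wbSub e f g) = wbSub eᵘ eˡ c
  where
  eᵘ : ∀ u → WellBound (proj₁ (liftˢ k l σ) u)
  eᵘ u with split k u
  ... | bound i rewrite liftˢ-boundᵘ k l σ i = tt
  ... | free u  rewrite liftˢ-freeᵘ k l σ u = WB-ren⁺ (wk k l) (proj₁ σ u) (e u)
  eˡ : ∀ a → WellBound (proj₂ (liftˢ k l σ) a)
  eˡ a with split l a
  ... | bound i rewrite liftˢ-boundˡ k l σ i = tt
  ... | free a  rewrite liftˢ-freeˡ k l σ a = WB-ren⁺ (wk k l) (proj₂ σ a) (f a)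
  c : ∀ u a → occ a (proj₁ (liftˢ k l σ) u) ≡ 0
  c u a with split k u
  ... | bound i rewrite liftˢ-boundᵘ k l σ i = refl
  ... | free u  rewrite liftˢ-freeᵘ k l σ u with split l a
  ... | bound i = occ-wk-bound k l i (proj₁ σ u)
  ... | free b  = trans (occ-wk k l b (proj₁ σ u)) (g u b)

boxed-sub : {σ : Sub m n m′ n′} → WBSub σ → (t : Term m (suc n)) →
  (∀ a → ¬ (suc a ∈fv t)) → ∀ a → ¬ (suc a ∈fv sub (liftˢ 0 1 σ) t)
boxed-sub {m′ = m′} {σ = σ} e t f a a∈ = contradiction (subst (0 <_) (occ-sub-0 t (notFree closed′ images)) a∈) λ ()
  where
  closed′ : ∀ u → occ (suc a) (proj₁ (liftˢ 0 1 σ) u) ≡ 0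
  closed′ u = WBSub.closed (WBSub-lift 0 1 e) u (suc a)
  images : ∀ c → c ∈fv t → occ (suc a) (proj₂ (liftˢ 0 1 σ) c) ≡ 0
  images zero    _  = refl
  images (suc c) c∈ = contradiction c∈ (f c)

WB-sub : {σ : Sub m n m′ n′} → WBSub σ → (t : Term m n) → WellBound t → WellBound (sub σ t)
WB-sub e (lvar a)       w           = WBSub.wbˡ e a
WB-sub e (uvar u)       w           = WBSub.wbᵘ e u
WB-sub e ⟨ t , s ⟩      (w , v)     = WB-sub e t w , WB-sub e s v
WB-sub {σ = σ} e (t [ p := s ]) (o , w , v) =
  (λ i → trans (occ-sub (Keeps-bound (#ᵘ p) (#ˡ p) σ i) t) (o i)) , WB-sub (WBSub-lift (#ᵘ p) (#ˡ p) e) t w , WB-sub e s v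
WB-sub {σ = σ} e (℘ t)  (o , w)     =
  (λ i → trans (occ-sub (Keeps-bound 0 2 σ i) t) (o i)) , WB-sub (WBSub-lift 0 2 e) t w
WB-sub e (t • s)        (w , v)     = WB-sub e t w , WB-sub e s v
WB-sub e (t ▼ s)        (w , v)     = WB-sub e t w , WB-sub e s v
WB-sub {σ = σ} e (! t)  (o , f , w) =
  trans (occ-sub (Keeps-bound 0 1 σ zero) t) o , boxed-sub e t f , WB-sub (WBSub-lift 0 1 e) t w
WB-sub e (¿ t)          w           = WB-sub (WBSub-lift 1 0 e) t w
WB-sub {σ = σ} e (t ▸ s) (o , f , w , v) =
  trans (occ-sub (Keeps-bound 0 1 σ zero) t) o , boxed-sub e t f , WB-sub (WBSub-lift 0 1 e) t w , WB-sub e s v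
WB-sub e (t ♯ s)        (w , v)     = WB-sub e t w , WB-sub e s v
WB-sub e ⋆              w           = tt

appˢ-WB : ∀ d {r : Term m n} → WellBound r → WBSub (appˢ d r)
appˢ-WB true  {r} w = wbSub (λ _ → tt) (λ { zero → WB-ren⁺ _ r w ; (suc _) → tt }) (λ _ _ → refl)
appˢ-WB false {r} w = wbSub (λ _ → tt) (λ { zero → tt ; (suc zero) → WB-ren⁺ _ r w ; (suc (suc _)) → tt }) (λ _ _ → refl)

other-occ : ∀ d {t : Term m (2 + n)} → (∀ (i : Fin 2) → occ (i ↑ˡ n) t ≡ 1) → occ (other d) t ≡ 1
other-occ true  o = o (suc zero)
other-occ false o = o zero

arg-occ : ∀ d {t : Term m (2 + n)} → (∀ (i : Fin 2) → occ (i ↑ˡ n) t ≡ 1) → occ (arg d) t ≡ 1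
arg-occ true  o = o zero
arg-occ false o = o (suc zero)

appˢ-occ : ∀ d (r : Term m n) {t : Term m (2 + n)} → (∀ (i : Fin 2) → occ (i ↑ˡ n) t ≡ 1) →
  occ zero (sub (appˢ d r) t) ≡ 1
appˢ-occ d r {t} o = trans (occ-sub (appˢ-keeps d r) t) (other-occ d {t} o)

-- Obtained by counting. With identity substitutions, `♯-contra` relates `t ♯ s` to
-- `contra a t s ♯ lvar a`. Equivalent terms have equal counts, `a` occurs once on the left, and the
-- displayed variable accounts for it on the right.
contra-occ : {Δ : UCtx X m} {Γ : LCtx X n} {A B : Formula X} {a : Fin n} {t s : Term m n} → lookup Γ a ≡ just B →
  Surf a t → Δ ⨾ Γ ⊩ t ∶ A → Δ ⨾ Γ ⊩ s ∶ A ^⊥ → occ a s ≡ 0 → occ a (contra a t s) ≡ 0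
contra-occ {m = m} {a = a} {t} {s} x f d e o = Nat.suc-injective (begin
  suc (occ a (contra a t s))                  ≡⟨ +-comm 1 _ ⟩
  occ a (contra a t s) + 1                    ≡⟨ cong (occ a (contra a t s) +_) (occ-lvar-≡ {m} a) ⟨
  occ a (contra a t s ♯ lvar a)               ≡⟨ ≈-occ c a ⟨
  occ a (t ♯ s)                               ≡⟨ cong₂ _+_ (Surf-occ f) o ⟩
  1                                           ∎)
  where
  open ≡-Reasoning
  c : _ ⨾ _ ⊩ t ♯ s ≈ contra a t s ♯ lvar a ∶ ⊥
  c = to (≡⇒⇌ (cong₂ _♯_ (sym (sub-id t)) (sym (sub-id s))) ⨟
    ♯-contra f {idˢ} {idˢ} (agreeOff (λ _ → refl) (λ _ _ → refl)) s ⨟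
    ≡⇒⇌ (cong (_♯ lvar a) (sub-id (contra a t s)))) (cut d e)

⟪⟫-≈ : {Δ : UCtx X m} {Γ : LCtx X n} {B : Formula X} {t t′ : Term m (suc n)} →
  Δ ⨾ just B ∷ Γ ⊩ t ≈ t′ ∶ ⊥ → occ zero t ≡ 1 → WellBound t → Δ ⨾ Γ ⊩ t ⟪\\⋆⟫ ≈ t′ ⟪\\⋆⟫ ∶ B ^⊥
⟪⟫-≈ {t = t} c o w = ≈-sub (tySub (λ _ → uvar refl) λ
  -- Variable 0 is the one to be removed. By `contra-occ` it no longer occurs, so its dummy image
  -- `⋆` needs no type.
  { zero a∈ _ → contradiction (subst (0 <_) (contra-occ refl (surf t o w) (Cong-tyˡ c) one refl) a∈) λ ()
  ; (suc a) _ x → lvar x }) (contra-≈ refl c o w one)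

pairˢ-≈ : {Δ : UCtx X m} {Γ : LCtx X n} {A B : Formula X} {s s′ r r′ : Term m n} →
  Δ ⨾ Γ ⊩ s ≈ s′ ∶ A → Δ ⨾ Γ ⊩ r ≈ r′ ∶ B → ≈Sub (pairˢ s r) (pairˢ s′ r′) Δ (just A ∷ just B ∷ Γ) Δ Γ
pairˢ-≈ c d = ≈sub (λ _ → uvar refl) λ { zero refl → c ; (suc zero) refl → d ; (suc (suc a)) x → lvar x }

substᵘ-≈ : {Δ : UCtx X m} {Γ : LCtx X n} {A : Formula X} {r r′ : Term m n} → Δ ⨾ Γ ⊩ r ≈ r′ ∶ A →
  ≈Sub (insertAt uvar zero r , lvar) (insertAt uvar zero r′ , lvar) (A ∷ Δ) Γ Δ Γ
substᵘ-≈ c = ≈sub (λ { zero → c ; (suc u) → uvar refl }) (λ a x → lvar x)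

argᵀ otherᵀ : Bool → Formula X → Formula X → Formula X
argᵀ   true  A B = A
argᵀ   false A B = B
otherᵀ true  A B = B
otherᵀ false A B = A

appˢ-≈ : ∀ d {Δ : UCtx X m} {Γ : LCtx X n} {A B : Formula X} {r r′ : Term m n} → Δ ⨾ Γ ⊩ r ≈ r′ ∶ argᵀ d A B →
  ≈Sub (appˢ d r) (appˢ d r′) Δ (just A ∷ just B ∷ Γ) Δ (just (otherᵀ d A B) ∷ Γ)
appˢ-≈ true  c = ≈sub (λ _ → uvar refl)
  λ { zero refl → ≈-ren (TyRen-wk [] (_ ∷ [])) c ; (suc zero) refl → lvar refl ; (suc (suc a)) x → lvar x }
appˢ-≈ false c = ≈sub (λ _ → uvar refl)
  λ { zero refl → lvar refl ; (suc zero) refl → ≈-ren (TyRen-wk [] (_ ∷ [])) c ; (suc (suc a)) x → lvar x }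

app-reduct-≈ : ∀ d {Δ : UCtx X m} {Γ : LCtx X n} {A B : Formula X} {r r′ : Term m n} {t t′ : Term m (2 + n)} →
  Δ ⨾ Γ ⊩ r ≈ r′ ∶ argᵀ d A B → WellBound r → Δ ⨾ just A ∷ just B ∷ Γ ⊩ t ≈ t′ ∶ ⊥ → WellBound (℘ t) →
  Δ ⨾ Γ ⊩ sub (appˢ d r) t ⟪\\⋆⟫ ≈ sub (appˢ d r′) t′ ⟪\\⋆⟫ ∶ otherᵀ d A B ^⊥
app-reduct-≈ d {r = r} {t = t} c v e (o , w) =
  ⟪⟫-≈ (sub-≈² (appˢ-≈ d c) e) (appˢ-occ d r {t} o) (WB-sub (appˢ-WB d v) t w)

-- Contraction puts the argument of an application, with its eliminator, at the variable `arg d`.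
-- That variable is in surface position, so `sub-pull` brings the eliminator to the root of the
-- body, and `⟪⟫-elim` takes it through the contra-substitution.
app-pull : ∀ p d {Δ : UCtx X m} {Γ : LCtx X n} {A B : Formula X}
  {r : Term (#ᵘ p + m) (#ˡ p + n)} {q : Term m n} {t : Term m (2 + n)} →
  Δ ⨾ Γ ⊩ r [ p := q ] ∶ argᵀ d A B → WellBound (r [ p := q ]) → Δ ⨾ just A ∷ just B ∷ Γ ⊩ t ∶ ⊥ → WellBound (℘ t) →
  Δ ⨾ Γ ⊩ sub (appˢ d (r [ p := q ])) t ⟪\\⋆⟫ ≈
    sub (appˢ d r) (ren (liftᴿ 0 2 (wk (#ᵘ p) (#ˡ p))) t) ⟪\\⋆⟫ [ p := q ] ∶ otherᵀ d A B ^⊥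
app-pull {m = m} {n = n} p d {r = r} {q} {t} dr wr dt (o , w) = subst (Cong Ax _ _ _ (sub (appˢ d (r [ p := q ])) t ⟪\\⋆⟫))
  (⟪⟫-elim p (sub (appˢ d r) t′) q (subst (0 <_) (sym (appˢ-occ d r {t′} (bound-ren⁺ 0 2 W {t} o))) (s≤s z≤n)))
  (⟪⟫-≈ (to pulled (Cong-tyˡ (sub-≈ (appˢ-≈ d (Cong-refl dr)) dt)))
    (appˢ-occ d (r [ p := q ]) {t} o) (WB-sub (appˢ-WB d {r [ p := q ]} wr) t w))
  where
  W : Ren m n (#ᵘ p + m) (#ˡ p + n)
  W = wk (#ᵘ p) (#ˡ p)
  t′ = ren (liftᴿ 0 2 W) t
  -- The variable `other d` is still free in the substituted body; `χ` puts the block of `p` inside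
  -- it.
  χ : Ren (#ᵘ p + m) (1 + (#ˡ p + n)) (#ᵘ p + m) (#ˡ p + (1 + n))
  χ = xch 0 1 (#ᵘ p) (#ˡ p)
  σ : Sub m (2 + n) (#ᵘ p + m) (#ˡ p + (1 + n))
  σ = χ ʳ∘ˢ (appˢ d r ˢ∘ʳ liftᴿ 0 2 W)
  uvars : ∀ u → ren χ (uvar (#ᵘ p ↑ʳ u)) ≡ uvar (#ᵘ p ↑ʳ u)
  uvars u = cong uvar (exchange-free 0 (#ᵘ p) u)
  lvars : ∀ a → ren χ (lvar (suc (#ˡ p ↑ʳ a))) ≡ lvar (#ˡ p ↑ʳ suc a)
  lvars a = cong lvar (exchange-free 1 (#ˡ p) a)
  is-pull : ∀ d → Pull p (arg d) (ren (liftᴿ (#ᵘ p) (#ˡ p) (wk 0 1)) r) (ren (wk 0 1) q)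
    (χ ʳ∘ˢ (appˢ d r ˢ∘ʳ liftᴿ 0 2 W)) (appˢ d (r [ p := q ]))
  is-pull true = pull refl (xch-wk-outer 0 1 (#ᵘ p) (#ˡ p) r)
    (λ { zero f → contradiction refl f
       ; (suc zero) _ → cong lvar (exchange-inner 1 (#ˡ p) zero)
       ; (suc (suc a)) _ → lvars a }) uvars
  is-pull false = pull refl (xch-wk-outer 0 1 (#ᵘ p) (#ˡ p) r)
    (λ { zero _ → cong lvar (exchange-inner 1 (#ˡ p) zero)
       ; (suc zero) f → contradiction refl f
       ; (suc (suc a)) _ → lvars a }) uvars
  pulled : sub (appˢ d (r [ p := q ])) t ⇌ ren χ (sub (appˢ d r) t′) [ p := ren (wk 0 1) q ]
  pulled = sub-pull p (surf t (arg-occ d {t} o) w) (is-pull d) ⨟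
    ≡⇒⇌ (cong (λ x → x [ p := ren (wk 0 1) q ])
      (trans (sym (ren-sub χ _ t)) (cong (ren χ) (sym (sub-ren (appˢ d r) (liftᴿ 0 2 W) t)))))

pair-pullˡ : ∀ p (r : Term (#ᵘ p + m) (#ˡ p + n)) (q s : Term m n) (t : Term m (2 + n)) → WellBound (℘ t) →
  sub (pairˢ (r [ p := q ]) s) t ⇌
  sub (pairˢ r (ren (wk (#ᵘ p) (#ˡ p)) s)) (ren (liftᴿ 0 2 (wk (#ᵘ p) (#ˡ p))) t) [ p := q ]
pair-pullˡ p r q s t (o , w) = sub-pull p (surf t (o zero) w)
  (pull refl refl (λ { zero f → contradiction refl f ; (suc zero) _ → refl ; (suc (suc a)) _ → refl }) (λ _ → refl)) ⨟
  ≡⇒⇌ (cong (λ x → x [ p := q ]) (sym (sub-ren _ _ t)))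

pair-pullʳ : ∀ p (r : Term (#ᵘ p + m) (#ˡ p + n)) (q s : Term m n) (t : Term m (2 + n)) → WellBound (℘ t) →
  sub (pairˢ s (r [ p := q ])) t ⇌
  sub (pairˢ (ren (wk (#ᵘ p) (#ˡ p)) s) r) (ren (liftᴿ 0 2 (wk (#ᵘ p) (#ˡ p))) t) [ p := q ]
pair-pullʳ p r q s t (o , w) = sub-pull p (surf t (o (suc zero)) w)
  (pull refl refl (λ { (suc zero) f → contradiction refl f ; zero _ → refl ; (suc (suc a)) _ → refl }) (λ _ → refl)) ⨟
  ≡⇒⇌ (cong (λ x → x [ p := q ]) (sym (sub-ren _ _ t)))

-- Typed heads and their reducts

infix 3 _⨾_⊩_≈ᴴ_∶_⇒_

-- `A ⇒ B` reads: a value of type `A` is eliminated into type `B`. A head related to itself is a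
-- typed head, so the relation doubles as the typing judgement for heads.
data _⨾_⊩_≈ᴴ_∶_⇒_ {X : Set} {m n : ℕ} (Δ : UCtx X m) (Γ : LCtx X n) :
    Head m n → Head m n → Formula X → Formula X → Set where
  app : ∀ d {r r′ A B} → Δ ⨾ Γ ⊩ r ≈ r′ ∶ argᵀ d A B ^⊥ → Δ ⨾ Γ ⊩ appᴴ d r ≈ᴴ appᴴ d r′ ∶ A ⅋ B ⇒ otherᵀ d A B
  tensor : ∀ {s s′ r r′ A B} → Δ ⨾ Γ ⊩ s ≈ s′ ∶ A ^⊥ → Δ ⨾ Γ ⊩ r ≈ r′ ∶ B ^⊥ →
    Δ ⨾ Γ ⊩ tensorᴴ s r ≈ᴴ tensorᴴ s′ r′ ∶ A ⅋ B ⇒ ⊥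
  pair : ∀ {t t′ A B C} → Δ ⨾ just A ∷ just B ∷ Γ ⊩ t ≈ t′ ∶ C → Δ ⨾ Γ ⊩ pairᴴ t ≈ᴴ pairᴴ t′ ∶ A ⊗ B ⇒ C
  bang : ∀ {t t′ A C} → A ∷ Δ ⨾ Γ ⊩ t ≈ t′ ∶ C → Δ ⨾ Γ ⊩ bangᴴ t ≈ᴴ bangᴴ t′ ∶ ! A ⇒ C
  whynot : ∀ {t t′ A} → Δ ⨾ just A ∷ Γ ⊩ t ≈ t′ ∶ ⊥ → Δ ⨾ Γ ⊩ whynotᴴ t ≈ᴴ whynotᴴ t′ ∶ ¿ A ⇒ ⊥
  cut : ∀ {x x′ A} → Δ ⨾ Γ ⊩ x ≈ x′ ∶ A ^⊥ → Δ ⨾ Γ ⊩ cutᴴ x ≈ᴴ cutᴴ x′ ∶ A ⇒ ⊥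

WBᴴ : Head m n → Set
WBᴴ (appᴴ d r)    = WellBound r
WBᴴ (tensorᴴ s r) = WellBound s × WellBound r
WBᴴ (pairᴴ t)     = WellBound (℘ t)
WBᴴ (bangᴴ t)     = WellBound t
WBᴴ (whynotᴴ t)   = WellBound (! t)
WBᴴ (cutᴴ x)      = WellBound x

WBᴴ-ren : (ρ : Ren m n m′ n′) (H : Head m n) → WBᴴ H → WBᴴ (renᴴ ρ H)
WBᴴ-ren ρ (appᴴ d r)    w       = WB-ren⁺ ρ r w
WBᴴ-ren ρ (tensorᴴ s r) (w , v) = WB-ren⁺ ρ s w , WB-ren⁺ ρ r v
WBᴴ-ren ρ (pairᴴ t)     w       = WB-ren⁺ ρ (℘ t) w
WBᴴ-ren ρ (bangᴴ t)     w       = WB-ren⁺ _ t w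
WBᴴ-ren ρ (whynotᴴ t)   w       = WB-ren⁺ ρ (! t) w
WBᴴ-ren ρ (cutᴴ x)      w       = WB-ren⁺ ρ x w

≈ᴴ-ren : {ρ : Ren m n m′ n′} {Δ : UCtx X m} {Γ : LCtx X n} {Δ′ : UCtx X m′} {Γ′ : LCtx X n′} →
  TyRen ρ Δ Γ Δ′ Γ′ → ∀ {H H′ A B} → Δ ⨾ Γ ⊩ H ≈ᴴ H′ ∶ A ⇒ B → Δ′ ⨾ Γ′ ⊩ renᴴ ρ H ≈ᴴ renᴴ ρ H′ ∶ A ⇒ B
≈ᴴ-ren e (app d c)    = app d (≈-ren e c)
≈ᴴ-ren e (tensor c d) = tensor (≈-ren e c) (≈-ren e d)
≈ᴴ-ren e (pair c)     = pair (≈-ren (TyRen-lift [] (_ ∷ _ ∷ []) e) c)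
≈ᴴ-ren e (bang c)     = bang (≈-ren (TyRen-lift (_ ∷ []) [] e) c)
≈ᴴ-ren e (whynot c)   = whynot (≈-ren (TyRen-lift [] (_ ∷ []) e) c)
≈ᴴ-ren e (cut c)      = cut (≈-ren e c)

module _ {X : Set} {m n : ℕ} {Δ : UCtx X m} {Γ : LCtx X n} where

  app-≈ : ∀ d {A B r r′ t t′} → Δ ⨾ Γ ⊩ r ≈ r′ ∶ argᵀ d A B ^⊥ → WellBound r →
    Δ ⨾ just (A ^⊥) ∷ just (B ^⊥) ∷ Γ ⊩ t ≈ t′ ∶ ⊥ → WellBound (℘ t) →
    Δ ⨾ Γ ⊩ sub (appˢ d r) t ⟪\\⋆⟫ ≈ sub (appˢ d r′) t′ ⟪\\⋆⟫ ∶ otherᵀ d A B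
  app-≈ true  {A} {B} c v e w =
    subst (λ C → Cong Ax Δ Γ C _ _) (^⊥-involutive B) (app-reduct-≈ true {A = A ^⊥} {B ^⊥} c v e w)
  app-≈ false {A} {B} c v e w = subst (λ C → Cong Ax Δ Γ C _ _) (^⊥-involutive A) (app-reduct-≈ false {A = A ^⊥} {B ^⊥} c v e w)

  bang-≈ : ∀ {A C s s′ t t′} → Δ ⨾ just (A ^⊥) ∷ Γ ⊩ s ≈ s′ ∶ ⊥ → WellBound (! s) → A ∷ Δ ⨾ Γ ⊩ t ≈ t′ ∶ C →
    Δ ⨾ Γ ⊩ t [ s ⟪\\⋆⟫ ]ᵘ ≈ t′ [ s′ ⟪\\⋆⟫ ]ᵘ ∶ C
  bang-≈ {A} {s = s} {s′} c (o , _ , w) d = sub-≈² (substᵘ-≈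
    (subst (Δ ⨾ Γ ⊩ s ⟪\\⋆⟫ ≈ s′ ⟪\\⋆⟫ ∶_) (^⊥-involutive A) (⟪⟫-≈ c o w))) d

  whynot-reduct-≈ : ∀ {A s s′ t t′} → (A ^⊥) ∷ Δ ⨾ Γ ⊩ s ≈ s′ ∶ ⊥ → Δ ⨾ just A ∷ Γ ⊩ t ≈ t′ ∶ ⊥ → WellBound (! t) →
    Δ ⨾ Γ ⊩ s [ t ⟪\\⋆⟫ ]ᵘ ≈ s′ [ t′ ⟪\\⋆⟫ ]ᵘ ∶ ⊥
  whynot-reduct-≈ c d (o , _ , w) = sub-≈² (substᵘ-≈ (⟪⟫-≈ d o w)) c

↘-ty : {Δ : UCtx X m} {Γ : LCtx X n} → ∀ {H t y A B} → H ∣ t ↘ y → Δ ⨾ Γ ⊩ H ≈ᴴ H ∶ A ⇒ B → WBᴴ H →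
  Δ ⨾ Γ ⊩ t ∶ A → WellBound t → Δ ⨾ Γ ⊩ y ∶ B
↘-ty app-℘ (app d c) v (par e) w = Cong-tyˡ (app-≈ d c v (Cong-refl e) w)
↘-ty tensor-℘ (tensor c d) v (par e) w = Cong-tyˡ (sub-≈ (pairˢ-≈ c d) e)
↘-ty pair-⟨⟩ (pair c) v (tensor d e) w = Cong-tyˡ (sub-≈ (pairˢ-≈ (Cong-refl d) (Cong-refl e)) (Cong-tyˡ c))
↘-ty bang-! (bang c) v (ofcourse e) w = Cong-tyˡ (bang-≈ (Cong-refl e) w c)
↘-ty whynot-¿ (whynot c) v (whynot e) w = Cong-tyˡ (whynot-reduct-≈ (Cong-refl e) c v)
↘-ty (cut-⟨⟩ x) (cut c) v (tensor d e) (wd , we) =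
  ↘-ty x (tensor (≈-invol (Cong-refl d)) (≈-invol (Cong-refl e))) (wd , we) (Cong-tyˡ c) v
↘-ty (cut-℘ x) (cut c) v (par d) w = ↘-ty x (pair (Cong-refl d)) w (Cong-tyˡ c) v
↘-ty (cut-! x) (cut c) v (ofcourse d) w = ↘-ty x (whynot (Cong-refl d)) w (Cong-tyˡ c) v
↘-ty (cut-¿ x) (cut c) v (whynot d) w = ↘-ty x (bang (Cong-refl d)) w (Cong-tyˡ c) v
↘-ty (peel p {H} x) h v (elim {Δₚ = Δₚ} {Γₚ} q d e) (_ , w , _) =
  elim q d (↘-ty x (≈ᴴ-ren (TyRen-wk Δₚ Γₚ) h) (WBᴴ-ren _ H v) e w)

-- The value that a head meets introduces a tensor, a par or an exponential. On the spine of a redex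
-- this excludes every axiom stated at `𝟙` or `⊥`, which leaves `slide` and `unit-⋆`.
↘-positive : {Δ : UCtx X m} {Γ : LCtx X n} → ∀ {H t y A} → H ∣ t ↘ y → Δ ⨾ Γ ⊩ t ∶ A → A ≢ 𝟙 × A ≢ ⊥
↘-positive app-℘       (par _)      = (λ ()) , λ ()
↘-positive tensor-℘    (par _)      = (λ ()) , λ ()
↘-positive pair-⟨⟩     (tensor _ _) = (λ ()) , λ ()
↘-positive bang-!      (ofcourse _) = (λ ()) , λ ()
↘-positive whynot-¿    (whynot _)   = (λ ()) , λ ()
↘-positive (cut-⟨⟩ _)  (tensor _ _) = (λ ()) , λ ()
↘-positive (cut-℘ _)   (par _)      = (λ ()) , λ ()
↘-positive (cut-! _)   (ofcourse _) = (λ ()) , λ ()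
↘-positive (cut-¿ _)   (whynot _)   = (λ ()) , λ ()
↘-positive (peel _ x)  (elim _ _ d) = ↘-positive x d

ren-id-lift : ∀ k l (t : Term (k + m) (l + n)) → ren (liftᴿ k l (id , id)) t ≡ t
ren-id-lift k l t = trans (ren-cong (lift-id k , lift-id l) t) (ren-id t)

renᴴ-id : (H : Head m n) → renᴴ (id , id) H ≡ H
renᴴ-id (appᴴ d r)    = cong (appᴴ d) (ren-id r)
renᴴ-id (tensorᴴ s r) = cong₂ tensorᴴ (ren-id s) (ren-id r)
renᴴ-id (pairᴴ t)     = cong pairᴴ (ren-id-lift 0 2 t)
renᴴ-id (bangᴴ t)     = cong bangᴴ (ren-id-lift 1 0 t)
renᴴ-id (whynotᴴ t)   = cong whynotᴴ (ren-id-lift 0 1 t)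
renᴴ-id (cutᴴ x)      = cong cutᴴ (ren-id x)

renᴴ-xch-wk-inner : ∀ k l k′ l′ (H : Head (k + m) (l + n)) →
  renᴴ (xch k l k′ l′) (renᴴ (liftᴿ k l (wk k′ l′)) H) ≡ renᴴ (wk k′ l′) H
renᴴ-xch-wk-inner k l k′ l′ H =
  trans (renᴴ-renᴴ _ _ H) (renᴴ-cong (exchange-wk-inner k k′ , exchange-wk-inner l l′) H)

renᴴ-xch-wk-outer : ∀ k l k′ l′ (H : Head (k′ + m) (l′ + n)) →
  renᴴ (xch k l k′ l′) (renᴴ (wk k l) H) ≡ renᴴ (liftᴿ k′ l′ (wk k l)) H
renᴴ-xch-wk-outer k l k′ l′ H =
  trans (renᴴ-renᴴ _ _ H) (renᴴ-cong (exchange-wk-outer k k′ , exchange-wk-outer l l′) H)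

-- The second head results from the first by absorbing [ p := r ] into one of its arguments.
data HSlide {m n : ℕ} (p : Pat) (r : Term m n) : Head (#ᵘ p + m) (#ˡ p + n) → Head m n → Set where
  app     : ∀ d {t} → HSlide p r (appᴴ d t) (appᴴ d (t [ p := r ]))
  tensorˡ : ∀ {t} x → HSlide p r (tensorᴴ t (ren (wk (#ᵘ p) (#ˡ p)) x)) (tensorᴴ (t [ p := r ]) x)
  tensorʳ : ∀ {t} x → HSlide p r (tensorᴴ (ren (wk (#ᵘ p) (#ˡ p)) x) t) (tensorᴴ x (t [ p := r ]))
  pair    : ∀ {t} → HSlide p r (pairᴴ t) (pairᴴ (ren (xch 0 2 (#ᵘ p) (#ˡ p)) t [ p := ren (wk 0 2) r ]))
  bang    : ∀ {t} → HSlide p r (bangᴴ t) (bangᴴ (ren (xch 1 0 (#ᵘ p) (#ˡ p)) t [ p := ren (wk 1 0) r ]))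
  cut     : ∀ {t} → HSlide p r (cutᴴ t) (cutᴴ (t [ p := r ]))

HSlide-ren : ∀ p {r : Term m n} {H H′} (ρ : Ren m n m′ n′) → HSlide p r H H′ →
  HSlide p (ren ρ r) (renᴴ (liftᴿ (#ᵘ p) (#ˡ p) ρ) H) (renᴴ ρ H′)
HSlide-ren p ρ (app d) = app d
HSlide-ren p {r} ρ (tensorˡ {t} x) = subst (λ y → HSlide p (ren ρ r) (tensorᴴ (ren (liftᴿ (#ᵘ p) (#ˡ p) ρ) t) y) (tensorᴴ (ren ρ (t [ p := r ])) (ren ρ x)))
  (sym (ren-wk (#ᵘ p) (#ˡ p) ρ x)) (tensorˡ (ren ρ x))
HSlide-ren p {r} ρ (tensorʳ {t} x) = subst (λ y → HSlide p (ren ρ r) (tensorᴴ y (ren (liftᴿ (#ᵘ p) (#ˡ p) ρ) t)) (tensorᴴ (ren ρ x) (ren ρ (t [ p := r ]))))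
  (sym (ren-wk (#ᵘ p) (#ˡ p) ρ x)) (tensorʳ (ren ρ x))
HSlide-ren p {r} ρ (pair {t}) = subst₂ (λ x y → HSlide p (ren ρ r) (pairᴴ t′) (pairᴴ (x [ p := y ])))
  (xch-ren 0 2 (#ᵘ p) (#ˡ p) ρ t) (sym (ren-wk 0 2 ρ r)) pair
  where t′ = ren (liftᴿ 0 2 (liftᴿ (#ᵘ p) (#ˡ p) ρ)) t
HSlide-ren p {r} ρ (bang {t}) = subst₂ (λ x y → HSlide p (ren ρ r) (bangᴴ t′) (bangᴴ (x [ p := y ])))
  (xch-ren 1 0 (#ᵘ p) (#ˡ p) ρ t) (sym (ren-wk 1 0 ρ r)) bang
  where t′ = ren (liftᴿ 1 0 (liftᴿ (#ᵘ p) (#ˡ p) ρ)) t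
HSlide-ren p ρ cut = cut

module _ {X : Set} {m n : ℕ} {Δ : UCtx X m} {Γ : LCtx X n} where

  app-pull-≈ : ∀ p d {A B r q t} → Δ ⨾ Γ ⊩ r [ p := q ] ∶ argᵀ d A B ^⊥ → WellBound (r [ p := q ]) →
    Δ ⨾ just (A ^⊥) ∷ just (B ^⊥) ∷ Γ ⊩ t ∶ ⊥ → WellBound (℘ t) →
    Δ ⨾ Γ ⊩ sub (appˢ d r) (ren (liftᴿ 0 2 (wk (#ᵘ p) (#ˡ p))) t) ⟪\\⋆⟫ [ p := q ] ≈
      sub (appˢ d (r [ p := q ])) t ⟪\\⋆⟫ ∶ otherᵀ d A B
  app-pull-≈ p true  {A} {B} {r} {q} {t} dr wr dt w = subst (λ C → Cong Ax Δ Γ C _ _) (^⊥-involutive B)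
    (Cong-sym (app-pull p true {A = A ^⊥} {B ^⊥} {r} {q} {t} dr wr dt w))
  app-pull-≈ p false {A} {B} {r} {q} {t} dr wr dt w = subst (λ C → Cong Ax Δ Γ C _ _) (^⊥-involutive A)
    (Cong-sym (app-pull p false {A = A ^⊥} {B ^⊥} {r} {q} {t} dr wr dt w))

side-reduct-bang : ∀ p (r : Term m n) (t : Term (1 + (#ᵘ p + m)) (#ˡ p + n)) (v : Term m (1 + n)) →
  t [ ren (liftᴿ 0 1 (wk (#ᵘ p) (#ˡ p))) v ⟪\\⋆⟫ ]ᵘ [ p := r ] ≡
  (ren (xch 1 0 (#ᵘ p) (#ˡ p)) t [ p := ren (wk 1 0) r ]) [ v ⟪\\⋆⟫ ]ᵘ
side-reduct-bang p r t v = trans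
  (cong (λ x → t [ x ]ᵘ [ p := r ]) (sym (ren-⟪⟫ (wk (#ᵘ p) (#ˡ p)) v))) (sym (substᵘ-elim p (v ⟪\\⋆⟫) t r))

-- Contracting with `[ p := r ]` outside agrees with contracting after the head has absorbed it. The
-- eliminators of `x` are crossed by `slide`. At the value, the absorbed eliminator either is on a
-- substituted argument, from which it is pulled out, or is in the body, through which the
-- substitution passes.
side⁺ : ∀ p {r : Term m n} {H H′} → HSlide p r H H′ → {Δ : UCtx X m} {Γ : LCtx X n} → ∀ {A B} →
  Δ ⨾ Γ ⊩ H′ ≈ᴴ H′ ∶ A ⇒ B → WBᴴ H′ → ∀ x → Δ ⨾ Γ ⊩ x ∶ A → WellBound x →
  ∀ {y} → H ∣ ren (wk (#ᵘ p) (#ˡ p)) x ↘ y → ∃[ y′ ] (H′ ∣ x ↘ y′ × Δ ⨾ Γ ⊩ y [ p := r ] ≈ y′ ∶ B)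
side⁻ : ∀ p {r : Term m n} {H H′} → HSlide p r H H′ → {Δ : UCtx X m} {Γ : LCtx X n} → ∀ {A B} →
  Δ ⨾ Γ ⊩ H′ ≈ᴴ H′ ∶ A ⇒ B → WBᴴ H′ → ∀ x → Δ ⨾ Γ ⊩ x ∶ A → WellBound x →
  ∀ {y′} → H′ ∣ x ↘ y′ → ∃[ y ] (H ∣ ren (wk (#ᵘ p) (#ˡ p)) x ↘ y × Δ ⨾ Γ ⊩ y [ p := r ] ≈ y′ ∶ B)

side⁺ p {r} {H} {H′} i h v (x [ q := s ]) (elim {Δₚ = Δₚ} {Γₚ} pt es ex) (_ , w , _) (peel _ {y = y} c)
  with side⁺ p (HSlide-ren p (wk (#ᵘ q) (#ˡ q)) i) (≈ᴴ-ren (TyRen-wk Δₚ Γₚ) h) (WBᴴ-ren _ H′ v) x ex w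
    (subst₂ (λ H x → H ∣ x ↘ _) (renᴴ-xch-wk-outer (#ᵘ q) (#ˡ q) (#ᵘ p) (#ˡ p) H)
      (xch-wk-inner (#ᵘ q) (#ˡ q) (#ᵘ p) (#ˡ p) x) (↘-ren⁺ (xch (#ᵘ q) (#ˡ q) (#ᵘ p) (#ˡ p)) c))
... | y′ , c′ , e = y′ [ q := s ] , peel q c′ ,
  Cong-sym (from (slide-⇌ p □[ q := s ] y r) (elim pt es (Cong-tyˡ e))) ⊙ elim pt (Cong-refl es) e
side⁺ p (app d) (app _ c) v (℘ t) (par e) w app-℘ = _ , app-℘ , app-pull-≈ p d (Cong-tyˡ c) v e w
side⁺ p {r} (tensorˡ {s} x) (tensor c c′) v (℘ t) (par e) w tensor-℘ = _ , tensor-℘ ,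
  Cong-sym (to (pair-pullˡ p s r x t w) (Cong-tyˡ (sub-≈ (pairˢ-≈ c c′) e)))
side⁺ p {r} (tensorʳ {s} x) (tensor c c′) v (℘ t) (par e) w tensor-℘ = _ , tensor-℘ ,
  Cong-sym (to (pair-pullʳ p s r x t w) (Cong-tyˡ (sub-≈ (pairˢ-≈ c c′) e)))
side⁺ p {r} (pair {t}) h v ⟨ s , x ⟩ e w pair-⟨⟩ = _ , pair-⟨⟩ ,
  Cong-sym (≡⇒≈ (pairˢ-elim p s x t r) (↘-ty pair-⟨⟩ h v e w))
side⁺ p {r} (bang {t}) h v (! s) e w bang-! = _ , bang-! ,
  Cong-sym (≡⇒≈ (sym (side-reduct-bang p r t s)) (↘-ty bang-! h v e w))
-- In a cut the roles are exchanged: the absorbed eliminator is the first one to be peeled from the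
-- left side, and the reducts coincide.
side⁺ p cut h v ⟨ s , x ⟩ e w (cut-⟨⟩ c) = _ , c′ , Cong-refl (↘-ty c′ h v e w)
  where c′ = cut-⟨⟩ (peel p c)
side⁺ p cut h v (℘ t) e w (cut-℘ c) = _ , c′ , Cong-refl (↘-ty c′ h v e w)
  where c′ = cut-℘ (peel p c)
side⁺ p cut h v (! t) e w (cut-! c) = _ , c′ , Cong-refl (↘-ty c′ h v e w)
  where c′ = cut-! (peel p c)
side⁺ p cut h v (¿ t) e w (cut-¿ c) = _ , c′ , Cong-refl (↘-ty c′ h v e w)
  where c′ = cut-¿ (peel p c)

side⁻ p {r} {H} {H′} i h v (x [ q := s ]) (elim {Δₚ = Δₚ} {Γₚ} pt es ex) (_ , w , _) (peel _ {y = y′} c)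
  with side⁻ p (HSlide-ren p (wk (#ᵘ q) (#ˡ q)) i) (≈ᴴ-ren (TyRen-wk Δₚ Γₚ) h) (WBᴴ-ren _ H′ v) x ex w c
... | y , c′ , e = _ , peel q (subst₂ (λ H x → H ∣ x ↘ ren χ y) (renᴴ-xch-wk-inner (#ᵘ p) (#ˡ p) (#ᵘ q) (#ˡ q) H)
      (xch-wk-outer (#ᵘ p) (#ˡ p) (#ᵘ q) (#ˡ q) x) (↘-ren⁺ χ c′)) ,
  Cong-sym (from (slide-⇌ p □[ q := s ] (ren χ y) r ⨟
    ≡⇒⇌ (cong (λ y → y [ p := ren (wk (#ᵘ q) (#ˡ q)) r ] [ q := s ]) (xch-involutive (#ᵘ p) (#ˡ p) (#ᵘ q) (#ˡ q) y)))
    (elim pt es (Cong-tyˡ e))) ⊙ elim pt (Cong-refl es) e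
  where
  χ : Ren (#ᵘ p + (#ᵘ q + _)) (#ˡ p + (#ˡ q + _)) (#ᵘ q + (#ᵘ p + _)) (#ˡ q + (#ˡ p + _))
  χ = xch (#ᵘ p) (#ˡ p) (#ᵘ q) (#ˡ q)
side⁻ p (app d) (app _ c) v (℘ t) (par e) w app-℘ = _ , app-℘ , app-pull-≈ p d (Cong-tyˡ c) v e w
side⁻ p {r} (tensorˡ {s} x) (tensor c c′) v (℘ t) (par e) w tensor-℘ = _ , tensor-℘ ,
  Cong-sym (to (pair-pullˡ p s r x t w) (Cong-tyˡ (sub-≈ (pairˢ-≈ c c′) e)))
side⁻ p {r} (tensorʳ {s} x) (tensor c c′) v (℘ t) (par e) w tensor-℘ = _ , tensor-℘ ,
  Cong-sym (to (pair-pullʳ p s r x t w) (Cong-tyˡ (sub-≈ (pairˢ-≈ c c′) e)))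
side⁻ p {r} (pair {t}) h v ⟨ s , x ⟩ e w pair-⟨⟩ = _ , pair-⟨⟩ ,
  Cong-sym (≡⇒≈ (pairˢ-elim p s x t r) (↘-ty pair-⟨⟩ h v e w))
side⁻ p {r} (bang {t}) h v (! s) e w bang-! = _ , bang-! ,
  Cong-sym (≡⇒≈ (sym (side-reduct-bang p r t s)) (↘-ty bang-! h v e w))
side⁻ p cut h v ⟨ s , x ⟩ e w c@(cut-⟨⟩ (peel _ c′)) = _ , cut-⟨⟩ c′ , Cong-refl (↘-ty c h v e w)
side⁻ p cut h v (℘ t) e w c@(cut-℘ (peel _ c′)) = _ , cut-℘ c′ , Cong-refl (↘-ty c h v e w)
side⁻ p cut h v (! t) e w c@(cut-! (peel _ c′)) = _ , cut-! c′ , Cong-refl (↘-ty c h v e w)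
side⁻ p cut h v (¿ t) e w c@(cut-¿ (peel _ c′)) = _ , cut-¿ c′ , Cong-refl (↘-ty c h v e w)

-- Survival of a redex under rewriting of its head and its value

↘-≡ : {H H′ : Head m n} {x y : Term m n} → H ≡ H′ → H ∣ x ↘ y → H′ ∣ x ↘ y
↘-≡ refl c = c

module _ {X : Set} {m n : ℕ} {Δ : UCtx X m} {Γ : LCtx X n} where

  Follows : Head m n → Term m n → Term m n → Formula X → Set
  Follows H x y B = ∃[ y′ ] (H ∣ x ↘ y′ × Δ ⨾ Γ ⊩ y ≈ y′ ∶ B)

  Follows-≡ : ∀ {H x x′ y B} → x ≡ x′ → Follows H x y B → Follows H x′ y B
  Follows-≡ refl f = f

  private
    flip : ∀ {H x y B} → ∃[ y′ ] (H ∣ x ↘ y′ × Δ ⨾ Γ ⊩ y′ ≈ y ∶ B) → Follows H x y B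
    flip (y′ , c , e) = y′ , c , Cong-sym e

  -- The sliding eliminator is on the spine of the value. If `S` is an eliminator as well, peelings
  -- are permuted or nested. Otherwise `S` is the constructor of the value and takes the eliminator
  -- into a component: there the substitution of the redex crosses it, or it is pulled out of a
  -- substituted component. If the head is a cut, the value acts as a head and `side⁺` applies.
  spine-slide⁺ : ∀ {k l} p (S : Surface m n k l) {t r H A B} →
    let x  = plug (renᔆ (wk (#ᵘ p) (#ˡ p)) S) t [ p := r ]
        x′ = plug S (ren (xch k l (#ᵘ p) (#ˡ p)) t [ p := ren (wk k l) r ]) in
    Δ ⨾ Γ ⊩ H ≈ᴴ H ∶ A ⇒ B → WBᴴ H → Δ ⨾ Γ ⊩ x ∶ A → WellBound x → Δ ⨾ Γ ⊩ x′ ∶ A → WellBound x′ →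
    ∀ {y} → H ∣ x ↘ y → Follows H x′ y B

  spine-slide⁻ : ∀ {k l} p (S : Surface m n k l) {t r H A B} →
    let x  = plug (renᔆ (wk (#ᵘ p) (#ˡ p)) S) t [ p := r ]
        x′ = plug S (ren (xch k l (#ᵘ p) (#ˡ p)) t [ p := ren (wk k l) r ]) in
    Δ ⨾ Γ ⊩ H ≈ᴴ H ∶ A ⇒ B → WBᴴ H → Δ ⨾ Γ ⊩ x ∶ A → WellBound x → Δ ⨾ Γ ⊩ x′ ∶ A → WellBound x′ →
    ∀ {y} → H ∣ x′ ↘ y → Follows H x y B

  slide-app : ∀ p a q (t : Term (#ᵘ p + m) (2 + (#ˡ p + n))) (r : Term m n) → (∀ (i : Fin 2) → occ (i ↑ˡ (#ˡ p + n)) t ≡ 1) →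
    sub (appˢ a q) (ren (xch 0 2 (#ᵘ p) (#ˡ p)) t [ p := ren (wk 0 2) r ]) ⟪\\⋆⟫ ≡
    sub (appˢ a (ren (wk (#ᵘ p) (#ˡ p)) q)) t ⟪\\⋆⟫ [ p := r ]
  slide-app p a q t r o = trans (cong _⟪\\⋆⟫ (appˢ-elim p a q t r))
    (⟪⟫-elim p (sub (appˢ a (ren (wk (#ᵘ p) (#ˡ p)) q)) t) r
      (subst (0 <_) (sym (appˢ-occ a (ren (wk (#ᵘ p) (#ˡ p)) q) {t} o)) (s≤s z≤n)))

  spine-slide⁺ p □[ q := x ] {t} {r} {H} h v d w d′ w′ c@(peel _ (peel _ {y = y} c′)) =
    _ , peel q (peel p (subst (λ H → H ∣ ren χ t ↘ ren χ y)
      (trans (renᴴ-xch-wk-outer (#ᵘ q) (#ˡ q) (#ᵘ p) (#ˡ p) (renᴴ (wk (#ᵘ p) (#ˡ p)) H)) (renᴴ-wk (#ᵘ p) (#ˡ p) _ H))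
      (↘-ren⁺ χ c′))) ,
    to (slide-⇌ p □[ q := x ] y r) (↘-ty c h v d w)
    where
    χ : Ren (#ᵘ q + (#ᵘ p + m)) (#ˡ q + (#ˡ p + n)) (#ᵘ p + (#ᵘ q + m)) (#ˡ p + (#ˡ q + n))
    χ = xch (#ᵘ q) (#ˡ q) (#ᵘ p) (#ˡ p)
  spine-slide⁺ p (elim□ q x) {t} {r} {H} h v d w d′ w′ c@(peel _ (peel _ c′))
    -- After the slide `p` is gone from the spine, so the weakening by `p` has to be undone on the
    -- body `x` and on its reduct.
    with ↘-ren⁻ (liftᴿ (#ᵘ q) (#ˡ q) (wk (#ᵘ p) (#ˡ p))) (renᴴ (wk (#ᵘ q) (#ˡ q)) H) x
      (subst (λ H → H ∣ _ ↘ _) (sym (renᴴ-wk (#ᵘ q) (#ˡ q) (wk (#ᵘ p) (#ˡ p)) H)) c′)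
  ... | y , c″ , refl = _ , peel q c″ ,
    (to (slide₀ p (elim□ q y) t r ⨟ ≡⇒⇌ (cong (λ z → y [ q := z ]) (sym (elim-0 p t r)))) (↘-ty c h v d w))
  spine-slide⁺ p ℘□ {t} {r} {appᴴ a q} h v d w@(_ , (o , _) , _) d′ w′ c@(peel _ app-℘) =
    _ , app-℘ , ≡⇒≈ (sym (slide-app p a q t r o)) (↘-ty c h v d w)
  spine-slide⁺ p ℘□ {t} {r} {tensorᴴ s q} h v d w d′ w′ c@(peel _ tensor-℘) =
    _ , tensor-℘ , ≡⇒≈ (sym (pairˢ-elim p s q t r)) (↘-ty c h v d w)
  spine-slide⁺ p ℘□ {H = cutᴴ z} (cut e) v d w (par d′) w′ (peel _ (cut-℘ c))
    with side⁺ p pair (pair (Cong-refl d′)) w′ z (Cong-tyˡ e) v c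
  ... | y′ , c′ , e′ = y′ , cut-℘ c′ , e′
  spine-slide⁺ p ⟨□, x ⟩ {t} {r} {pairᴴ q} h v d w d′ w′ c@(peel _ pair-⟨⟩) =
    Follows-≡ (cong (λ z → ⟨ z , x ⟩) (sym (elim-0 p t r)))
      (_ , pair-⟨⟩ , from (pair-pullˡ p t r x q v) (↘-ty c h v d w))
  spine-slide⁺ p ⟨□, x ⟩ {t} {r} {cutᴴ z} {A} (cut e) v d w d′ w′ (peel _ (cut-⟨⟩ c))
    with subst (λ y → Δ ⨾ Γ ⊩ ⟨ y , x ⟩ ∶ A) (elim-0 p t r) d′ | subst (λ y → WellBound ⟨ y , x ⟩) (elim-0 p t r) w′
  ... | tensor d₁ d₂ | w″
    with side⁺ p (tensorˡ x) (tensor (≈-invol (Cong-refl d₁)) (≈-invol (Cong-refl d₂))) w″ z (Cong-tyˡ e) v c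
  ... | y′ , c′ , e′ = Follows-≡ (cong (λ y → ⟨ y , x ⟩) (sym (elim-0 p t r))) (y′ , cut-⟨⟩ c′ , e′)
  spine-slide⁺ p ⟨ x ,□⟩ {t} {r} {pairᴴ q} h v d w d′ w′ c@(peel _ pair-⟨⟩) =
    Follows-≡ (cong (λ z → ⟨ x , z ⟩) (sym (elim-0 p t r)))
      (_ , pair-⟨⟩ , from (pair-pullʳ p t r x q v) (↘-ty c h v d w))
  spine-slide⁺ p ⟨ x ,□⟩ {t} {r} {cutᴴ z} {A} (cut e) v d w d′ w′ (peel _ (cut-⟨⟩ c))
    with subst (λ y → Δ ⨾ Γ ⊩ ⟨ x , y ⟩ ∶ A) (elim-0 p t r) d′ | subst (λ y → WellBound ⟨ x , y ⟩) (elim-0 p t r) w′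
  ... | tensor d₁ d₂ | w″
    with side⁺ p (tensorʳ x) (tensor (≈-invol (Cong-refl d₁)) (≈-invol (Cong-refl d₂))) w″ z (Cong-tyˡ e) v c
  ... | y′ , c′ , e′ = Follows-≡ (cong (λ y → ⟨ x , y ⟩) (sym (elim-0 p t r))) (y′ , cut-⟨⟩ c′ , e′)
  spine-slide⁺ p ¿□ {t} {r} {whynotᴴ q} h v d w d′ w′ c@(peel _ whynot-¿) =
    _ , whynot-¿ , ≡⇒≈ (side-reduct-bang p r t q) (↘-ty c h v d w)
  spine-slide⁺ p ¿□ {H = cutᴴ z} (cut e) v d w (whynot d′) w′ (peel _ (cut-¿ c))
    with side⁺ p bang (bang (Cong-refl d′)) w′ z (Cong-tyˡ e) v c
  ... | y′ , c′ , e′ = y′ , cut-¿ c′ , e′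

  spine-slide⁻ p □[ q := x ] {t} {r} {H} h v d w d′ w′ c@(peel _ (peel _ {y = y} c′)) =
    _ , peel p (peel q (subst₂ (λ H t → H ∣ t ↘ ren χ′ y)
      (trans (renᴴ-xch-wk-outer (#ᵘ p) (#ˡ p) (#ᵘ q) (#ˡ q) (renᴴ (wk (#ᵘ q) (#ˡ q)) H)) (renᴴ-wk (#ᵘ q) (#ˡ q) _ H))
      (xch-involutive (#ᵘ q) (#ˡ q) (#ᵘ p) (#ˡ p) t)
      (↘-ren⁺ χ′ c′))) ,
    from (slide-⇌ p □[ q := x ] (ren χ′ y) r ⨟
      ≡⇒⇌ (cong (λ y → y [ p := ren (wk (#ᵘ q) (#ˡ q)) r ] [ q := x ]) (xch-involutive (#ᵘ p) (#ˡ p) (#ᵘ q) (#ˡ q) y)))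
      (↘-ty c h v d′ w′)
    where
    χ′ : Ren (#ᵘ p + (#ᵘ q + m)) (#ˡ p + (#ˡ q + n)) (#ᵘ q + (#ᵘ p + m)) (#ˡ q + (#ˡ p + n))
    χ′ = xch (#ᵘ p) (#ˡ p) (#ᵘ q) (#ˡ q)
  spine-slide⁻ p (elim□ q x) {t} {r} {H} h v d w d′ w′ c@(peel _ {y = y} c′) =
    _ , peel p (peel q (subst (λ H → H ∣ ren _ x ↘ ren _ y) (renᴴ-wk (#ᵘ q) (#ˡ q) (wk (#ᵘ p) (#ˡ p)) H)
      (↘-ren⁺ (liftᴿ (#ᵘ q) (#ˡ q) (wk (#ᵘ p) (#ˡ p))) c′))) ,
    from (slide₀ p (elim□ q y) t r ⨟ ≡⇒⇌ (cong (λ z → y [ q := z ]) (sym (elim-0 p t r)))) (↘-ty c h v d′ w′)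
  spine-slide⁻ p ℘□ {t} {r} {appᴴ a q} h v d (_ , (o , _) , _) d′ w′ c@app-℘ =
    _ , peel p app-℘ , ≡⇒≈ (slide-app p a q t r o) (↘-ty c h v d′ w′)
  spine-slide⁻ p ℘□ {t} {r} {tensorᴴ s q} h v d w d′ w′ c@tensor-℘ =
    _ , peel p tensor-℘ , ≡⇒≈ (pairˢ-elim p s q t r) (↘-ty c h v d′ w′)
  spine-slide⁻ p ℘□ {H = cutᴴ z} (cut e) v d w (par d′) w′ (cut-℘ c)
    with side⁻ p pair (pair (Cong-refl d′)) w′ z (Cong-tyˡ e) v c
  ... | y′ , c′ , e′ = flip (_ , peel p (cut-℘ c′) , e′)
  spine-slide⁻ p ⟨□, x ⟩ {t} {r} {pairᴴ q} h v d w d′ w′ c@pair-⟨⟩ =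
    _ , peel p pair-⟨⟩ ,
    to (≡⇒⇌ (cong (λ z → sub (pairˢ z x) q) (elim-0 p t r)) ⨟ pair-pullˡ p t r x q v) (↘-ty c h v d′ w′)
  spine-slide⁻ p ⟨□, x ⟩ {t} {r} {cutᴴ z} {A} (cut e) v d w d′ w′ (cut-⟨⟩ c)
    with subst (λ y → Δ ⨾ Γ ⊩ ⟨ y , x ⟩ ∶ A) (elim-0 p t r) d′ | subst (λ y → WellBound ⟨ y , x ⟩) (elim-0 p t r) w′
  ... | tensor d₁ d₂ | w″
    with side⁻ p (tensorˡ x) (tensor (≈-invol (Cong-refl d₁)) (≈-invol (Cong-refl d₂))) w″ z (Cong-tyˡ e) v
      (↘-≡ (cong (λ y → tensorᴴ y x) (elim-0 p t r)) c)
  ... | y′ , c′ , e′ = flip (_ , peel p (cut-⟨⟩ c′) , e′)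
  spine-slide⁻ p ⟨ x ,□⟩ {t} {r} {pairᴴ q} h v d w d′ w′ c@pair-⟨⟩ =
    _ , peel p pair-⟨⟩ ,
    to (≡⇒⇌ (cong (λ z → sub (pairˢ x z) q) (elim-0 p t r)) ⨟ pair-pullʳ p t r x q v) (↘-ty c h v d′ w′)
  spine-slide⁻ p ⟨ x ,□⟩ {t} {r} {cutᴴ z} {A} (cut e) v d w d′ w′ (cut-⟨⟩ c)
    with subst (λ y → Δ ⨾ Γ ⊩ ⟨ x , y ⟩ ∶ A) (elim-0 p t r) d′ | subst (λ y → WellBound ⟨ x , y ⟩) (elim-0 p t r) w′
  ... | tensor d₁ d₂ | w″
    with side⁻ p (tensorʳ x) (tensor (≈-invol (Cong-refl d₁)) (≈-invol (Cong-refl d₂))) w″ z (Cong-tyˡ e) v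
      (↘-≡ (cong (λ y → tensorᴴ x y) (elim-0 p t r)) c)
  ... | y′ , c′ , e′ = flip (_ , peel p (cut-⟨⟩ c′) , e′)
  spine-slide⁻ p ¿□ {t} {r} {whynotᴴ q} h v d w d′ w′ c@whynot-¿ =
    _ , peel p whynot-¿ , ≡⇒≈ (sym (side-reduct-bang p r t q)) (↘-ty c h v d′ w′)
  spine-slide⁻ p ¿□ {H = cutᴴ z} (cut e) v d w (whynot d′) w′ (cut-¿ c)
    with side⁻ p bang (bang (Cong-refl d′)) w′ z (Cong-tyˡ e) v c
  ... | y′ , c′ , e′ = flip (_ , peel p (cut-¿ c′) , e′)

  spine-Ax⁺ : ∀ {x x′ H A B} → Ax A x x′ → Δ ⨾ Γ ⊩ H ≈ᴴ H ∶ A ⇒ B → WBᴴ H → Δ ⨾ Γ ⊩ x ∶ A → WellBound x →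
    ∀ {y} → H ∣ x ↘ y → Follows H x′ y B
  spine-Ax⁺ r@(slide p S) h v d w c = spine-slide⁺ p S h v d w (Ax-ty⁺ r d) (Ax-WB⁺ r w) c
  spine-Ax⁺ {H = H} unit-⋆ h v (elim unit one d) (_ , w , _) (peel _ {y = y} c) =
    _ , c′ , to (unit-⋆-⇌ y) (elim unit one (↘-ty c′ h v d w))
    where c′ = subst (_∣ _ ↘ _) (renᴴ-id H) c
  spine-Ax⁺ unit-swap h v d w c = contradiction refl (proj₁ (↘-positive c d))
  spine-Ax⁺ comm h v d w c = contradiction refl (proj₂ (↘-positive c d))
  spine-Ax⁺ ⋆-♯ h v d w c = contradiction refl (proj₂ (↘-positive c d))
  spine-Ax⁺ •-♯ h v d w c = contradiction refl (proj₂ (↘-positive c d))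
  spine-Ax⁺ ▼-♯ h v d w c = contradiction refl (proj₂ (↘-positive c d))
  spine-Ax⁺ ℘-♯ h v d w c = contradiction refl (proj₂ (↘-positive c d))
  spine-Ax⁺ ¿-♯ h v d w c = contradiction refl (proj₂ (↘-positive c d))
  spine-Ax⁺ ▸-♯ h v d w c = contradiction refl (proj₂ (↘-positive c d))

  spine-Ax⁻ : ∀ {x x′ H A B} → Ax A x x′ → Δ ⨾ Γ ⊩ H ≈ᴴ H ∶ A ⇒ B → WBᴴ H → Δ ⨾ Γ ⊩ x′ ∶ A → WellBound x′ →
    ∀ {y} → H ∣ x′ ↘ y → Follows H x y B
  spine-Ax⁻ r@(slide p S) h v d w c = spine-slide⁻ p S h v (Ax-ty⁻ r d) (Ax-WB⁻ r w) d w c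
  spine-Ax⁻ {H = H} unit-⋆ h v d w {y} c = _ , peel unit (subst (_∣ _ ↘ _) (sym (renᴴ-id H)) c) ,
    from (unit-⋆-⇌ y) (↘-ty c h v d w)
  spine-Ax⁻ unit-swap h v d w c = contradiction refl (proj₁ (↘-positive c d))
  spine-Ax⁻ comm h v d w c = contradiction refl (proj₂ (↘-positive c d))
  spine-Ax⁻ ⋆-♯ h v d w c = contradiction refl (proj₂ (↘-positive c d))
  spine-Ax⁻ •-♯ h v d w c = contradiction refl (proj₂ (↘-positive c d))
  spine-Ax⁻ ▼-♯ h v d w c = contradiction refl (proj₂ (↘-positive c d))
  spine-Ax⁻ ℘-♯ h v d w c = contradiction refl (proj₂ (↘-positive c d))
  spine-Ax⁻ ¿-♯ h v d w c = contradiction refl (proj₂ (↘-positive c d))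
  spine-Ax⁻ ▸-♯ h v d w c = contradiction refl (proj₂ (↘-positive c d))

-- Bounds how often head and value may still exchange roles. A head obtained from a value is never a
-- cut, so rank 1 suffices for every head. `spineˣ` and `spineᴴ` call each other only at an
-- exchange, which lowers this number.
data Rank {m n : ℕ} : ℕ → Head m n → Set where
  app    : ∀ {k d r} → Rank k (appᴴ d r)
  tensor : ∀ {k s r} → Rank k (tensorᴴ s r)
  pair   : ∀ {k t} → Rank k (pairᴴ t)
  bang   : ∀ {k t} → Rank k (bangᴴ t)
  whynot : ∀ {k t} → Rank k (whynotᴴ t)
  cut    : ∀ {k x} → Rank (suc k) (cutᴴ x)

Rank-ren : {ρ : Ren m n m′ n′} {H : Head m n} → Rank k H → Rank k (renᴴ ρ H)
Rank-ren app    = app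
Rank-ren tensor = tensor
Rank-ren pair   = pair
Rank-ren bang   = bang
Rank-ren whynot = whynot
Rank-ren cut    = cut

rank : (H : Head m n) → Rank 1 H
rank (appᴴ _ _)    = app
rank (tensorᴴ _ _) = tensor
rank (pairᴴ _)     = pair
rank (bangᴴ _)     = bang
rank (whynotᴴ _)   = whynot
rank (cutᴴ _)      = cut

-- The value is rewritten while the head stays fixed, and conversely in `spineᴴ`. In a cut the value
-- is the head that meets the left side, so rewriting its components is a case of `spineᴴ`.
spineˣ : ∀ k {Δ : UCtx X m} {Γ : LCtx X n} {H x x′ A B} → Rank k H → Δ ⨾ Γ ⊩ x ≈ x′ ∶ A →
  Δ ⨾ Γ ⊩ H ≈ᴴ H ∶ A ⇒ B → WBᴴ H → WellBound x → ∀ {y} → H ∣ x ↘ y → Follows {Δ = Δ} {Γ} H x′ y B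
spineᴴ : ∀ k {Δ : UCtx X m} {Γ : LCtx X n} {H H′ x A B} → Rank k H → Δ ⨾ Γ ⊩ x ∶ A →
  Δ ⨾ Γ ⊩ H ≈ᴴ H′ ∶ A ⇒ B → WBᴴ H → WellBound x → ∀ {y} → H ∣ x ↘ y → Follows {Δ = Δ} {Γ} H′ x y B

spineˣ k rk (tensor c d) (pair e) v w pair-⟨⟩ = _ , pair-⟨⟩ , sub-≈² (pairˢ-≈ c d) e
spineˣ (suc k) cut (tensor c d) (cut e) v w (cut-⟨⟩ r)
  with spineᴴ k tensor (Cong-tyˡ e) (tensor (≈-invol c) (≈-invol d)) w v r
... | y , r′ , f = y , cut-⟨⟩ r′ , f
spineˣ k {H = H} rk (elim {Δₚ = Δₚ} {Γₚ} q d c) h v (_ , w , _) (peel p r)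
  with spineˣ k (Rank-ren rk) c (≈ᴴ-ren (TyRen-wk Δₚ Γₚ) h) (WBᴴ-ren _ H v) w r
... | y , r′ , f = _ , peel p r′ , elim q d f
spineˣ k rk (par c) (app d e) v w app-℘ = _ , app-℘ , app-≈ d e v c w
spineˣ k rk (par c) (tensor e f) v w tensor-℘ = _ , tensor-℘ , sub-≈² (pairˢ-≈ e f) c
spineˣ (suc k) cut (par c) (cut e) v w (cut-℘ r) with spineᴴ k pair (Cong-tyˡ e) (pair c) w v r
... | y , r′ , f = y , cut-℘ r′ , f
spineˣ k rk (ofcourse c) (bang e) v w bang-! = _ , bang-! , bang-≈ c w e
spineˣ (suc k) cut (ofcourse c) (cut e) v w (cut-! r) with spineᴴ k whynot (Cong-tyˡ e) (whynot c) w v r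
... | y , r′ , f = y , cut-! r′ , f
spineˣ k rk (whynot c) (whynot e) v w whynot-¿ = _ , whynot-¿ , whynot-reduct-≈ c e v
spineˣ (suc k) cut (whynot c) (cut e) v w (cut-¿ r) with spineᴴ k bang (Cong-tyˡ e) (bang c) w v r
... | y , r′ , f = y , cut-¿ r′ , f
spineˣ k rk (fwd a d e) h v w r = spine-Ax⁺ a h v d w r
spineˣ k rk (bwd a d e) h v w r = spine-Ax⁻ a h v e w r
spineˣ k rk (c ⊙ d) h v w r with spineˣ k rk c h v w r
... | y , r′ , f with spineˣ k rk d h v (≈-WB c w) r′
... | y′ , r″ , f′ = y′ , r″ , f ⊙ f′

spineᴴ k rk (tensor c d) (pair e) v w pair-⟨⟩ = _ , pair-⟨⟩ , sub-≈² (pairˢ-≈ (Cong-refl c) (Cong-refl d)) e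
spineᴴ (suc k) cut (tensor c d) (cut e) v w (cut-⟨⟩ r)
  with spineˣ k tensor e (tensor (≈-invol (Cong-refl c)) (≈-invol (Cong-refl d))) w v r
... | y , r′ , f = y , cut-⟨⟩ r′ , f
spineᴴ k {H = H} rk (elim {Δₚ = Δₚ} {Γₚ} q d c) h v (_ , w , _) (peel p r)
  with spineᴴ k (Rank-ren rk) c (≈ᴴ-ren (TyRen-wk Δₚ Γₚ) h) (WBᴴ-ren _ H v) w r
... | y , r′ , f = _ , peel p r′ , elim q (Cong-refl d) f
spineᴴ k rk (par c) (app d e) v w app-℘ = _ , app-℘ , app-≈ d e v (Cong-refl c) w
spineᴴ k rk (par c) (tensor e f) v w tensor-℘ = _ , tensor-℘ , sub-≈² (pairˢ-≈ e f) (Cong-refl c)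
spineᴴ (suc k) cut (par c) (cut e) v w (cut-℘ r) with spineˣ k pair e (pair (Cong-refl c)) w v r
... | y , r′ , f = y , cut-℘ r′ , f
spineᴴ k rk (ofcourse c) (bang e) v w bang-! = _ , bang-! , bang-≈ (Cong-refl c) w e
spineᴴ (suc k) cut (ofcourse c) (cut e) v w (cut-! r) with spineˣ k whynot e (whynot (Cong-refl c)) w v r
... | y , r′ , f = y , cut-! r′ , f
spineᴴ k rk (whynot c) (whynot e) v w whynot-¿ = _ , whynot-¿ , whynot-reduct-≈ (Cong-refl c) e v
spineᴴ (suc k) cut (whynot c) (cut e) v w (cut-¿ r) with spineˣ k bang e (bang (Cong-refl c)) w v r
... | y , r′ , f = y , cut-¿ r′ , f

≈ᴴ-tyˡ : {Δ : UCtx X m} {Γ : LCtx X n} → ∀ {H H′ A B} → Δ ⨾ Γ ⊩ H ≈ᴴ H′ ∶ A ⇒ B → Δ ⨾ Γ ⊩ H ≈ᴴ H ∶ A ⇒ B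
≈ᴴ-tyˡ (app d c)    = app d (Cong-refl (Cong-tyˡ c))
≈ᴴ-tyˡ (tensor c d) = tensor (Cong-refl (Cong-tyˡ c)) (Cong-refl (Cong-tyˡ d))
≈ᴴ-tyˡ (pair c)     = pair (Cong-refl (Cong-tyˡ c))
≈ᴴ-tyˡ (bang c)     = bang (Cong-refl (Cong-tyˡ c))
≈ᴴ-tyˡ (whynot c)   = whynot (Cong-refl (Cong-tyˡ c))
≈ᴴ-tyˡ (cut c)      = cut (Cong-refl (Cong-tyˡ c))

spine : {Δ : UCtx X m} {Γ : LCtx X n} → ∀ {H H′ x x′ A B} → Δ ⨾ Γ ⊩ H ≈ᴴ H′ ∶ A ⇒ B → Δ ⨾ Γ ⊩ x ≈ x′ ∶ A →
  WBᴴ H → WellBound x → ∀ {y} → H ∣ x ↘ y → Follows {Δ = Δ} {Γ} H′ x′ y B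
spine {H = H} h c v w r with spineˣ 1 (rank H) c (≈ᴴ-tyˡ h) v w r
... | y , r′ , e with spineᴴ 1 (rank H) (Cong-tyʳ c) h v (≈-WB c w) r′
... | y′ , r″ , e′ = y′ , r″ , e ⊙ e′

-- Reduction

infix 4 _⟶_

-- Pre-reduction stripped of typings, with redexes given by `↘`, so that renaming and decomposition
-- of steps are plain inductions. `⟶⁻⇒⟶` and `⟶⇒⟶⁻` relate it to the typed relation.
data _⟶_ {m n : ℕ} : Term m n → Term m n → Set where
  app-red    : ∀ {x r y} → appᴴ true r ∣ x ↘ y → x • r ⟶ y
  coapp-red  : ∀ {x r y} → appᴴ false r ∣ x ↘ y → x ▼ r ⟶ y
  pair-red   : ∀ {x t y} → pairᴴ t ∣ x ↘ y → t [ pair := x ] ⟶ y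
  bang-red   : ∀ {x t y} → bangᴴ t ∣ x ↘ y → t [ bang := x ] ⟶ y
  whynot-red : ∀ {x t y} → whynotᴴ t ∣ x ↘ y → t ▸ x ⟶ y
  cut-red    : ∀ {x w y} → cutᴴ x ∣ w ↘ y → x ♯ w ⟶ y
  tensorˡ    : ∀ {t t′ s} → t ⟶ t′ → ⟨ t , s ⟩ ⟶ ⟨ t′ , s ⟩
  tensorʳ    : ∀ {t s s′} → s ⟶ s′ → ⟨ t , s ⟩ ⟶ ⟨ t , s′ ⟩
  elimˡ      : ∀ {p t t′ s} → t ⟶ t′ → t [ p := s ] ⟶ t′ [ p := s ]
  elimʳ      : ∀ {p t s s′} → s ⟶ s′ → t [ p := s ] ⟶ t [ p := s′ ]
  par        : ∀ {t t′} → t ⟶ t′ → ℘ t ⟶ ℘ t′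
  appˡ       : ∀ {t t′ s} → t ⟶ t′ → t • s ⟶ t′ • s
  appʳ       : ∀ {t s s′} → s ⟶ s′ → t • s ⟶ t • s′
  coappˡ     : ∀ {t t′ s} → t ⟶ t′ → t ▼ s ⟶ t′ ▼ s
  coappʳ     : ∀ {t s s′} → s ⟶ s′ → t ▼ s ⟶ t ▼ s′
  ofcourse   : ∀ {t t′} → t ⟶ t′ → ! t ⟶ ! t′
  whynot     : ∀ {t t′} → t ⟶ t′ → ¿ t ⟶ ¿ t′
  elim-whynotˡ : ∀ {t t′ s} → t ⟶ t′ → t ▸ s ⟶ t′ ▸ s
  elim-whynotʳ : ∀ {t s s′} → s ⟶ s′ → t ▸ s ⟶ t ▸ s′
  cutˡ       : ∀ {t t′ s} → t ⟶ t′ → t ♯ s ⟶ t′ ♯ s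
  cutʳ       : ∀ {t s s′} → s ⟶ s′ → t ♯ s ⟶ t ♯ s′

⟶-ren⁺ : (ρ : Ren m n m′ n′) → ∀ {t t′} → t ⟶ t′ → ren ρ t ⟶ ren ρ t′
⟶-ren⁺ ρ (app-red r)      = app-red (↘-ren⁺ ρ r)
⟶-ren⁺ ρ (coapp-red r)    = coapp-red (↘-ren⁺ ρ r)
⟶-ren⁺ ρ (pair-red r)     = pair-red (↘-ren⁺ ρ r)
⟶-ren⁺ ρ (bang-red r)     = bang-red (↘-ren⁺ ρ r)
⟶-ren⁺ ρ (whynot-red r)   = whynot-red (↘-ren⁺ ρ r)
⟶-ren⁺ ρ (cut-red r)      = cut-red (↘-ren⁺ ρ r)
⟶-ren⁺ ρ (tensorˡ r)      = tensorˡ (⟶-ren⁺ ρ r)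
⟶-ren⁺ ρ (tensorʳ r)      = tensorʳ (⟶-ren⁺ ρ r)
⟶-ren⁺ ρ (elimˡ r)        = elimˡ (⟶-ren⁺ _ r)
⟶-ren⁺ ρ (elimʳ r)        = elimʳ (⟶-ren⁺ ρ r)
⟶-ren⁺ ρ (par r)          = par (⟶-ren⁺ _ r)
⟶-ren⁺ ρ (appˡ r)         = appˡ (⟶-ren⁺ ρ r)
⟶-ren⁺ ρ (appʳ r)         = appʳ (⟶-ren⁺ ρ r)
⟶-ren⁺ ρ (coappˡ r)       = coappˡ (⟶-ren⁺ ρ r)
⟶-ren⁺ ρ (coappʳ r)       = coappʳ (⟶-ren⁺ ρ r)
⟶-ren⁺ ρ (ofcourse r)     = ofcourse (⟶-ren⁺ _ r)
⟶-ren⁺ ρ (whynot r)       = whynot (⟶-ren⁺ _ r)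
⟶-ren⁺ ρ (elim-whynotˡ r) = elim-whynotˡ (⟶-ren⁺ _ r)
⟶-ren⁺ ρ (elim-whynotʳ r) = elim-whynotʳ (⟶-ren⁺ ρ r)
⟶-ren⁺ ρ (cutˡ r)         = cutˡ (⟶-ren⁺ ρ r)
⟶-ren⁺ ρ (cutʳ r)         = cutʳ (⟶-ren⁺ ρ r)

⟶-ren⁻ : (ρ : Ren m n m′ n′) → ∀ t {y} → ren ρ t ⟶ y → ∃[ t′ ] (t ⟶ t′ × y ≡ ren ρ t′)
⟶-ren⁻ ρ (x • r) (app-red c) with ↘-ren⁻ ρ (appᴴ true r) x c
... | y , c′ , e = y , app-red c′ , e
⟶-ren⁻ ρ (x ▼ r) (coapp-red c) with ↘-ren⁻ ρ (appᴴ false r) x c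
... | y , c′ , e = y , coapp-red c′ , e
⟶-ren⁻ ρ (t [ pair := x ]) (pair-red c) with ↘-ren⁻ ρ (pairᴴ t) x c
... | y , c′ , e = y , pair-red c′ , e
⟶-ren⁻ ρ (t [ bang := x ]) (bang-red c) with ↘-ren⁻ ρ (bangᴴ t) x c
... | y , c′ , e = y , bang-red c′ , e
⟶-ren⁻ ρ (t ▸ x) (whynot-red c) with ↘-ren⁻ ρ (whynotᴴ t) x c
... | y , c′ , e = y , whynot-red c′ , e
⟶-ren⁻ ρ (x ♯ w) (cut-red c) with ↘-ren⁻ ρ (cutᴴ x) w c
... | y , c′ , e = y , cut-red c′ , e
⟶-ren⁻ ρ ⟨ t , s ⟩ (tensorˡ c) with ⟶-ren⁻ ρ t c
... | _ , c′ , refl = _ , tensorˡ c′ , refl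
⟶-ren⁻ ρ ⟨ t , s ⟩ (tensorʳ c) with ⟶-ren⁻ ρ s c
... | _ , c′ , refl = _ , tensorʳ c′ , refl
⟶-ren⁻ ρ (t [ p := s ]) (elimˡ c) with ⟶-ren⁻ _ t c
... | _ , c′ , refl = _ , elimˡ c′ , refl
⟶-ren⁻ ρ (t [ p := s ]) (elimʳ c) with ⟶-ren⁻ ρ s c
... | _ , c′ , refl = _ , elimʳ c′ , refl
⟶-ren⁻ ρ (℘ t) (par c) with ⟶-ren⁻ _ t c
... | _ , c′ , refl = _ , par c′ , refl
⟶-ren⁻ ρ (t • s) (appˡ c) with ⟶-ren⁻ ρ t c
... | _ , c′ , refl = _ , appˡ c′ , refl
⟶-ren⁻ ρ (t • s) (appʳ c) with ⟶-ren⁻ ρ s c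
... | _ , c′ , refl = _ , appʳ c′ , refl
⟶-ren⁻ ρ (t ▼ s) (coappˡ c) with ⟶-ren⁻ ρ t c
... | _ , c′ , refl = _ , coappˡ c′ , refl
⟶-ren⁻ ρ (t ▼ s) (coappʳ c) with ⟶-ren⁻ ρ s c
... | _ , c′ , refl = _ , coappʳ c′ , refl
⟶-ren⁻ ρ (! t) (ofcourse c) with ⟶-ren⁻ _ t c
... | _ , c′ , refl = _ , ofcourse c′ , refl
⟶-ren⁻ ρ (¿ t) (whynot c) with ⟶-ren⁻ _ t c
... | _ , c′ , refl = _ , whynot c′ , refl
⟶-ren⁻ ρ (t ▸ s) (elim-whynotˡ c) with ⟶-ren⁻ _ t c
... | _ , c′ , refl = _ , elim-whynotˡ c′ , refl
⟶-ren⁻ ρ (t ▸ s) (elim-whynotʳ c) with ⟶-ren⁻ ρ s c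
... | _ , c′ , refl = _ , elim-whynotʳ c′ , refl
⟶-ren⁻ ρ (t ♯ s) (cutˡ c) with ⟶-ren⁻ ρ t c
... | _ , c′ , refl = _ , cutˡ c′ , refl
⟶-ren⁻ ρ (t ♯ s) (cutʳ c) with ⟶-ren⁻ ρ s c
... | _ , c′ , refl = _ , cutʳ c′ , refl

⟶-ty : {Δ : UCtx X m} {Γ : LCtx X n} → ∀ {t t′ A} → t ⟶ t′ → Δ ⨾ Γ ⊩ t ∶ A → WellBound t → Δ ⨾ Γ ⊩ t′ ∶ A
⟶-ty (app-red r) (app d e) (w , v) = ↘-ty r (app true (Cong-refl e)) v d w
⟶-ty (coapp-red r) (coapp d e) (w , v) = ↘-ty r (app false (Cong-refl e)) v d w
⟶-ty (pair-red r) (elim pair d e) (o , w , v) = ↘-ty r (pair (Cong-refl e)) (o , w) d v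
⟶-ty (bang-red r) (elim bang d e) (_ , w , v) = ↘-ty r (bang (Cong-refl e)) w d v
⟶-ty (whynot-red r) (elim-whynot d e) (o , f , w , v) = ↘-ty r (whynot (Cong-refl e)) (o , f , w) d v
⟶-ty (cut-red r) (cut d e) (w , v) = ↘-ty r (cut (≈-invol (Cong-refl d))) w e v
⟶-ty (tensorˡ r) (tensor d e) (w , v) = tensor (⟶-ty r d w) e
⟶-ty (tensorʳ r) (tensor d e) (w , v) = tensor d (⟶-ty r e v)
⟶-ty (elimˡ r) (elim p d e) (_ , w , v) = elim p d (⟶-ty r e w)
⟶-ty (elimʳ r) (elim p d e) (_ , w , v) = elim p (⟶-ty r d v) e
⟶-ty (par r) (par d) (_ , w) = par (⟶-ty r d w)
⟶-ty (appˡ r) (app d e) (w , v) = app (⟶-ty r d w) e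
⟶-ty (appʳ r) (app d e) (w , v) = app d (⟶-ty r e v)
⟶-ty (coappˡ r) (coapp d e) (w , v) = coapp (⟶-ty r d w) e
⟶-ty (coappʳ r) (coapp d e) (w , v) = coapp d (⟶-ty r e v)
⟶-ty (ofcourse r) (ofcourse d) (_ , _ , w) = ofcourse (⟶-ty r d w)
⟶-ty (whynot r) (whynot d) w = whynot (⟶-ty r d w)
⟶-ty (elim-whynotˡ r) (elim-whynot d e) (_ , _ , w , v) = elim-whynot d (⟶-ty r e w)
⟶-ty (elim-whynotʳ r) (elim-whynot d e) (_ , _ , w , v) = elim-whynot (⟶-ty r d v) e
⟶-ty (cutˡ r) (cut d e) (w , v) = cut (⟶-ty r d w) e
⟶-ty (cutʳ r) (cut d e) (w , v) = cut d (⟶-ty r e v)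

⟶-plug : (S : Surface m n k l) {t t′ : Term (k + m) (l + n)} → t ⟶ t′ → plug S t ⟶ plug S t′
⟶-plug ℘□          r = par r
⟶-plug ⟨□, _ ⟩     r = tensorˡ r
⟶-plug ⟨ _ ,□⟩     r = tensorʳ r
⟶-plug (□• _)      r = appˡ r
⟶-plug (_ •□)      r = appʳ r
⟶-plug (□▼ _)      r = coappˡ r
⟶-plug (_ ▼□)      r = coappʳ r
⟶-plug (□♯ _)      r = cutˡ r
⟶-plug (_ ♯□)      r = cutʳ r
⟶-plug ¿□          r = whynot r
⟶-plug □[ _ := _ ] r = elimˡ r
⟶-plug (elim□ _ _) r = elimʳ r
⟶-plug (_ ▸□)      r = elim-whynotʳ r

infix 4 _⟶ᔆ_

data _⟶ᔆ_ {m n : ℕ} : {k l : ℕ} → Surface m n k l → Surface m n k l → Set where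
  ⟨□,_⟩    : ∀ {t t′} → t ⟶ t′ → ⟨□, t ⟩ ⟶ᔆ ⟨□, t′ ⟩
  ⟨_,□⟩    : ∀ {t t′} → t ⟶ t′ → ⟨ t ,□⟩ ⟶ᔆ ⟨ t′ ,□⟩
  □•_      : ∀ {t t′} → t ⟶ t′ → □• t ⟶ᔆ □• t′
  _•□      : ∀ {t t′} → t ⟶ t′ → t •□ ⟶ᔆ t′ •□
  □▼_      : ∀ {t t′} → t ⟶ t′ → □▼ t ⟶ᔆ □▼ t′
  _▼□      : ∀ {t t′} → t ⟶ t′ → t ▼□ ⟶ᔆ t′ ▼□
  □♯_      : ∀ {t t′} → t ⟶ t′ → □♯ t ⟶ᔆ □♯ t′
  _♯□      : ∀ {t t′} → t ⟶ t′ → t ♯□ ⟶ᔆ t′ ♯□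
  □[_:=_]  : ∀ p {t t′} → t ⟶ t′ → □[ p := t ] ⟶ᔆ □[ p := t′ ]
  elim□    : ∀ p {t t′} → t ⟶ t′ → elim□ p t ⟶ᔆ elim□ p t′
  _▸□      : ∀ {t t′} → t ⟶ t′ → t ▸□ ⟶ᔆ t′ ▸□

⟶ᔆ-plug : {S S′ : Surface m n k l} → S ⟶ᔆ S′ → (t : Term (k + m) (l + n)) → plug S t ⟶ plug S′ t
⟶ᔆ-plug ⟨□, r ⟩      t = tensorʳ r
⟶ᔆ-plug ⟨ r ,□⟩      t = tensorˡ r
⟶ᔆ-plug (□• r)       t = appʳ r
⟶ᔆ-plug (r •□)       t = appˡ r
⟶ᔆ-plug (□▼ r)       t = coappʳ r
⟶ᔆ-plug (r ▼□)       t = coappˡ r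
⟶ᔆ-plug (□♯ r)       t = cutʳ r
⟶ᔆ-plug (r ♯□)       t = cutˡ r
⟶ᔆ-plug □[ p := r ]  t = elimʳ r
⟶ᔆ-plug (elim□ p r)  t = elimˡ r
⟶ᔆ-plug (r ▸□)       t = elim-whynotˡ r

⟶ᔆ-ren⁺ : (ρ : Ren m n m′ n′) {S S′ : Surface m n k l} → S ⟶ᔆ S′ → renᔆ ρ S ⟶ᔆ renᔆ ρ S′
⟶ᔆ-ren⁺ ρ ⟨□, r ⟩      = ⟨□, ⟶-ren⁺ ρ r ⟩
⟶ᔆ-ren⁺ ρ ⟨ r ,□⟩      = ⟨ ⟶-ren⁺ ρ r ,□⟩
⟶ᔆ-ren⁺ ρ (□• r)       = □• ⟶-ren⁺ ρ r
⟶ᔆ-ren⁺ ρ (r •□)       = ⟶-ren⁺ ρ r •□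
⟶ᔆ-ren⁺ ρ (□▼ r)       = □▼ ⟶-ren⁺ ρ r
⟶ᔆ-ren⁺ ρ (r ▼□)       = ⟶-ren⁺ ρ r ▼□
⟶ᔆ-ren⁺ ρ (□♯ r)       = □♯ ⟶-ren⁺ ρ r
⟶ᔆ-ren⁺ ρ (r ♯□)       = ⟶-ren⁺ ρ r ♯□
⟶ᔆ-ren⁺ ρ □[ p := r ]  = □[ p := ⟶-ren⁺ ρ r ]
⟶ᔆ-ren⁺ ρ (elim□ p r)  = elim□ p (⟶-ren⁺ _ r)
⟶ᔆ-ren⁺ ρ (r ▸□)       = ⟶-ren⁺ _ r ▸□

⟶ᔆ-ren⁻ : (ρ : Ren m n m′ n′) (S : Surface m n k l) {S₁ : Surface m′ n′ k l} → renᔆ ρ S ⟶ᔆ S₁ →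
  ∃[ S′ ] (S ⟶ᔆ S′ × S₁ ≡ renᔆ ρ S′)
⟶ᔆ-ren⁻ ρ ⟨□, t ⟩ ⟨□, r ⟩ with ⟶-ren⁻ ρ t r
... | _ , r′ , refl = _ , ⟨□, r′ ⟩ , refl
⟶ᔆ-ren⁻ ρ ⟨ t ,□⟩ ⟨ r ,□⟩ with ⟶-ren⁻ ρ t r
... | _ , r′ , refl = _ , ⟨ r′ ,□⟩ , refl
⟶ᔆ-ren⁻ ρ (□• t) (□• r) with ⟶-ren⁻ ρ t r
... | _ , r′ , refl = _ , (□• r′) , refl
⟶ᔆ-ren⁻ ρ (t •□) (r •□) with ⟶-ren⁻ ρ t r
... | _ , r′ , refl = _ , (r′ •□) , refl
⟶ᔆ-ren⁻ ρ (□▼ t) (□▼ r) with ⟶-ren⁻ ρ t r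
... | _ , r′ , refl = _ , (□▼ r′) , refl
⟶ᔆ-ren⁻ ρ (t ▼□) (r ▼□) with ⟶-ren⁻ ρ t r
... | _ , r′ , refl = _ , (r′ ▼□) , refl
⟶ᔆ-ren⁻ ρ (□♯ t) (□♯ r) with ⟶-ren⁻ ρ t r
... | _ , r′ , refl = _ , (□♯ r′) , refl
⟶ᔆ-ren⁻ ρ (t ♯□) (r ♯□) with ⟶-ren⁻ ρ t r
... | _ , r′ , refl = _ , (r′ ♯□) , refl
⟶ᔆ-ren⁻ ρ □[ p := t ] □[ _ := r ] with ⟶-ren⁻ ρ t r
... | _ , r′ , refl = _ , □[ p := r′ ] , refl
⟶ᔆ-ren⁻ ρ (elim□ p t) (elim□ _ r) with ⟶-ren⁻ _ t r
... | _ , r′ , refl = _ , elim□ p r′ , refl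
⟶ᔆ-ren⁻ ρ (t ▸□) (r ▸□) with ⟶-ren⁻ _ t r
... | _ , r′ , refl = _ , (r′ ▸□) , refl

-- Redexes made by `S` together with the term in its hole, which is the eliminated term or, in the
-- cases ending in `-arg`, a part of the head.
data RedPlug {m n : ℕ} : {k l : ℕ} → Surface m n k l → Term (k + m) (l + n) → Term m n → Set where
  app      : ∀ {t x y} → appᴴ true x ∣ t ↘ y → RedPlug (□• x) t y
  app-arg  : ∀ {t x y} → appᴴ true t ∣ x ↘ y → RedPlug (x •□) t y
  coapp    : ∀ {t x y} → appᴴ false x ∣ t ↘ y → RedPlug (□▼ x) t y
  coapp-arg : ∀ {t x y} → appᴴ false t ∣ x ↘ y → RedPlug (x ▼□) t y
  pair     : ∀ {t x y} → pairᴴ x ∣ t ↘ y → RedPlug (elim□ pair x) t y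
  pair-arg : ∀ {t x y} → pairᴴ t ∣ x ↘ y → RedPlug □[ pair := x ] t y
  bang     : ∀ {t x y} → bangᴴ x ∣ t ↘ y → RedPlug (elim□ bang x) t y
  bang-arg : ∀ {t x y} → bangᴴ t ∣ x ↘ y → RedPlug □[ bang := x ] t y
  whynot   : ∀ {t x y} → whynotᴴ x ∣ t ↘ y → RedPlug (x ▸□) t y
  cut      : ∀ {t x y} → cutᴴ x ∣ t ↘ y → RedPlug (x ♯□) t y
  cut-arg  : ∀ {t x y} → cutᴴ t ∣ x ↘ y → RedPlug (□♯ x) t y

RedPlug⇒⟶ : {S : Surface m n k l} → ∀ {t y} → RedPlug S t y → plug S t ⟶ y
RedPlug⇒⟶ (app r)       = app-red r
RedPlug⇒⟶ (app-arg r)   = app-red r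
RedPlug⇒⟶ (coapp r)     = coapp-red r
RedPlug⇒⟶ (coapp-arg r) = coapp-red r
RedPlug⇒⟶ (pair r)      = pair-red r
RedPlug⇒⟶ (pair-arg r)  = pair-red r
RedPlug⇒⟶ (bang r)      = bang-red r
RedPlug⇒⟶ (bang-arg r)  = bang-red r
RedPlug⇒⟶ (whynot r)    = whynot-red r
RedPlug⇒⟶ (cut r)       = cut-red r
RedPlug⇒⟶ (cut-arg r)   = cut-red r

data PlugStep {m n k l : ℕ} (S : Surface m n k l) (t : Term (k + m) (l + n)) : Term m n → Set where
  in-hole : ∀ {t′} → t ⟶ t′ → PlugStep S t (plug S t′)
  in-side : ∀ {S′} → S ⟶ᔆ S′ → PlugStep S t (plug S′ t)
  at-root : ∀ {y} → RedPlug S t y → PlugStep S t y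

plug-step : (S : Surface m n k l) {t : Term (k + m) (l + n)} {y : Term m n} → plug S t ⟶ y → PlugStep S t y
plug-step ℘□ (par r) = in-hole r
plug-step ⟨□, _ ⟩ (tensorˡ r) = in-hole r
plug-step ⟨□, _ ⟩ (tensorʳ r) = in-side ⟨□, r ⟩
plug-step ⟨ _ ,□⟩ (tensorʳ r) = in-hole r
plug-step ⟨ _ ,□⟩ (tensorˡ r) = in-side ⟨ r ,□⟩
plug-step (□• _) (appˡ r) = in-hole r
plug-step (□• _) (appʳ r) = in-side (□• r)
plug-step (□• _) (app-red r) = at-root (app r)
plug-step (_ •□) (appʳ r) = in-hole r
plug-step (_ •□) (appˡ r) = in-side (r •□)
plug-step (_ •□) (app-red r) = at-root (app-arg r)
plug-step (□▼ _) (coappˡ r) = in-hole r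
plug-step (□▼ _) (coappʳ r) = in-side (□▼ r)
plug-step (□▼ _) (coapp-red r) = at-root (coapp r)
plug-step (_ ▼□) (coappʳ r) = in-hole r
plug-step (_ ▼□) (coappˡ r) = in-side (r ▼□)
plug-step (_ ▼□) (coapp-red r) = at-root (coapp-arg r)
plug-step (□♯ _) (cutˡ r) = in-hole r
plug-step (□♯ _) (cutʳ r) = in-side (□♯ r)
plug-step (□♯ _) (cut-red r) = at-root (cut-arg r)
plug-step (_ ♯□) (cutʳ r) = in-hole r
plug-step (_ ♯□) (cutˡ r) = in-side (r ♯□)
plug-step (_ ♯□) (cut-red r) = at-root (cut r)
plug-step ¿□ (whynot r) = in-hole r
plug-step □[ p := _ ] (elimˡ r) = in-hole r
plug-step □[ p := _ ] (elimʳ r) = in-side □[ p := r ]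
plug-step □[ pair := _ ] (pair-red r) = at-root (pair-arg r)
plug-step □[ bang := _ ] (bang-red r) = at-root (bang-arg r)
plug-step (elim□ p _) (elimʳ r) = in-hole r
plug-step (elim□ p _) (elimˡ r) = in-side (elim□ p r)
plug-step (elim□ pair _) (pair-red r) = at-root (pair r)
plug-step (elim□ bang _) (bang-red r) = at-root (bang r)
plug-step (_ ▸□) (elim-whynotʳ r) = in-hole r
plug-step (_ ▸□) (elim-whynotˡ r) = in-side (r ▸□)
plug-step (_ ▸□) (whynot-red r) = at-root (whynot r)

-- The patterns that form redexes. For `unit` there is no reduction axiom; `unit-⋆` belongs to the
-- equivalence.
data Positive : Pat → Set where
  pair : Positive pair
  bang : Positive bang

headᴾ : ∀ {p} → Positive p → Term (#ᵘ p + m) (#ˡ p + n) → Head m n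
headᴾ pair t = pairᴴ t
headᴾ bang t = bangᴴ t

renᴴ-headᴾ : ∀ {p} (P : Positive p) (ρ : Ren m n m′ n′) (t : Term (#ᵘ p + m) (#ˡ p + n)) →
  renᴴ ρ (headᴾ P t) ≡ headᴾ P (ren (liftᴿ (#ᵘ p) (#ˡ p) ρ) t)
renᴴ-headᴾ pair ρ t = refl
renᴴ-headᴾ bang ρ t = refl

module _ {m n k l : ℕ} (S : Surface m n k l) where

  -- The side terms of `S` are weakened over the bound pair, so the substitution acts in the hole
  -- only.
  pair-reduct-plug : (s x : Term m n) (t : Term (k + m) (l + (2 + n))) →
    sub (pairˢ s x) (plug (renᔆ (wk 0 2) S) t) ≡
    plug S (sub (pairˢ (ren (wk k l) s) (ren (wk k l) x)) (ren (xch k l 0 2) t))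
  pair-reduct-plug s x t = trans (sub-plug (pairˢ s x) (renᔆ (wk 0 2) S) t) (cong₂ plug
    (trans (subᔆ-renᔆ _ _ S) (trans (subᔆ-cong ((λ _ → refl) , (λ _ → refl)) S) (subᔆ-id S)))
    (trans (cong (sub (liftˢ k l (pairˢ s x))) (sym (xch-involutive k l 0 2 t)))
      (trans (Block-xch k l 0 2 0 0 {pairˢ s x} {pairˢ (ren (wk k l) s) (ren (wk k l) x)}
        (block (λ _ → refl) (λ _ → refl)) (block (λ _ → refl) (λ _ → refl))
        (λ ()) (λ { zero → refl ; (suc zero) → refl }) (ren (xch k l 0 2) t))
        (xch-0 k l _))))

  bang-reduct-plug : (s : Term m n) (t : Term (k + (1 + m)) (l + n)) →
    (plug (renᔆ (wk 1 0) S) t) [ s ]ᵘ ≡ plug S (ren (xch k l 1 0) t [ ren (wk k l) s ]ᵘ)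
  bang-reduct-plug s t = trans (sub-plug _ (renᔆ (wk 1 0) S) t) (cong₂ plug
    (trans (subᔆ-renᔆ _ _ S) (trans (subᔆ-cong ((λ _ → refl) , (λ _ → refl)) S) (subᔆ-id S)))
    (trans (cong (sub (liftˢ k l (insertAt uvar zero s , lvar))) (sym (xch-involutive k l 1 0 t)))
      (trans (Block-xch k l 1 0 0 0 {insertAt uvar zero s , lvar} {insertAt uvar zero (ren (wk k l) s) , lvar}
        (block (λ _ → refl) (λ _ → refl)) (block (λ _ → refl) (λ _ → refl))
        (λ { zero → refl }) (λ ()) (ren (xch k l 1 0) t))
        (xch-0 k l _))))

module _ {p : Pat} (P : Positive p) where

  head-plug-ren : (S : Surface m n k l) (t : Term (k + (#ᵘ p + m)) (l + (#ˡ p + n))) (ρ : Ren m n m′ n′) →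
    renᴴ ρ (headᴾ P (plug (renᔆ (wk (#ᵘ p) (#ˡ p)) S) t)) ≡
    headᴾ P (plug (renᔆ (wk (#ᵘ p) (#ˡ p)) (renᔆ ρ S)) (ren (liftᴿ k l (liftᴿ (#ᵘ p) (#ˡ p) ρ)) t))
  head-plug-ren {k = k} {l} S t ρ = trans (renᴴ-headᴾ P ρ _) (cong (headᴾ P)
    (trans (ren-plug (liftᴿ (#ᵘ p) (#ˡ p) ρ) (renᔆ (wk (#ᵘ p) (#ˡ p)) S) t)
      (cong (λ S → plug S (ren (liftᴿ k l (liftᴿ (#ᵘ p) (#ˡ p) ρ)) t)) (renᔆ-wk (#ᵘ p) (#ˡ p) ρ S))))

  head-xch-ren : ∀ k l (t : Term (k + (#ᵘ p + m)) (l + (#ˡ p + n))) (ρ : Ren m n m′ n′) →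
    renᴴ (liftᴿ k l ρ) (headᴾ P (ren (xch k l (#ᵘ p) (#ˡ p)) t)) ≡
    headᴾ P (ren (xch k l (#ᵘ p) (#ˡ p)) (ren (liftᴿ k l (liftᴿ (#ᵘ p) (#ˡ p) ρ)) t))
  head-xch-ren k l t ρ = trans (renᴴ-headᴾ P (liftᴿ k l ρ) _) (cong (headᴾ P) (sym (xch-ren k l (#ᵘ p) (#ˡ p) ρ t)))

-- The sliding eliminator is the redex itself. Its substitution leaves the side terms of `S` as they
-- were, and the eliminators peeled off `r` slide across `S` in the reduct.
elim-frame⁺ : ∀ {p} (P : Positive p) (S : Surface m n k l) (t : Term (k + (#ᵘ p + m)) (l + (#ˡ p + n))) (r : Term m n) →
  ∀ {y} → headᴾ P (plug (renᔆ (wk (#ᵘ p) (#ˡ p)) S) t) ∣ r ↘ y →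
  ∃[ y′ ] (headᴾ P (ren (xch k l (#ᵘ p) (#ˡ p)) t) ∣ ren (wk k l) r ↘ y′ × y ⇌ plug S y′)
elim-frame⁺ pair S t ⟨ s , x ⟩ pair-⟨⟩ = _ , pair-⟨⟩ , ≡⇒⇌ (pair-reduct-plug S s x t)
elim-frame⁺ {k = k} {l} bang S t (! s) bang-! = _ , bang-! ,
  ≡⇒⇌ (trans (bang-reduct-plug S (s ⟪\\⋆⟫) t) (cong (λ x → plug S (ren (xch k l 1 0) t [ x ]ᵘ)) (ren-⟪⟫ (wk k l) s)))
elim-frame⁺ {k = k} {l} {p} P S t (r [ q := x ]) (peel _ {y = y} c)
  with elim-frame⁺ P (renᔆ W S) (ren (liftᴿ k l (liftᴿ (#ᵘ p) (#ˡ p) W)) t) r (↘-≡ (head-plug-ren P S t W) c)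
  where
  W : ∀ {m n} → Ren m n (#ᵘ q + m) (#ˡ q + n)
  W = wk (#ᵘ q) (#ˡ q)
... | y′ , c′ , e = _ , peel q (subst₂ (λ H x → H ∣ x ↘ ren χ y′)
    (trans (cong (renᴴ χ) (sym (head-xch-ren P k l t (wk (#ᵘ q) (#ˡ q)))))
      (renᴴ-xch-wk-inner k l (#ᵘ q) (#ˡ q) (headᴾ P (ren (xch k l (#ᵘ p) (#ˡ p)) t))))
    (xch-wk-outer k l (#ᵘ q) (#ˡ q) r)
    (↘-ren⁺ χ c′)) ,
  elim-⇌ q e ⇌-refl ⨟ slide-⇌ q S y′ x
  where
  χ : Ren (k + (#ᵘ q + _)) (l + (#ˡ q + _)) (#ᵘ q + (k + _)) (#ˡ q + (l + _))
  χ = xch k l (#ᵘ q) (#ˡ q)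

elim-frame⁻ : ∀ {p} (P : Positive p) (S : Surface m n k l) (t : Term (k + (#ᵘ p + m)) (l + (#ˡ p + n))) (r : Term m n) →
  ∀ {y′} → headᴾ P (ren (xch k l (#ᵘ p) (#ˡ p)) t) ∣ ren (wk k l) r ↘ y′ →
  ∃[ y ] (headᴾ P (plug (renᔆ (wk (#ᵘ p) (#ˡ p)) S) t) ∣ r ↘ y × y ⇌ plug S y′)
elim-frame⁻ pair S t ⟨ s , x ⟩ pair-⟨⟩ = _ , pair-⟨⟩ , ≡⇒⇌ (pair-reduct-plug S s x t)
elim-frame⁻ {k = k} {l} bang S t (! s) bang-! = _ , bang-! ,
  ≡⇒⇌ (trans (bang-reduct-plug S (s ⟪\\⋆⟫) t) (cong (λ x → plug S (ren (xch k l 1 0) t [ x ]ᵘ)) (ren-⟪⟫ (wk k l) s)))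
elim-frame⁻ {m = m} {n} {k} {l} {p} P S t (r [ q := x ]) (peel _ {y = y′} c)
  with elim-frame⁻ P (renᔆ (wk (#ᵘ q) (#ˡ q)) S) (ren (liftᴿ k l (liftᴿ (#ᵘ p) (#ˡ p) (wk (#ᵘ q) (#ˡ q)))) t) r
    (subst₂ (λ H x → H ∣ x ↘ ren χ y′)
      (trans (renᴴ-xch-wk-outer (#ᵘ q) (#ˡ q) k l (headᴾ P (ren (xch k l (#ᵘ p) (#ˡ p)) t)))
        (head-xch-ren P k l t (wk (#ᵘ q) (#ˡ q))))
      (xch-wk-inner (#ᵘ q) (#ˡ q) k l r) (↘-ren⁺ χ c))
  where
  χ : Ren (#ᵘ q + (k + m)) (#ˡ q + (l + n)) (k + (#ᵘ q + m)) (l + (#ˡ q + n))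
  χ = xch (#ᵘ q) (#ˡ q) k l
... | y , c′ , e = _ , peel q (↘-≡ (sym (head-plug-ren P S t (wk (#ᵘ q) (#ˡ q)))) c′) ,
  elim-⇌ q e ⇌-refl ⨟ slide-⇌ q S _ x ⨟
  ≡⇒⇌ (cong (λ y → plug S (y [ q := ren (wk k l) x ])) (xch-involutive (#ᵘ q) (#ˡ q) k l y′))

-- Seen from its other side the redex has literally the same reduct, since `tensor-℘` and `pair-⟨⟩`
-- perform the same substitution. The next lemmas do this for the other kinds of values.
cut-tensor : ∀ {s r x y : Term m n} → tensorᴴ s r ∣ x ↘ y → cutᴴ ⟨ s , r ⟩ ∣ x ↘ y
cut-tensor tensor-℘   = cut-℘ pair-⟨⟩
cut-tensor (peel p c) = peel p (cut-tensor c)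

cut-par : ∀ {t} {x y : Term m n} → pairᴴ t ∣ x ↘ y → cutᴴ (℘ t) ∣ x ↘ y
cut-par pair-⟨⟩    = cut-⟨⟩ tensor-℘
cut-par (peel p c) = peel p (cut-par c)

cut-ofcourse : ∀ {t} {x y : Term m n} → whynotᴴ t ∣ x ↘ y → cutᴴ (! t) ∣ x ↘ y
cut-ofcourse whynot-¿   = cut-¿ bang-!
cut-ofcourse (peel p c) = peel p (cut-ofcourse c)

cut-whynot : ∀ {t} {x y : Term m n} → bangᴴ t ∣ x ↘ y → cutᴴ (¿ t) ∣ x ↘ y
cut-whynot bang-!     = cut-! whynot-¿
cut-whynot (peel p c) = peel p (cut-whynot c)

cut-par⁻ : ∀ {t} {x y : Term m n} → cutᴴ (℘ t) ∣ x ↘ y → pairᴴ t ∣ x ↘ y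
cut-par⁻ (cut-⟨⟩ tensor-℘) = pair-⟨⟩
cut-par⁻ (peel p c)        = peel p (cut-par⁻ c)

cut-whynot⁻ : ∀ {t} {x y : Term m n} → cutᴴ (¿ t) ∣ x ↘ y → bangᴴ t ∣ x ↘ y
cut-whynot⁻ (cut-! whynot-¿) = bang-!
cut-whynot⁻ (peel p c)       = peel p (cut-whynot⁻ c)

-- The eliminators on `w` were peeled outermost; after the swap they belong to the head. `side⁺` for
-- a cut head moves them there one by one.
cut-comm : {Δ : UCtx X m} {Γ : LCtx X n} → ∀ {x w A y} → Δ ⨾ Γ ⊩ x ∶ A ^⊥ → WellBound x → Δ ⨾ Γ ⊩ w ∶ A → WellBound w →
  cutᴴ x ∣ w ↘ y → Follows {Δ = Δ} {Γ} (cutᴴ w) x y ⊥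
cut-comm dx wx dw ww r@(cut-⟨⟩ c) = _ , cut-tensor c , Cong-refl (↘-ty r (cut (Cong-refl dx)) wx dw ww)
cut-comm dx wx dw ww r@(cut-℘ c) = _ , cut-par c , Cong-refl (↘-ty r (cut (Cong-refl dx)) wx dw ww)
cut-comm dx wx dw ww r@(cut-! c) = _ , cut-ofcourse c , Cong-refl (↘-ty r (cut (Cong-refl dx)) wx dw ww)
cut-comm dx wx dw ww r@(cut-¿ c) = _ , cut-whynot c , Cong-refl (↘-ty r (cut (Cong-refl dx)) wx dw ww)
cut-comm {x = x} dx wx dw@(elim {Δₚ = Δₚ} {Γₚ} q d e) ww@(_ , w , _) (peel p c)
  with cut-comm (ren-ty⁺ (TyRen-wk Δₚ Γₚ) dx) (WB-ren⁺ (wk (#ᵘ p) (#ˡ p)) x wx) e w c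
... | y , c′ , f with side⁺ p cut (cut (≈-invol (Cong-refl dw))) ww x dx wx c′
... | y′ , c″ , f′ = y′ , c″ , elim q (Cong-refl d) f ⊙ f′

tensorᵈ : Bool → Term m n → Term m n → Head m n
tensorᵈ true  s r = tensorᴴ s r
tensorᵈ false s r = tensorᴴ r s

pairᵈ : Bool → Term m n → Term m n → Sub m (2 + n) m n
pairᵈ true  s r = pairˢ s r
pairᵈ false s r = pairˢ r s

renᴴ-tensorᵈ : ∀ d (ρ : Ren m n m′ n′) (s r : Term m n) → renᴴ ρ (tensorᵈ d s r) ≡ tensorᵈ d (ren ρ s) (ren ρ r)
renᴴ-tensorᵈ true  ρ s r = refl
renᴴ-tensorᵈ false ρ s r = refl

appˢ-substˡ : ∀ d (s r : Term m n) t → sub (appˢ d s) t [ r ]ˡ ≡ sub (pairᵈ d s r) t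
appˢ-substˡ d s r t = trans (sub-sub _ _ t) (sub-cong (eᵘ d , e d) t)
  where
  eᵘ : ∀ d u → uvar u ≡ proj₁ (pairᵈ d s r) u
  eᵘ true  u = refl
  eᵘ false u = refl
  e : ∀ d a → proj₂ (appˢ d s) a [ r ]ˡ ≡ proj₂ (pairᵈ d s r) a
  e true  zero          = wk-substˡ s r
  e true  (suc zero)    = refl
  e true  (suc (suc a)) = refl
  e false zero          = refl
  e false (suc zero)    = wk-substˡ s r
  e false (suc (suc a)) = refl

module _ {X : Set} {m n : ℕ} {Δ : UCtx X m} {Γ : LCtx X n} where

  -- An application leaves a contra-substitution at `⋆` for the variable not yet filled. Cutting it
  -- against `r` fills that variable with `r`, by `♯-contra`, which gives the simultaneous
  -- substitution performed by the tensor head.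
  tensor-reduct-≈ : ∀ d s r t → WellBound s → WellBound (℘ t) → Δ ⨾ Γ ⊩ sub (pairᵈ d s r) t ∶ ⊥ →
    Δ ⨾ Γ ⊩ sub (appˢ d s) t ⟪\\⋆⟫ ♯ r ≈ sub (pairᵈ d s r) t ∶ ⊥
  tensor-reduct-≈ d s r t v (o , w) e = Cong-sym (Cong-sym (♯-⋆-≈ e) ⊙
    to (≡⇒⇌ (cong (_♯ ⋆) (sym (appˢ-substˡ d s r t))) ⨟
      ♯-contra f {uvar , insertAt lvar zero ⋆} {uvar , insertAt lvar zero r}
        (agreeOff (λ _ → refl) λ { zero g → contradiction refl g ; (suc a) _ → refl }) ⋆) (cut e one))
    where f = surf (sub (appˢ d s) t) (appˢ-occ d s {t} o) (WB-sub (appˢ-WB d {s} v) t w)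

tensorᵈ-typed : ∀ d {Δ : UCtx X m} {Γ : LCtx X n} {A B : Formula X} {s r : Term m n} →
  Δ ⨾ Γ ⊩ s ∶ argᵀ d A B ^⊥ → Δ ⨾ Γ ⊩ r ∶ otherᵀ d A B ^⊥ → Δ ⨾ Γ ⊩ tensorᵈ d s r ≈ᴴ tensorᵈ d s r ∶ A ⅋ B ⇒ ⊥
tensorᵈ-typed true  d e = tensor (Cong-refl d) (Cong-refl e)
tensorᵈ-typed false d e = tensor (Cong-refl e) (Cong-refl d)

tensorᵈ-WB : ∀ d {s r : Term m n} → WellBound s → WellBound r → WBᴴ (tensorᵈ d s r)
tensorᵈ-WB true  w v = w , v
tensorᵈ-WB false w v = v , w

tensorᵈ-℘ : ∀ d {s r : Term m n} {t} → tensorᵈ d s r ∣ ℘ t ↘ sub (pairᵈ d s r) t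
tensorᵈ-℘ true  = tensor-℘
tensorᵈ-℘ false = tensor-℘

♯-elim : ∀ p (y : Term (#ᵘ p + m) (#ˡ p + n)) (q r : Term m n) →
  (y [ p := q ]) ♯ r ⇌ (y ♯ ren (wk (#ᵘ p) (#ˡ p)) r) [ p := q ]
♯-elim p y q r = ⇌-sym (slide₀ p (□♯ r) y q)

app-tensor⁺ : ∀ d {Δ : UCtx X m} {Γ : LCtx X n} {A B : Formula X} {s r x : Term m n} →
  Δ ⨾ Γ ⊩ s ∶ argᵀ d A B ^⊥ → WellBound s → Δ ⨾ Γ ⊩ r ∶ otherᵀ d A B ^⊥ → WellBound r → Δ ⨾ Γ ⊩ x ∶ A ⅋ B → WellBound x →
  ∀ {y} → appᴴ d s ∣ x ↘ y → Follows {Δ = Δ} {Γ} (tensorᵈ d s r) x (y ♯ r) ⊥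
app-tensor⁺ d {s = s} {r} ds ws dr wr dx@(par dt) (o , w) (app-℘ {t = t}) = _ , tensorᵈ-℘ d ,
  tensor-reduct-≈ d s r t ws (o , w)
    (↘-ty (tensorᵈ-℘ d) (tensorᵈ-typed d ds dr) (tensorᵈ-WB d ws wr) dx (o , w))
app-tensor⁺ d {s = s} {r} ds ws dr wr dx@(elim {s = q} {Δₚ = Δₚ} {Γₚ} pt dq de) (_ , w , _) (peel p {y = y} c)
  with app-tensor⁺ d (ren-ty⁺ (TyRen-wk Δₚ Γₚ) ds) (WB-ren⁺ _ s ws) (ren-ty⁺ (TyRen-wk Δₚ Γₚ) dr) (WB-ren⁺ _ r wr) de w c
... | y′ , c′ , e = _ , peel p (↘-≡ (sym (renᴴ-tensorᵈ d _ s r)) c′) ,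
  Cong-sym (from (♯-elim p y q r) (elim pt dq (Cong-tyˡ e))) ⊙ elim pt (Cong-refl dq) e

app-tensor⁻ : ∀ d {Δ : UCtx X m} {Γ : LCtx X n} {A B : Formula X} {s r x : Term m n} →
  Δ ⨾ Γ ⊩ s ∶ argᵀ d A B ^⊥ → WellBound s → Δ ⨾ Γ ⊩ r ∶ otherᵀ d A B ^⊥ → WellBound r → Δ ⨾ Γ ⊩ x ∶ A ⅋ B → WellBound x →
  ∀ {y} → tensorᵈ d s r ∣ x ↘ y → ∃[ y′ ] (appᴴ d s ∣ x ↘ y′ × Δ ⨾ Γ ⊩ y ≈ y′ ♯ r ∶ ⊥)
app-tensor⁻ true {s = s} {r} ds ws dr wr dx@(par dt) (o , w) (tensor-℘ {t = t}) = _ , app-℘ ,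
  Cong-sym (tensor-reduct-≈ true s r t ws (o , w)
    (↘-ty tensor-℘ (tensorᵈ-typed true ds dr) (ws , wr) dx (o , w)))
app-tensor⁻ false {s = s} {r} ds ws dr wr dx@(par dt) (o , w) (tensor-℘ {t = t}) = _ , app-℘ ,
  Cong-sym (tensor-reduct-≈ false s r t ws (o , w)
    (↘-ty tensor-℘ (tensorᵈ-typed false ds dr) (wr , ws) dx (o , w)))
app-tensor⁻ d {s = s} {r} ds ws dr wr dx@(elim {s = q} {Δₚ = Δₚ} {Γₚ} pt dq de) (_ , w , _) (peel p c)
  with app-tensor⁻ d (ren-ty⁺ (TyRen-wk Δₚ Γₚ) ds) (WB-ren⁺ _ s ws) (ren-ty⁺ (TyRen-wk Δₚ Γₚ) dr) (WB-ren⁺ _ r wr) de w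
    (↘-≡ (renᴴ-tensorᵈ d _ s r) c)
... | y′ , c′ , e = _ , peel p c′ ,
  elim pt (Cong-refl dq) e ⊙ from (♯-elim p y′ q r) (elim pt dq (Cong-tyʳ e))

↘-≡ᵗ : {H : Head m n} {x x′ y : Term m n} → x ≡ x′ → H ∣ x ↘ y → H ∣ x′ ↘ y
↘-≡ᵗ refl c = c

-- Simulation of a step across an axiom and across an equivalence

module _ {X : Set} {m n : ℕ} {Δ : UCtx X m} {Γ : LCtx X n} where

  Simulates : Term m n → Term m n → Formula X → Set
  Simulates x y A = ∃[ y′ ] (x ⟶ y′ × Δ ⨾ Γ ⊩ y ≈ y′ ∶ A)

  Simulates-≡ : ∀ {x x′ y A} → x ≡ x′ → Simulates x y A → Simulates x′ y A
  Simulates-≡ refl s = s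

  module _ (p : Pat) {A : Formula X} where
    private
      W : ∀ {m n} → Ren m n (#ᵘ p + m) (#ˡ p + n)
      W = wk (#ᵘ p) (#ˡ p)

    slide-ty₀ : (S : Surface m n 0 0) (t : Term (#ᵘ p + m) (#ˡ p + n)) (r : Term m n) →
      Δ ⨾ Γ ⊩ plug (renᔆ W S) t [ p := r ] ∶ A → Δ ⨾ Γ ⊩ plug S (t [ p := r ]) ∶ A
    slide-ty₀ S t r d = Cong-tyʳ (to (slide₀ p S t r) d)

    slide-WB₀ : (S : Surface m n 0 0) (t : Term (#ᵘ p + m) (#ˡ p + n)) (r : Term m n) →
      Δ ⨾ Γ ⊩ plug (renᔆ W S) t [ p := r ] ∶ A → WellBound (plug (renᔆ W S) t [ p := r ]) → WellBound (plug S (t [ p := r ]))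
    slide-WB₀ S t r d w = ≈-WB (to (slide₀ p S t r) d) w

    -- If the hole is the eliminated term, the eliminator joins its spine and is peeled, with the
    -- same reduct. If the hole belongs to the head, the head absorbs the eliminator by `side⁺`.
    sim-root⁺ : ∀ {k l} (S : Surface m n k l) t r {y} →
      Δ ⨾ Γ ⊩ plug (renᔆ W S) t [ p := r ] ∶ A → WellBound (plug (renᔆ W S) t [ p := r ]) →
      RedPlug (renᔆ W S) t y → Simulates (plug S (ren (xch k l (#ᵘ p) (#ˡ p)) t [ p := ren (wk k l) r ])) (y [ p := r ]) A
    sim-root⁺ S@(□• x) t r d w ρ@(app c) = Simulates-≡ (cong (plug S) (sym (elim-0 p t r)))
      (_ , app-red (peel p c) , Cong-refl (⟶-ty (elimˡ (RedPlug⇒⟶ ρ)) d w))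
    sim-root⁺ S@(x •□) t r d w (app-arg c) with slide-ty₀ S t r d | slide-WB₀ S t r d w
    ... | app dx dt | wx , wt with side⁺ p (app true) (app true (Cong-refl dt)) wt x dx wx c
    ... | y , c′ , e = Simulates-≡ (cong (plug S) (sym (elim-0 p t r))) (y , app-red c′ , e)
    sim-root⁺ S@(□▼ x) t r d w ρ@(coapp c) = Simulates-≡ (cong (plug S) (sym (elim-0 p t r)))
      (_ , coapp-red (peel p c) , Cong-refl (⟶-ty (elimˡ (RedPlug⇒⟶ ρ)) d w))
    sim-root⁺ S@(x ▼□) t r d w (coapp-arg c) with slide-ty₀ S t r d | slide-WB₀ S t r d w
    ... | coapp dx dt | wx , wt with side⁺ p (app false) (app false (Cong-refl dt)) wt x dx wx c
    ... | y , c′ , e = Simulates-≡ (cong (plug S) (sym (elim-0 p t r))) (y , coapp-red c′ , e)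
    sim-root⁺ S@(elim□ pair x) t r d w ρ@(pair c) = Simulates-≡ (cong (plug S) (sym (elim-0 p t r)))
      (_ , pair-red (peel p c) , Cong-refl (⟶-ty (elimˡ (RedPlug⇒⟶ ρ)) d w))
    sim-root⁺ S@(□[ pair := x ]) t r d w (pair-arg c) with Ax-ty⁺ (slide p S) d | WB-slide⁺ p S t r w
    ... | elim pair dx dt | o , wt , wx with side⁺ p pair (pair (Cong-refl dt)) (o , wt) x dx wx c
    ... | y , c′ , e = y , pair-red c′ , e
    sim-root⁺ S@(elim□ bang x) t r d w ρ@(bang c) = Simulates-≡ (cong (plug S) (sym (elim-0 p t r)))
      (_ , bang-red (peel p c) , Cong-refl (⟶-ty (elimˡ (RedPlug⇒⟶ ρ)) d w))
    sim-root⁺ S@(□[ bang := x ]) t r d w (bang-arg c) with Ax-ty⁺ (slide p S) d | WB-slide⁺ p S t r w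
    ... | elim bang dx dt | _ , wt , wx with side⁺ p bang (bang (Cong-refl dt)) wt x dx wx c
    ... | y , c′ , e = y , bang-red c′ , e
    sim-root⁺ S@(x ▸□) t r d w ρ@(whynot c) = Simulates-≡ (cong (plug S) (sym (elim-0 p t r)))
      (_ , whynot-red (peel p c) , Cong-refl (⟶-ty (elimˡ (RedPlug⇒⟶ ρ)) d w))
    sim-root⁺ S@(x ♯□) t r d w ρ@(cut c) = Simulates-≡ (cong (plug S) (sym (elim-0 p t r)))
      (_ , cut-red (peel p c) , Cong-refl (⟶-ty (elimˡ (RedPlug⇒⟶ ρ)) d w))
    sim-root⁺ S@(□♯ x) t r d w (cut-arg c) with slide-ty₀ S t r d | slide-WB₀ S t r d w
    ... | cut dt dx | wt , wx with side⁺ p cut (cut (≈-invol (Cong-refl dt))) wt x dx wx c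
    ... | y , c′ , e = Simulates-≡ (cong (plug S) (sym (elim-0 p t r))) (y , cut-red c′ , e)

    sim-root⁻ : ∀ {k l} (S : Surface m n k l) t r {y} →
      Δ ⨾ Γ ⊩ plug (renᔆ W S) t [ p := r ] ∶ A → WellBound (plug (renᔆ W S) t [ p := r ]) → Δ ⨾ Γ ⊩ y ∶ A →
      RedPlug S (ren (xch k l (#ᵘ p) (#ˡ p)) t [ p := ren (wk k l) r ]) y → Simulates (plug (renᔆ W S) t [ p := r ]) y A
    sim-root⁻ (□• x) t r d w dy (app c) with ↘-≡ᵗ (elim-0 p t r) c
    ... | peel _ c′ = _ , elimˡ (app-red c′) , Cong-refl dy
    sim-root⁻ S@(x •□) t r d w dy (app-arg c) with slide-ty₀ S t r d | slide-WB₀ S t r d w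
    ... | app dx dt | wx , wt
      with side⁻ p (app true) (app true (Cong-refl dt)) wt x dx wx (↘-≡ (cong (appᴴ true) (elim-0 p t r)) c)
    ... | y , c′ , e = _ , elimˡ (app-red c′) , Cong-sym e
    sim-root⁻ (□▼ x) t r d w dy (coapp c) with ↘-≡ᵗ (elim-0 p t r) c
    ... | peel _ c′ = _ , elimˡ (coapp-red c′) , Cong-refl dy
    sim-root⁻ S@(x ▼□) t r d w dy (coapp-arg c) with slide-ty₀ S t r d | slide-WB₀ S t r d w
    ... | coapp dx dt | wx , wt
      with side⁻ p (app false) (app false (Cong-refl dt)) wt x dx wx (↘-≡ (cong (appᴴ false) (elim-0 p t r)) c)
    ... | y , c′ , e = _ , elimˡ (coapp-red c′) , Cong-sym e
    sim-root⁻ (elim□ pair x) t r d w dy (pair c) with ↘-≡ᵗ (elim-0 p t r) c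
    ... | peel _ c′ = _ , elimˡ (pair-red c′) , Cong-refl dy
    sim-root⁻ S@(□[ pair := x ]) t r d w dy (pair-arg c) with Ax-ty⁺ (slide p S) d | WB-slide⁺ p S t r w
    ... | elim pair dx dt | o , wt , wx with side⁻ p pair (pair (Cong-refl dt)) (o , wt) x dx wx c
    ... | y , c′ , e = _ , elimˡ (pair-red c′) , Cong-sym e
    sim-root⁻ (elim□ bang x) t r d w dy (bang c) with ↘-≡ᵗ (elim-0 p t r) c
    ... | peel _ c′ = _ , elimˡ (bang-red c′) , Cong-refl dy
    sim-root⁻ S@(□[ bang := x ]) t r d w dy (bang-arg c) with Ax-ty⁺ (slide p S) d | WB-slide⁺ p S t r w
    ... | elim bang dx dt | _ , wt , wx with side⁻ p bang (bang (Cong-refl dt)) wt x dx wx c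
    ... | y , c′ , e = _ , elimˡ (bang-red c′) , Cong-sym e
    sim-root⁻ (x ▸□) t r d w dy (whynot c) with ↘-≡ᵗ (elim-0 p t r) c
    ... | peel _ c′ = _ , elimˡ (whynot-red c′) , Cong-refl dy
    sim-root⁻ (x ♯□) t r d w dy (cut c) with ↘-≡ᵗ (elim-0 p t r) c
    ... | peel _ c′ = _ , elimˡ (cut-red c′) , Cong-refl dy
    sim-root⁻ S@(□♯ x) t r d w dy (cut-arg c) with slide-ty₀ S t r d | slide-WB₀ S t r d w
    ... | cut dt dx | wt , wx
      with side⁻ p cut (cut (≈-invol (Cong-refl dt))) wt x dx wx (↘-≡ (cong cutᴴ (elim-0 p t r)) c)
    ... | y , c′ , e = _ , elimˡ (cut-red c′) , Cong-sym e

  -- The step may be in `r`, contract the sliding eliminator, or be in the hole, in a side term of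
  -- `S`, or between `S` and its hole. `slide` applies again to the reducts unless `S` or the
  -- eliminator takes part in the redex.
  sim-slide⁺ : ∀ {k l} p (S : Surface m n k l) t r {A y} →
    Δ ⨾ Γ ⊩ plug (renᔆ (wk (#ᵘ p) (#ˡ p)) S) t [ p := r ] ∶ A → WellBound (plug (renᔆ (wk (#ᵘ p) (#ˡ p)) S) t [ p := r ]) →
    plug (renᔆ (wk (#ᵘ p) (#ˡ p)) S) t [ p := r ] ⟶ y →
    Simulates (plug S (ren (xch k l (#ᵘ p) (#ˡ p)) t [ p := ren (wk k l) r ])) y A
  sim-slide⁺ {k} {l} p S t r d w ρ@(elimʳ c) =
    _ , ⟶-plug S (elimʳ (⟶-ren⁺ (wk k l) c)) , to (slide-⇌ p S t _) (⟶-ty ρ d w)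
  sim-slide⁺ {k} {l} pair S t r d w ρ@(pair-red c) with elim-frame⁺ pair S t r c
  ... | y , c′ , e = _ , ⟶-plug S (pair-red c′) , to e (⟶-ty ρ d w)
  sim-slide⁺ {k} {l} bang S t r d w ρ@(bang-red c) with elim-frame⁺ bang S t r c
  ... | y , c′ , e = _ , ⟶-plug S (bang-red c′) , to e (⟶-ty ρ d w)
  sim-slide⁺ {k} {l} p S t r d w ρ@(elimˡ c) with plug-step (renᔆ (wk (#ᵘ p) (#ˡ p)) S) c
  ... | in-hole c′ = _ , ⟶-plug S (elimˡ (⟶-ren⁺ (xch k l (#ᵘ p) (#ˡ p)) c′)) , to (slide-⇌ p S _ r) (⟶-ty ρ d w)
  ... | at-root c′ = sim-root⁺ p S t r d w c′
  ... | in-side c′ with ⟶ᔆ-ren⁻ (wk (#ᵘ p) (#ˡ p)) S c′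
  ... | S′ , c″ , refl = _ , ⟶ᔆ-plug c″ _ , to (slide-⇌ p S′ t r) (⟶-ty ρ d w)

  sim-slide⁻ : ∀ {k l} p (S : Surface m n k l) t r {A y} →
    let x = plug S (ren (xch k l (#ᵘ p) (#ˡ p)) t [ p := ren (wk k l) r ]) in
    Δ ⨾ Γ ⊩ x ∶ A → WellBound x → x ⟶ y → Simulates (plug (renᔆ (wk (#ᵘ p) (#ˡ p)) S) t [ p := r ]) y A
  sim-slide⁻ {k} {l} p S t r {A} d w ρ with plug-step S ρ
  ... | at-root c = sim-root⁻ p S t r (Ax-ty⁻ (slide {r = r} {A} p S {t}) d) (WB-slide⁻ p S t r w) (⟶-ty ρ d w) c
  ... | in-side c = _ , elimˡ (⟶ᔆ-plug (⟶ᔆ-ren⁺ _ c) t) , from (slide-⇌ p _ t r) (⟶-ty ρ d w)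
  ... | in-hole (elimˡ c) with ⟶-ren⁻ (xch k l (#ᵘ p) (#ˡ p)) t c
  ... | t′ , c′ , refl = _ , elimˡ (⟶-plug _ c′) , from (slide-⇌ p S t′ r) (⟶-ty ρ d w)
  sim-slide⁻ {k} {l} p S t r d w ρ | in-hole (elimʳ c) with ⟶-ren⁻ (wk k l) r c
  ... | r′ , c′ , refl = _ , elimʳ c′ , from (slide-⇌ p S t r′) (⟶-ty ρ d w)
  sim-slide⁻ {k} {l} pair S t r d w ρ | in-hole (pair-red c) with elim-frame⁻ pair S t r c
  ... | y , c′ , e = _ , pair-red c′ , from e (⟶-ty ρ d w)
  sim-slide⁻ {k} {l} bang S t r d w ρ | in-hole (bang-red c) with elim-frame⁻ bang S t r c
  ... | y , c′ , e = _ , bang-red c′ , from e (⟶-ty ρ d w)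

  sim-Ax⁺ : ∀ {A x x′ y} → Ax A x x′ → Δ ⨾ Γ ⊩ x ∶ A → WellBound x → x ⟶ y → Simulates x′ y A
  sim-Ax⁻ : ∀ {A x x′ y} → Ax A x x′ → Δ ⨾ Γ ⊩ x′ ∶ A → WellBound x′ → x′ ⟶ y → Simulates x y A

  cut-flip : ∀ {x w y} → Δ ⨾ Γ ⊩ x ♯ w ∶ ⊥ → WellBound (x ♯ w) → cutᴴ x ∣ w ↘ y → ∃[ y′ ] (cutᴴ w ∣ x ↘ y′ × Δ ⨾ Γ ⊩ y ≈ y′ ∶ ⊥)
  cut-flip (cut dx dw) (wx , ww) c = cut-comm (Cong-tyˡ (≈-invol (Cong-refl dx))) wx dw ww c

  private
    -- For steps inside a subterm named by the axiom: the same axiom relates the reducts.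
    by : ∀ {A x x′ y y′} → Ax A y y′ → Δ ⨾ Γ ⊩ x ∶ A → WellBound x → x ⟶ y → x′ ⟶ y′ → Simulates x′ y A
    by a d w r r′ = let e = ⟶-ty r d w in _ , r′ , fwd a e (Ax-ty⁺ a e)

    by⁻ : ∀ {A x x′ y y′} → Ax A y′ y → Δ ⨾ Γ ⊩ x ∶ A → WellBound x → x ⟶ y → x′ ⟶ y′ → Simulates x′ y A
    by⁻ a d w r r′ = let e = ⟶-ty r d w in _ , r′ , bwd a (Ax-ty⁻ a e) e

    same : ∀ {A x x′ y} → Δ ⨾ Γ ⊩ x ∶ A → WellBound x → x ⟶ y → x′ ⟶ y → Simulates x′ y A
    same d w r r′ = _ , r′ , Cong-refl (⟶-ty r d w)

  sim-Ax⁺ (slide p S) d w r = sim-slide⁺ p S _ _ d w r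
  sim-Ax⁺ unit-⋆ d w r@(elimˡ c) = by unit-⋆ d w r c
  sim-Ax⁺ unit-swap d w r@(elimˡ c) = by unit-swap d w r (elimʳ c)
  sim-Ax⁺ unit-swap d w r@(elimʳ c) = by unit-swap d w r (elimˡ c)
  sim-Ax⁺ comm d w r@(cutˡ c) = by comm d w r (cutʳ c)
  sim-Ax⁺ comm d w r@(cutʳ c) = by comm d w r (cutˡ c)
  sim-Ax⁺ comm d w (cut-red c) with cut-flip d w c
  ... | y , c′ , e = y , cut-red c′ , e
  sim-Ax⁺ ⋆-♯ d w r@(cutʳ c) = by ⋆-♯ d w r c
  -- Flipped, this redex would have `⋆` as its value, which no head meets. The same argument refutes
  -- the corresponding cases of `•-♯` and `▼-♯`, whose left sides are eliminations.
  sim-Ax⁺ ⋆-♯ d w (cut-red c) with cut-flip d w c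
  ... | _ , () , _
  sim-Ax⁺ •-♯ d w r@(cutˡ (appˡ c)) = by •-♯ d w r (cutˡ c)
  sim-Ax⁺ •-♯ d w r@(cutˡ (appʳ c)) = by •-♯ d w r (cutʳ (tensorˡ c))
  sim-Ax⁺ •-♯ d w r@(cutʳ c) = by •-♯ d w r (cutʳ (tensorʳ c))
  sim-Ax⁺ •-♯ (cut (app dt ds) dr) ((wt , ws) , wr) (cutˡ (app-red c)) with app-tensor⁺ true ds ws dr wr dt wt c
  ... | y , c′ , e = y , cut-red (cut-⟨⟩ c′) , e
  sim-Ax⁺ •-♯ d w (cut-red c) with cut-flip d w c
  ... | _ , () , _
  sim-Ax⁺ ▼-♯ d w r@(cutˡ (coappˡ c)) = by ▼-♯ d w r (cutˡ c)
  sim-Ax⁺ ▼-♯ d w r@(cutˡ (coappʳ c)) = by ▼-♯ d w r (cutʳ (tensorʳ c))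
  sim-Ax⁺ ▼-♯ d w r@(cutʳ c) = by ▼-♯ d w r (cutʳ (tensorˡ c))
  sim-Ax⁺ ▼-♯ (cut (coapp dt ds) dr) ((wt , ws) , wr) (cutˡ (coapp-red c)) with app-tensor⁺ false ds ws dr wr dt wt c
  ... | y , c′ , e = y , cut-red (cut-⟨⟩ c′) , e
  sim-Ax⁺ ▼-♯ d w (cut-red c) with cut-flip d w c
  ... | _ , () , _
  sim-Ax⁺ ℘-♯ d w r@(cutˡ (par c)) = by ℘-♯ d w r (elimˡ c)
  sim-Ax⁺ ℘-♯ d w r@(cutʳ c) = by ℘-♯ d w r (elimʳ c)
  sim-Ax⁺ ℘-♯ d w r@(cut-red c) = same d w r (pair-red (cut-par⁻ c))
  sim-Ax⁺ ¿-♯ d w r@(cutˡ (whynot c)) = by ¿-♯ d w r (elimˡ c)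
  sim-Ax⁺ ¿-♯ d w r@(cutʳ c) = by ¿-♯ d w r (elimʳ c)
  sim-Ax⁺ ¿-♯ d w r@(cut-red c) = same d w r (bang-red (cut-whynot⁻ c))
  sim-Ax⁺ ▸-♯ d w r@(elim-whynotˡ c) = by ▸-♯ d w r (cutʳ (ofcourse c))
  sim-Ax⁺ ▸-♯ d w r@(elim-whynotʳ c) = by ▸-♯ d w r (cutˡ c)
  sim-Ax⁺ ▸-♯ d w r@(whynot-red c) = same d w r (cut-red (cut-! c))

  sim-Ax⁻ (slide p S) d w r = sim-slide⁻ p S _ _ d w r
  sim-Ax⁻ unit-⋆ d w r = by⁻ unit-⋆ d w r (elimˡ r)
  sim-Ax⁻ unit-swap d w r@(elimˡ c) = by⁻ unit-swap d w r (elimʳ c)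
  sim-Ax⁻ unit-swap d w r@(elimʳ c) = by⁻ unit-swap d w r (elimˡ c)
  sim-Ax⁻ comm d w r@(cutˡ c) = by⁻ comm d w r (cutʳ c)
  sim-Ax⁻ comm d w r@(cutʳ c) = by⁻ comm d w r (cutˡ c)
  sim-Ax⁻ comm d w (cut-red c) with cut-flip d w c
  ... | y , c′ , e = y , cut-red c′ , e
  sim-Ax⁻ ⋆-♯ d w r = by⁻ ⋆-♯ d w r (cutʳ r)
  sim-Ax⁻ •-♯ d w r@(cutˡ c) = by⁻ •-♯ d w r (cutˡ (appˡ c))
  sim-Ax⁻ •-♯ d w r@(cutʳ (tensorˡ c)) = by⁻ •-♯ d w r (cutˡ (appʳ c))
  sim-Ax⁻ •-♯ d w r@(cutʳ (tensorʳ c)) = by⁻ •-♯ d w r (cutʳ c)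
  sim-Ax⁻ •-♯ (cut {B = _ ⅋ _} dt (tensor ds dr)) (wt , ws , wr) (cut-red (cut-⟨⟩ c))
    with app-tensor⁻ true ds ws dr wr dt wt c
  ... | y , c′ , e = _ , cutˡ (app-red c′) , e
  sim-Ax⁻ ▼-♯ d w r@(cutˡ c) = by⁻ ▼-♯ d w r (cutˡ (coappˡ c))
  sim-Ax⁻ ▼-♯ d w r@(cutʳ (tensorˡ c)) = by⁻ ▼-♯ d w r (cutʳ c)
  sim-Ax⁻ ▼-♯ d w r@(cutʳ (tensorʳ c)) = by⁻ ▼-♯ d w r (cutˡ (coappʳ c))
  sim-Ax⁻ ▼-♯ (cut {B = _ ⅋ _} dt (tensor dr ds)) (wt , wr , ws) (cut-red (cut-⟨⟩ c))
    with app-tensor⁻ false ds ws dr wr dt wt c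
  ... | y , c′ , e = _ , cutˡ (coapp-red c′) , e
  sim-Ax⁻ ℘-♯ d w r@(elimˡ c) = by⁻ ℘-♯ d w r (cutˡ (par c))
  sim-Ax⁻ ℘-♯ d w r@(elimʳ c) = by⁻ ℘-♯ d w r (cutʳ c)
  sim-Ax⁻ ℘-♯ d w r@(pair-red c) = same d w r (cut-red (cut-par c))
  sim-Ax⁻ ¿-♯ d w r@(elimˡ c) = by⁻ ¿-♯ d w r (cutˡ (whynot c))
  sim-Ax⁻ ¿-♯ d w r@(elimʳ c) = by⁻ ¿-♯ d w r (cutʳ c)
  sim-Ax⁻ ¿-♯ d w r@(bang-red c) = same d w r (cut-red (cut-whynot c))
  sim-Ax⁻ ▸-♯ d w r@(cutʳ (ofcourse c)) = by⁻ ▸-♯ d w r (elim-whynotˡ c)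
  sim-Ax⁻ ▸-♯ d w r@(cutˡ c) = by⁻ ▸-♯ d w r (elim-whynotʳ c)
  sim-Ax⁻ ▸-♯ d w r@(cut-red (cut-! c)) = same d w r (whynot-red c)

-- A congruence rule may rewrite the head and the value of a root redex at once; `spine` is made for
-- this case, and the steps below the root are inductive.
simulation : {Δ : UCtx X m} {Γ : LCtx X n} → ∀ {A x x′ y} → Δ ⨾ Γ ⊩ x ≈ x′ ∶ A → WellBound x → x ⟶ y →
  Simulates {Δ = Δ} {Γ} x′ y A
simulation (tensor c d) (w , v) (tensorˡ r) with simulation c w r
... | _ , r′ , e = _ , tensorˡ r′ , tensor e d
simulation (tensor c d) (w , v) (tensorʳ r) with simulation d v r
... | _ , r′ , e = _ , tensorʳ r′ , tensor c e
simulation (elim p d c) (_ , w , v) (elimˡ r) with simulation c w r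
... | _ , r′ , e = _ , elimˡ r′ , elim p d e
simulation (elim p d c) (_ , w , v) (elimʳ r) with simulation d v r
... | _ , r′ , e = _ , elimʳ r′ , elim p e c
simulation (elim pair d c) (o , w , v) (pair-red r) with spine (pair c) d (o , w) v r
... | _ , r′ , e = _ , pair-red r′ , e
simulation (elim bang d c) (_ , w , v) (bang-red r) with spine (bang c) d w v r
... | _ , r′ , e = _ , bang-red r′ , e
simulation (par c) (_ , w) (par r) with simulation c w r
... | _ , r′ , e = _ , par r′ , par e
simulation (app c d) (w , v) (appˡ r) with simulation c w r
... | _ , r′ , e = _ , appˡ r′ , app e d
simulation (app c d) (w , v) (appʳ r) with simulation d v r
... | _ , r′ , e = _ , appʳ r′ , app c e
simulation (app c d) (w , v) (app-red r) with spine (app true d) c v w r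
... | _ , r′ , e = _ , app-red r′ , e
simulation (coapp c d) (w , v) (coappˡ r) with simulation c w r
... | _ , r′ , e = _ , coappˡ r′ , coapp e d
simulation (coapp c d) (w , v) (coappʳ r) with simulation d v r
... | _ , r′ , e = _ , coappʳ r′ , coapp c e
simulation (coapp c d) (w , v) (coapp-red r) with spine (app false d) c v w r
... | _ , r′ , e = _ , coapp-red r′ , e
simulation (ofcourse c) (_ , _ , w) (ofcourse r) with simulation c w r
... | _ , r′ , e = _ , ofcourse r′ , ofcourse e
simulation (whynot c) w (whynot r) with simulation c w r
... | _ , r′ , e = _ , whynot r′ , whynot e
simulation (elim-whynot d c) (_ , _ , w , v) (elim-whynotˡ r) with simulation c w r
... | _ , r′ , e = _ , elim-whynotˡ r′ , elim-whynot d e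
simulation (elim-whynot d c) (_ , _ , w , v) (elim-whynotʳ r) with simulation d v r
... | _ , r′ , e = _ , elim-whynotʳ r′ , elim-whynot e c
simulation (elim-whynot d c) (o , f , w , v) (whynot-red r) with spine (whynot c) d (o , f , w) v r
... | _ , r′ , e = _ , whynot-red r′ , e
simulation (cut c d) (w , v) (cutˡ r) with simulation c w r
... | _ , r′ , e = _ , cutˡ r′ , cut e d
simulation (cut c d) (w , v) (cutʳ r) with simulation d v r
... | _ , r′ , e = _ , cutʳ r′ , cut c e
simulation (cut c d) (w , v) (cut-red r) with spine (cut (≈-invol c)) d w v r
... | _ , r′ , e = _ , cut-red r′ , e
simulation (fwd a d e) w r = sim-Ax⁺ a d w r
simulation (bwd a d e) w r = sim-Ax⁻ a e w r
simulation (c ⊙ d) w r with simulation c w r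
... | _ , r′ , e with simulation d (≈-WB c w) r′
... | _ , r″ , e′ = _ , r″ , e ⊙ e′

-- Uniqueness of the type 𝟙

-- A term may have several types, and the axiom unit-swap is not restricted
-- to type 𝟙.  Two typings of one term are compared in the phase space ℤ/2 with
-- pole {0}: a fact is any subset of Bool, and _xor_ is addition.
Fact : Set
Fact = Bool → Bool

_∋_ : Fact → Bool → Set
F ∋ b = F b ≡ true

-- `dualᶠ F` is the orthogonal of `F`: `c` belongs to it iff `b + c = 0` for all `b` in `F`, that
-- is, iff `1 + c` is not in `F`. It is involutive, so every subset is closed. `bangᶠ` intersects
-- with {0}, and `whynotᶠ` is its dual, the union with {0}.
dualᶠ bangᶠ whynotᶠ : Fact → Fact
dualᶠ F b = not (F (not b))
bangᶠ F false = F false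
bangᶠ F true  = false
whynotᶠ F false = true
whynotᶠ F true  = F true

-- The sumset `F + G`: the summand taken from `F` is 0 or 1, and `b` fixes the other one.
tensorᶠ parᶠ : Fact → Fact → Fact
tensorᶠ F G b = (F false ∧ G b) ∨ (F true ∧ G (not b))
parᶠ F G = dualᶠ (tensorᶠ (dualᶠ F) (dualᶠ G))

-- The singletons {0} and {1}, both self-dual. The first is the pole, and it interprets `𝟙` and `⊥`
-- alike.
zeroᶠ oneᶠ : Fact
zeroᶠ = not
oneᶠ  = id

-- The value {1} at mismatches rejects every pair A , 𝟙 with A ≢ 𝟙, because a
-- closed proof has weight 0.
⟦_,_⟧ : Formula X → Formula X → Fact
⟦ atom _  , atom _  ⟧ = zeroᶠ
⟦ natom _ , natom _ ⟧ = zeroᶠ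
⟦ A ⊗ B   , A′ ⊗ B′ ⟧ = tensorᶠ ⟦ A , A′ ⟧ ⟦ B , B′ ⟧
⟦ A ⅋ B   , A′ ⅋ B′ ⟧ = parᶠ ⟦ A , A′ ⟧ ⟦ B , B′ ⟧
⟦ 𝟙       , 𝟙       ⟧ = zeroᶠ
⟦ ⊥       , ⊥       ⟧ = zeroᶠ
⟦ ! A     , ! A′    ⟧ = bangᶠ ⟦ A , A′ ⟧
⟦ ¿ A     , ¿ A′    ⟧ = whynotᶠ ⟦ A , A′ ⟧
⟦ _       , _       ⟧ = oneᶠ

tensorᶠ-cong : {F F′ G G′ : Fact} → (∀ b → F b ≡ F′ b) → (∀ b → G b ≡ G′ b) → ∀ b → tensorᶠ F G b ≡ tensorᶠ F′ G′ b
tensorᶠ-cong e f b = cong₂ _∨_ (cong₂ _∧_ (e false) (f b)) (cong₂ _∧_ (e true) (f (not b)))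

dualᶠ-cong : {F F′ : Fact} → (∀ b → F b ≡ F′ b) → ∀ b → dualᶠ F b ≡ dualᶠ F′ b
dualᶠ-cong e b = cong not (e (not b))

dualᶠ-involutive : ∀ F b → dualᶠ (dualᶠ F) b ≡ F b
dualᶠ-involutive F b = trans (not-involutive _) (cong F (not-involutive b))

-- Negation sends matching formulas to matching ones and mismatches to mismatches, and the value {1}
-- of a mismatch is self-dual. The compound matches follow by De Morgan.
⟦⟧-^⊥ : (A B : Formula X) → ∀ b → ⟦ A ^⊥ , B ^⊥ ⟧ b ≡ dualᶠ ⟦ A , B ⟧ b
⟦⟧-^⊥ (atom _)  (atom _)  b = sym (not-involutive (not b))
⟦⟧-^⊥ (natom _) (natom _) b = sym (not-involutive (not b))
⟦⟧-^⊥ (A ⊗ B) (A′ ⊗ B′) b = dualᶠ-cong (tensorᶠ-cong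
  (λ c → trans (dualᶠ-cong (⟦⟧-^⊥ A A′) c) (dualᶠ-involutive ⟦ A , A′ ⟧ c))
  (λ c → trans (dualᶠ-cong (⟦⟧-^⊥ B B′) c) (dualᶠ-involutive ⟦ B , B′ ⟧ c))) b
⟦⟧-^⊥ (A ⅋ B) (A′ ⅋ B′) b = trans (tensorᶠ-cong (⟦⟧-^⊥ A A′) (⟦⟧-^⊥ B B′) b) (sym (dualᶠ-involutive (tensorᶠ (dualᶠ ⟦ A , A′ ⟧) (dualᶠ ⟦ B , B′ ⟧)) b))
⟦⟧-^⊥ 𝟙 𝟙 b = sym (not-involutive (not b))
⟦⟧-^⊥ ⊥ ⊥ b = sym (not-involutive (not b))
⟦⟧-^⊥ (! A) (! A′) false = refl
⟦⟧-^⊥ (! A) (! A′) true  = ⟦⟧-^⊥ A A′ true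
⟦⟧-^⊥ (¿ A) (¿ A′) false = ⟦⟧-^⊥ A A′ false
⟦⟧-^⊥ (¿ A) (¿ A′) true  = refl
⟦⟧-^⊥ (atom _) (natom _) b = sym (not-involutive b)
⟦⟧-^⊥ (atom _) (_ ⊗ _) b = sym (not-involutive b)
⟦⟧-^⊥ (atom _) (_ ⅋ _) b = sym (not-involutive b)
⟦⟧-^⊥ (atom _) 𝟙 b = sym (not-involutive b)
⟦⟧-^⊥ (atom _) ⊥ b = sym (not-involutive b)
⟦⟧-^⊥ (atom _) (! _) b = sym (not-involutive b)
⟦⟧-^⊥ (atom _) (¿ _) b = sym (not-involutive b)
⟦⟧-^⊥ (natom _) (atom _) b = sym (not-involutive b)
⟦⟧-^⊥ (natom _) (_ ⊗ _) b = sym (not-involutive b)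
⟦⟧-^⊥ (natom _) (_ ⅋ _) b = sym (not-involutive b)
⟦⟧-^⊥ (natom _) 𝟙 b = sym (not-involutive b)
⟦⟧-^⊥ (natom _) ⊥ b = sym (not-involutive b)
⟦⟧-^⊥ (natom _) (! _) b = sym (not-involutive b)
⟦⟧-^⊥ (natom _) (¿ _) b = sym (not-involutive b)
⟦⟧-^⊥ (_ ⊗ _) (atom _) b = sym (not-involutive b)
⟦⟧-^⊥ (_ ⊗ _) (natom _) b = sym (not-involutive b)
⟦⟧-^⊥ (_ ⊗ _) (_ ⅋ _) b = sym (not-involutive b)
⟦⟧-^⊥ (_ ⊗ _) 𝟙 b = sym (not-involutive b)
⟦⟧-^⊥ (_ ⊗ _) ⊥ b = sym (not-involutive b)
⟦⟧-^⊥ (_ ⊗ _) (! _) b = sym (not-involutive b)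
⟦⟧-^⊥ (_ ⊗ _) (¿ _) b = sym (not-involutive b)
⟦⟧-^⊥ (_ ⅋ _) (atom _) b = sym (not-involutive b)
⟦⟧-^⊥ (_ ⅋ _) (natom _) b = sym (not-involutive b)
⟦⟧-^⊥ (_ ⅋ _) (_ ⊗ _) b = sym (not-involutive b)
⟦⟧-^⊥ (_ ⅋ _) 𝟙 b = sym (not-involutive b)
⟦⟧-^⊥ (_ ⅋ _) ⊥ b = sym (not-involutive b)
⟦⟧-^⊥ (_ ⅋ _) (! _) b = sym (not-involutive b)
⟦⟧-^⊥ (_ ⅋ _) (¿ _) b = sym (not-involutive b)
⟦⟧-^⊥ 𝟙 (atom _) b = sym (not-involutive b)
⟦⟧-^⊥ 𝟙 (natom _) b = sym (not-involutive b)
⟦⟧-^⊥ 𝟙 (_ ⊗ _) b = sym (not-involutive b)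
⟦⟧-^⊥ 𝟙 (_ ⅋ _) b = sym (not-involutive b)
⟦⟧-^⊥ 𝟙 ⊥ b = sym (not-involutive b)
⟦⟧-^⊥ 𝟙 (! _) b = sym (not-involutive b)
⟦⟧-^⊥ 𝟙 (¿ _) b = sym (not-involutive b)
⟦⟧-^⊥ ⊥ (atom _) b = sym (not-involutive b)
⟦⟧-^⊥ ⊥ (natom _) b = sym (not-involutive b)
⟦⟧-^⊥ ⊥ (_ ⊗ _) b = sym (not-involutive b)
⟦⟧-^⊥ ⊥ (_ ⅋ _) b = sym (not-involutive b)
⟦⟧-^⊥ ⊥ 𝟙 b = sym (not-involutive b)
⟦⟧-^⊥ ⊥ (! _) b = sym (not-involutive b)
⟦⟧-^⊥ ⊥ (¿ _) b = sym (not-involutive b)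
⟦⟧-^⊥ (! _) (atom _) b = sym (not-involutive b)
⟦⟧-^⊥ (! _) (natom _) b = sym (not-involutive b)
⟦⟧-^⊥ (! _) (_ ⊗ _) b = sym (not-involutive b)
⟦⟧-^⊥ (! _) (_ ⅋ _) b = sym (not-involutive b)
⟦⟧-^⊥ (! _) 𝟙 b = sym (not-involutive b)
⟦⟧-^⊥ (! _) ⊥ b = sym (not-involutive b)
⟦⟧-^⊥ (! _) (¿ _) b = sym (not-involutive b)
⟦⟧-^⊥ (¿ _) (atom _) b = sym (not-involutive b)
⟦⟧-^⊥ (¿ _) (natom _) b = sym (not-involutive b)
⟦⟧-^⊥ (¿ _) (_ ⊗ _) b = sym (not-involutive b)
⟦⟧-^⊥ (¿ _) (_ ⅋ _) b = sym (not-involutive b)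
⟦⟧-^⊥ (¿ _) 𝟙 b = sym (not-involutive b)
⟦⟧-^⊥ (¿ _) ⊥ b = sym (not-involutive b)
⟦⟧-^⊥ (¿ _) (! _) b = sym (not-involutive b)

-- Every connective sends {0} to {0}.
⟦⟧-refl : (A : Formula X) → ∀ b → ⟦ A , A ⟧ b ≡ not b
⟦⟧-refl (atom _)  b     = refl
⟦⟧-refl (natom _) b     = refl
⟦⟧-refl (A ⊗ B)   b     = trans (tensorᶠ-cong (⟦⟧-refl A) (⟦⟧-refl B) b) (∨-identityʳ (not b))
⟦⟧-refl (A ⅋ B)   b     = trans
  (dualᶠ-cong (tensorᶠ-cong (dualᶠ-cong (⟦⟧-refl A)) (dualᶠ-cong (⟦⟧-refl B))) b) (zero-par b)
  where
  zero-par : ∀ b → parᶠ not not b ≡ not b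
  zero-par false = refl
  zero-par true  = refl
⟦⟧-refl 𝟙         b     = refl
⟦⟧-refl ⊥         b     = refl
⟦⟧-refl (! A)     false = ⟦⟧-refl A false
⟦⟧-refl (! A)     true  = refl
⟦⟧-refl (¿ A)     false = refl
⟦⟧-refl (¿ A)     true  = ⟦⟧-refl A true

⟦𝟙⟧-false : (A : Formula X) → ⟦ A , 𝟙 ⟧ ∋ false → A ≡ 𝟙
⟦𝟙⟧-false 𝟙 e = refl

not-xor : ∀ b c → true xor (not b xor c) ≡ b xor c
not-xor false c = not-involutive c
not-xor true  c = refl

tensor-intro : ∀ F G b c → F ∋ b → G ∋ c → tensorᶠ F G ∋ (b xor c)
tensor-intro F G false c e f rewrite e | f = refl
tensor-intro F G true  c e f rewrite e | not-involutive c | f = ∨-zeroʳ _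

tensor-elim : ∀ F G H b c → tensorᶠ F G ∋ b → (∀ p q → F ∋ p → G ∋ q → H ∋ (p xor (q xor c))) → H ∋ (b xor c)
tensor-elim F G H b c e h with F false in f₀ | G b in g₀ | F true in f₁ | G (not b) in g₁
... | true  | true  | _    | _    = h false b f₀ g₀
... | true  | false | true | true = subst (λ d → H d ≡ true) (not-xor b c) (h true (not b) f₁ g₁)
... | false | _     | true | true = subst (λ d → H d ≡ true) (not-xor b c) (h true (not b) f₁ g₁)
tensor-elim F G H b c () h | true  | false | false | _
tensor-elim F G H b c () h | true  | false | true  | false
tensor-elim F G H b c () h | false | _     | false | _
tensor-elim F G H b c () h | false | _     | true  | false

xor-rotate : ∀ b c d → (c xor d) xor b ≡ d xor (b xor c)
xor-rotate b c d = trans (xor-comm (c xor d) b) (trans (sym (xor-assoc b c d)) (xor-comm (b xor c) d))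

dual-intro : ∀ F c → (∀ b → F ∋ b → zeroᶠ ∋ (b xor c)) → dualᶠ F ∋ c
dual-intro F false h with F true in f
... | true  = contradiction (h true f) λ ()
... | false = refl
dual-intro F true  h with F false in f
... | true  = contradiction (h false f) λ ()
... | false = refl

dual-elim : ∀ F b c → F ∋ b → dualᶠ F ∋ c → zeroᶠ ∋ (b xor c)
dual-elim F false false e e′ = refl
dual-elim F true  true  e e′ = refl
dual-elim F false true  e e′ rewrite e = e′
dual-elim F true  false e e′ rewrite e = e′

par-intro : ∀ F G c → (∀ p q → dualᶠ F ∋ p → dualᶠ G ∋ q → zeroᶠ ∋ (p xor (q xor c))) → parᶠ F G ∋ c
par-intro F G c h = dual-intro (tensorᶠ (dualᶠ F) (dualᶠ G)) c
  (λ b e → tensor-elim (dualᶠ F) (dualᶠ G) zeroᶠ b c e h)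

par-elimˡ : ∀ F G b c → parᶠ F G ∋ b → dualᶠ F ∋ c → G ∋ (b xor c)
par-elimˡ F G b c e f = trans (sym (dualᶠ-involutive G (b xor c))) (dual-intro (dualᶠ G) (b xor c) λ d g →
  subst (zeroᶠ ∋_) (xor-rotate b c d)
    (dual-elim (tensorᶠ (dualᶠ F) (dualᶠ G)) (c xor d) b (tensor-intro (dualᶠ F) (dualᶠ G) c d f g) e))

par-elimʳ : ∀ F G b c → parᶠ F G ∋ b → dualᶠ G ∋ c → F ∋ (b xor c)
par-elimʳ F G b c e f = trans (sym (dualᶠ-involutive F (b xor c))) (dual-intro (dualᶠ F) (b xor c) λ d g →
  subst (zeroᶠ ∋_) (trans (cong (_xor b) (xor-comm d c)) (xor-rotate b c d))
    (dual-elim (tensorᶠ (dualᶠ F) (dualᶠ G)) (d xor c) b (tensor-intro (dualᶠ F) (dualᶠ G) d c g f) e))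

bang-elim : ∀ F G b c → bangᶠ F ∋ b → (F ∋ false → G ∋ c) → G ∋ (b xor c)
bang-elim F G false c e h = h e

whynot-intro : ∀ F c → (dualᶠ F ∋ false → zeroᶠ ∋ c) → whynotᶠ F ∋ c
whynot-intro F false h = refl
whynot-intro F true  h with F true
... | true  = refl
... | false = h refl

whynot-elim : ∀ F b → whynotᶠ F ∋ b → (F ∋ b → zeroᶠ ∋ b) → zeroᶠ ∋ b
whynot-elim F false e h = refl
whynot-elim F true  e h = h e

zero-elim : ∀ F b c → zeroᶠ ∋ b → F ∋ c → F ∋ (b xor c)
zero-elim F false c e f = f

-- Weights of terms and adequacy

infixr 5 _◂_

_◂_ : Bool → (Fin n → Bool) → Fin (suc n) → Bool
(b ◂ x) zero    = b
(b ◂ x) (suc a) = x a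

-- Bound variables get the value 0; the value chosen for them is added afterwards by `wt-bound₁` and
-- `wt-bound₂`.
ext : ∀ l → (Fin n → Bool) → Fin (l + n) → Bool
ext zero    x = x
ext (suc l) x = false ◂ ext l x

-- The realiser of a term in the phase space: the sum modulo 2 of the values of its free linear
-- occurrences. Unrestricted variables count 0, the only element that `bangᶠ` admits.
wt : (Fin n → Bool) → Term m n → Bool
wt x (lvar a)       = x a
wt x (uvar u)       = false
wt x ⟨ t , s ⟩      = wt x t xor wt x s
wt x (t [ p := s ]) = wt x s xor wt (ext (#ˡ p) x) t
wt x (℘ t)          = wt (ext 2 x) t
wt x (t • s)        = wt x t xor wt x s
wt x (t ▼ s)        = wt x t xor wt x s
wt x (! t)          = wt (ext 1 x) t
wt x (¿ t)          = wt x t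
wt x (t ▸ s)        = wt (ext 1 x) t xor wt x s
wt x (t ♯ s)        = wt x t xor wt x s
wt x ⋆              = false

ext-cong : ∀ l {x y : Fin n → Bool} {P : Fin (l + n) → Set} →
  (∀ a → P (l ↑ʳ a) → x a ≡ y a) → ∀ a → P a → ext l x a ≡ ext l y a
ext-cong zero    e a       p = e a p
ext-cong (suc l) e zero    p = refl
ext-cong (suc l) {P = P} e (suc a) p = ext-cong l {P = P ∘ suc} e a p

ext-free : ∀ l (x : Fin n → Bool) a → ext l x (l ↑ʳ a) ≡ x a
ext-free zero    x a = refl
ext-free (suc l) x a = ext-free l x a

wt-agree : (t : Term m n) {x y : Fin n → Bool} → (∀ a → a ∈fv t → x a ≡ y a) → wt x t ≡ wt y t
wt-agree₂ : (t s : Term m n) {x y : Fin n → Bool} → (∀ a → 0 < occ a t + occ a s → x a ≡ y a) →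
  wt x t xor wt x s ≡ wt y t xor wt y s
wt-agree₂ t s e = cong₂ _xor_ (wt-agree t (λ a q → e a (∈fv-+ˡ _ q))) (wt-agree s (λ a q → e a (∈fv-+ʳ (occ a t) q)))
wt-agree {m} (lvar a) e = e a (subst (0 <_) (sym (occ-lvar-≡ {m} a)) (s≤s z≤n))
wt-agree (uvar u)       e = refl
wt-agree ⟨ t , s ⟩      e = wt-agree₂ t s e
wt-agree (t [ p := s ]) e = cong₂ _xor_ (wt-agree s (λ a q → e a (∈fv-+ʳ (occ (#ˡ p ↑ʳ a) t) q)))
  (wt-agree t (ext-cong (#ˡ p) (λ a q → e a (∈fv-+ˡ _ q))))
wt-agree (℘ t)          e = wt-agree t (ext-cong 2 e)
wt-agree (t • s)        e = wt-agree₂ t s e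
wt-agree (t ▼ s)        e = wt-agree₂ t s e
wt-agree (! t)          e = wt-agree t (ext-cong 1 e)
wt-agree (¿ t)          e = wt-agree t e
wt-agree (t ▸ s)        e = cong₂ _xor_ (wt-agree t (ext-cong 1 (λ a q → e a (∈fv-+ˡ _ q))))
  (wt-agree s (λ a q → e a (∈fv-+ʳ (occ (suc a) t) q)))
wt-agree (t ♯ s)        e = wt-agree₂ t s e
wt-agree ⋆              e = refl

wt-absent : {a : Fin n} {x y : Fin n → Bool} (t : Term m n) → occ a t ≡ 0 →
  (∀ b → b ≢ a → x b ≡ y b) → wt x t ≡ wt y t
wt-absent t o e = wt-agree t (λ b b∈ → e b λ { refl → contradiction (subst (0 <_) o b∈) λ () })

xor-swap : ∀ p b c → b xor (p xor c) ≡ p xor (b xor c)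
xor-swap p b c = trans (sym (xor-assoc b p c)) (trans (cong (_xor c) (xor-comm b p)) (xor-assoc p b c))

record Raised (a : Fin n) (p : Bool) (x y : Fin n → Bool) : Set where
  constructor raised
  field
    off : ∀ b → b ≢ a → x b ≡ y b
    at  : x a ≡ p xor y a
open Raised

-- A variable that occurs once contributes its value to the sum exactly once.
wt-single : {a : Fin n} {x y : Fin n → Bool} {p : Bool} (t : Term m n) → occ a t ≡ 1 →
  Raised a p x y → wt x t ≡ p xor wt y t
wt-single₂ : {a : Fin n} {x y : Fin n → Bool} {p : Bool} (t s : Term m n) → occ a t + occ a s ≡ 1 →
  Raised a p x y → wt x t xor wt x s ≡ p xor (wt y t xor wt y s)
wt-under : ∀ l {a : Fin n} {x y : Fin n → Bool} {p : Bool} (t : Term m (l + n)) → occ (l ↑ʳ a) t ≡ 1 →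
  Raised a p x y → wt (ext l x) t ≡ p xor wt (ext l y) t
wt-under l {a} {x} {y} {p} t o (raised e f) = wt-single {y = ext l y} {p} t o (raised
  (ext-cong l (λ b q → e b (q ∘ cong (l ↑ʳ_)))) (trans (ext-free l x a) (trans f (cong (p xor_) (sym (ext-free l y a))))))
wt-under-absent : ∀ l {a : Fin n} {x y : Fin n → Bool} (t : Term m (l + n)) → occ (l ↑ʳ a) t ≡ 0 →
  (∀ b → b ≢ a → x b ≡ y b) → wt (ext l x) t ≡ wt (ext l y) t
wt-under-absent l t o e = wt-absent t o (ext-cong l (λ b q → e b (q ∘ cong (l ↑ʳ_))))
wt-single₂ {a = a} {y = y} {p} t s o r with +≡1 (occ a t) o
... | inj₁ (o₁ , o₀) = trans (cong₂ _xor_ (wt-single t o₁ r) (wt-absent s o₀ (off r))) (xor-assoc p (wt y t) (wt y s))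
... | inj₂ (o₀ , o₁) = trans (cong₂ _xor_ (wt-absent t o₀ (off r)) (wt-single s o₁ r)) (xor-swap p (wt y t) (wt y s))
wt-single {a = a} {x} {y} {p} (lvar b) o r with a ≟ b
... | yes refl = at r
wt-single ⟨ t , s ⟩      o r = wt-single₂ t s o r
wt-single {a = a} {y = y} {p} (t [ q := s ]) o r with +≡1 (occ (#ˡ q ↑ʳ a) t) o
... | inj₁ (o₁ , o₀) = trans (cong₂ _xor_ (wt-absent s o₀ (off r)) (wt-under (#ˡ q) t o₁ r))
  (xor-swap p (wt y s) (wt (ext (#ˡ q) y) t))
... | inj₂ (o₀ , o₁) = trans (cong₂ _xor_ (wt-single s o₁ r) (wt-under-absent (#ˡ q) t o₀ (off r)))
  (xor-assoc p (wt y s) (wt (ext (#ˡ q) y) t))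
wt-single (℘ t)          o r = wt-under 2 t o r
wt-single (t • s)        o r = wt-single₂ t s o r
wt-single (t ▼ s)        o r = wt-single₂ t s o r
wt-single (! t)          o r = wt-under 1 t o r
wt-single (¿ t)          o r = wt-single t o r
wt-single {a = a} {y = y} {p} (t ▸ s) o r with +≡1 (occ (suc a) t) o
... | inj₁ (o₁ , o₀) = trans (cong₂ _xor_ (wt-under 1 t o₁ r) (wt-absent s o₀ (off r)))
  (xor-assoc p (wt (ext 1 y) t) (wt y s))
... | inj₂ (o₀ , o₁) = trans (cong₂ _xor_ (wt-under-absent 1 t o₀ (off r)) (wt-single s o₁ r))
  (xor-swap p (wt (ext 1 y) t) (wt y s))
wt-single (t ♯ s)        o r = wt-single₂ t s o r

wt-bound₁ : (t : Term m (1 + n)) (x : Fin n → Bool) → occ zero t ≡ 1 → ∀ p →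
  wt (p ◂ x) t ≡ p xor wt (ext 1 x) t
wt-bound₁ t x o p = wt-single {y = ext 1 x} {p} t o
  (raised (λ { zero q → contradiction refl q ; (suc b) q → refl }) (sym (xor-identityʳ p)))

wt-bound₂ : (t : Term m (2 + n)) (x : Fin n → Bool) → occ zero t ≡ 1 → occ (suc zero) t ≡ 1 → ∀ p q →
  wt (p ◂ q ◂ x) t ≡ p xor (q xor wt (ext 2 x) t)
wt-bound₂ t x o o′ p q = trans
  (wt-bound₁ t (q ◂ x) o p)
  (cong (p xor_) (wt-single {y = ext 2 x} {q} t o′
    (raised (λ { zero r → refl ; (suc zero) r → contradiction refl r ; (suc (suc b)) r → refl }) (sym (xor-identityʳ q)))))

wt-const : (t : Term m n) → wt (λ _ → false) t ≡ false
wt-const-under : ∀ l (t : Term m (l + n)) → wt (ext l (λ _ → false)) t ≡ false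
wt-const-under l t = trans (wt-agree t (λ a _ → ext-const l a)) (wt-const t)
  where
  ext-const : ∀ l a → ext {n} l (λ _ → false) a ≡ false
  ext-const zero    a       = refl
  ext-const (suc l) zero    = refl
  ext-const (suc l) (suc a) = ext-const l a
wt-const (lvar a)       = refl
wt-const (uvar u)       = refl
wt-const ⟨ t , s ⟩      = cong₂ _xor_ (wt-const t) (wt-const s)
wt-const (t [ p := s ]) = cong₂ _xor_ (wt-const s) (wt-const-under (#ˡ p) t)
wt-const (℘ t)          = wt-const-under 2 t
wt-const (t • s)        = cong₂ _xor_ (wt-const t) (wt-const s)
wt-const (t ▼ s)        = cong₂ _xor_ (wt-const t) (wt-const s)
wt-const (! t)          = wt-const-under 1 t
wt-const (¿ t)          = wt-const t
wt-const (t ▸ s)        = cong₂ _xor_ (wt-const-under 1 t) (wt-const s)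
wt-const (t ♯ s)        = cong₂ _xor_ (wt-const t) (wt-const s)
wt-const ⋆              = refl

wt-closed : (t : Term m (1 + n)) (x : Fin n → Bool) → (∀ a → ¬ suc a ∈fv t) → wt (ext 1 x) t ≡ false
wt-closed t x c = trans
  (wt-agree t (λ { zero _ → refl ; (suc a) a∈ → contradiction a∈ (c a) })) (wt-const t)

Validᵘ : (Δ Δ′ : UCtx X m) → Set
Validᵘ Δ Δ′ = ∀ u → ⟦ lookup Δ u , lookup Δ′ u ⟧ ∋ false

Valid : (Γ Γ′ : LCtx X n) → (Fin n → Bool) → Set
Valid Γ Γ′ x = ∀ a {A A′} → lookup Γ a ≡ just A → lookup Γ′ a ≡ just A′ → ⟦ A , A′ ⟧ ∋ x a

Validᵘ-∷ : {Δ Δ′ : UCtx X m} {A A′ : Formula X} → ⟦ A , A′ ⟧ ∋ false → Validᵘ Δ Δ′ → Validᵘ (A ∷ Δ) (A′ ∷ Δ′)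
Validᵘ-∷ e v zero    = e
Validᵘ-∷ e v (suc u) = v u

Valid-∷ : {Γ Γ′ : LCtx X n} {x : Fin n → Bool} {A A′ : Formula X} {b : Bool} →
  ⟦ A , A′ ⟧ ∋ b → Valid Γ Γ′ x → Valid (just A ∷ Γ) (just A′ ∷ Γ′) (b ◂ x)
Valid-∷ e v zero    refl refl = e
Valid-∷ e v (suc a) p    q    = v a p q

∋-^⊥⁺ : (A A′ : Formula X) {b : Bool} → dualᶠ ⟦ A , A′ ⟧ ∋ b → ⟦ A ^⊥ , A′ ^⊥ ⟧ ∋ b
∋-^⊥⁺ A A′ e = trans (⟦⟧-^⊥ A A′ _) e

∋-^⊥⁻ : (A A′ : Formula X) {b : Bool} → ⟦ A ^⊥ , A′ ^⊥ ⟧ ∋ b → dualᶠ ⟦ A , A′ ⟧ ∋ b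
∋-^⊥⁻ A A′ e = trans (sym (⟦⟧-^⊥ A A′ _)) e

-- Soundness of the phase model, for two typings of one term. The term determines the rules, so both
-- derivations are taken apart in parallel while their formulas may differ. `WellBound` guarantees
-- that each bound linear variable adds its value exactly once.
adequacy : {Δ Δ′ : UCtx X m} {Γ Γ′ : LCtx X n} {t : Term m n} {A A′ : Formula X} {x : Fin n → Bool} →
  Validᵘ Δ Δ′ → Valid Γ Γ′ x → WellBound t → Δ ⨾ Γ ⊩ t ∶ A → Δ′ ⨾ Γ′ ⊩ t ∶ A′ → ⟦ A , A′ ⟧ ∋ wt x t
adequacy v w _ (lvar {a} p) (lvar p′) = w a p p′
adequacy v w _ (uvar {u} refl) (uvar refl) = v u
adequacy {x = x} v w (l , r) (tensor {t} {s} {A} {B} d e) (tensor {A = A′} {B′} d′ e′) =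
  tensor-intro ⟦ A , A′ ⟧ ⟦ B , B′ ⟧ (wt x t) (wt x s) (adequacy v w l d d′) (adequacy v w r e e′)
adequacy {A = C} {A′ = C′} {x} v w (o , l , r) (elim {t = t} {s} (pair {A} {B}) d e) (elim (pair {A′} {B′}) d′ e′) =
  tensor-elim ⟦ A , A′ ⟧ ⟦ B , B′ ⟧ ⟦ C , C′ ⟧ (wt x s) (wt (ext 2 x) t) (adequacy v w r d d′)
    (λ p q f g → subst (⟦ C , C′ ⟧ ∋_) (wt-bound₂ t x (o zero) (o (suc zero)) p q)
      (adequacy v (Valid-∷ f (Valid-∷ g w)) l e e′))
adequacy {A = C} {A′ = C′} {x} v w (o , l , r) (elim {t = t} {s} (bang {A}) d e) (elim (bang {A′}) d′ e′) =
  bang-elim ⟦ A , A′ ⟧ ⟦ C , C′ ⟧ (wt x s) (wt x t) (adequacy v w r d d′)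
    (λ f → adequacy (Validᵘ-∷ f v) w l e e′)
adequacy {A = C} {A′ = C′} {x} v w (o , l , r) (elim {t = t} {s} unit d e) (elim unit d′ e′) =
  zero-elim ⟦ C , C′ ⟧ (wt x s) (wt x t) (adequacy v w r d d′) (adequacy v w l e e′)
adequacy {x = x} v w (o , l) (par {t} {A} {B} d) (par {A = A′} {B′} d′) =
  par-intro ⟦ A , A′ ⟧ ⟦ B , B′ ⟧ (wt (ext 2 x) t)
    (λ p q f g → subst (zeroᶠ ∋_) (wt-bound₂ t x (o zero) (o (suc zero)) p q)
      (adequacy v (Valid-∷ (∋-^⊥⁺ A A′ f) (Valid-∷ (∋-^⊥⁺ B B′ g) w)) l d d′))
adequacy {x = x} v w (l , r) (app {t} {s} {A} {B} d e) (app {A = A′} {B′} d′ e′) =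
  par-elimˡ ⟦ A , A′ ⟧ ⟦ B , B′ ⟧ (wt x t) (wt x s) (adequacy v w l d d′) (∋-^⊥⁻ A A′ (adequacy v w r e e′))
adequacy {x = x} v w (l , r) (coapp {t} {s} {A} {B} d e) (coapp {A = A′} {B′} d′ e′) =
  par-elimʳ ⟦ A , A′ ⟧ ⟦ B , B′ ⟧ (wt x t) (wt x s) (adequacy v w l d d′) (∋-^⊥⁻ B B′ (adequacy v w r e e′))
-- A box has weight 0, as membership in `bangᶠ` requires.
adequacy {x = x} v w (o , c , l) (ofcourse {t} {A} d) (ofcourse {A = A′} d′) rewrite wt-closed t x c =
  trans (sym (dualᶠ-involutive ⟦ A , A′ ⟧ false)) (dual-intro (dualᶠ ⟦ A , A′ ⟧) false
    (λ p f → subst (λ b → zeroᶠ ∋ b) (trans (wt-bound₁ t x o p) (cong (p xor_) (wt-closed t x c)))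
      (adequacy v (Valid-∷ (∋-^⊥⁺ A A′ f) w) l d d′)))
adequacy {x = x} v w l (whynot {t} {A} d) (whynot {A = A′} d′) =
  whynot-intro ⟦ A , A′ ⟧ (wt x t) (λ f → adequacy (Validᵘ-∷ (∋-^⊥⁺ A A′ f) v) w l d d′)
adequacy {x = x} v w (o , c , l , r) (elim-whynot {t} {s} {A} d e) (elim-whynot {A = A′} d′ e′)
  rewrite wt-closed t x c = whynot-elim ⟦ A , A′ ⟧ (wt x s) (adequacy v w r d d′)
    (λ f → subst (zeroᶠ ∋_)
      (trans (wt-bound₁ t x o (wt x s)) (trans (cong (wt x s xor_) (wt-closed t x c)) (xor-identityʳ (wt x s))))
      (adequacy v (Valid-∷ f w) l e e′))
adequacy {x = x} v w (l , r) (cut {t} {s} {A} d e) (cut {B = A′} d′ e′) =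
  dual-elim ⟦ A , A′ ⟧ (wt x t) (wt x s) (adequacy v w l d d′) (∋-^⊥⁻ A A′ (adequacy v w r e e′))
adequacy v w _ one one = refl

-- With equal contexts the valuation constantly 0 is admissible, and under it every term has weight
-- 0. Against `𝟙`, only `𝟙` itself contains 0.
𝟙-unique : {Δ : UCtx X m} {Γ : LCtx X n} {t : Term m n} {A : Formula X} →
  WellBound t → Δ ⨾ Γ ⊩ t ∶ A → Δ ⨾ Γ ⊩ t ∶ 𝟙 → A ≡ 𝟙
𝟙-unique {Δ = Δ} {Γ} {t} {A} w d e = ⟦𝟙⟧-false A (subst (⟦ A , 𝟙 ⟧ ∋_) (wt-const t) (adequacy
  (λ u → ⟦⟧-refl (lookup Δ u) false)
  (λ a {B} p q → subst (λ C → ⟦ B , C ⟧ ∋ false) (just-injective (trans (sym p) q)) (⟦⟧-refl B false))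
  w d e))

-- Typings with split contexts

infix 4 _⊑_

_⊑_ : LCtx X n → LCtx X n → Set
Γ ⊑ Γ′ = ∀ a {A} → lookup Γ a ≡ just A → lookup Γ′ a ≡ just A

⊑-∷ : {Γ Γ′ : LCtx X n} {x : Maybe (Formula X)} → Γ ⊑ Γ′ → x ∷ Γ ⊑ x ∷ Γ′
⊑-∷ f zero    = id
⊑-∷ f (suc a) = f a

∅⊑ : {Γ : LCtx X n} → ∅ ⊑ Γ
∅⊑ {n = n} a e with trans (sym (lookup-replicate {n = n} a nothing)) e
... | ()

⊑-splitˡ : {Γ Γ₁ Γ₂ : LCtx X n} → Γ ≔ Γ₁ ⊎ Γ₂ → Γ₁ ⊑ Γ
⊑-splitˡ (left s)  zero    e = e
⊑-splitˡ (none s)  (suc a) e = ⊑-splitˡ s a e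
⊑-splitˡ (left s)  (suc a) e = ⊑-splitˡ s a e
⊑-splitˡ (right s) (suc a) e = ⊑-splitˡ s a e

⊑-splitʳ : {Γ Γ₁ Γ₂ : LCtx X n} → Γ ≔ Γ₁ ⊎ Γ₂ → Γ₂ ⊑ Γ
⊑-splitʳ (right s) zero    e = e
⊑-splitʳ (none s)  (suc a) e = ⊑-splitʳ s a e
⊑-splitʳ (left s)  (suc a) e = ⊑-splitʳ s a e
⊑-splitʳ (right s) (suc a) e = ⊑-splitʳ s a e

⊢⇒⊩ : {Δ : UCtx X m} {Γ Γ′ : LCtx X n} {t : Term m n} {A : Formula X} → Γ ⊑ Γ′ → Δ ∣ Γ ⊢ t ∶ A → Δ ⨾ Γ′ ⊩ t ∶ A
⊢⇒⊩ {n = n} f (lvar {a} {A}) = lvar (f a (lookup∘updateAt a (∅ {n = n})))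
⊢⇒⊩ f (uvar x) = uvar ([]=⇒lookup x)
⊢⇒⊩ f (tensor s d e) = tensor (⊢⇒⊩ (λ a → f a ∘ ⊑-splitˡ s a) d) (⊢⇒⊩ (λ a → f a ∘ ⊑-splitʳ s a) e)
⊢⇒⊩ f (elim-pair s d e) = elim pair (⊢⇒⊩ (λ a → f a ∘ ⊑-splitˡ s a) d)
  (⊢⇒⊩ (⊑-∷ (⊑-∷ (λ a → f a ∘ ⊑-splitʳ s a))) e)
⊢⇒⊩ f (par d) = par′ (⊢⇒⊩ (⊑-∷ (⊑-∷ f)) d)
⊢⇒⊩ f (app s d e) = app (⊢⇒⊩ (λ a → f a ∘ ⊑-splitˡ s a) d) (⊢⇒⊩ (λ a → f a ∘ ⊑-splitʳ s a) e)
⊢⇒⊩ f (coapp s d e) = coapp (⊢⇒⊩ (λ a → f a ∘ ⊑-splitˡ s a) d) (⊢⇒⊩ (λ a → f a ∘ ⊑-splitʳ s a) e)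
⊢⇒⊩ f (ofcourse d) = ofcourse′ (⊢⇒⊩ (⊑-∷ f) d)
⊢⇒⊩ f (elim-bang s d e) = elim bang (⊢⇒⊩ (λ a → f a ∘ ⊑-splitˡ s a) d) (⊢⇒⊩ (λ a → f a ∘ ⊑-splitʳ s a) e)
⊢⇒⊩ f (whynot d) = whynot (⊢⇒⊩ f d)
⊢⇒⊩ {Γ′ = Γ′} f (elim-whynot d e) = elim-whynot (⊢⇒⊩ f d) (⊢⇒⊩ (⊑-∷ (∅⊑ {Γ = Γ′})) e)
⊢⇒⊩ f (cut s d e) = cut (⊢⇒⊩ (λ a → f a ∘ ⊑-splitˡ s a) d) (⊢⇒⊩ (λ a → f a ∘ ⊑-splitʳ s a) e)
⊢⇒⊩ f one = one
⊢⇒⊩ f (elim-unit s d e) = elim unit (⊢⇒⊩ (λ a → f a ∘ ⊑-splitˡ s a) d) (⊢⇒⊩ (λ a → f a ∘ ⊑-splitʳ s a) e)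

size : Maybe X → ℕ
size nothing  = 0
size (just _) = 1

Sizes : LCtx X n → (Fin n → ℕ) → Set
Sizes Γ i = ∀ a → i a ≡ size (lookup Γ a)

-- Together with `WellBound` and a typing in a shared context this amounts to a typing with split
-- contexts, by `⊢-exact`, `⊢-WB` and `⊩⇒⊢`.
Exact : LCtx X n → Term m n → Set
Exact Γ t = Sizes Γ (λ a → occ a t)

Sizes-⊎ : {Γ Γ₁ Γ₂ : LCtx X n} {i j : Fin n → ℕ} → Γ ≔ Γ₁ ⊎ Γ₂ → Sizes Γ₁ i → Sizes Γ₂ j → Sizes Γ (λ a → i a + j a)
Sizes-⊎ s e f a = trans (cong₂ _+_ (e a) (f a)) (size-⊎ s a)
  where
  size-⊎ : {Γ Γ₁ Γ₂ : LCtx X n} → Γ ≔ Γ₁ ⊎ Γ₂ → ∀ a → size (lookup Γ₁ a) + size (lookup Γ₂ a) ≡ size (lookup Γ a)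
  size-⊎ (none s)  zero    = refl
  size-⊎ (left s)  zero    = refl
  size-⊎ (right s) zero    = refl
  size-⊎ (none s)  (suc a) = size-⊎ s a
  size-⊎ (left s)  (suc a) = size-⊎ s a
  size-⊎ (right s) (suc a) = size-⊎ s a

Sizes-∅ : Sizes (∅ {X} {n}) (λ _ → 0)
Sizes-∅ {n = n} a = cong size (sym (lookup-replicate {n = n} a nothing))

⊢-exact : {Δ : UCtx X m} {Γ : LCtx X n} {t : Term m n} {A : Formula X} → Δ ∣ Γ ⊢ t ∶ A → Exact Γ t
⊢-exact {X = X} {m = m} (lvar {a} {A}) = var a
  where
  var : ∀ {n} (a : Fin n) → Exact {m = m} (∅ [ a ]≔ just A) (lvar a)
  var zero    zero    = refl
  var {suc n} zero (suc b) = Sizes-∅ {X} {n} b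
  var (suc a) zero    = refl
  var {suc n} (suc a) (suc b) = trans (occ-suc b) (var a b)
    where
    occ-suc : ∀ b → occ {m} (suc b) (lvar (suc a)) ≡ occ {m} b (lvar a)
    occ-suc b with b ≟ a
    ... | yes _ = refl
    ... | no _  = refl
⊢-exact {X} {n = n} (uvar x) = Sizes-∅ {X} {n}
⊢-exact (tensor s d e) = Sizes-⊎ s (⊢-exact d) (⊢-exact e)
⊢-exact (elim-pair {t = t} {s} p d e) a =
  trans (+-comm (occ (2 ↑ʳ a) t) (occ a s)) (Sizes-⊎ p (⊢-exact d) (λ a → ⊢-exact e (2 ↑ʳ a)) a)
⊢-exact (par d) a = ⊢-exact d (2 ↑ʳ a)
⊢-exact (app s d e) = Sizes-⊎ s (⊢-exact d) (⊢-exact e)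
⊢-exact (coapp s d e) = Sizes-⊎ s (⊢-exact d) (⊢-exact e)
⊢-exact (ofcourse d) a = ⊢-exact d (suc a)
⊢-exact (elim-bang {t = t} {s} p d e) a =
  trans (+-comm (occ a t) (occ a s)) (Sizes-⊎ p (⊢-exact d) (⊢-exact e) a)
⊢-exact (whynot d) = ⊢-exact d
⊢-exact {X} {n = n} (elim-whynot d e) a =
  trans (cong (_+ _) (trans (⊢-exact e (suc a)) (sym (Sizes-∅ {X} {n} a)))) (⊢-exact d a)
⊢-exact (cut s d e) = Sizes-⊎ s (⊢-exact d) (⊢-exact e)
⊢-exact {X} {n = n} one = Sizes-∅ {X} {n}
⊢-exact (elim-unit {t = t} {s} p d e) a =
  trans (+-comm (occ a t) (occ a s)) (Sizes-⊎ p (⊢-exact d) (⊢-exact e) a)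

⊢-closed : {Δ : UCtx X m} {t : Term m (suc n)} {A B : Formula X} →
  Δ ∣ just A ∷ ∅ ⊢ t ∶ B → ∀ a → ¬ suc a ∈fv t
⊢-closed {X} {n = n} d a a∈ with subst (0 <_) (trans (⊢-exact d (suc a)) (sym (Sizes-∅ {X} {n} a))) a∈
... | ()

⊢-WB : {Δ : UCtx X m} {Γ : LCtx X n} {t : Term m n} {A : Formula X} → Δ ∣ Γ ⊢ t ∶ A → WellBound t
⊢-WB lvar = tt
⊢-WB (uvar x) = tt
⊢-WB (tensor s d e) = ⊢-WB d , ⊢-WB e
⊢-WB (elim-pair s d e) = (λ { zero → ⊢-exact e zero ; (suc zero) → ⊢-exact e (suc zero) }) , ⊢-WB e , ⊢-WB d
⊢-WB (par d) = (λ { zero → ⊢-exact d zero ; (suc zero) → ⊢-exact d (suc zero) }) , ⊢-WB d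
⊢-WB (app s d e) = ⊢-WB d , ⊢-WB e
⊢-WB (coapp s d e) = ⊢-WB d , ⊢-WB e
⊢-WB (ofcourse d) = ⊢-exact d zero , ⊢-closed d , ⊢-WB d
⊢-WB (elim-bang s d e) = (λ ()) , ⊢-WB e , ⊢-WB d
⊢-WB (whynot d) = ⊢-WB d
⊢-WB (elim-whynot d e) = ⊢-exact e zero , ⊢-closed e , ⊢-WB e , ⊢-WB d
⊢-WB (cut s d e) = ⊢-WB d , ⊢-WB e
⊢-WB one = tt
⊢-WB (elim-unit s d e) = (λ ()) , ⊢-WB e , ⊢-WB d

record Divided {X : Set} {n : ℕ} (Γ : LCtx X n) (i j : Fin n → ℕ) : Set where
  constructor divided
  field
    {Γ₁ Γ₂} : LCtx X n
    parts   : Γ ≔ Γ₁ ⊎ Γ₂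
    sizesˡ  : Sizes Γ₁ i
    sizesʳ  : Sizes Γ₂ j

-- Each variable of `Γ` is counted once in total, so it belongs to exactly one part: the counts
-- determine the splitting.
divide : (Γ : LCtx X n) (i j : Fin n → ℕ) → Sizes Γ (λ a → i a + j a) → Divided Γ i j
divide [] i j e = divided [] (λ ()) (λ ())
divide (nothing ∷ Γ) i j e with divide Γ (i ∘ suc) (j ∘ suc) (e ∘ suc)
... | divided p f g = divided (none p)
  (λ { zero → m+n≡0⇒m≡0 (i zero) (e zero) ; (suc a) → f a })
  (λ { zero → m+n≡0⇒n≡0 (i zero) (e zero) ; (suc a) → g a })
divide (just A ∷ Γ) i j e with divide Γ (i ∘ suc) (j ∘ suc) (e ∘ suc) | +≡1 (i zero) (e zero)
... | divided p f g | inj₁ (x , y) = divided (left p) (λ { zero → x ; (suc a) → f a }) (λ { zero → y ; (suc a) → g a })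
... | divided p f g | inj₂ (x , y) = divided (right p) (λ { zero → x ; (suc a) → f a }) (λ { zero → y ; (suc a) → g a })

lookup-ext : {A : Set} {xs ys : Vec A n} → (∀ i → lookup xs i ≡ lookup ys i) → xs ≡ ys
lookup-ext {xs = xs} {ys} e = trans (sym (tabulate∘lookup xs)) (trans (tabulate-cong e) (tabulate∘lookup ys))

Sizes-∅⁻ : {Γ : LCtx X n} → Sizes Γ (λ _ → 0) → Γ ≡ ∅
Sizes-∅⁻ {Γ = []}          e = refl
Sizes-∅⁻ {Γ = nothing ∷ Γ} e = cong (nothing ∷_) (Sizes-∅⁻ (e ∘ suc))
Sizes-∅⁻ {Γ = just _ ∷ Γ}  e with e zero
... | ()

lvar-Γ : {Γ Γ′ : LCtx X n} {a : Fin n} {A : Formula X} →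
  Γ′ ⊑ Γ → lookup Γ a ≡ just A → Exact {m = m} Γ′ (lvar a) → Γ′ ≡ ∅ [ a ]≔ just A
lvar-Γ {n = n} {m = m} {Γ = Γ} {Γ′} {a} {A} f x e = lookup-ext go
  where
  go : ∀ b → lookup Γ′ b ≡ lookup (∅ [ a ]≔ just A) b
  go b with b ≟ a
  go b | yes refl with lookup Γ′ b in eq | trans (sym (occ-lvar-≡ {m} b)) (e b)
  ... | just B | _ = trans (trans (sym (f b eq)) x) (sym (lookup∘update b (∅ {n = n}) (just A)))
  go b | no b≢a with lookup Γ′ b in eq | trans (sym (occ-lvar-≢ {m} b≢a)) (e b)
  ... | nothing | _ = trans (sym (lookup-replicate {n = n} b nothing)) (sym (lookup∘update′ b≢a (∅ {n = n}) (just A)))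

record Halves {X : Set} {n : ℕ} (Γ Γ′ : LCtx X n) (i j : Fin n → ℕ) : Set where
  constructor halves
  field
    {Γ₁ Γ₂} : LCtx X n
    parts   : Γ′ ≔ Γ₁ ⊎ Γ₂
    ⊑ˡ      : Γ₁ ⊑ Γ
    sizesˡ  : Sizes Γ₁ i
    ⊑ʳ      : Γ₂ ⊑ Γ
    sizesʳ  : Sizes Γ₂ j

halve : (Γ : LCtx X n) {Γ′ : LCtx X n} (i j : Fin n → ℕ) → Γ′ ⊑ Γ → Sizes Γ′ (λ a → i a + j a) → Halves Γ Γ′ i j
halve Γ {Γ′} i j f e with divide Γ′ i j e
... | divided p g h = halves p (λ a → f a ∘ ⊑-splitˡ p a) g (λ a → f a ∘ ⊑-splitʳ p a) h

halve′ : (Γ : LCtx X n) {Γ′ : LCtx X n} (i j : Fin n → ℕ) → Γ′ ⊑ Γ → Sizes Γ′ (λ a → i a + j a) → Halves Γ Γ′ j i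
halve′ Γ i j f e = halve Γ j i f (λ a → trans (+-comm (j a) (i a)) (e a))

Exact-1 : {Γ : LCtx X n} {A : Formula X} {t : Term m (1 + n)} →
  occ zero t ≡ 1 → Sizes Γ (λ a → occ (suc a) t) → Exact (just A ∷ Γ) t
Exact-1 o e zero    = o
Exact-1 o e (suc a) = e a

Exact-2 : {Γ : LCtx X n} {A B : Formula X} {t : Term m (2 + n)} →
  (∀ (i : Fin 2) → occ (i ↑ˡ n) t ≡ 1) → Sizes Γ (λ a → occ (2 ↑ʳ a) t) → Exact (just A ∷ just B ∷ Γ) t
Exact-2 o e zero          = o zero
Exact-2 o e (suc zero)    = o (suc zero)
Exact-2 o e (suc (suc a)) = e a

Exact-closed : {A : Formula X} {t : Term m (1 + n)} →
  occ zero t ≡ 1 → (∀ a → ¬ suc a ∈fv t) → Exact (just A ∷ ∅) t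
Exact-closed {X} {n = n} {t = t} o c = Exact-1 {t = t} o (λ a → trans (occ≡0 {t = t} (c a)) (Sizes-∅ {X} {n} a))

closed-Γ : {Γ : LCtx X n} {t : Term m (1 + n)} → (∀ a → ¬ suc a ∈fv t) → Exact Γ (! t) → Γ ≡ ∅
closed-Γ {t = t} c e = Sizes-∅⁻ (λ a → trans (sym (occ≡0 {t = t} (c a))) (e a))

record Equated {X : Set} {m n : ℕ} (Δ : UCtx X m) (Γ : LCtx X n) (A : Formula X) (t s : Term m n) : Set where
  constructor equated
  field
    tyˡ   : Δ ∣ Γ ⊢ t ∶ A
    tyʳ   : Δ ∣ Γ ⊢ s ∶ A
    steps : Δ ∣ Γ ⊢ t ≋ s ∶ A
open Equated

Equated-sym : {Δ : UCtx X m} {Γ : LCtx X n} {A : Formula X} {t s : Term m n} → Equated Δ Γ A t s → Equated Δ Γ A s t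
Equated-sym (equated d e c) = equated e d (symmetric _ c)

module _ {R : Axioms}
    (step⁺ : ∀ {X m n} {Δ : UCtx X m} {Γ Γ′ : LCtx X n} {A t s} → R A t s → Γ′ ⊑ Γ →
      Δ ⨾ Γ ⊩ t ∶ A → Δ ⨾ Γ ⊩ s ∶ A → Exact Γ′ t → WellBound t → Equated Δ Γ′ A t s)
    (step⁻ : ∀ {X m n} {Δ : UCtx X m} {Γ Γ′ : LCtx X n} {A t s} → R A t s → Γ′ ⊑ Γ →
      Δ ⨾ Γ ⊩ t ∶ A → Δ ⨾ Γ ⊩ s ∶ A → Exact Γ′ s → WellBound s → Equated Δ Γ′ A s t) where

  -- Replays a congruence with split contexts. `Γ′` shrinks to the variables of the current subterm,
  -- while the derivation goes on referring to the shared `Γ`. Typings of both sides are produced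
  -- along the way, because `Closure` demands a typing of every neighbour of a step.
  equate : {Δ : UCtx X m} {Γ Γ′ : LCtx X n} {A : Formula X} {t s : Term m n} →
    Γ′ ⊑ Γ → Cong R Δ Γ A t s → Exact Γ′ t → WellBound t → Equated Δ Γ′ A t s
  equate {m = m} {Δ = Δ} {Γ} {A = A} f (lvar {a} x) e w =
    subst (λ Γ → Equated Δ Γ A (lvar a) (lvar a)) (sym (lvar-Γ {m = m} {Γ = Γ} f x e)) (equated lvar lvar ε)
  equate {Δ = Δ} {A = A} f (uvar {u} x) e w =
    subst (λ Γ → Equated Δ Γ A (uvar u) (uvar u)) (sym (Sizes-∅⁻ e)) (equated d d ε)
    where d = uvar (lookup⇒[]= u Δ x)
  equate {Γ = Γ} f (tensor {t} {s = s} c d) e (w , v) with halve Γ (λ a → occ a t) (λ a → occ a s) f e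
  ... | halves p f₁ e₁ f₂ e₂ with equate f₁ c e₁ w | equate f₂ d e₂ v
  ... | equated x x′ y | equated z z′ u = equated (tensor p x z) (tensor p x′ z′)
    -- A parallel step becomes two sequential ones: the first beside the old right component, the
    -- second beside the new left one.
    (transitive _ (gmap ⟨_, _ ⟩ (λ q → tensorˡ p q z) y) (gmap ⟨ _ ,_⟩ (tensorʳ p x′) u))
  equate {Γ = Γ} f (elim {t = t} {s = s} pair c d) e (o , w , v) with halve′ Γ (λ a → occ (2 ↑ʳ a) t) (λ a → occ a s) f e
  ... | halves p f₁ e₁ f₂ e₂ with equate f₁ c e₁ v | equate (⊑-∷ (⊑-∷ f₂)) d (Exact-2 {t = t} o e₂) w
  ... | equated x x′ y | equated z z′ u = equated (elim-pair p x z) (elim-pair p x′ z′)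
    (transitive _ (gmap (elim pair _) (λ q → elim-pairʳ p q z) y) (gmap (λ t → elim pair t _) (elim-pairˡ p x′) u))
  equate {Γ = Γ} f (elim {t = t} {s = s} bang c d) e (_ , w , v) with halve′ Γ (λ a → occ a t) (λ a → occ a s) f e
  ... | halves p f₁ e₁ f₂ e₂ with equate f₁ c e₁ v | equate f₂ d e₂ w
  ... | equated x x′ y | equated z z′ u = equated (elim-bang p x z) (elim-bang p x′ z′)
    (transitive _ (gmap (elim bang _) (λ q → elim-bangʳ p q z) y) (gmap (λ t → elim bang t _) (elim-bangˡ p x′) u))
  equate {Γ = Γ} f (elim {t = t} {s = s} unit c d) e (_ , w , v) with halve′ Γ (λ a → occ a t) (λ a → occ a s) f e
  ... | halves p f₁ e₁ f₂ e₂ with equate f₁ c e₁ v | equate f₂ d e₂ w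
  ... | equated x x′ y | equated z z′ u = equated (elim-unit p x z) (elim-unit p x′ z′)
    (transitive _ (gmap (elim unit _) (λ q → elim-unitʳ p q z) y) (gmap (λ t → elim unit t _) (elim-unitˡ p x′) u))
  equate {Δ = Δ} {Γ′ = Γ′} f (par {t} {t′} {A} {B} c) e (o , w) with equate (⊑-∷ (⊑-∷ f)) c (Exact-2 {t = t} o e) w
  -- The given rule negates the types of the bound variables, here already negated, so its
  -- conclusion is at doubly negated formulas.
  ... | equated x x′ y = subst₂ (λ A B → Equated Δ Γ′ (A ⅋ B) (℘ t) (℘ t′)) (^⊥-involutive A) (^⊥-involutive B)
    (equated (par x) (par x′) (gmap ℘_ par y))
  equate {Γ = Γ} f (app {t} {s = s} c d) e (w , v) with halve Γ (λ a → occ a t) (λ a → occ a s) f e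
  ... | halves p f₁ e₁ f₂ e₂ with equate f₁ c e₁ w | equate f₂ d e₂ v
  ... | equated x x′ y | equated z z′ u = equated (app p x z) (app p x′ z′)
    (transitive _ (gmap (_• _) (λ q → appˡ p q z) y) (gmap (_ •_) (appʳ p x′) u))
  equate {Γ = Γ} f (coapp {t} {s = s} c d) e (w , v) with halve Γ (λ a → occ a t) (λ a → occ a s) f e
  ... | halves p f₁ e₁ f₂ e₂ with equate f₁ c e₁ w | equate f₂ d e₂ v
  ... | equated x x′ y | equated z z′ u = equated (coapp p x z) (coapp p x′ z′)
    (transitive _ (gmap (_▼ _) (λ q → coappˡ p q z) y) (gmap (_ ▼_) (coappʳ p x′) u))
  equate {Δ = Δ} {Γ′ = Γ′} f (ofcourse {t} {t′} {A} c) e (o , k , w) with closed-Γ {Γ = Γ′} {t = t} k e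
  ... | refl with equate (⊑-∷ f) c (Exact-1 {t = t} o e) w
  ... | equated x x′ y = subst (λ A → Equated Δ Γ′ (! A) (! t) (! t′)) (^⊥-involutive A)
    (equated (ofcourse x) (ofcourse x′) (gmap !_ ofcourse y))
  equate f (whynot c) e w with equate f c e w
  ... | equated x x′ y = equated (whynot x) (whynot x′) (gmap ¿_ whynot y)
  equate {Γ = Γ} f (elim-whynot {t = t} {s = s} c d) e (o , k , w , v)
    with equate f c (λ a → trans (cong (_+ occ a s) (sym (occ≡0 {t = t} (k a)))) (e a)) v
       | equate (⊑-∷ (∅⊑ {Γ = Γ})) d (Exact-closed {t = t} o k) w
  ... | equated x x′ y | equated z z′ u = equated (elim-whynot x z) (elim-whynot x′ z′)
    (transitive _ (gmap (_ ▸_) (λ q → elim-whynotʳ q z) y) (gmap (_▸ _) (elim-whynotˡ x′) u))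
  equate {Γ = Γ} f (cut {t} {s = s} c d) e (w , v) with halve Γ (λ a → occ a t) (λ a → occ a s) f e
  ... | halves p f₁ e₁ f₂ e₂ with equate f₁ c e₁ w | equate f₂ d e₂ v
  ... | equated x x′ y | equated z z′ u = equated (cut p x z) (cut p x′ z′)
    (transitive _ (gmap (_♯ _) (λ q → cutˡ p q z) y) (gmap (_ ♯_) (cutʳ p x′) u))
  equate {Δ = Δ} f one e w = subst (λ Γ → Equated Δ Γ 𝟙 ⋆ ⋆) (sym (Sizes-∅⁻ e)) (equated one one ε)
  equate f (fwd r d d′) e w = step⁺ r f d d′ e w
  equate f (bwd r d d′) e w = step⁻ r f d d′ e w
  equate f (c ⊙ d) e w with equate f c e w
  ... | equated x y u with equate f d (⊢-exact y) (⊢-WB y)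
  ... | equated _ z v = equated x z (transitive _ u v)

NoAxiom : Axioms
NoAxiom _ _ _ = Empty.⊥

-- Without axioms a congruence is a typing, so the conversion of typings is an instance of `equate`.
⊩⇒⊢ : {Δ : UCtx X m} {Γ Γ′ : LCtx X n} {A : Formula X} {t : Term m n} →
  Γ′ ⊑ Γ → Δ ⨾ Γ ⊩ t ∶ A → Exact Γ′ t → WellBound t → Δ ∣ Γ′ ⊢ t ∶ A
⊩⇒⊢ f d e w = tyˡ (equate {R = NoAxiom} (λ ()) (λ ()) f (Cong-refl d) e w)

module _ {R : Axioms}
    (sound : ∀ {X m n} {Δ : UCtx X m} {Γ : LCtx X n} {A t s} → R A t s →
      Δ ⨾ Γ ⊩ t ∶ A → Δ ⨾ Γ ⊩ s ∶ A → Δ ⨾ Γ ⊩ t ≈ s ∶ A)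
    (step : ∀ {X m n} {Δ : UCtx X m} {Γ : LCtx X n} {A t s} → R A t s →
      Δ ∣ Γ ⊢ t ∶ A → Δ ∣ Γ ⊢ s ∶ A → Δ ∣ Γ ⊢ t ≋ s ∶ A) where
  private
    step⁺ : ∀ {X m n} {Δ : UCtx X m} {Γ Γ′ : LCtx X n} {A t s} → R A t s → Γ′ ⊑ Γ →
      Δ ⨾ Γ ⊩ t ∶ A → Δ ⨾ Γ ⊩ s ∶ A → Exact Γ′ t → WellBound t → Equated Δ Γ′ A t s
    step⁺ r f d d′ e w = equated x y (step r x y)
      where
      c = sound r d d′
      x = ⊩⇒⊢ f d e w
      y = ⊩⇒⊢ f d′ (λ a → trans (sym (≈-occ c a)) (e a)) (≈-WB c w)

    step⁻ : ∀ {X m n} {Δ : UCtx X m} {Γ Γ′ : LCtx X n} {A t s} → R A t s → Γ′ ⊑ Γ →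
      Δ ⨾ Γ ⊩ t ∶ A → Δ ⨾ Γ ⊩ s ∶ A → Exact Γ′ s → WellBound s → Equated Δ Γ′ A s t
    step⁻ r f d d′ e w = Equated-sym (step⁺ r f d d′ (λ a → trans (≈-occ c a) (e a)) (≈-WB (Cong-sym c) w))
      where c = sound r d d′

  -- Used twice in `≈⇒≋`: for `Ax`, and for `Base` to expand each single instance of `Ax`.
  Cong⇒Equated : {Δ : UCtx X m} {Γ : LCtx X n} {A : Formula X} {t s : Term m n} →
    Cong R Δ Γ A t s → Exact Γ t → WellBound t → Equated Δ Γ A t s
  Cong⇒Equated = equate step⁺ step⁻ (λ a → id)

-- Structural equivalence

-- The given axioms, except that `unit-swap` is confined to `𝟙`. By `≋₀⇒Base` the typed instances on
-- well-bound terms are all of this form.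
data Base {X : Set} {m n : ℕ} : Formula X → Term m n → Term m n → Set where
  slide : ∀ {k l r A} (p : Pat) (S : Surface m n k l) {t : Term (k + (#ᵘ p + m)) (l + (#ˡ p + n))} →
    Base A (plug (renᔆ (wk (#ᵘ p) (#ˡ p)) S) t [ p := r ])
           (plug S (ren (xch k l (#ᵘ p) (#ˡ p)) t [ p := ren (wk k l) r ]))
  unit-⋆ : ∀ {t A} → Base A (t [ unit := ⋆ ]) t
  unit-swap : ∀ {t s} → Base 𝟙 (t [ unit := s ]) (s [ unit := t ])
  cut-subst : ∀ t {r A} → Linear t → zero ∈fv t → Base A (t ⟪\\⋆⟫ ♯ r) (t [ r ]ˡ)

Base⇒≋₀ : {A : Formula X} {t s : Term m n} → Base A t s → t ≋₀ s
Base⇒≋₀ (slide p S)      = slide p S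
Base⇒≋₀ unit-⋆           = unit-⋆
Base⇒≋₀ unit-swap        = unit-swap
Base⇒≋₀ (cut-subst t l a∈) = cut-subst {t = t} l a∈

≋₀⇒Base : {Δ : UCtx X m} {Γ : LCtx X n} {t s : Term m n} {A : Formula X} →
  WellBound t → Δ ⨾ Γ ⊩ t ∶ A → Δ ⨾ Γ ⊩ s ∶ A → t ≋₀ s → Base A t s
≋₀⇒Base w d e (slide p S) = slide p S
≋₀⇒Base w d e unit-⋆ = unit-⋆
-- The two sides of the swap give `t` the types `A` and `𝟙`.
≋₀⇒Base (_ , w , _) (elim unit _ d) (elim unit e _) unit-swap with 𝟙-unique w d e
... | refl = unit-swap
≋₀⇒Base w d e (cut-subst {t} l a∈) = cut-subst t l a∈

Base⇒≈ : {Δ : UCtx X m} {Γ : LCtx X n} {A : Formula X} {t s : Term m n} → Base A t s →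
  Δ ⨾ Γ ⊩ t ∶ A → Δ ⨾ Γ ⊩ s ∶ A → Δ ⨾ Γ ⊩ t ≈ s ∶ A
Base⇒≈ (slide p S) d e = fwd (slide p S) d e
Base⇒≈ unit-⋆ d e = fwd unit-⋆ d e
Base⇒≈ unit-swap d e = fwd unit-swap d e
Base⇒≈ (cut-subst t (o , w) a∈) d@(cut _ _) e =
  -- Here `τ` substitutes `r` and `σ` strengthens with the dummy `⋆`. The cut of `t`, with `r`
  -- substituted, against `⋆` is then removed.
  from (♯-contra (surf t (o zero a∈) w) (agreeOff (λ u → refl) λ { zero q → contradiction refl q ; (suc b) q → refl }) ⋆) d
  ⊙ ♯-⋆-≈ e

-- The local axioms as instances of substitution across a cut

fill : List (Surface m n 0 0) → Term m n → Term m n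
fill []      r = r
fill (S ∷ C) r = plug S (fill C r)

-- What `contra` computes along the path `C`, described without naming the variable at its end.
refocus : List (Surface m n 0 0) → Term m n → Term m n
refocus []      s = s
refocus (S ∷ C) s = wrap S s (refocus C (into S s))

-- Has the linear variable 0 in place of the hole, which makes it a term that `cut-subst` can be
-- applied to.
opening : List (Surface m n 0 0) → Term m (suc n)
opening []      = lvar zero
opening (S ∷ C) = plug (renᔆ (wk 0 1) S) (opening C)

substᔆ-wk : (S : Surface m n k l) (r : Term m n) →
  subᔆ (uvar , insertAt lvar zero r) (renᔆ (wk 0 1) S) ≡ S
substᔆ-wk S r = trans (subᔆ-renᔆ _ (wk 0 1) S) (subᔆ-id S)

opening-subst : (C : List (Surface m n 0 0)) (r : Term m n) → opening C [ r ]ˡ ≡ fill C r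
opening-subst []      r = refl
opening-subst (S ∷ C) r = trans (sub-plug _ (renᔆ (wk 0 1) S) (opening C))
  (cong₂ plug (substᔆ-wk S r) (trans (sub-lift-0 _ (opening C)) (opening-subst C r)))

occᔆ-wk-0 : (S : Surface m n k l) → occᔆ zero (renᔆ (wk 0 1) S) ≡ 0
occᔆ-wk-0 S = occᔆ-ren-0 (wk 0 1) (λ b ()) S

occ-opening-0 : (C : List (Surface m n 0 0)) → occ zero (opening C) ≡ 1
occ-opening-0 []      = refl
occ-opening-0 (S ∷ C) = trans (occ-plug zero (renᔆ (wk 0 1) S) (opening C))
  (cong₂ _+_ (occ-opening-0 C) (occᔆ-wk-0 S))

opening-contra : (C : List (Surface m n 0 0)) (s : Term m (suc n)) →
  contra zero (opening C) s [ ⋆ ]ˡ ≡ refocus C (s [ ⋆ ]ˡ)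
opening-contra []      s = refl
opening-contra (S ∷ C) s = begin
  contra zero (plug S′ (opening C)) s [ ⋆ ]ˡ
    ≡⟨ cong _[ ⋆ ]ˡ (contra-plug zero S′ (opening C) s
         (subst (0 <_) (sym (occ-opening-0 C)) (s≤s z≤n)) (occᔆ-wk-0 S)) ⟩
  wrap S′ s (contra zero (opening C) (into S′ s)) [ ⋆ ]ˡ
    ≡⟨ sub-wrap _ S′ s _ ⟩
  wrap (subᔆ σ S′) (s [ ⋆ ]ˡ) (sub (liftˢ 0 0 σ) (contra zero (opening C) (into S′ s)))
    ≡⟨ cong₂ (λ S y → wrap S (s [ ⋆ ]ˡ) y) (substᔆ-wk S ⋆) (trans (sub-lift-0 σ (contra zero (opening C) (into S′ s))) (opening-contra C (into S′ s))) ⟩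
  wrap S (s [ ⋆ ]ˡ) (refocus C (into S′ s [ ⋆ ]ˡ))
    ≡⟨ cong (λ y → wrap S (s [ ⋆ ]ˡ) (refocus C y)) (trans (sym (sub-lift-0 σ (into S′ s))) (sub-into σ S′ s)) ⟩
  wrap S (s [ ⋆ ]ˡ) (refocus C (into (subᔆ σ S′) (s [ ⋆ ]ˡ)))
    ≡⟨ cong (λ S₁ → wrap S (s [ ⋆ ]ˡ) (refocus C (into S₁ (s [ ⋆ ]ˡ)))) (substᔆ-wk S ⋆) ⟩
  wrap S (s [ ⋆ ]ˡ) (refocus C (into S (s [ ⋆ ]ˡ))) ∎
  where
  open ≡-Reasoning
  S′ = renᔆ (wk 0 1) S
  σ  = uvar , insertAt lvar zero ⋆

occ-opening : (C : List (Surface m n 0 0)) (r : Term m n) → ∀ a →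
  occ (suc a) (opening C) + occ a r ≡ occ a (fill C r)
occ-opening []      r a = refl
occ-opening (S ∷ C) r a = begin
  occ (suc a) (plug S′ (opening C)) + occ a r        ≡⟨ cong (_+ occ a r) (occ-plug (suc a) S′ (opening C)) ⟩
  occ (suc a) (opening C) + occᔆ (suc a) S′ + occ a r ≡⟨ +-assoc (occ (suc a) (opening C)) _ _ ⟩
  occ (suc a) (opening C) + (occᔆ (suc a) S′ + occ a r)
    ≡⟨ cong (occ (suc a) (opening C) +_) (+-comm (occᔆ (suc a) S′) (occ a r)) ⟩
  occ (suc a) (opening C) + (occ a r + occᔆ (suc a) S′) ≡⟨ +-assoc (occ (suc a) (opening C)) _ _ ⟨
  occ (suc a) (opening C) + occ a r + occᔆ (suc a) S′
    ≡⟨ cong₂ _+_ (occ-opening C r a) (occᔆ-ren (wk 0 1) (Over-wk 1) S) ⟩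
  occ a (fill C r) + occᔆ a S                        ≡⟨ occ-plug a S (fill C r) ⟨
  occ a (plug S (fill C r))                          ∎
  where
  open ≡-Reasoning
  S′ = renᔆ (wk 0 1) S

WB-opening : (C : List (Surface m n 0 0)) {r : Term m n} → WellBound (fill C r) → WellBound (opening C)
WB-opening []      w = tt
WB-opening (S ∷ C) w with WB-plug⁻ S w
... | _ , v , u = WB-plug⁺ (renᔆ (wk 0 1) S) (λ ()) (WB-opening C v) (WBᔆ-ren⁺ (wk 0 1) S u)

part≡1 : ∀ {i j} → 0 < i → i + j ≡ 1 → i ≡ 1
part≡1 {i} p e with +≡1 i e
part≡1 p  e | inj₁ (q , _) = q
part≡1 () e | inj₂ (refl , _)

Linear-opening : (C : List (Surface m n 0 0)) {r : Term m n} → Linear (fill C r) → Linear (opening C)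
Linear-opening C {r} (o , w) = go , WB-opening C w
  where
  go : ∀ a → a ∈fv opening C → occ a (opening C) ≡ 1
  go zero    _  = occ-opening-0 C
  go (suc a) a∈ = part≡1 a∈ (trans (occ-opening C r a)
    (o a (subst (0 <_) (occ-opening C r a) (∈fv-+ˡ (occ a r) a∈))))

-- This is `cut-subst` at the opening of `C`. Each cut axiom of `Ax` arises from a context of at
-- most two layers, chosen so that `refocus C ⋆` is, up to added units, the term wanted on the left
-- of the cut.
cut-fill : (C : List (Surface m n 0 0)) (r : Term m n) {A : Formula X} →
  Linear (fill C r) → Base A (refocus C ⋆ ♯ r) (fill C r)
cut-fill C r {A} l = subst₂ (Base A) (cong (_♯ r) (opening-contra C ⋆)) (opening-subst C r)
  (cut-subst (opening C) (Linear-opening C l) (subst (0 <_) (sym (occ-opening-0 C)) (s≤s z≤n)))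

Linear-occ : (t s : Term m n) → (∀ a → occ a t ≡ occ a s) → WellBound s → Linear t → Linear s
Linear-occ t s e w (o , _) = (λ a a∈ → trans (sym (e a)) (o a (subst (0 <_) (sym (e a)) a∈))) , w

module _ {X : Set} {m n : ℕ} {Δ : UCtx X m} {Γ : LCtx X n} where

  add-⋆ : ∀ {t A} → Δ ⨾ Γ ⊩ t ∶ A → Cong Base Δ Γ A t (t [ unit := ⋆ ])
  add-⋆ d = bwd unit-⋆ (elim unit one d) d

  cut-commᴮ : ∀ {t s} → Linear (s ♯ t) → Δ ⨾ Γ ⊩ t ♯ s ∶ ⊥ → Cong Base Δ Γ ⊥ (t ♯ s) (s ♯ t)
  -- Refocusing through `□♯ t` wraps `t` in a unit eliminator on `⋆`, which is therefore added
  -- beforehand.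
  cut-commᴮ {t} {s} l (cut d e) = cut (add-⋆ d) (Cong-refl e) ⊙
    fwd (cut-fill ((□♯ t) ∷ []) s l) (cut (elim unit one d) e) (cut′ e d)

  ♯-⋆ᴮ : ∀ {t} → Linear t → Δ ⨾ Γ ⊩ t ∶ ⊥ → Cong Base Δ Γ ⊥ t (t ♯ ⋆)
  ♯-⋆ᴮ {t} l@(_ , w) d = bwd (cut-fill [] t l) (cut one d) d ⊙
    cut-commᴮ (Linear-occ t (t ♯ ⋆) (λ a → sym (+-identityʳ (occ a t))) (w , tt) l) (cut one d)

Linear-under : (t : Term m (l + n)) → (∀ (i : Fin l) → occ (i ↑ˡ n) t ≡ 1) → WellBound t →
  (∀ a → l ↑ʳ a ∈fv t → occ (l ↑ʳ a) t ≡ 1) → Linear t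
Linear-under {l = l} t b w o = go , w
  where
  go : ∀ a → a ∈fv t → occ a t ≡ 1
  go a a∈ with split l a
  ... | bound i = b i
  ... | free j  = o j a∈

Ax-linear : {A : Formula X} {t s : Term m n} → Ax A t s → Linear t → Linear s
Ax-linear {t = t} {s} a l = Linear-occ t s (Ax-occ a) (Ax-WB⁺ a (proj₂ l)) l

Ax⇒Base : {Δ : UCtx X m} {Γ : LCtx X n} {A : Formula X} {t s : Term m n} → Ax A t s → Linear t →
  Δ ⨾ Γ ⊩ t ∶ A → Δ ⨾ Γ ⊩ s ∶ A → Cong Base Δ Γ A t s
Ax⇒Base (slide p S) l d e = fwd (slide p S) d e
Ax⇒Base unit-⋆ l d e = fwd unit-⋆ d e
Ax⇒Base unit-swap l d e = fwd unit-swap d e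
Ax⇒Base a@(comm {t} {s}) l d e = cut-commᴮ (Ax-linear a l) d
Ax⇒Base (⋆-♯ {t}) (o , _ , w) d e = fwd (cut-fill [] t (o , w)) d e
Ax⇒Base a@(•-♯ {t} {s} {r}) l (cut d d′) e = cut (add-⋆ d) (Cong-refl d′) ⊙
  fwd (cut-fill ((t ♯□) ∷ ⟨ s ,□⟩ ∷ []) r (Ax-linear a l)) (cut (elim unit one d) d′) e
Ax⇒Base a@(▼-♯ {t} {s} {r}) l (cut d d′) e = cut (add-⋆ d) (Cong-refl d′) ⊙
  fwd (cut-fill ((t ♯□) ∷ ⟨□, s ⟩ ∷ []) r (Ax-linear a l)) (cut (elim unit one d) d′) e
-- Refocusing through the eliminator yields `℘ (t ♯ ⋆)`, hence the detour by `♯-⋆ᴮ` on the body.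
Ax⇒Base a@(℘-♯ {t} {r}) l@(o , (b , w) , _) (cut (par d) d′) e =
  cut (par c) (Cong-refl d′) ⊙
  fwd (cut-fill (elim□ pair t ∷ []) r (Ax-linear a l)) (cut (par (Cong-tyʳ c)) d′) e
  where c = ♯-⋆ᴮ (Linear-under t b w (λ j j∈ → part≡1 j∈ (o j (∈fv-+ˡ (occ j r) j∈)))) d
Ax⇒Base a@(¿-♯ {t} {r}) l@(o , w , _) (cut (whynot d) d′) e =
  cut (whynot c) (Cong-refl d′) ⊙
  fwd (cut-fill (elim□ bang t ∷ []) r (Ax-linear a l)) (cut (whynot (Cong-tyʳ c)) d′) e
  where c = ♯-⋆ᴮ ((λ j j∈ → part≡1 j∈ (o j (∈fv-+ˡ (occ j r) j∈))) , w) d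
Ax⇒Base {Δ = Δ} {Γ} a@(▸-♯ {t} {r}) l d (cut {B = B} f g) =
  bwd (cut-fill ((t ▸□) ∷ []) r l) (cut (elim unit one g) f′) d ⊙
  cut (fwd unit-⋆ (elim unit one g) g) (Cong-refl f′) ⊙
  cut-commᴮ (Ax-linear a l) (cut g f′)
  where f′ = subst (λ C → Δ ⨾ Γ ⊩ r ∶ C) (sym (^⊥-involutive B)) f

Exact⇒Linear : {Γ : LCtx X n} (t : Term m n) → Exact Γ t → WellBound t → Linear t
Exact⇒Linear {Γ = Γ} t e w = go , w
  where
  go : ∀ a → a ∈fv t → occ a t ≡ 1
  go a a∈ with lookup Γ a | e a
  ... | just _  | o = o
  ... | nothing | o = contradiction (subst (0 <_) o a∈) λ ()

≋₀⇒≈ : {Δ : UCtx X m} {Γ Γ′ : LCtx X n} {A : Formula X} {t s : Term m n} →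
  Γ ⊑ Γ′ → Closure _≋₀_ Δ Γ A t s → Δ ⨾ Γ′ ⊩ t ≈ s ∶ A
≋₀⇒≈ f (axiom r d e) = Base⇒≈ (≋₀⇒Base (⊢-WB d) d′ e′ r) d′ e′
  where
  d′ = ⊢⇒⊩ f d
  e′ = ⊢⇒⊩ f e
≋₀⇒≈ f (tensorˡ p c d) = tensor (≋₀⇒≈ (λ a → f a ∘ ⊑-splitˡ p a) c) (Cong-refl (⊢⇒⊩ (λ a → f a ∘ ⊑-splitʳ p a) d))
≋₀⇒≈ f (tensorʳ p d c) = tensor (Cong-refl (⊢⇒⊩ (λ a → f a ∘ ⊑-splitˡ p a) d)) (≋₀⇒≈ (λ a → f a ∘ ⊑-splitʳ p a) c)
≋₀⇒≈ f (elim-pairˡ p d c) = elim pair (Cong-refl (⊢⇒⊩ (λ a → f a ∘ ⊑-splitˡ p a) d))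
  (≋₀⇒≈ (⊑-∷ (⊑-∷ (λ a → f a ∘ ⊑-splitʳ p a))) c)
≋₀⇒≈ f (elim-pairʳ p c d) = elim pair (≋₀⇒≈ (λ a → f a ∘ ⊑-splitˡ p a) c)
  (Cong-refl (⊢⇒⊩ (⊑-∷ (⊑-∷ (λ a → f a ∘ ⊑-splitʳ p a))) d))
≋₀⇒≈ {Δ = Δ} {Γ′ = Γ′} f (par {t = t} {t′} {A} {B} c) = par (subst₂ (λ C D → Δ ⨾ just C ∷ just D ∷ Γ′ ⊩ t ≈ t′ ∶ ⊥)
  (sym (^⊥-involutive A)) (sym (^⊥-involutive B)) (≋₀⇒≈ (⊑-∷ (⊑-∷ f)) c))
≋₀⇒≈ f (appˡ p c d) = app (≋₀⇒≈ (λ a → f a ∘ ⊑-splitˡ p a) c) (Cong-refl (⊢⇒⊩ (λ a → f a ∘ ⊑-splitʳ p a) d))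
≋₀⇒≈ f (appʳ p d c) = app (Cong-refl (⊢⇒⊩ (λ a → f a ∘ ⊑-splitˡ p a) d)) (≋₀⇒≈ (λ a → f a ∘ ⊑-splitʳ p a) c)
≋₀⇒≈ f (coappˡ p c d) = coapp (≋₀⇒≈ (λ a → f a ∘ ⊑-splitˡ p a) c) (Cong-refl (⊢⇒⊩ (λ a → f a ∘ ⊑-splitʳ p a) d))
≋₀⇒≈ f (coappʳ p d c) = coapp (Cong-refl (⊢⇒⊩ (λ a → f a ∘ ⊑-splitˡ p a) d)) (≋₀⇒≈ (λ a → f a ∘ ⊑-splitʳ p a) c)
≋₀⇒≈ {Δ = Δ} {Γ′ = Γ′} f (ofcourse {t} {t′} {A} c) = ofcourse (subst (λ C → Δ ⨾ just C ∷ Γ′ ⊩ t ≈ t′ ∶ ⊥)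
  (sym (^⊥-involutive A)) (≋₀⇒≈ (⊑-∷ f) c))
≋₀⇒≈ f (elim-bangˡ p d c) = elim bang (Cong-refl (⊢⇒⊩ (λ a → f a ∘ ⊑-splitˡ p a) d)) (≋₀⇒≈ (λ a → f a ∘ ⊑-splitʳ p a) c)
≋₀⇒≈ f (elim-bangʳ p c d) = elim bang (≋₀⇒≈ (λ a → f a ∘ ⊑-splitˡ p a) c) (Cong-refl (⊢⇒⊩ (λ a → f a ∘ ⊑-splitʳ p a) d))
≋₀⇒≈ f (whynot c) = whynot (≋₀⇒≈ f c)
≋₀⇒≈ {Γ′ = Γ′} f (elim-whynotˡ d c) = elim-whynot (Cong-refl (⊢⇒⊩ f d)) (≋₀⇒≈ (⊑-∷ (∅⊑ {Γ = Γ′})) c)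
≋₀⇒≈ {Γ′ = Γ′} f (elim-whynotʳ c d) = elim-whynot (≋₀⇒≈ f c) (Cong-refl (⊢⇒⊩ (⊑-∷ (∅⊑ {Γ = Γ′})) d))
≋₀⇒≈ f (cutˡ p c d) = cut (≋₀⇒≈ (λ a → f a ∘ ⊑-splitˡ p a) c) (Cong-refl (⊢⇒⊩ (λ a → f a ∘ ⊑-splitʳ p a) d))
≋₀⇒≈ f (cutʳ p d c) = cut (Cong-refl (⊢⇒⊩ (λ a → f a ∘ ⊑-splitˡ p a) d)) (≋₀⇒≈ (λ a → f a ∘ ⊑-splitʳ p a) c)
≋₀⇒≈ f (elim-unitˡ p d c) = elim unit (Cong-refl (⊢⇒⊩ (λ a → f a ∘ ⊑-splitˡ p a) d)) (≋₀⇒≈ (λ a → f a ∘ ⊑-splitʳ p a) c)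
≋₀⇒≈ f (elim-unitʳ p c d) = elim unit (≋₀⇒≈ (λ a → f a ∘ ⊑-splitˡ p a) c) (Cong-refl (⊢⇒⊩ (λ a → f a ∘ ⊑-splitʳ p a) d))

≋⇒≈ : {Δ : UCtx X m} {Γ : LCtx X n} {A : Formula X} {t s : Term m n} →
  Δ ⨾ Γ ⊩ t ∶ A → Δ ∣ Γ ⊢ t ≋ s ∶ A → Δ ⨾ Γ ⊩ t ≈ s ∶ A
≋⇒≈ d ε            = Cong-refl d
≋⇒≈ d (fwd c ◅ cs) = c′ ⊙ ≋⇒≈ (Cong-tyʳ c′) cs
  where c′ = ≋₀⇒≈ (λ _ → id) c
≋⇒≈ d (bwd c ◅ cs) = c′ ⊙ ≋⇒≈ (Cong-tyʳ c′) cs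
  where c′ = Cong-sym (≋₀⇒≈ (λ _ → id) c)

-- In two stages. The derivation is first cut into single steps with split contexts, where the terms
-- are known to be linear, as `Ax⇒Base` requires; each step is then expanded in `Base` and cut into
-- steps again.
≈⇒≋ : {Δ : UCtx X m} {Γ : LCtx X n} {A : Formula X} {t s : Term m n} →
  Exact Γ t → WellBound t → Δ ⨾ Γ ⊩ t ≈ s ∶ A → Δ ∣ Γ ⊢ t ≋ s ∶ A
≈⇒≋ e w c = steps (Cong⇒Equated fwd local c e w)
  where
  local : ∀ {X m n} {Δ : UCtx X m} {Γ : LCtx X n} {A t s} → Ax A t s →
    Δ ∣ Γ ⊢ t ∶ A → Δ ∣ Γ ⊢ s ∶ A → Δ ∣ Γ ⊢ t ≋ s ∶ A
  local {Γ = Γ} {t = t} a d e = steps (Cong⇒Equated Base⇒≈ (λ b d e → return (axiom (Base⇒≋₀ b) d e))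
    (Ax⇒Base a (Exact⇒Linear {Γ = Γ} t (⊢-exact d) (⊢-WB d)) (⊢⇒⊩ {Γ = Γ} (λ _ → id) d) (⊢⇒⊩ {Γ = Γ} (λ _ → id) e))  (⊢-exact d) (⊢-WB d))

-- Pre-reduction

renᴴ-wkᴸ : ∀ p ps (H : Head m n) → renᴴ (wkᴸ (p ∷ ps)) H ≡ renᴴ (wkᴸ ps) (renᴴ (wk (#ᵘ p) (#ˡ p)) H)
renᴴ-wkᴸ p ps H = sym (renᴴ-renᴴ (wkᴸ ps) (wk (#ᵘ p) (#ˡ p)) H)

peel* : ∀ {ps} (L : PosCtx ps m n) {H v y} → renᴴ (wkᴸ ps) H ∣ v ↘ y → H ∣ v $ᴸ L ↘ y $ᴸ L
peel* □ {H} r = subst (_∣ _ ↘ _) (renᴴ-id H) r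
peel* {ps = p ∷ ps} (elimᴸ p L s) {H} r = peel p (peel* L (subst (_∣ _ ↘ _) (renᴴ-wkᴸ p ps H) r))

ren-$ᴸ : ∀ {ps} (ρ : Ren m n m′ n′) (L : PosCtx ps m n) v → ren ρ (v $ᴸ L) ≡ ren (liftᴸ ps ρ) v $ᴸ renᴸ ρ L
ren-$ᴸ ρ □             v = refl
ren-$ᴸ ρ (elimᴸ p L s) v = cong (λ x → x [ p := ren ρ s ]) (ren-$ᴸ _ L v)

-- In a cut, the left side is weakened over the eliminators of the right one before its own
-- eliminators are peeled.
peelᴿ : ∀ {ps} (ρ : Ren m n m′ n′) (L : PosCtx ps m n) {H v y} →
  renᴴ (wkᴸ ps) H ∣ ren (liftᴸ ps ρ) v ↘ y → H ∣ ren ρ (v $ᴸ L) ↘ y $ᴸ renᴸ ρ L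
peelᴿ ρ L {H} {v} {y} r = subst (H ∣_↘ y $ᴸ renᴸ ρ L) (sym (ren-$ᴸ ρ L v)) (peel* (renᴸ ρ L) r)

appˢ-true : (r : Term m n) (t : Term m (2 + n)) → t [ ren (wk 0 1) r ]ˡ ≡ sub (appˢ true r) t
appˢ-true r = sub-cong ((λ _ → refl) , λ { zero → refl ; (suc a) → refl })

appˢ-false : (r : Term m n) (t : Term m (2 + n)) → substˡ (suc zero) t (ren (wk 0 1) r) ≡ sub (appˢ false r) t
appˢ-false r = sub-cong ((λ _ → refl) , λ { zero → refl ; (suc zero) → refl ; (suc (suc a)) → refl })

pairˢ-substˡ : (s r : Term m n) (t : Term m (2 + n)) → t [ ren (wk 0 1) s ]ˡ [ r ]ˡ ≡ sub (pairˢ s r) t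
pairˢ-substˡ s r t = trans (sub-sub _ _ t) (sub-cong
  ((λ _ → refl) , λ { zero → wk-substˡ s r ; (suc zero) → refl ; (suc (suc a)) → refl }) t)

-- The reducts agree up to two equations: successive substitutions are merged into a simultaneous
-- one, and renaming commutes with contra-substitution at `⋆`.
↦⇒⟶ : {t t′ : Term m n} → t ↦ t′ → t ⟶ t′
↦⇒⟶ (℘-• {ps} {t} {r} L) rewrite appˢ-true (ren (wkᴸ ps) r) t = app-red (peel* L app-℘)
↦⇒⟶ (℘-▼ {ps} {t} {r} L) rewrite appˢ-false (ren (wkᴸ ps) r) t = coapp-red (peel* L app-℘)
↦⇒⟶ (pair-⟨⟩ {ps} {t} {s} {r} L) rewrite pairˢ-substˡ s r (ren (liftᴿ 0 2 (wkᴸ ps)) t) = pair-red (peel* L pair-⟨⟩)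
↦⇒⟶ (bang-! L) = bang-red (peel* L bang-!)
↦⇒⟶ (▸-¿ {ps} {t} L) rewrite ren-⟪⟫ (wkᴸ ps) t = whynot-red (peel* L whynot-¿)
↦⇒⟶ (℘-♯-⟨⟩ {ps} {qs} {t} {s} {r} L K)
  rewrite pairˢ-substˡ (ren (wkᴸ ps) s) (ren (wkᴸ ps) r) (ren (liftᴿ 0 2 (liftᴸ ps (wkᴸ qs))) t) =
  cut-red (peel* K (cut-⟨⟩ (peelᴿ (wkᴸ qs) L tensor-℘)))
↦⇒⟶ (⟨⟩-♯-℘ {ps} {qs} {t} {s} {r} L K)
  rewrite pairˢ-substˡ (ren (liftᴸ ps (wkᴸ qs)) s) (ren (liftᴸ ps (wkᴸ qs)) r) (ren (liftᴿ 0 2 (wkᴸ ps)) t) =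
  cut-red (peel* K (cut-℘ (peelᴿ (wkᴸ qs) L pair-⟨⟩)))
↦⇒⟶ (!-♯-¿ {ps} {qs} {t} L K) rewrite ren-⟪⟫ (liftᴸ ps (wkᴸ qs)) t =
  cut-red (peel* K (cut-¿ (peelᴿ (wkᴸ qs) L bang-!)))
↦⇒⟶ (¿-♯-! {ps} {qs} {t} L K) rewrite ren-⟪⟫ (wkᴸ ps) t =
  cut-red (peel* K (cut-! (peelᴿ (wkᴸ qs) L whynot-¿)))

data Value {m n : ℕ} : Term m n → Set where
  ⟨_,_⟩ : ∀ t s → Value ⟨ t , s ⟩
  ℘_    : ∀ t → Value (℘ t)
  !_    : ∀ t → Value (! t)
  ¿_    : ∀ t → Value (¿ t)

data Unpeeled {m n : ℕ} (H : Head m n) : Term m n → Term m n → Set where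
  unpeeled : ∀ {ps v y} (L : PosCtx ps m n) → Value v → renᴴ (wkᴸ ps) H ∣ v ↘ y → Unpeeled H (v $ᴸ L) (y $ᴸ L)

unpeeled-□ : {H : Head m n} {v y : Term m n} → Value v → H ∣ v ↘ y → Unpeeled H v y
unpeeled-□ {H = H} v r = unpeeled □ v (subst (_∣ _ ↘ _) (sym (renᴴ-id H)) r)

unpeel : {H : Head m n} {x y : Term m n} → H ∣ x ↘ y → Unpeeled H x y
unpeel r@app-℘      = unpeeled-□ (℘ _) r
unpeel r@tensor-℘   = unpeeled-□ (℘ _) r
unpeel r@pair-⟨⟩    = unpeeled-□ ⟨ _ , _ ⟩ r
unpeel r@bang-!     = unpeeled-□ (! _) r
unpeel r@whynot-¿   = unpeeled-□ (¿ _) r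
unpeel r@(cut-⟨⟩ _) = unpeeled-□ ⟨ _ , _ ⟩ r
unpeel r@(cut-℘ _)  = unpeeled-□ (℘ _) r
unpeel r@(cut-! _)  = unpeeled-□ (! _) r
unpeel r@(cut-¿ _)  = unpeeled-□ (¿ _) r
unpeel (peel p {H} {s = s} r) with unpeel r
... | unpeeled {ps} L v r′ = unpeeled (elimᴸ p L s) v (subst (_∣ _ ↘ _) (sym (renᴴ-wkᴸ p ps H)) r′)

-- `L` is found in the term before its renaming, as the rules of `_↦_` require for the left side of
-- a cut.
data Unpeeledᴿ {m n m′ n′ : ℕ} (ρ : Ren m n m′ n′) (H : Head m′ n′) : Term m n → Term m′ n′ → Set where
  unpeeled : ∀ {ps v y} (L : PosCtx ps m n) → Value v →
    renᴴ (wkᴸ ps) H ∣ ren (liftᴸ ps ρ) v ↘ y → Unpeeledᴿ ρ H (v $ᴸ L) (y $ᴸ renᴸ ρ L)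

unpeelᴿ : (ρ : Ren m n m′ n′) (H : Head m′ n′) (x : Term m n) {y : Term m′ n′} → H ∣ ren ρ x ↘ y → Unpeeledᴿ ρ H x y
unpeelᴿ ρ H ⟨ t , s ⟩ r = unpeeled □ ⟨ t , s ⟩ (subst (_∣ _ ↘ _) (sym (renᴴ-id H)) r)
unpeelᴿ ρ H (℘ t)     r = unpeeled □ (℘ t) (subst (_∣ _ ↘ _) (sym (renᴴ-id H)) r)
unpeelᴿ ρ H (! t)     r = unpeeled □ (! t) (subst (_∣ _ ↘ _) (sym (renᴴ-id H)) r)
unpeelᴿ ρ H (¿ t)     r = unpeeled □ (¿ t) (subst (_∣ _ ↘ _) (sym (renᴴ-id H)) r)
unpeelᴿ ρ H (t [ p := s ]) (peel p r) with unpeelᴿ (liftᴿ (#ᵘ p) (#ˡ p) ρ) (renᴴ (wk (#ᵘ p) (#ˡ p)) H) t r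
... | unpeeled {ps} L v r′ = unpeeled (elimᴸ p L s) v (subst (_∣ _ ↘ _) (sym (renᴴ-wkᴸ p ps H)) r′)

app-↦ : {x r y : Term m n} → appᴴ true r ∣ x ↘ y → x • r ↦ y
app-↦ {r = r} c with unpeel c
... | unpeeled {ps} L (℘ t) app-℘ rewrite sym (appˢ-true (ren (wkᴸ ps) r) t) = ℘-• L

coapp-↦ : {x r y : Term m n} → appᴴ false r ∣ x ↘ y → x ▼ r ↦ y
coapp-↦ {r = r} c with unpeel c
... | unpeeled {ps} L (℘ t) app-℘ rewrite sym (appˢ-false (ren (wkᴸ ps) r) t) = ℘-▼ L

pair-↦ : {t : Term m (2 + n)} {x y : Term m n} → pairᴴ t ∣ x ↘ y → t [ pair := x ] ↦ y
pair-↦ {t = t} c with unpeel c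
... | unpeeled {ps} L ⟨ s , r ⟩ pair-⟨⟩ rewrite sym (pairˢ-substˡ s r (ren (liftᴿ 0 2 (wkᴸ ps)) t)) = pair-⟨⟩ L

bang-↦ : {t : Term (1 + m) n} {x y : Term m n} → bangᴴ t ∣ x ↘ y → t [ bang := x ] ↦ y
bang-↦ c with unpeel c
... | unpeeled L (! _) bang-! = bang-! L

whynot-↦ : {t : Term m (1 + n)} {x y : Term m n} → whynotᴴ t ∣ x ↘ y → t ▸ x ↦ y
whynot-↦ {t = t} c with unpeel c
... | unpeeled {ps} L (¿ _) whynot-¿ rewrite sym (ren-⟪⟫ (wkᴸ ps) t) = ▸-¿ L

cut-↦ : {x w y : Term m n} → cutᴴ x ∣ w ↘ y → x ♯ w ↦ y
cut-↦ {x = x} c with unpeel c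
... | unpeeled {qs} K ⟨ s , r ⟩ (cut-⟨⟩ c′) with unpeelᴿ (wkᴸ qs) (tensorᴴ s r) x c′
... | unpeeled {ps} L (℘ t) tensor-℘
  rewrite sym (pairˢ-substˡ (ren (wkᴸ ps) s) (ren (wkᴸ ps) r) (ren (liftᴿ 0 2 (liftᴸ ps (wkᴸ qs))) t)) = ℘-♯-⟨⟩ L K
cut-↦ {x = x} c | unpeeled {qs} K (℘ t) (cut-℘ c′) with unpeelᴿ (wkᴸ qs) (pairᴴ t) x c′
... | unpeeled {ps} L ⟨ s , r ⟩ pair-⟨⟩
  rewrite sym (pairˢ-substˡ (ren (liftᴸ ps (wkᴸ qs)) s) (ren (liftᴸ ps (wkᴸ qs)) r) (ren (liftᴿ 0 2 (wkᴸ ps)) t)) =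
  ⟨⟩-♯-℘ L K
cut-↦ {x = x} c | unpeeled {qs} K (! t) (cut-! c′) with unpeelᴿ (wkᴸ qs) (whynotᴴ t) x c′
... | unpeeled {ps} L (¿ _) whynot-¿ rewrite sym (ren-⟪⟫ (wkᴸ ps) t) = ¿-♯-! L K
cut-↦ {x = x} c | unpeeled {qs} K (¿ r) (cut-¿ c′) with unpeelᴿ (wkᴸ qs) (bangᴴ r) x c′
... | unpeeled {ps} L (! t) bang-! rewrite sym (ren-⟪⟫ (liftᴸ ps (wkᴸ qs)) t) = !-♯-¿ L K

-- The typing of the reduct is rebuilt from the one that the axiom instance carries, and with it
-- comes the linearity of the reduct.
⟶⁻⇒⟶ : {Δ : UCtx X m} {Γ : LCtx X n} {A : Formula X} {t t′ : Term m n} →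
  Δ ∣ Γ ⊢ t ⟶⁻ t′ ∶ A → (t ⟶ t′) × (Δ ∣ Γ ⊢ t′ ∶ A)
⟶⁻⇒⟶ (axiom r _ d)       = ↦⇒⟶ r , d
⟶⁻⇒⟶ (tensorˡ p c d)     = Product.map tensorˡ (λ e → tensor p e d) (⟶⁻⇒⟶ c)
⟶⁻⇒⟶ (tensorʳ p d c)     = Product.map tensorʳ (tensor p d) (⟶⁻⇒⟶ c)
⟶⁻⇒⟶ (elim-pairˡ p d c)  = Product.map elimˡ (elim-pair p d) (⟶⁻⇒⟶ c)
⟶⁻⇒⟶ (elim-pairʳ p c d)  = Product.map elimʳ (λ e → elim-pair p e d) (⟶⁻⇒⟶ c)
⟶⁻⇒⟶ (par c)             = Product.map par par (⟶⁻⇒⟶ c)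
⟶⁻⇒⟶ (appˡ p c d)        = Product.map appˡ (λ e → app p e d) (⟶⁻⇒⟶ c)
⟶⁻⇒⟶ (appʳ p d c)        = Product.map appʳ (app p d) (⟶⁻⇒⟶ c)
⟶⁻⇒⟶ (coappˡ p c d)      = Product.map coappˡ (λ e → coapp p e d) (⟶⁻⇒⟶ c)
⟶⁻⇒⟶ (coappʳ p d c)      = Product.map coappʳ (coapp p d) (⟶⁻⇒⟶ c)
⟶⁻⇒⟶ (ofcourse c)        = Product.map ofcourse ofcourse (⟶⁻⇒⟶ c)
⟶⁻⇒⟶ (elim-bangˡ p d c)  = Product.map elimˡ (elim-bang p d) (⟶⁻⇒⟶ c)
⟶⁻⇒⟶ (elim-bangʳ p c d)  = Product.map elimʳ (λ e → elim-bang p e d) (⟶⁻⇒⟶ c)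
⟶⁻⇒⟶ (whynot c)          = Product.map whynot whynot (⟶⁻⇒⟶ c)
⟶⁻⇒⟶ (elim-whynotˡ d c)  = Product.map elim-whynotˡ (elim-whynot d) (⟶⁻⇒⟶ c)
⟶⁻⇒⟶ (elim-whynotʳ c d)  = Product.map elim-whynotʳ (λ e → elim-whynot e d) (⟶⁻⇒⟶ c)
⟶⁻⇒⟶ (cutˡ p c d)        = Product.map cutˡ (λ e → cut p e d) (⟶⁻⇒⟶ c)
⟶⁻⇒⟶ (cutʳ p d c)        = Product.map cutʳ (cut p d) (⟶⁻⇒⟶ c)
⟶⁻⇒⟶ (elim-unitˡ p d c)  = Product.map elimˡ (elim-unit p d) (⟶⁻⇒⟶ c)
⟶⁻⇒⟶ (elim-unitʳ p c d)  = Product.map elimʳ (λ e → elim-unit p e d) (⟶⁻⇒⟶ c)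

occ-cancelʳ : (i j : Fin n → ℕ) (k : Fin n → ℕ) → (∀ a → i a + k a ≡ j a + k a) → ∀ a → i a ≡ j a
occ-cancelʳ i j k e a = Nat.+-cancelʳ-≡ (k a) (i a) (j a) (e a)

occ-cancelˡ : (i j : Fin n → ℕ) (k : Fin n → ℕ) → (∀ a → k a + i a ≡ k a + j a) → ∀ a → i a ≡ j a
occ-cancelˡ i j k e a = Nat.+-cancelˡ-≡ (k a) (i a) (j a) (e a)

-- The counts and well-boundness of the reduct are hypotheses, since they determine the split
-- contexts in its typing. At a subterm the counts follow by cancelling those of its sibling.
⟶⇒⟶⁻ : {Δ : UCtx X m} {Γ Γ′ : LCtx X n} {A : Formula X} {t t′ : Term m n} → t ⟶ t′ → Γ′ ⊑ Γ → Δ ⨾ Γ ⊩ t ∶ A →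
  Exact Γ′ t → WellBound t → (∀ a → occ a t′ ≡ occ a t) → WellBound t′ → Δ ∣ Γ′ ⊢ t ⟶⁻ t′ ∶ A
root : {Δ : UCtx X m} {Γ Γ′ : LCtx X n} {A : Formula X} {t t′ : Term m n} → t ↦ t′ → t ⟶ t′ → Γ′ ⊑ Γ → Δ ⨾ Γ ⊩ t ∶ A →
  Exact Γ′ t → WellBound t → (∀ a → occ a t′ ≡ occ a t) → WellBound t′ → Δ ∣ Γ′ ⊢ t ⟶⁻ t′ ∶ A
root r r′ f d e w q w′ = axiom r (⊩⇒⊢ f d e w) (⊩⇒⊢ f (⟶-ty r′ d w) (λ a → trans (q a) (e a)) w′)
⟶⇒⟶⁻ r@(app-red c)    = root (app-↦ c) r
⟶⇒⟶⁻ r@(coapp-red c)  = root (coapp-↦ c) r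
⟶⇒⟶⁻ r@(pair-red c)   = root (pair-↦ c) r
⟶⇒⟶⁻ r@(bang-red c)   = root (bang-↦ c) r
⟶⇒⟶⁻ r@(whynot-red c) = root (whynot-↦ c) r
⟶⇒⟶⁻ r@(cut-red c)    = root (cut-↦ c) r
⟶⇒⟶⁻ {Γ = Γ} (tensorˡ {t} {t′} {s} r) f (tensor d d′) e (w , v) q (w′ , _) with halve Γ (λ a → occ a t) (λ a → occ a s) f e
... | halves p f₁ e₁ f₂ e₂ = tensorˡ p (⟶⇒⟶⁻ r f₁ d e₁ w (occ-cancelʳ _ _ (λ a → occ a s) q) w′) (⊩⇒⊢ f₂ d′ e₂ v)
⟶⇒⟶⁻ {Γ = Γ} (tensorʳ {t} {s} {s′} r) f (tensor d d′) e (w , v) q (_ , v′) with halve Γ (λ a → occ a t) (λ a → occ a s) f e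
... | halves p f₁ e₁ f₂ e₂ = tensorʳ p (⊩⇒⊢ f₁ d e₁ w) (⟶⇒⟶⁻ r f₂ d′ e₂ v (occ-cancelˡ _ _ (λ a → occ a t) q) v′)
⟶⇒⟶⁻ {n = n} {Γ = Γ} (elimˡ {pair} {t} {t′} {s} r) f (elim pair d d′) e (o , w , v) q (o′ , w′ , _)
  with halve′ Γ (λ a → occ (2 ↑ʳ a) t) (λ a → occ a s) f e
... | halves p f₁ e₁ f₂ e₂ = elim-pairˡ p (⊩⇒⊢ f₁ d e₁ v)
  (⟶⇒⟶⁻ r (⊑-∷ (⊑-∷ f₂)) d′ (Exact-2 {t = t} o e₂) w
    (λ { zero → trans (o′ zero) (sym (o zero)) ; (suc zero) → trans (o′ (suc zero)) (sym (o (suc zero)))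
       ; (suc (suc a)) → occ-cancelʳ (λ a → occ (2 ↑ʳ a) t′) (λ a → occ (2 ↑ʳ a) t) (λ a → occ a s) q a }) w′)
⟶⇒⟶⁻ {Γ = Γ} (elimˡ {bang} {t} {t′} {s} r) f (elim bang d d′) e (_ , w , v) q (_ , w′ , _)
  with halve′ Γ (λ a → occ a t) (λ a → occ a s) f e
... | halves p f₁ e₁ f₂ e₂ = elim-bangˡ p (⊩⇒⊢ f₁ d e₁ v) (⟶⇒⟶⁻ r f₂ d′ e₂ w (occ-cancelʳ _ _ (λ a → occ a s) q) w′)
⟶⇒⟶⁻ {Γ = Γ} (elimˡ {unit} {t} {t′} {s} r) f (elim unit d d′) e (_ , w , v) q (_ , w′ , _)
  with halve′ Γ (λ a → occ a t) (λ a → occ a s) f e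
... | halves p f₁ e₁ f₂ e₂ = elim-unitˡ p (⊩⇒⊢ f₁ d e₁ v) (⟶⇒⟶⁻ r f₂ d′ e₂ w (occ-cancelʳ _ _ (λ a → occ a s) q) w′)
⟶⇒⟶⁻ {Γ = Γ} (elimʳ {pair} {t} {s} {s′} r) f (elim pair d d′) e (o , w , v) q (_ , _ , v′)
  with halve′ Γ (λ a → occ (2 ↑ʳ a) t) (λ a → occ a s) f e
... | halves p f₁ e₁ f₂ e₂ = elim-pairʳ p (⟶⇒⟶⁻ r f₁ d e₁ v (occ-cancelˡ _ _ (λ a → occ (2 ↑ʳ a) t) q) v′)
  (⊩⇒⊢ (⊑-∷ (⊑-∷ f₂)) d′ (Exact-2 {t = t} o e₂) w)
⟶⇒⟶⁻ {Γ = Γ} (elimʳ {bang} {t} {s} {s′} r) f (elim bang d d′) e (_ , w , v) q (_ , _ , v′)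
  with halve′ Γ (λ a → occ a t) (λ a → occ a s) f e
... | halves p f₁ e₁ f₂ e₂ = elim-bangʳ p (⟶⇒⟶⁻ r f₁ d e₁ v (occ-cancelˡ _ _ (λ a → occ a t) q) v′) (⊩⇒⊢ f₂ d′ e₂ w)
⟶⇒⟶⁻ {Γ = Γ} (elimʳ {unit} {t} {s} {s′} r) f (elim unit d d′) e (_ , w , v) q (_ , _ , v′)
  with halve′ Γ (λ a → occ a t) (λ a → occ a s) f e
... | halves p f₁ e₁ f₂ e₂ = elim-unitʳ p (⟶⇒⟶⁻ r f₁ d e₁ v (occ-cancelˡ _ _ (λ a → occ a t) q) v′) (⊩⇒⊢ f₂ d′ e₂ w)
⟶⇒⟶⁻ {Δ = Δ} {Γ′ = Γ′} (par {t} {t′} r) f (par {A = A} {B} d) e (o , w) q (o′ , w′) =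
  subst₂ (λ A B → Δ ∣ Γ′ ⊢ ℘ t ⟶⁻ ℘ t′ ∶ A ⅋ B) (^⊥-involutive A) (^⊥-involutive B)
    (par (⟶⇒⟶⁻ r (⊑-∷ (⊑-∷ f)) d (Exact-2 {t = t} o e) w
      (λ { zero → trans (o′ zero) (sym (o zero)) ; (suc zero) → trans (o′ (suc zero)) (sym (o (suc zero)))
         ; (suc (suc a)) → q a }) w′))
⟶⇒⟶⁻ {Γ = Γ} (appˡ {t} {t′} {s} r) f (app d d′) e (w , v) q (w′ , _) with halve Γ (λ a → occ a t) (λ a → occ a s) f e
... | halves p f₁ e₁ f₂ e₂ = appˡ p (⟶⇒⟶⁻ r f₁ d e₁ w (occ-cancelʳ _ _ (λ a → occ a s) q) w′) (⊩⇒⊢ f₂ d′ e₂ v)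
⟶⇒⟶⁻ {Γ = Γ} (appʳ {t} {s} {s′} r) f (app d d′) e (w , v) q (_ , v′) with halve Γ (λ a → occ a t) (λ a → occ a s) f e
... | halves p f₁ e₁ f₂ e₂ = appʳ p (⊩⇒⊢ f₁ d e₁ w) (⟶⇒⟶⁻ r f₂ d′ e₂ v (occ-cancelˡ _ _ (λ a → occ a t) q) v′)
⟶⇒⟶⁻ {Γ = Γ} (coappˡ {t} {t′} {s} r) f (coapp d d′) e (w , v) q (w′ , _) with halve Γ (λ a → occ a t) (λ a → occ a s) f e
... | halves p f₁ e₁ f₂ e₂ = coappˡ p (⟶⇒⟶⁻ r f₁ d e₁ w (occ-cancelʳ _ _ (λ a → occ a s) q) w′) (⊩⇒⊢ f₂ d′ e₂ v)
⟶⇒⟶⁻ {Γ = Γ} (coappʳ {t} {s} {s′} r) f (coapp d d′) e (w , v) q (_ , v′) with halve Γ (λ a → occ a t) (λ a → occ a s) f e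
... | halves p f₁ e₁ f₂ e₂ = coappʳ p (⊩⇒⊢ f₁ d e₁ w) (⟶⇒⟶⁻ r f₂ d′ e₂ v (occ-cancelˡ _ _ (λ a → occ a t) q) v′)
⟶⇒⟶⁻ {Δ = Δ} {Γ′ = Γ′} (ofcourse {t} {t′} r) f (ofcourse {A = A} d) e (o , k , w) q (o′ , _ , w′)
  with closed-Γ {Γ = Γ′} {t = t} k e
... | refl = subst (λ A → Δ ∣ ∅ ⊢ ! t ⟶⁻ ! t′ ∶ ! A) (^⊥-involutive A)
  (ofcourse (⟶⇒⟶⁻ r (⊑-∷ f) d (Exact-1 {t = t} o e) w (λ { zero → trans o′ (sym o) ; (suc a) → q a }) w′))
⟶⇒⟶⁻ (whynot r) f (whynot d) e w q w′ = whynot (⟶⇒⟶⁻ r f d e w q w′)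
⟶⇒⟶⁻ {Γ = Γ} (elim-whynotˡ {t} {t′} {s} r) f (elim-whynot d d′) e (o , k , w , v) q (o′ , _ , w′ , _) =
  elim-whynotˡ (⊩⇒⊢ f d (λ a → trans (cong (_+ occ a s) (sym (occ≡0 {t = t} (k a)))) (e a)) v)
    (⟶⇒⟶⁻ r (⊑-∷ (∅⊑ {Γ = Γ})) d′ (Exact-closed {t = t} o k) w
      (λ { zero → trans o′ (sym o) ; (suc a) → occ-cancelʳ (λ a → occ (suc a) t′) (λ a → occ (suc a) t) (λ a → occ a s) q a }) w′)
⟶⇒⟶⁻ {Γ = Γ} (elim-whynotʳ {t} {s} {s′} r) f (elim-whynot d d′) e (o , k , w , v) q (_ , _ , _ , v′) =
  elim-whynotʳ (⟶⇒⟶⁻ r f d (λ a → trans (cong (_+ occ a s) (sym (occ≡0 {t = t} (k a)))) (e a)) v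
    (occ-cancelˡ _ _ (λ a → occ (suc a) t) q) v′) (⊩⇒⊢ (⊑-∷ (∅⊑ {Γ = Γ})) d′ (Exact-closed {t = t} o k) w)
⟶⇒⟶⁻ {Γ = Γ} (cutˡ {t} {t′} {s} r) f (cut d d′) e (w , v) q (w′ , _) with halve Γ (λ a → occ a t) (λ a → occ a s) f e
... | halves p f₁ e₁ f₂ e₂ = cutˡ p (⟶⇒⟶⁻ r f₁ d e₁ w (occ-cancelʳ _ _ (λ a → occ a s) q) w′) (⊩⇒⊢ f₂ d′ e₂ v)
⟶⇒⟶⁻ {Γ = Γ} (cutʳ {t} {s} {s′} r) f (cut d d′) e (w , v) q (_ , v′) with halve Γ (λ a → occ a t) (λ a → occ a s) f e
... | halves p f₁ e₁ f₂ e₂ = cutʳ p (⊩⇒⊢ f₁ d e₁ w) (⟶⇒⟶⁻ r f₂ d′ e₂ v (occ-cancelˡ _ _ (λ a → occ a t) q) v′)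

theorem14 : {X : Set} {m n : ℕ} (Δ : UCtx X m) (Γ : LCtx X n) (A : Formula X) (t s t′ : Term m n) →
    Linear t → Linear s →
    Δ ∣ Γ ⊢ t ∶ A → Δ ∣ Γ ⊢ s ∶ A →
    Δ ∣ Γ ⊢ t ≋ s ∶ A →
    Δ ∣ Γ ⊢ t ⟶⁻ t′ ∶ A →
    ∃[ s′ ] (Linear s′ × (Δ ∣ Γ ⊢ s ⟶⁻ s′ ∶ A) × (Δ ∣ Γ ⊢ t′ ≋ s′ ∶ A))
theorem14 Δ Γ A t s t′ _ _ d e c r with ⟶⁻⇒⟶ r
... | r₀ , d′ with simulation (≋⇒≈ (⊢⇒⊩ {Γ = Γ} (λ _ → id) d) c) (⊢-WB d) r₀
... | s′ , q , c′ =
  s′ , Exact⇒Linear {Γ = Γ} s′ x w ,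
  ⟶⇒⟶⁻ {Γ = Γ} {Γ} q (λ _ → id) (⊢⇒⊩ {Γ = Γ} (λ _ → id) e) (⊢-exact e) (⊢-WB e) (λ a → trans (x a) (sym (⊢-exact e a))) w ,
  ≈⇒≋ (⊢-exact d′) (⊢-WB d′) c′
  where
  -- Linearity of `s′` is inherited from the typed reduct `t′` along their equivalence.
  w = ≈-WB c′ (⊢-WB d′)
  x : Exact Γ s′
  x a = trans (sym (≈-occ c′ a)) (⊢-exact d′ a)
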